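{- Let $\delta \in [0,0.9]$ and let $\varepsilon = 0.3012\,\delta - 0.1283\,\delta^{3/2}$. There exists $\Delta_1(\delta)$ such that if $G$ is a $\delta$-sparse graph with $\Delta(G) > \Delta_1(\delta)$, then $\chi(G) \leq \chi_\ell(G) \leq (1-\varepsilon)(\Delta(G)+1)$.
   Context: For $\delta\ge 0$, a graph $G$ of maximum degree $\Delta$ is $\delta$-sparse if for every vertex $v$ the subgraph induced by the neighbourhood $N(v)$ has at most $(1-\delta)\binom{\Delta}{2}$ edges. $\chi(G)$ is the chromatic number and $\chi_\ell(G)$ the list chromatic number: the least $k$ such that $G$ has a proper colouring from the lists whenever every vertex is given a list of at least $k$ colours.
   Formalization: The parameter δ ranges over the rational numbers in [0, 0.9] instead of the real numbers; the term δ^{3/2} in ε is kept exactly. -}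

module Defs where

open import Data.Nat as ℕ using (ℕ; zero; suc; _∸_; _<ᵇ_)
open import Data.Bool using (Bool; true; false; _∧_; T)
open import Data.Fin using (Fin; toℕ)
open import Data.List using (List; []; _∷_; length; filter; map; foldr; concatMap; allFin)
open import Data.List.Membership.Propositional using (_∈_)
open import Data.List.Relation.Unary.Unique.Propositional using (Unique)
open import Data.Integer using (+_)
open import Data.Rational using (ℚ; _/_; _+_; _-_; _*_; _≤_; 0ℚ; 1ℚ)
open import Data.Product using (_×_)
open import Data.Sum using (_⊎_)
open import Relation.Binary.PropositionalEquality using (_≡_; _≢_)
open import Relation.Nullary using (¬_)
open import Relation.Nullary.Decidable using (Dec)
open import Data.Bool using (_≟_)

record Graph (n : ℕ) : Set where
  field
    adj   : Fin n → Fin n → Bool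
    sym   : ∀ u v → adj u v ≡ adj v u
    irrefl : ∀ v → adj v v ≡ false

open Graph public

Adjacent : ∀ {n} → Graph n → Fin n → Fin n → Set
Adjacent G u v = T (adj G u v)

deg : ∀ {n} → Graph n → Fin n → ℕ
deg {n} G v = length (filter (λ u → adj G v u ≟ true) (allFin n))

maxDeg : ∀ {n} → Graph n → ℕ
maxDeg {n} G = foldr ℕ._⊔_ 0 (map (deg G) (allFin n))

-- number of edges of the subgraph induced by N(v):
-- unordered pairs {u,w} (counted once, via toℕ u < toℕ w) with u,w ∈ N(v), uw ∈ E
nbhdEdges : ∀ {n} → Graph n → Fin n → ℕ
nbhdEdges {n} G v =
  length (filter (λ w → w ≟ true)
    (concatMap (λ u → map (λ w → (toℕ u <ᵇ toℕ w) ∧ adj G v u ∧ adj G v w ∧ adj G u w)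
                          (allFin n))
               (allFin n)))

ℕ→ℚ : ℕ → ℚ
ℕ→ℚ k = + k / 1

choose2 : ℕ → ℚ
choose2 m = (ℕ→ℚ m * ℕ→ℚ (m ∸ 1)) * (+ 1 / 2)

Sparse : ℚ → ∀ {n} → Graph n → Set
Sparse δ G = ∀ v → ℕ→ℚ (nbhdEdges G v) ≤ (1ℚ - δ) * choose2 (maxDeg G)

-- x ≤√ y  expresses  x ≤ √y  (for y ≥ 0) without square roots
_≤√_ : ℚ → ℚ → Set
x ≤√ y = (x ≤ 0ℚ) ⊎ (x * x ≤ y)

-- BoundHolds δ D k  expresses  k ≤ (1 - ε)(D + 1)
-- where ε = 0.3012 δ - 0.1283 δ^{3/2}, i.e.
--   k ≤ (D+1)(1 - 0.3012 δ) + (D+1) · 0.1283 · δ · √δ,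
-- i.e.  k - (D+1)(1 - 0.3012 δ) ≤ √( ((D+1) · 0.1283)^2 · δ^3 )   (δ ≥ 0)
BoundHolds : ℚ → ℕ → ℕ → Set
BoundHolds δ D k =
  (ℕ→ℚ k - N * (1ℚ - a * δ)) ≤√ ((N * b) * (N * b) * (δ * δ * δ))
  where
    N = ℕ→ℚ (suc D)
    a = + 3012 / 10000
    b = + 1283 / 10000

Colourable : ∀ {n} → Graph n → ℕ → Set
Colourable {n} G k =
  Data.Product.Σ (Fin n → Fin k) λ c → ∀ u v → Adjacent G u v → c u ≢ c v
  where import Data.Product

IsChromaticNumber : ∀ {n} → Graph n → ℕ → Set
IsChromaticNumber G k = Colourable G k × (∀ j → j ℕ.< k → ¬ Colourable G j)

ListAssignment : ℕ → ℕ → Set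
ListAssignment n k = Data.Product.Σ (Fin n → List ℕ) λ L → ∀ v → Unique (L v) × k ℕ.≤ length (L v)
  where import Data.Product

ColourableFrom : ∀ {n} → Graph n → (Fin n → List ℕ) → Set
ColourableFrom {n} G L =
  Data.Product.Σ (Fin n → ℕ) λ c → (∀ v → c v ∈ L v) × (∀ u v → Adjacent G u v → c u ≢ c v)
  where import Data.Product

Choosable : ∀ {n} → Graph n → ℕ → Set
Choosable {n} G k = (L : ListAssignment n k) → ColourableFrom G (Data.Product.proj₁ L)
  where import Data.Product

IsListChromaticNumber : ∀ {n} → Graph n → ℕ → Set
IsListChromaticNumber G k = Choosable G k × (∀ j → j ℕ.< k → ¬ Choosable G j)

{-# OPTIONS --safe #-}

-- Call an instance (ε, δ)-good if degrees are at most D, lists have at least (1 - ε) D colours and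
-- every neighbourhood spans at most (1 - δ) D² ordered adjacent pairs.  One round of the naive
-- colouring procedure lets every vertex pick a random colour of its list and resolves each
-- monochromatic edge against a randomly chosen end.  A vertex is coloured with probability
-- ρ ≈ e^(-c/2), where c = D / (number of colours), so degrees shrink to (1 - ρ) D and neighbourhoods
-- keep their density.  A non-adjacent pair of neighbours keeps a common colour with probability at
-- least ρ² / C² and an independent triple with probability at most e^(-7c/8) / C³.  By inclusion and
-- exclusion a vertex loses only (ρ - s) D colours, with s ≥ ½ δ c ρ² - δ^(3/2) c² e^(-7c/8) / 6.
-- Since s > ρ ε as long as ε ≤ 0.3012 δ - 0.1283 δ^(3/2) + o(1), a round replaces ε by ε - ξ for a
-- constant ξ > 0, and after boundedly many rounds the lists exceed the degrees, so greedy colouring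
-- finishes.  Deviations from the expectations are excluded by a twelfth moment bound and the local lemma.
module Submission where

-- The power δ^(3/2) is irrational, while everything happens in ℚ: `δ` is accompanied by a rational
-- `σ` with `δ ≤ σ * σ`, and `σ * δ` stands for δ^(3/2). The constant 0.3012 lies slightly below the
-- value 0.3033 of ½ c e^(-c/2) at c = 1, and the difference pays for the Taylor truncations, for
-- rounding √δ and for ξ. The constant 0.1283 is too small for the triple term c² e^(-3c/8) / 6 when
-- c is large, but there the pair term has grown enough to compensate. Since δ ≤ 0.9 keeps ε below
-- 0.1617, only c between 1 and 1.193 has to be examined. Two obstacles stand in the way of
-- concentration. Recolouring one vertex may undo many neighbours of v that share its colour, so
-- degrees and edges are counted with large colour classes treated as uncoloured. And about D²
-- vertices can influence v, so a vertex at distance two is charged only the probability of order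
-- 1/C that its colour agrees with that of a common neighbour. The bad events have dependency degree
-- of order D⁴; a moment of order 2j makes each of them as rare as D^(-j), so j must exceed 4.

-- Rational arithmetic and polynomial inequalities

module Rationals where

  open import Defs using (ℕ→ℚ) public
  open import Data.Nat as ℕ using (ℕ; zero; suc) public
  open import Data.Nat.Base using (nonZero) public
  import Data.Nat.Properties as ℕP
  open import Data.Integer as ℤ using (ℤ; +_) public
  import Data.Integer.Properties as ℤP
  open import Data.Rational using (ℚ; mkℚ; _/_; _+_; _-_; _*_; -_; _≤_; _<_; 0ℚ; 1ℚ; ½; ∣_∣; nonNegative; positive; NonZero; 1/_) public
  open import Data.Rational.Properties as ℚP using (≤-refl; ≤-reflexive; ≤-trans; <⇒≤; <-≤-trans; ≤-<-trans; +-mono-≤; +-*-commutativeRing; _≤?_; _<?_; 0≤∣p∣; ∣p+q∣≤∣p∣+∣q∣; ∣p*q∣≡∣p∣*∣q∣) public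
  import Data.Rational.Unnormalised as ℚᵘ
  import Data.Rational.Unnormalised.Properties as ℚᵘP
  open import Relation.Binary.PropositionalEquality using (_≡_; _≢_; refl; sym; trans; cong; cong₂; subst; subst₂) public
  open import Data.Product using (Σ; ∃; ∃-syntax; _×_; _,_; proj₁; proj₂) public
  open import Data.Sum using (_⊎_; inj₁; inj₂; [_,_]′) public
  open import Data.Empty using (⊥; ⊥-elim) public
  open import Data.Bool as Bool using (Bool; true; false; _∧_; _∨_; not; T; if_then_else_) public
  open import Function using (_∘_; _∋_; id) public
  open import Relation.Nullary using (¬_; Dec; yes; no; does) public
  open import Relation.Nullary.Decidable using (True; toWitness; dec⇒maybe) public
  open import Tactic.RingSolver.Core.AlmostCommutativeRing using (AlmostCommutativeRing; fromCommutativeRing)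
  open import Tactic.RingSolver using (solve-∀) public
  open import Data.List using (List; []; _∷_) public

  ring : AlmostCommutativeRing _ _
  ring = fromCommutativeRing +-*-commutativeRing λ x → dec⇒maybe (0ℚ ℚP.≟ x)

  -- The tool for polynomial inequalities: known inequalities are added up with suitable nonnegative
  -- multipliers to `a ≤ b`, and what remains is an identity for the ring solver.
  ≤-by : ∀ {a b l r} → a ≤ b → l + b ≡ r + a → l ≤ r
  ≤-by {a} {b} {l} {r} h e = subst₂ _≤_ (trans (cong (_- b) (sym e)) (eq₁ l b)) (eq₁ r b)
      (+-mono-≤ (+-mono-≤ (≤-refl {r}) h) (≤-refl { - b}))
    where
    eq₁ : ∀ l b → l + b - b ≡ l
    eq₁ = solve-∀ ring

  <-by : ∀ {a b l r} → a < b → l + b ≡ r + a → l < r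
  <-by {a} {b} {l} {r} h e = subst₂ _<_ (trans (cong (_- b) (sym e)) (eq₁ l b)) (eq₁ r b)
      (ℚP.+-monoˡ-< (- b) (ℚP.+-monoʳ-< r h))
    where
    eq₁ : ∀ l b → l + b - b ≡ l
    eq₁ = solve-∀ ring

  infixl 6 _⊕_
  infixl 5 _⨾_
  _⊕_ : ∀ {a b c d} → a ≤ b → c ≤ d → a + c ≤ b + d
  _⊕_ = +-mono-≤

  _⨾_ : ∀ {x y z} → x ≤ y → y ≤ z → x ≤ z
  _⨾_ = ≤-trans

  0≤a*b : ∀ {a b} → 0ℚ ≤ a → 0ℚ ≤ b → 0ℚ ≤ a * b
  0≤a*b {a} {b} p q = subst (_≤ a * b) (ℚP.*-zeroʳ a) (ℚP.*-monoˡ-≤-nonNeg a {{nonNegative p}} q)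

  0≤a+b : ∀ {a b} → 0ℚ ≤ a → 0ℚ ≤ b → 0ℚ ≤ a + b
  0≤a+b {a} {b} p q = subst (_≤ a + b) (ℚP.+-identityˡ 0ℚ) (p ⊕ q)

  0<a*b : ∀ {a b} → 0ℚ < a → 0ℚ < b → 0ℚ < a * b
  0<a*b {a} {b} p q = subst (_< a * b) (ℚP.*-zeroʳ a) (ℚP.*-monoʳ-<-pos a {{positive p}} q)

  0<a+b : ∀ {a b} → 0ℚ < a → 0ℚ ≤ b → 0ℚ < a + b
  0<a+b {a} {b} p q = subst (_< a + b) (ℚP.+-identityˡ 0ℚ) (ℚP.+-mono-<-≤ p q)

  infixr 7 _⊙_
  _⊙_ : ∀ {a b c} → 0ℚ ≤ c → a ≤ b → c * a ≤ c * b
  _⊙_ {c = c} p q = ℚP.*-monoˡ-≤-nonNeg c {{nonNegative p}} q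

  infixl 7 _⊙ʳ_
  _⊙ʳ_ : ∀ {a b c} → a ≤ b → 0ℚ ≤ c → a * c ≤ b * c
  _⊙ʳ_ {c = c} q p = ℚP.*-monoʳ-≤-nonNeg c {{nonNegative p}} q

  *-mono : ∀ {a b c d} → 0ℚ ≤ c → 0ℚ ≤ b → a ≤ b → c ≤ d → a * c ≤ b * d
  *-mono p q h k = (h ⊙ʳ p) ⨾ (q ⊙ k)

  ⊙-cancel : ∀ {a b c} → 0ℚ < c → c * a ≤ c * b → a ≤ b
  ⊙-cancel {c = c} p h = ℚP.*-cancelˡ-≤-pos c {{positive p}} h

  0≤b-a : ∀ {a b} → a ≤ b → 0ℚ ≤ b - a
  0≤b-a {a} {b} h = ≤-by h (eq a b)
    where
    eq : ∀ a b → 0ℚ + b ≡ b - a + a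
    eq = solve-∀ ring

  a≤b : ∀ {a b} → 0ℚ ≤ b - a → a ≤ b
  a≤b {a} {b} h = ≤-by h (eq a b)
    where
    eq : ∀ a b → a + (b - a) ≡ b + 0ℚ
    eq = solve-∀ ring

  neg-≤ : ∀ {a b} → a ≤ b → - b ≤ - a
  neg-≤ = ℚP.neg-antimono-≤

  0≤sq : ∀ a → 0ℚ ≤ a * a
  0≤sq a with ℚP.≤-total 0ℚ a
  ... | inj₁ p = 0≤a*b p p
  ... | inj₂ p = subst (0ℚ ≤_) (eq a) (0≤a*b (neg-≤ p) (neg-≤ p))
    where
    eq : ∀ a → (- a) * (- a) ≡ a * a
    eq = solve-∀ ring

  infixr 8 _^_
  _^_ : ℚ → ℕ → ℚ
  x ^ zero = 1ℚ
  x ^ suc n = x * x ^ n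

  dec≤ : ∀ {a b} → {True (a ≤? b)} → a ≤ b
  dec≤ {a} {b} {t} = toWitness {a? = a ≤? b} t

  dec< : ∀ {a b} → {True (a <? b)} → a < b
  dec< {a} {b} {t} = toWitness {a? = a <? b} t

  0≤1 : 0ℚ ≤ 1ℚ
  0≤1 = dec≤

  ^-nonneg : ∀ {x} n → 0ℚ ≤ x → 0ℚ ≤ x ^ n
  ^-nonneg zero p = 0≤1
  ^-nonneg (suc n) p = 0≤a*b p (^-nonneg n p)

  ^-pos : ∀ {x} n → 0ℚ < x → 0ℚ < x ^ n
  ^-pos zero p = dec<
  ^-pos (suc n) p = 0<a*b p (^-pos n p)

  ^-mono : ∀ {x y} n → 0ℚ ≤ x → x ≤ y → x ^ n ≤ y ^ n
  ^-mono zero p h = ≤-refl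
  ^-mono (suc n) p h = *-mono (^-nonneg n p) (p ⨾ h) h (^-mono n p h)

  ^-≤1 : ∀ {x} n → 0ℚ ≤ x → x ≤ 1ℚ → x ^ n ≤ 1ℚ
  ^-≤1 zero p h = ≤-refl
  ^-≤1 (suc n) p h = *-mono (^-nonneg n p) 0≤1 h (^-≤1 n p h)

  ^-+ : ∀ x m n → x ^ (m ℕ.+ n) ≡ x ^ m * x ^ n
  ^-+ x zero n = sym (ℚP.*-identityˡ _)
  ^-+ x (suc m) n = trans (cong (x *_) (^-+ x m n)) (sym (ℚP.*-assoc x _ _))

  ^-* : ∀ x y n → (x * y) ^ n ≡ x ^ n * y ^ n
  ^-* x y zero = refl
  ^-* x y (suc n) = trans (cong (x * y *_) (^-* x y n)) (eq x y _ _)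
    where
    eq : ∀ x y a b → x * y * (a * b) ≡ x * a * (y * b)
    eq = solve-∀ ring

  -- Stands in for a cube root: the survival bound for three vertices is a geometric mean of three
  -- factors and is proved in cubed form.
  cube-cancel : ∀ {x y} → 0ℚ ≤ y → x * x * x ≤ y * y * y → x ≤ y
  cube-cancel {x} {y} py h with x ≤? y
  ... | yes p = p
  ... | no ¬p = ⊥-elim (ℚP.<-irrefl refl (<-≤-trans lt h))
    where
    lt₀ : y < x
    lt₀ = ℚP.≰⇒> ¬p
    px : 0ℚ < x
    px = ≤-<-trans py lt₀
    lt : y * y * y < x * x * x
    lt = ≤-<-trans (*-mono py (0≤sq x) (*-mono py (<⇒≤ px) (<⇒≤ lt₀) (<⇒≤ lt₀)) (≤-refl {y}))
           (ℚP.*-monoʳ-<-pos (x * x) {{positive (0<a*b px px)}} lt₀)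

  opaque
    ι : ℕ → ℚ
    ι = ℕ→ℚ

    ι-+ : ∀ m n → ι (m ℕ.+ n) ≡ ι m + ι n
    ι-+ m n = ℚP.toℚᵘ-injective (ℚᵘP.≃-trans (ℚP.toℚᵘ-fromℚᵘ (ℚᵘ.mkℚᵘ (+ (m ℕ.+ n)) 0))
       (ℚᵘP.≃-sym (ℚᵘP.≃-trans (ℚP.toℚᵘ-homo-+ (ι m) (ι n))
         (ℚᵘP.≃-trans (ℚᵘP.+-cong (ℚP.toℚᵘ-fromℚᵘ (ℚᵘ.mkℚᵘ (+ m) 0)) (ℚP.toℚᵘ-fromℚᵘ (ℚᵘ.mkℚᵘ (+ n) 0)))
           (ℚᵘ.*≡* (cong (ℤ._* ℤ.1ℤ) (cong₂ ℤ._+_ (ℤP.*-identityʳ (+ m)) (ℤP.*-identityʳ (+ n)))))))))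

    ι-suc : ∀ n → ι (suc n) ≡ 1ℚ + ι n
    ι-suc = ι-+ 1

    0≤ι : ∀ n → 0ℚ ≤ ι n
    0≤ι zero = ≤-refl
    0≤ι (suc n) = subst (0ℚ ≤_) (sym (ι-suc n)) (0≤a+b 0≤1 (0≤ι n))

    0<ι : ∀ n → 0ℚ < ι (suc n)
    0<ι n = subst (0ℚ <_) (sym (ι-suc n)) (0<a+b {1ℚ} dec< (0≤ι n))

    ι-mono : ∀ {m n} → m ℕ.≤ n → ι m ≤ ι n
    ι-mono {m} {n} h = subst (ι m ≤_) (trans (sym (ι-+ m (n ℕ.∸ m))) (cong ι (ℕP.m+[n∸m]≡n h)))
       (≤-by (0≤ι (n ℕ.∸ m)) (eq (ι m) (ι (n ℕ.∸ m))))
      where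
      eq : ∀ a b → a + b ≡ a + b + 0ℚ
      eq = solve-∀ ring

    ι-mono-< : ∀ {m n} → m ℕ.< n → ι m < ι n
    ι-mono-< {m} {n} h = <-≤-trans (<-by {0ℚ} {1ℚ} dec< (trans (eq (ι m)) (cong (_+ 0ℚ) (sym (ι-suc m))))) (ι-mono h)
      where
      eq : ∀ a → a + 1ℚ ≡ 1ℚ + a + 0ℚ
      eq = solve-∀ ring

    ι-cancel : ∀ {m n} → ι m ≤ ι n → m ℕ.≤ n
    ι-cancel {m} {n} h with m ℕ.≤? n
    ... | yes p = p
    ... | no ¬p = ⊥-elim (ℚP.<-irrefl refl (<-≤-trans (ι-mono-< (ℕP.≰⇒> ¬p)) h))

    ι-def : ∀ n → ι n ≡ ℕ→ℚ n
    ι-def n = refl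

    ι-0 : ι 0 ≡ 0ℚ
    ι-0 = refl

    ι-1 : ι 1 ≡ 1ℚ
    ι-1 = refl

  recip : ∀ x → 0ℚ < x → ∃[ y ] (0ℚ < y) × (x * y ≡ 1ℚ)
  recip x p = 1/x , ℚP.positive⁻¹ 1/x {{ℚP.1/pos⇒pos x {{positive p}}}} , ℚP.*-inverseʳ x {{nz}}
    where
    nz : NonZero x
    nz = ℚP.pos⇒nonZero x {{positive p}}
    1/x : ℚ
    1/x = (1/ x) {{nz}}

  opaque
    unfolding ι

    archimedes : ∀ x → ∃[ n ] x ≤ ι n
    archimedes x@(mkℚ p d c) = ℤ.∣ p ∣ , ℚP.toℚᵘ-cancel-≤ (ℚᵘP.≤-respʳ-≃ (ℚᵘP.≃-sym (ℚP.toℚᵘ-fromℚᵘ (ℚᵘ.mkℚᵘ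
        (+ ℤ.∣ p ∣) 0)))
       (ℚᵘ.*≤* (ℤP.≤-trans (ℤP.≤-reflexive (ℤP.*-identityʳ p)) (ℤP.≤-trans (i≤∣i∣ p) (big ℤ.∣ p ∣)))))
      where
      i≤∣i∣ : ∀ i → i ℤ.≤ + ℤ.∣ i ∣
      i≤∣i∣ (+ n) = ℤP.≤-refl
      i≤∣i∣ (ℤ.-[1+ n ]) = ℤ.-≤+
      big : ∀ k → + k ℤ.≤ + k ℤ.* + suc d
      big k = ℤP.≤-trans (ℤ.+≤+ (ℕP.m≤m*n k (suc d))) (ℤP.≤-reflexive (ℤP.pos-* k (suc d)))

  ⟦_⟧ : Bool → ℚ
  ⟦ true ⟧ = 1ℚ
  ⟦ false ⟧ = 0ℚ

  0≤⟦_⟧ : ∀ b → 0ℚ ≤ ⟦ b ⟧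
  0≤⟦ true ⟧ = 0≤1
  0≤⟦ false ⟧ = ≤-refl

  ⟦_⟧≤1 : ∀ b → ⟦ b ⟧ ≤ 1ℚ
  ⟦ true ⟧≤1 = ≤-refl
  ⟦ false ⟧≤1 = 0≤1

  ⟦∧⟧ : ∀ a b → ⟦ a ∧ b ⟧ ≡ ⟦ a ⟧ * ⟦ b ⟧
  ⟦∧⟧ true b = sym (ℚP.*-identityˡ ⟦ b ⟧)
  ⟦∧⟧ false b = sym (ℚP.*-zeroˡ ⟦ b ⟧)

  ⟦not⟧ : ∀ a → ⟦ not a ⟧ ≡ 1ℚ - ⟦ a ⟧
  ⟦not⟧ true = refl
  ⟦not⟧ false = refl

  ∧-trueˡ : ∀ {a b} → a ∧ b ≡ true → a ≡ true
  ∧-trueˡ {true} _ = refl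

  ∧-trueʳ : ∀ {a b} → a ∧ b ≡ true → b ≡ true
  ∧-trueʳ {true} e = e

  false≢true : ∀ {A : Set} {b} → b ≡ false → b ≡ true → A
  false≢true refl ()

  ⟦∨⟧≤ : ∀ a b → ⟦ a ∨ b ⟧ ≤ ⟦ a ⟧ + ⟦ b ⟧
  ⟦∨⟧≤ true b = ≤-by 0≤⟦ b ⟧ (e ⟦ b ⟧)
    where
    e : ∀ x → 1ℚ + x ≡ 1ℚ + x + 0ℚ
    e = solve-∀ ring
  ⟦∨⟧≤ false b = ≤-reflexive (sym (ℚP.+-identityˡ ⟦ b ⟧))

  x≤∣x∣ : ∀ x → x ≤ ∣ x ∣
  x≤∣x∣ x with ℚP.≤-total 0ℚ x
  ... | inj₁ h = ≤-reflexive (sym (ℚP.0≤p⇒∣p∣≡p h))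
  ... | inj₂ h = h ⨾ 0≤∣p∣ x

  -x≤∣x∣ : ∀ x → - x ≤ ∣ x ∣
  -x≤∣x∣ x = subst (- x ≤_) (ℚP.∣-p∣≡∣p∣ x) (x≤∣x∣ (- x))

  1-a≤1 : ∀ {a} → 0ℚ ≤ a → 1ℚ - a ≤ 1ℚ
  1-a≤1 {a} h = ≤-by h (eq a)
    where
    eq : ∀ a → 1ℚ - a + a ≡ 1ℚ + 0ℚ
    eq = solve-∀ ring

-- Finite probability spaces as expectation functionals

module FiniteProbability where

  open Rationals public
  import Data.Rational.Properties as ℚP
  open import Data.Fin as Fin using (Fin; toℕ) renaming (zero to fzero; suc to fsuc) public
  open import Data.Vec as Vec using (Vec; lookup; _[_]≔_) renaming ([] to []ᵛ; _∷_ to _∷ᵛ_) public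

  opaque
    ∑ : ∀ {n} → (Fin n → ℚ) → ℚ
    ∑ {zero} f = 0ℚ
    ∑ {suc n} f = f fzero + ∑ (f ∘ fsuc)

    ∏ : ∀ {n} → (Fin n → ℚ) → ℚ
    ∏ {zero} f = 1ℚ
    ∏ {suc n} f = f fzero * ∏ (f ∘ fsuc)

    ∑-cong : ∀ {n} {f g : Fin n → ℚ} → (∀ i → f i ≡ g i) → ∑ f ≡ ∑ g
    ∑-cong {zero} h = refl
    ∑-cong {suc n} h = cong₂ _+_ (h fzero) (∑-cong (h ∘ fsuc))

    ∑-mono : ∀ {n} {f g : Fin n → ℚ} → (∀ i → f i ≤ g i) → ∑ f ≤ ∑ g
    ∑-mono {zero} h = ≤-refl
    ∑-mono {suc n} h = h fzero ⊕ ∑-mono (h ∘ fsuc)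

    ∑-+ : ∀ {n} (f g : Fin n → ℚ) → ∑ (λ i → f i + g i) ≡ ∑ f + ∑ g
    ∑-+ {zero} f g = refl
    ∑-+ {suc n} f g = trans (cong (λ z → f fzero + g fzero + z) (∑-+ (f ∘ fsuc) (g ∘ fsuc))) (eq (f fzero)
        (g fzero) _ _)
      where
      eq : ∀ a b c d → a + b + (c + d) ≡ a + c + (b + d)
      eq = solve-∀ ring

    ∑-*ˡ : ∀ {n} c (f : Fin n → ℚ) → ∑ (λ i → c * f i) ≡ c * ∑ f
    ∑-*ˡ {zero} c f = sym (ℚP.*-zeroʳ c)
    ∑-*ˡ {suc n} c f = trans (cong (λ z → c * f fzero + z) (∑-*ˡ c (f ∘ fsuc))) (sym (ℚP.*-distribˡ-+ c _ _))

    ∑-*ʳ : ∀ {n} c (f : Fin n → ℚ) → ∑ (λ i → f i * c) ≡ ∑ f * c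
    ∑-*ʳ c f = trans (∑-cong (λ i → ℚP.*-comm (f i) c)) (trans (∑-*ˡ c f) (ℚP.*-comm c _))

    ∑-const : ∀ n c → ∑ {n} (λ _ → c) ≡ ι n * c
    ∑-const zero c = sym (trans (cong (_* c) ι-0) (ℚP.*-zeroˡ c))
    ∑-const (suc n) c = trans (cong (λ z → c + z) (∑-const n c)) (trans (eq c (ι n)) (cong (_* c) (sym (ι-suc n))))
      where
      eq : ∀ a b → a + b * a ≡ (1ℚ + b) * a
      eq = solve-∀ ring

    ∑-0 : ∀ n → ∑ {n} (λ _ → 0ℚ) ≡ 0ℚ
    ∑-0 n = trans (∑-const n 0ℚ) (ℚP.*-zeroʳ (ι n))

    ∑-nonneg : ∀ {n} {f : Fin n → ℚ} → (∀ i → 0ℚ ≤ f i) → 0ℚ ≤ ∑ f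
    ∑-nonneg {n} {f} h = subst (_≤ ∑ f) (∑-0 n) (∑-mono h)

    term≤∑ : ∀ {n} {f : Fin n → ℚ} → (∀ i → 0ℚ ≤ f i) → ∀ i → f i ≤ ∑ f
    term≤∑ {suc n} {f} h fzero = ≤-by (∑-nonneg (h ∘ fsuc)) (eq (f fzero) _)
      where
      eq : ∀ a b → a + b ≡ a + b + 0ℚ
      eq = solve-∀ ring
    term≤∑ {suc n} {f} h (fsuc i) = ≤-by (h fzero ⊕ term≤∑ (h ∘ fsuc) i) (eq (f fzero) (f (fsuc i)) _)
      where
      eq : ∀ a b c → b + (a + c) ≡ a + c + (0ℚ + b)
      eq = solve-∀ ring

    ∑-abs : ∀ {n} (f : Fin n → ℚ) → ∣ ∑ f ∣ ≤ ∑ (λ i → ∣ f i ∣)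
    ∑-abs {zero} f = ≤-refl
    ∑-abs {suc n} f = ∣p+q∣≤∣p∣+∣q∣ (f fzero) _ ⨾ (≤-refl {∣ f fzero ∣} ⊕ ∑-abs (f ∘ fsuc))

    ∏-cong : ∀ {n} {f g : Fin n → ℚ} → (∀ i → f i ≡ g i) → ∏ f ≡ ∏ g
    ∏-cong {zero} h = refl
    ∏-cong {suc n} h = cong₂ _*_ (h fzero) (∏-cong (h ∘ fsuc))

    ∏-nonneg : ∀ {n} {f : Fin n → ℚ} → (∀ i → 0ℚ ≤ f i) → 0ℚ ≤ ∏ f
    ∏-nonneg {zero} h = 0≤1
    ∏-nonneg {suc n} h = 0≤a*b (h fzero) (∏-nonneg (h ∘ fsuc))

    ∏-mono : ∀ {n} {f g : Fin n → ℚ} → (∀ i → 0ℚ ≤ f i) → (∀ i → f i ≤ g i) → ∏ f ≤ ∏ g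
    ∏-mono {zero} p h = ≤-refl
    ∏-mono {suc n} p h = *-mono (∏-nonneg (p ∘ fsuc)) (p fzero ⨾ h fzero) (h fzero) (∏-mono (p ∘ fsuc) (h ∘ fsuc))

    ∏-* : ∀ {n} (f g : Fin n → ℚ) → ∏ (λ i → f i * g i) ≡ ∏ f * ∏ g
    ∏-* {zero} f g = refl
    ∏-* {suc n} f g = trans (cong (f fzero * g fzero *_) (∏-* (f ∘ fsuc) (g ∘ fsuc))) (eq (f fzero) (g fzero) _ _)
      where
      eq : ∀ a b c d → a * b * (c * d) ≡ a * c * (b * d)
      eq = solve-∀ ring

    ∑-suc : ∀ {n} (f : Fin (suc n) → ℚ) → ∑ f ≡ f fzero + ∑ (f ∘ fsuc)
    ∑-suc f = refl

    ∑-zero : (f : Fin 0 → ℚ) → ∑ f ≡ 0ℚ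
    ∑-zero f = refl

    ∏-suc : ∀ {n} (f : Fin (suc n) → ℚ) → ∏ f ≡ f fzero * ∏ (f ∘ fsuc)
    ∏-suc f = refl

    ∏-zero : (f : Fin 0 → ℚ) → ∏ f ≡ 1ℚ
    ∏-zero f = refl

  ∑-sub : ∀ {n} (f g : Fin n → ℚ) → ∑ (λ i → f i - g i) ≡ ∑ f - ∑ g
  ∑-sub f g = trans (∑-+ f (λ i → - g i)) (cong (λ z → ∑ f + z) (trans (∑-cong (λ i →
      neg (g i))) (trans (∑-*ˡ (- 1ℚ) g) (sym (neg (∑ g))))))
    where
    neg : ∀ a → - a ≡ (- 1ℚ) * a
    neg = solve-∀ ring

  record Lin {A : Set} (E : (A → ℚ) → ℚ) : Set where
    field
      congE : ∀ {f g} → (∀ a → f a ≡ g a) → E f ≡ E g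
      addE : ∀ f g → E (λ a → f a + g a) ≡ E f + E g
      mulE : ∀ c f → E (λ a → c * f a) ≡ c * E f
  open Lin

  ∑-lin : ∀ {n} → Lin (∑ {n})
  ∑-lin = record { congE = ∑-cong ; addE = ∑-+ ; mulE = ∑-*ˡ }

  -- A probability space is given only by its expectation. `swap` with an arbitrary linear
  -- functional covers Fubini and finite sums at once; `pick` is the existence step of the
  -- probabilistic method.
  record Exp (A : Set) : Set₁ where
    field
      𝔼 : (A → ℚ) → ℚ
      lin : Lin 𝔼
      one : 𝔼 (λ _ → 1ℚ) ≡ 1ℚ
      mono : ∀ {f g} → (∀ a → f a ≤ g a) → 𝔼 f ≤ 𝔼 g
      swap : ∀ {B : Set} {F : (B → ℚ) → ℚ} → Lin F → (h : A → B → ℚ) → 𝔼 (λ a → F (h a)) ≡ F (λ b → 𝔼 (λ a → h a b))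
      pick : ∀ f → 0ℚ < 𝔼 f → ∃[ a ] 0ℚ < f a
  open Exp public

  module _ {A : Set} (X : Exp A) where
    𝔼-cong : ∀ {f g} → (∀ a → f a ≡ g a) → 𝔼 X f ≡ 𝔼 X g
    𝔼-cong = congE (lin X)
    𝔼-+ : ∀ f g → 𝔼 X (λ a → f a + g a) ≡ 𝔼 X f + 𝔼 X g
    𝔼-+ = addE (lin X)
    𝔼-*ˡ : ∀ c f → 𝔼 X (λ a → c * f a) ≡ c * 𝔼 X f
    𝔼-*ˡ = mulE (lin X)
    𝔼-*ʳ : ∀ c f → 𝔼 X (λ a → f a * c) ≡ 𝔼 X f * c
    𝔼-*ʳ c f = trans (𝔼-cong (λ a → ℚP.*-comm (f a) c)) (trans (𝔼-*ˡ c f) (ℚP.*-comm c _))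
    𝔼-const : ∀ c → 𝔼 X (λ _ → c) ≡ c
    𝔼-const c = trans (𝔼-cong (λ _ → sym (ℚP.*-identityʳ c))) (trans (𝔼-*ˡ c (λ _ →
        1ℚ)) (trans (cong (c *_) (one X)) (ℚP.*-identityʳ c)))
    𝔼-neg : ∀ f → 𝔼 X (λ a → - f a) ≡ - 𝔼 X f
    𝔼-neg f = trans (𝔼-cong (λ a → eq (f a))) (trans (𝔼-*ˡ (- 1ℚ) f) (sym (eq _)))
      where
      eq : ∀ a → - a ≡ (- 1ℚ) * a
      eq = solve-∀ ring
    𝔼-sub : ∀ f g → 𝔼 X (λ a → f a - g a) ≡ 𝔼 X f - 𝔼 X g
    𝔼-sub f g = trans (𝔼-+ f (λ a → - g a)) (cong (λ z → 𝔼 X f + z) (𝔼-neg g))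
    𝔼-nonneg : ∀ {f} → (∀ a → 0ℚ ≤ f a) → 0ℚ ≤ 𝔼 X f
    𝔼-nonneg {f} h = subst (_≤ 𝔼 X f) (𝔼-const 0ℚ) (mono X h)
    𝔼-∑ : ∀ {n} (h : A → Fin n → ℚ) → 𝔼 X (λ a → ∑ (h a)) ≡ ∑ (λ i → 𝔼 X (λ a → h a i))
    𝔼-∑ h = swap X ∑-lin h
    𝔼-abs : ∀ f → ∣ 𝔼 X f ∣ ≤ 𝔼 X (λ a → ∣ f a ∣)
    𝔼-abs f with ℚP.∣p∣≡p∨∣p∣≡-p (𝔼 X f)
    ... | inj₁ e = ≤-reflexive e ⨾ mono X (λ a → x≤∣x∣ (f a))
    ... | inj₂ e = ≤-reflexive (trans e (sym (𝔼-neg f))) ⨾ mono X (λ a → -x≤∣x∣ (f a))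

  -- inv k is 1 / (k + 1).
  opaque
    inv : ℕ → ℚ
    inv k = proj₁ (recip (ι (suc k)) (0<ι k))

    0<inv : ∀ k → 0ℚ < inv k
    0<inv k = proj₁ (proj₂ (recip (ι (suc k)) (0<ι k)))

    inv-eq : ∀ k → inv k * ι (suc k) ≡ 1ℚ
    inv-eq k = trans (ℚP.*-comm (inv k) _) (proj₂ (proj₂ (recip (ι (suc k)) (0<ι k))))

  pos-factor : ∀ {a b} → 0ℚ ≤ a → 0ℚ < a * b → 0ℚ < b
  pos-factor {a} {b} p h = ℚP.*-cancelˡ-<-nonNeg a {{nonNegative p}} (subst (_< a * b) (sym (ℚP.*-zeroʳ a)) h)

  pos-summand : ∀ a b → 0ℚ < a + b → (0ℚ < a) ⊎ (0ℚ < b)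
  pos-summand a b h with 0ℚ <? a
  ... | yes p = inj₁ p
  ... | no ¬p = inj₂ (<-≤-trans h (≤-by (ℚP.≮⇒≥ ¬p) (eq a b)))
    where
    eq : ∀ a b → a + b + 0ℚ ≡ b + a
    eq = solve-∀ ring

  opaque
    unfolding ∑

    ∑-pick : ∀ {n} (f : Fin n → ℚ) → 0ℚ < ∑ f → ∃[ i ] 0ℚ < f i
    ∑-pick {zero} f h = ⊥-elim (ℚP.<-irrefl refl h)
    ∑-pick {suc n} f h with pos-summand (f fzero) _ h
    ... | inj₁ p = fzero , p
    ... | inj₂ p with ∑-pick (f ∘ fsuc) p
    ...   | i , q = fsuc i , q

    ∑-swap : ∀ {n} {B : Set} {F : (B → ℚ) → ℚ} → Lin F → (h : Fin n → B → ℚ) → ∑ (λ i → F (h i)) ≡ F (λ b → ∑ (λ i →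
        h i b))
    ∑-swap {zero} {F = F} L h = sym (trans (congE L {g = λ _ → 0ℚ * 0ℚ} (λ _ → refl)) (trans (mulE L 0ℚ (λ _ →
        0ℚ)) (ℚP.*-zeroˡ (F (λ _ → 0ℚ)))))
    ∑-swap {suc n} {F = F} L h = trans (cong (λ z → F (h fzero) + z) (∑-swap L (h ∘ fsuc))) (sym (addE L _ _))

  unif : ∀ k → Exp (Fin (suc k))
  unif k = record
    { 𝔼 = λ f → inv k * ∑ f
    ; lin = record
        { congE = λ h → cong (inv k *_) (∑-cong h)
        ; addE = λ f g → trans (cong (inv k *_) (∑-+ f g)) (ℚP.*-distribˡ-+ (inv k) _ _)
        ; mulE = λ c f → trans (cong (inv k *_) (∑-*ˡ c f)) (eq (inv k) c _) }
    ; one = trans (cong (inv k *_) (trans (∑-const (suc k) 1ℚ) (ℚP.*-identityʳ _))) (inv-eq k)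
    ; mono = λ h → <⇒≤ (0<inv k) ⊙ ∑-mono h
    ; swap = λ L h → trans (cong (inv k *_) (∑-swap L h)) (sym (mulE L (inv k) _))
    ; pick = λ f h → ∑-pick f (pos-factor (<⇒≤ (0<inv k)) h) }
    where
    eq : ∀ a b c → a * (b * c) ≡ b * (a * c)
    eq = solve-∀ ring

  coin : ∀ p → 0ℚ ≤ p → p ≤ 1ℚ → Exp Bool
  coin p p≥0 p≤1 = record
    { 𝔼 = λ f → p * f true + (1ℚ - p) * f false
    ; lin = record
        { congE = λ h → cong₂ (λ a b → p * a + (1ℚ - p) * b) (h true) (h false)
        ; addE = λ f g → eq₁ p (f true) (f false) (g true) (g false)
        ; mulE = λ c f → eq₂ p c (f true) (f false) }
    ; one = eq₃ p
    ; mono = λ h → (p≥0 ⊙ h true) ⊕ (0≤b-a p≤1 ⊙ h false)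
    ; swap = λ {_} {F} L h → sym (trans (addE L _ _) (cong₂ _+_ (mulE L p _) (mulE L (1ℚ - p) _)))
    ; pick = λ f h → [ (λ q → true , pos-factor p≥0 q) , (λ q → false , pos-factor (0≤b-a p≤1) q) ]′ (pos-summand
        (p * f true) _ h) }
    where
    eq₁ : ∀ p a b c d → p * (a + c) + (1ℚ - p) * (b + d) ≡ p * a + (1ℚ - p) * b + (p * c + (1ℚ - p) * d)
    eq₁ = solve-∀ ring
    eq₂ : ∀ p c a b → p * (c * a) + (1ℚ - p) * (c * b) ≡ c * (p * a + (1ℚ - p) * b)
    eq₂ = solve-∀ ring
    eq₃ : ∀ p → p * 1ℚ + (1ℚ - p) * 1ℚ ≡ 1ℚ
    eq₃ = solve-∀ ring

  infixr 4 _⊗_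
  _⊗_ : ∀ {A B} → Exp A → Exp B → Exp (A × B)
  X ⊗ Y = record
    { 𝔼 = λ f → 𝔼 X (λ a → 𝔼 Y (λ b → f (a , b)))
    ; lin = record
        { congE = λ h → 𝔼-cong X (λ a → 𝔼-cong Y (λ b → h (a , b)))
        ; addE = λ f g → trans (𝔼-cong X (λ a → 𝔼-+ Y _ _)) (𝔼-+ X _ _)
        ; mulE = λ c f → trans (𝔼-cong X (λ a → 𝔼-*ˡ Y c _)) (𝔼-*ˡ X c _) }
    ; one = trans (𝔼-cong X (λ a → one Y)) (one X)
    ; mono = λ h → mono X (λ a → mono Y (λ b → h (a , b)))
    ; swap = λ L h → trans (𝔼-cong X (λ a → swap Y L (λ b → h (a , b)))) (swap X L _)
    ; pick = λ f h → let (a , q) = pick X _ h ; (b , r) = pick Y _ q in (a , b) , r }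

  module _ {Ω : Set} (X : Exp Ω) where
    vec : ∀ n → Exp (Vec Ω n)
    vec zero = record
      { 𝔼 = λ f → f []ᵛ
      ; lin = record { congE = λ h → h []ᵛ ; addE = λ _ _ → refl ; mulE = λ _ _ → refl }
      ; one = refl ; mono = λ h → h []ᵛ ; swap = λ _ _ → refl ; pick = λ f h → []ᵛ , h }
    vec (suc n) = record
      { 𝔼 = λ f → 𝔼 Y (λ ρ → 𝔼 X (λ a → f (a ∷ᵛ ρ)))
      ; lin = record
          { congE = λ h → 𝔼-cong Y (λ ρ → 𝔼-cong X (λ a → h (a ∷ᵛ ρ)))
          ; addE = λ f g → trans (𝔼-cong Y (λ ρ → 𝔼-+ X _ _)) (𝔼-+ Y _ _)
          ; mulE = λ c f → trans (𝔼-cong Y (λ ρ → 𝔼-*ˡ X c _)) (𝔼-*ˡ Y c _) }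
      ; one = trans (𝔼-cong Y (λ ρ → one X)) (one Y)
      ; mono = λ h → mono Y (λ ρ → mono X (λ a → h (a ∷ᵛ ρ)))
      ; swap = λ L h → trans (𝔼-cong Y (λ ρ → swap X L (λ a → h (a ∷ᵛ ρ)))) (swap Y L _)
      ; pick = λ f h → let (ρ , q) = pick Y _ h ; (a , r) = pick X _ q in (a ∷ᵛ ρ) , r }
      where
      Y : Exp (Vec Ω n)
      Y = vec n

    -- A fresh independent value in one coordinate does not change the law. This replaces
    -- conditioning on all other coordinates.
    resample : ∀ {n} (i : Fin n) f → 𝔼 (vec n) f ≡ 𝔼 X (λ a → 𝔼 (vec n) (λ ω → f (ω [ i ]≔ a)))
    resample {suc n} fzero f = sym (trans (𝔼-cong X (λ a → 𝔼-cong (vec n) (λ ρ → 𝔼-const X _)))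
       (swap X (lin (vec n)) (λ a ρ → f (a ∷ᵛ ρ))))
    resample {suc n} (fsuc i) f = trans (resample i (λ ρ → 𝔼 X (λ a → f (a ∷ᵛ ρ)))) refl

    opaque
      unfolding ∏

      𝔼-∏ : ∀ {n} (g : Fin n → Ω → ℚ) → 𝔼 (vec n) (λ ω → ∏ (λ i → g i (lookup ω i))) ≡ ∏ (λ i → 𝔼 X (g i))
      𝔼-∏ {zero} g = refl
      𝔼-∏ {suc n} g = trans (𝔼-cong (vec n) (λ ρ → 𝔼-*ʳ X _ (g fzero))) (trans (𝔼-*ˡ (vec n) (𝔼 X (g fzero)) (λ ρ →
          ∏ (λ i → g (fsuc i) (lookup ρ i)))) (cong (𝔼 X (g fzero) *_) (𝔼-∏ (g ∘ fsuc))))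

    Agree : ∀ {n} → (Fin n → Bool) → Vec Ω n → Vec Ω n → Set
    Agree S ω ω′ = ∀ i → S i ≡ true → lookup ω i ≡ lookup ω′ i

    private
      const-left : ∀ (f g : Ω → ℚ) → (∀ a b → f a ≡ f b) → 𝔼 X (λ a → f a * g a) ≡ 𝔼 X f * 𝔼 X g
      const-left f g h = trans (𝔼-cong X (λ a → cong (_* g a) (trans (sym (𝔼-const X (f a))) (𝔼-cong X (λ b →
          h a b))))) (𝔼-*ˡ X (𝔼 X f) g)

    -- Induction on the vector: its head is read by only one of `f` and `g`, so the other factor is
    -- constant in the head and can be pulled out of that average.
    indep : ∀ {n} (S : Fin n → Bool) (f g : Vec Ω n → ℚ) →
      (∀ ω ω′ → Agree S ω ω′ → f ω ≡ f ω′) → (∀ ω ω′ → Agree (not ∘ S) ω ω′ → g ω ≡ g ω′) →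
      𝔼 (vec n) (λ ω → f ω * g ω) ≡ 𝔼 (vec n) f * 𝔼 (vec n) g
    indep {zero} S f g hf hg = refl
    indep {suc n} S f g hf hg = trans (𝔼-cong (vec n) inner)
        (indep (S ∘ fsuc) (λ ρ → 𝔼 X (λ a → f (a ∷ᵛ ρ))) (λ ρ → 𝔼 X (λ a → g (a ∷ᵛ ρ)))
          (λ ρ ρ′ h → 𝔼-cong X (λ a → hf _ _ (λ { fzero _ → refl ; (fsuc i) e → h i e })))
          (λ ρ ρ′ h → 𝔼-cong X (λ a → hg _ _ (λ { fzero _ → refl ; (fsuc i) e → h i e }))))
      where
      inner : ∀ ρ → 𝔼 X (λ a → f (a ∷ᵛ ρ) * g (a ∷ᵛ ρ)) ≡ 𝔼 X (λ a → f (a ∷ᵛ ρ)) * 𝔼 X (λ a → g (a ∷ᵛ ρ))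
      inner ρ with S fzero in e
      ... | false = const-left _ _ (λ a b → hf _ _ (λ { fzero t → ⊥-elim (f≢t (trans (sym e) t)) ; (fsuc i) _ →
          refl }))
        where
        f≢t : false ≢ true
        f≢t ()
      ... | true = trans (𝔼-cong X (λ a → ℚP.*-comm (f (a ∷ᵛ ρ)) _)) (trans (const-left _ _
            (λ a b → hg _ _ (λ { fzero t → ⊥-elim (t≢f (trans (sym (cong not e)) t)) ; (fsuc i) _ →
                refl }))) (ℚP.*-comm (𝔼 X (λ a → g (a ∷ᵛ ρ))) (𝔼 X (λ a → f (a ∷ᵛ ρ)))))
        where
        t≢f : false ≢ true
        t≢f ()

-- High moments and tails for functions of independent coordinates

module Concentration where

  open FiniteProbability public
  import Data.Rational.Properties as ℚP

  ∣x∣²≡x² : ∀ x → ∣ x ∣ * ∣ x ∣ ≡ x * x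
  ∣x∣²≡x² x = trans (sym (∣p*q∣≡∣p∣*∣q∣ x x)) (ℚP.0≤p⇒∣p∣≡p (0≤sq x))

  2ℚ 3ℚ 4ℚ : ℚ
  2ℚ = + 2 / 1
  3ℚ = + 3 / 1
  4ℚ = + 4 / 1

  linCoeff remCoeff : ℕ → ℚ
  linCoeff zero = 2ℚ
  linCoeff (suc j) = linCoeff j + 2ℚ
  remCoeff zero = 1ℚ
  remCoeff (suc j) = remCoeff j + (3ℚ * linCoeff j + 1ℚ)

  0≤linCoeff : ∀ j → 0ℚ ≤ linCoeff j
  0≤linCoeff zero = dec≤
  0≤linCoeff (suc j) = 0≤a+b (0≤linCoeff j) dec≤

  0≤remCoeff : ∀ j → 0ℚ ≤ remCoeff j
  0≤remCoeff zero = dec≤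
  0≤remCoeff (suc j) = 0≤a+b (0≤remCoeff j) (0≤a+b (0≤a*b {3ℚ} dec≤ (0≤linCoeff j)) 0≤1)

  module _ (S d : ℚ) where
    private
      M² = 2ℚ * (S * S + d * d)
      0≤M² : 0ℚ ≤ M²
      0≤M² = 0≤a*b {2ℚ} dec≤ (0≤a+b (0≤sq S) (0≤sq d))
      S²≤M² : S * S ≤ M²
      S²≤M² = ≤-by (0≤sq S ⊕ (0≤sq d ⊕ 0≤sq d)) (eq S d)
        where
        eq : ∀ S d → S * S + (S * S + (d * d + d * d)) ≡ 2ℚ * (S * S + d * d) + (0ℚ + (0ℚ + 0ℚ))
        eq = solve-∀ ring
      Sd≤M² : S * d ≤ M²
      Sd≤M² = ≤-by ((0ℚ ≤ ½ ∋ dec≤) ⊙ 0≤sq (S - d) ⊕ (0ℚ ≤ 3ℚ * ½ ∋ dec≤) ⊙ (0≤a+b (0≤sq S) (0≤sq d))) (eq S d)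
        where
        eq : ∀ S d → S * d + (½ * ((S - d) * (S - d)) + 3ℚ * ½ * (S * S + d * d))
            ≡ 2ℚ * (S * S + d * d) + (½ * 0ℚ + 3ℚ * ½ * 0ℚ)
        eq = solve-∀ ring
      sum²≤M² : (S + d) * (S + d) ≤ M²
      sum²≤M² = ≤-by (0≤sq (S - d)) (eq S d)
        where
        eq : ∀ S d → (S + d) * (S + d) + (S - d) * (S - d) ≡ 2ℚ * (S * S + d * d) + 0ℚ
        eq = solve-∀ ring

    -- Multiply by (S + d)² repeatedly. The linear coefficient 2j + 2 has to stay exact, because
    -- that term is to vanish in expectation; every other product is absorbed by `M²`, which
    -- dominates S², S d and (S + d)².
    even-power-expand : ∀ j → ((S + d) * (S + d)) ^ suc j ≤
      (S * S) ^ suc j + linCoeff j * (S * (S * S) ^ j) * d + remCoeff j * (M² ^ j) * (d * d)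
    even-power-expand zero = ≤-reflexive (eq S d)
      where
      eq : ∀ S d → (S + d) * (S + d) * 1ℚ ≡ S * S * 1ℚ + 2ℚ * (S * 1ℚ) * d + 1ℚ * 1ℚ * (d * d)
      eq = solve-∀ ring
    even-power-expand (suc j) = (0≤sq (S + d) ⊙ even-power-expand j) ⨾
       ≤-by ((0≤a*b (0≤remCoeff j) (0≤sq d) ⊙ (sum²≤M² ⊙ʳ ^-nonneg j 0≤M²))
          ⊕ (0≤a*b (0≤a+b (0≤a*b {2ℚ} dec≤ (0≤linCoeff j)) 0≤1) (0≤sq d) ⊙ ^-mono (suc j) (0≤sq S) S²≤M²)
          ⊕ (0≤a*b (0≤linCoeff j) (0≤sq d) ⊙ ((Sd≤M² ⊙ʳ ^-nonneg j (0≤sq S)) ⨾ (0≤M² ⊙ ^-mono j (0≤sq S) S²≤M²))))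
         (eq S d ((S * S) ^ j) (M² ^ j) (linCoeff j) (remCoeff j))
      where
      eq : ∀ S d x y b a →
        (S + d) * (S + d) * (S * S * x + b * (S * x) * d + a * y * (d * d))
         + (a * (d * d) * (2ℚ * (S * S + d * d) * y) + (2ℚ * b + 1ℚ) * (d * d) * (2ℚ * (S * S + d * d) * y) + b *
             (d * d) * (2ℚ * (S * S + d * d) * y))
        ≡ S * S * (S * S * x) + (b + 2ℚ) * (S * (S * S * x)) * d + (a + (3ℚ * b + 1ℚ)) * (2ℚ *
            (S * S + d * d) * y) * (d * d)
         + (a * (d * d) * ((S + d) * (S + d) * y) + (2ℚ * b + 1ℚ) * (d * d) * (S * S * x) + b * (d * d) * (S * d * x))
      eq = solve-∀ ring

  sum-power : ∀ j {x y} → 0ℚ ≤ x → 0ℚ ≤ y → (x + y) ^ j ≤ 2ℚ ^ j * (x ^ j + y ^ j)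
  sum-power j {x} {y} p q with ℚP.≤-total x y
  ... | inj₁ h = ^-mono j (0≤a+b p q) (≤-by h (eq x y)) ⨾ ≤-reflexive (^-* 2ℚ y j)
      ⨾ (^-nonneg j dec≤ ⊙ ≤-by (^-nonneg j p) (eq₂ (x ^ j) (y ^ j)))
    where
    eq : ∀ x y → x + y + y ≡ 2ℚ * y + x
    eq = solve-∀ ring
    eq₂ : ∀ x y → y + x ≡ x + y + 0ℚ
    eq₂ = solve-∀ ring
  ... | inj₂ h = ^-mono j (0≤a+b p q) (≤-by h (eq x y)) ⨾ ≤-reflexive (^-* 2ℚ x j)
      ⨾ (^-nonneg j dec≤ ⊙ ≤-by (^-nonneg j q) (eq₂ (x ^ j) (y ^ j)))
    where
    eq : ∀ x y → x + y + x ≡ 2ℚ * x + y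
    eq = solve-∀ ring
    eq₂ : ∀ x y → x + y ≡ x + y + 0ℚ
    eq₂ = solve-∀ ring

  expandCoeff : ℕ → ℚ
  expandCoeff j = remCoeff j * (2ℚ ^ j * 2ℚ ^ j)

  momentCoeff : ℕ → ℚ
  momentCoeff zero = 1ℚ
  momentCoeff (suc j) = expandCoeff j * (momentCoeff j + 1ℚ)

  0≤expandCoeff : ∀ j → 0ℚ ≤ expandCoeff j
  0≤expandCoeff j = 0≤a*b (0≤remCoeff j) (0≤a*b (^-nonneg j dec≤) (^-nonneg j dec≤))

  0≤momentCoeff : ∀ j → 0ℚ ≤ momentCoeff j
  0≤momentCoeff zero = 0≤1
  0≤momentCoeff (suc j) = 0≤a*b (0≤expandCoeff j) (0≤a+b (0≤momentCoeff j) 0≤1)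

  even-power-bound : ∀ j S d {κ} → d * d ≤ κ → ((S + d) * (S + d)) ^ suc j ≤
      (S * S) ^ suc j + linCoeff j * (S * (S * S) ^ j) * d + expandCoeff j * ((S * S) ^ j + κ ^ j) * (d * d)
  even-power-bound j S d {κ} h = even-power-expand S d j ⨾
     (≤-refl {(S * S) ^ suc j + linCoeff j * (S * (S * S) ^ j) * d}
         ⊕ ((0≤remCoeff j ⊙ (≤-reflexive (^-* 2ℚ (S * S + d * d) j) ⨾
        (^-nonneg j dec≤ ⊙ (sum-power j (0≤sq S) (0≤sq d) ⨾ (^-nonneg j dec≤ ⊙ (≤-refl {(S * S) ^ j}
            ⊕ ^-mono j (0≤sq d) h)))))
        ⨾ ≤-reflexive (eq (remCoeff j) (2ℚ ^ j) ((S * S) ^ j + κ ^ j))) ⊙ʳ 0≤sq d))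
    where
    eq : ∀ a b c → a * (b * (b * c)) ≡ a * (b * b) * c
    eq = solve-∀ ring

  module _ {Ω : Set} (X : Exp Ω) where

    -- f changes by at most K when coordinate i changes, and only with probability p i does it differ
    -- from its value f₀ i with that coordinate neutralised.
    record BoundedDiff {n} (f : Vec Ω n → ℚ) (K : ℚ) (p : Fin n → ℚ) : Set where
      field
        f₀ ind : Fin n → Vec Ω n → ℚ
        f₀-indep : ∀ i ω a → f₀ i (ω [ i ]≔ a) ≡ f₀ i ω
        close : ∀ i ω → ∣ f ω - f₀ i ω ∣ ≤ K * ind i ω
        0≤ind : ∀ i ω → 0ℚ ≤ ind i ω
        ind≤1 : ∀ i ω → ind i ω ≤ 1ℚ
        ind-avg : ∀ i ω → 𝔼 X (λ a → ind i (ω [ i ]≔ a)) ≤ p i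
    open BoundedDiff

    -- The partial averages form the Doob martingale of `f`; each of them inherits the bounded
    -- differences, so an induction can expose one coordinate at a time.
    average : ∀ {n f K p} → BoundedDiff {suc n} f K p → BoundedDiff {n} (λ ρ → 𝔼 X (λ a → f (a ∷ᵛ ρ))) K (p ∘ fsuc)
    average {n} {f} {K} {p} B = record
      { f₀ = λ i ρ → 𝔼 X (λ a → f₀ B (fsuc i) (a ∷ᵛ ρ))
      ; ind = λ i ρ → 𝔼 X (λ a → ind B (fsuc i) (a ∷ᵛ ρ))
      ; f₀-indep = λ i ρ b → 𝔼-cong X (λ a → f₀-indep B (fsuc i) (a ∷ᵛ ρ) b)
      ; close = λ i ρ → ≤-reflexive (cong ∣_∣ (sym (𝔼-sub X _ _))) ⨾ 𝔼-abs X _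
          ⨾ mono X (λ a → close B (fsuc i) (a ∷ᵛ ρ)) ⨾ ≤-reflexive (𝔼-*ˡ X K _)
      ; 0≤ind = λ i ρ → 𝔼-nonneg X (λ a → 0≤ind B (fsuc i) (a ∷ᵛ ρ))
      ; ind≤1 = λ i ρ → mono X (λ a → ind≤1 B (fsuc i) (a ∷ᵛ ρ)) ⨾ ≤-reflexive (one X)
      ; ind-avg = λ i ρ → ≤-reflexive (swap X (lin X) _) ⨾ mono X (λ a → ind-avg B (fsuc i) (a ∷ᵛ ρ))
          ⨾ ≤-reflexive (𝔼-const X (p (fsuc i))) }

    private
      -- One martingale step: `S` is the deviation of the partial average from the mean, and `d` is
      -- the increment due to the head, which has mean zero.
      module Step {n f K p} (K≥0 : 0ℚ ≤ K) (B : BoundedDiff {suc n} f K p) (ρ : Vec Ω n) (S : ℚ) (j : ℕ) where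
        κ : ℚ
        κ = 4ℚ * (K * K)
        f̄ : ℚ
        f̄ = 𝔼 X (λ a → f (a ∷ᵛ ρ))
        d : Ω → ℚ
        d a = f (a ∷ᵛ ρ) - f̄
        g : Ω → ℚ
        g a = f (a ∷ᵛ ρ) - f₀ B fzero (a ∷ᵛ ρ)
        I : Ω → ℚ
        I a = ind B fzero (a ∷ᵛ ρ)
        EI≤p : 𝔼 X I ≤ p fzero
        EI≤p = ≤-reflexive (sym (𝔼-const X (𝔼 X I))) ⨾ mono X (λ b → ind-avg B fzero (b ∷ᵛ ρ))
            ⨾ ≤-reflexive (𝔼-const X (p fzero))
        EI≤1 : 𝔼 X I ≤ 1ℚ
        EI≤1 = mono X (λ a → ind≤1 B fzero (a ∷ᵛ ρ)) ⨾ ≤-reflexive (one X)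
        f₀const : ∀ a b → f₀ B fzero (a ∷ᵛ ρ) ≡ f₀ B fzero (b ∷ᵛ ρ)
        f₀const a b = f₀-indep B fzero (b ∷ᵛ ρ) a
        d≡ : ∀ a → d a ≡ g a - 𝔼 X g
        d≡ a = sym (trans (cong (λ z → g a - z) (trans (𝔼-sub X _ _) (cong (λ z → f̄ - z)
                 (trans (𝔼-cong X (λ b → f₀const b a)) (𝔼-const X (f₀ B fzero (a ∷ᵛ ρ))))))) (eq (f (a ∷ᵛ ρ)) f̄
                     (f₀ B fzero (a ∷ᵛ ρ))))
          where
          eq : ∀ x y z → x - z - (y - z) ≡ x - y
          eq = solve-∀ ring
        ∣d∣≤ : ∀ a → ∣ d a ∣ ≤ K * (I a + 𝔼 X I)
        ∣d∣≤ a = ≤-reflexive (cong ∣_∣ (d≡ a)) ⨾ ℚP.∣p-q∣≤∣p∣+∣q∣ (g a) (𝔼 X g) ⨾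
           (close B fzero (a ∷ᵛ ρ) ⊕ (𝔼-abs X g ⨾ mono X (λ b → close B fzero (b ∷ᵛ ρ))
               ⨾ ≤-reflexive (𝔼-*ˡ X K I))) ⨾ ≤-reflexive (sym (ℚP.*-distribˡ-+ K (I a) (𝔼 X I)))
        ∣d∣≤2K : ∀ a → ∣ d a ∣ ≤ K * 2ℚ
        ∣d∣≤2K a = ∣d∣≤ a ⨾ (K≥0 ⊙ (ind≤1 B fzero (a ∷ᵛ ρ) ⊕ EI≤1))
        d² : ∀ a → d a * d a ≤ K * 2ℚ * (K * (I a + 𝔼 X I))
        d² a = ≤-reflexive (sym (∣x∣²≡x² (d a))) ⨾ *-mono (0≤∣p∣ (d a)) (0≤a*b {K} {2ℚ} K≥0 dec≤) (∣d∣≤2K a) (∣d∣≤ a)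
        d²≤κ : ∀ a → d a * d a ≤ κ
        d²≤κ a = d² a ⨾ (0≤a*b {K} {2ℚ} K≥0 dec≤ ⊙ (K≥0 ⊙ (ind≤1 B fzero (a ∷ᵛ ρ) ⊕ EI≤1))) ⨾ ≤-reflexive (eq K)
          where
          eq : ∀ K → K * 2ℚ * (K * (1ℚ + 1ℚ)) ≡ 4ℚ * (K * K)
          eq = solve-∀ ring
        Ed : 𝔼 X d ≡ 0ℚ
        Ed = trans (𝔼-sub X _ _) (trans (cong (λ z → f̄ - z) (𝔼-const X f̄)) (ℚP.+-inverseʳ f̄))
        -- One factor |d| is bounded by 2K and only the other by its indicator, so the variance is
        -- linear in the probability p.
        Ed² : 𝔼 X (λ a → d a * d a) ≤ κ * p fzero
        Ed² = mono X d² ⨾ ≤-reflexive (trans (𝔼-*ˡ X (K * 2ℚ) _) (cong (K * 2ℚ *_) (trans (𝔼-*ˡ X K _)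
                 (cong (K *_) (trans (𝔼-+ X I _) (cong (λ z → 𝔼 X I + z) (𝔼-const X (𝔼 X I))))))))
               ⨾ (0≤a*b {K} {2ℚ} K≥0 dec≤ ⊙ (K≥0 ⊙ (EI≤p ⊕ EI≤p))) ⨾ ≤-reflexive (eq K (p fzero))
          where
          eq : ∀ K p → K * 2ℚ * (K * (p + p)) ≡ 4ℚ * (K * K) * p
          eq = solve-∀ ring
        0≤κ : 0ℚ ≤ κ
        0≤κ = 0≤a*b {4ℚ} dec≤ (0≤sq K)
        c₁ c₂ c₃ : ℚ
        c₁ = (S * S) ^ suc j
        c₂ = linCoeff j * (S * (S * S) ^ j)
        c₃ = expandCoeff j * ((S * S) ^ j + κ ^ j)
        result : 𝔼 X (λ a → ((S + d a) * (S + d a)) ^ suc j) ≤ c₁ + c₃ * (κ * p fzero)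
        result = mono X (λ a → even-power-bound j S (d a) (d²≤κ a)) ⨾
          ≤-reflexive (trans (𝔼-+ X _ _) (cong₂ _+_ (trans (𝔼-+ X _ _) (cong₂ _+_ (𝔼-const X c₁) (trans
              (𝔼-*ˡ X c₂ d) (trans (cong (c₂ *_) Ed) (ℚP.*-zeroʳ c₂))))) (𝔼-*ˡ X c₃ _)))
          ⨾ (≤-reflexive (ℚP.+-identityʳ c₁) ⊕ (0≤a*b (0≤expandCoeff j) (0≤a+b (^-nonneg j (0≤sq S))
              (^-nonneg j 0≤κ)) ⊙ Ed²))

    dev : ∀ {n} → (Vec Ω n → ℚ) → Vec Ω n → ℚ
    dev {n} f ω = f ω - 𝔼 (vec X n) f

    -- An inequality of Rosenthal type. Each exposed coordinate adds at most κ p times a moment of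
    -- order 2j, already bounded by a multiple of V^j; summing over the coordinates gives one
    -- further factor V.
    moment-bound : ∀ K V → 0ℚ ≤ K → 4ℚ * (K * K) ≤ V → ∀ j {n} (f : Vec Ω n → ℚ) p → (∀ i → 0ℚ ≤ p i) →
      BoundedDiff f K p → 4ℚ * (K * K) * ∑ p ≤ V → 𝔼 (vec X n) (λ ω → (dev f ω * dev f ω) ^ j) ≤ momentCoeff j * V ^ j
    moment-bound K V K≥0 κ≤V = go
      where
      κ : ℚ
      κ = 4ℚ * (K * K)
      0≤κ : 0ℚ ≤ κ
      0≤κ = 0≤a*b {4ℚ} dec≤ (0≤sq K)
      0≤V : 0ℚ ≤ V
      0≤V = 0≤κ ⨾ κ≤V
      go : ∀ j {n} (f : Vec Ω n → ℚ) p → (∀ i → 0ℚ ≤ p i) → BoundedDiff f K p → κ * ∑ p ≤ V → 𝔼 (vec X n) (λ ω →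
          (dev f ω * dev f ω) ^ j) ≤ momentCoeff j * V ^ j
      inner : ∀ j {n} (f : Vec Ω n → ℚ) p → (∀ i → 0ℚ ≤ p i) → BoundedDiff f K p → κ * ∑ p ≤ V →
        𝔼 (vec X n) (λ ω → (dev f ω * dev f ω) ^ suc j) ≤ expandCoeff j * (momentCoeff j * V ^ j + V ^ j) * (κ * ∑ p)
      inner j {zero} f p p≥0 B h = ≤-reflexive (trans (cong (λ z → z * z * (z * z) ^ j) (ℚP.+-inverseʳ (f []ᵛ)))
          (trans (ℚP.*-zeroˡ ((0ℚ * 0ℚ) ^ j)) (sym (trans (cong (E *_) (trans (cong (κ *_) (∑-zero p))
          (ℚP.*-zeroʳ κ))) (ℚP.*-zeroʳ E)))))
        where
        E : ℚ
        E = expandCoeff j * (momentCoeff j * V ^ j + V ^ j)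
      inner j {suc n} f p p≥0 B h =
        ≤-reflexive (𝔼-cong (vec X n) (λ ρ → 𝔼-cong X (λ a → cong (λ z →
            (z * z) ^ suc j) (split (f (a ∷ᵛ ρ)) (f̄ ρ) m)))) ⨾
        mono (vec X n) (λ ρ → Step.result K≥0 B ρ (f̄ ρ - m) j) ⨾
        ≤-reflexive (trans (𝔼-+ (vec X n) _ _) (cong (λ z → 𝔼 (vec X n) (λ ρ → (dev f̄ ρ * dev f̄ ρ) ^ suc j) + z)
           (trans (𝔼-*ʳ (vec X n) (κ * p fzero) _) (cong (_* (κ * p fzero)) (trans (𝔼-*ˡ (vec X n)
               (expandCoeff j) _) (cong (expandCoeff j *_) (trans (𝔼-+ (vec X n) _ _) (cong (λ z → 𝔼 (vec X n) (λ ρ →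
               (dev f̄ ρ * dev f̄ ρ) ^ j) + z) (𝔼-const (vec X n) (κ ^ j)))))))))) ⨾
        (inner j f̄ (p ∘ fsuc) (p≥0 ∘ fsuc) (average B) h′ ⊕ ((0≤expandCoeff j ⊙ (go j f̄ (p ∘ fsuc) (p≥0 ∘ fsuc)
            (average B) h′ ⊕ ^-mono j 0≤κ κ≤V)) ⊙ʳ 0≤a*b 0≤κ (p≥0 fzero)))
        ⨾ ≤-reflexive (trans (eq E κ (p fzero) (∑ (p ∘ fsuc))) (cong (λ z → E * (κ * z)) (sym (∑-suc p))))
        where
        E : ℚ
        E = expandCoeff j * (momentCoeff j * V ^ j + V ^ j)
        f̄ : Vec Ω n → ℚ
        f̄ ρ = 𝔼 X (λ a → f (a ∷ᵛ ρ))
        m : ℚ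
        m = 𝔼 (vec X n) f̄
        split : ∀ x y z → x - z ≡ y - z + (x - y)
        split = solve-∀ ring
        eq : ∀ e k p q → e * (k * q) + e * (k * p) ≡ e * (k * (p + q))
        eq = solve-∀ ring
        h′ : κ * ∑ (p ∘ fsuc) ≤ V
        h′ = (0≤κ ⊙ (≤-by (p≥0 fzero) (eq₂ (p fzero) (∑ (p ∘ fsuc))) ⨾ ≤-reflexive (sym (∑-suc p)))) ⨾ h
          where
          eq₂ : ∀ a b → b + a ≡ a + b + 0ℚ
          eq₂ = solve-∀ ring
      go zero {n} f p p≥0 B h = ≤-reflexive (trans (one (vec X n)) (sym (ℚP.*-identityʳ 1ℚ)))
      go (suc j) f p p≥0 B h = inner j f p p≥0 B h ⨾ (0≤a*b (0≤expandCoeff j) (0≤a+b (0≤a*b (0≤momentCoeff j)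
          (^-nonneg j 0≤V)) (^-nonneg j 0≤V)) ⊙ h)
          ⨾ ≤-reflexive (eq (expandCoeff j) (momentCoeff j) (V ^ j) V)
        where
        eq : ∀ e c v V → e * (c * v + v) * V ≡ e * (c + 1ℚ) * (V * v)
        eq = solve-∀ ring

    -- Markov's inequality for the 2j-th power of the deviation.
    tail-bound : ∀ K V t → 0ℚ ≤ K → 0ℚ ≤ t → 4ℚ * (K * K) ≤ V → ∀ j {n} (f : Vec Ω n → ℚ) p → (∀ i → 0ℚ ≤ p i) →
      BoundedDiff f K p → 4ℚ * (K * K) * ∑ p ≤ V → (A : Vec Ω n → Bool) → (∀ ω → A ω ≡ true →
          𝔼 (vec X n) f + t ≤ f ω) →
      𝔼 (vec X n) (λ ω → ⟦ A ω ⟧) * (t * t) ^ j ≤ momentCoeff j * V ^ j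
    tail-bound K V t K≥0 t≥0 κ≤V j {n} f p p≥0 B h A hA = ≤-reflexive (sym (𝔼-*ʳ (vec X n) ((t * t) ^ j) _)) ⨾
       mono (vec X n) pt ⨾ moment-bound K V K≥0 κ≤V j f p p≥0 B h
      where
      pt : ∀ ω → ⟦ A ω ⟧ * (t * t) ^ j ≤ (dev f ω * dev f ω) ^ j
      pt ω with A ω in e
      ... | false = ≤-reflexive (ℚP.*-zeroˡ ((t * t) ^ j)) ⨾ ^-nonneg j (0≤sq (dev f ω))
      ... | true = ≤-reflexive (ℚP.*-identityˡ ((t * t) ^ j)) ⨾ ^-mono j (0≤sq t) (*-mono t≥0 (t≥0 ⨾ t≤d) t≤d t≤d)
        where
        t≤d : t ≤ dev f ω
        t≤d = ≤-by (hA ω e) (eq t (f ω) (𝔼 (vec X n) f))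
          where
          eq : ∀ t x m → t + x ≡ x - m + (m + t)
          eq = solve-∀ ring

-- The symmetric Lovász local lemma

module LocalLemma where

  open Concentration public
  import Data.Rational.Properties as ℚP
  import Data.Nat as ℕ
  import Data.Nat.Properties as ℕP
  import Data.Fin as Fin
  import Data.Fin.Properties as FinP
  import Data.Bool.Properties as BoolP

  card : ∀ {m} → (Fin m → Bool) → ℕ
  card {zero} S = 0
  card {suc m} S = (if S fzero then 1 else 0) ℕ.+ card (S ∘ fsuc)

  _⊆_ : ∀ {m} → (Fin m → Bool) → (Fin m → Bool) → Set
  S ⊆ S′ = ∀ i → S i ≡ true → S′ i ≡ true

  card-mono : ∀ {m} {S S′ : Fin m → Bool} → S ⊆ S′ → card S ℕ.≤ card S′
  card-mono {zero} h = ℕ.z≤n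
  card-mono {suc m} {S} {S′} h with S fzero in e | S′ fzero in e′
  ... | true | true = ℕ.s≤s (card-mono (h ∘ fsuc))
  ... | false | true = ℕP.m≤n⇒m≤1+n (card-mono (h ∘ fsuc))
  ... | false | false = card-mono (h ∘ fsuc)
  ... | true | false with trans (sym (h fzero e)) e′
  ...   | ()

  card-strict : ∀ {m} {S S′ : Fin m → Bool} → S ⊆ S′ → ∀ i → S i ≡ false → S′ i ≡ true → card S ℕ.< card S′
  card-strict {suc m} {S} {S′} h fzero e e′ rewrite e | e′ = ℕ.s≤s (card-mono (h ∘ fsuc))
  card-strict {suc m} {S} {S′} h (fsuc i) e e′ with S fzero in q | S′ fzero in q′
  ... | true | true = ℕ.s≤s (card-strict (h ∘ fsuc) i e e′)
  ... | false | true = ℕP.m≤n⇒m≤1+n (card-strict (h ∘ fsuc) i e e′)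
  ... | false | false = card-strict (h ∘ fsuc) i e e′
  ... | true | false with trans (sym (h fzero q)) q′
  ...   | ()

  opaque
    unfolding ∑ ∏

    union-bound : ∀ {n} (x : Fin n → ℚ) → (∀ i → 0ℚ ≤ x i) → (∀ i → x i ≤ 1ℚ) → 1ℚ ≤ ∏ (λ i → 1ℚ - x i) + ∑ x
    union-bound {zero} x p q = ≤-refl
    union-bound {suc n} x p q = ≤-by
        ((0≤b-a (q fzero) ⊙ union-bound (x ∘ fsuc) (p ∘ fsuc) (q ∘ fsuc)) ⊕ 0≤a*b (p fzero) (∑-nonneg (p ∘ fsuc)))
        (eq (x fzero) (∏ (λ i → 1ℚ - x (fsuc i))) (∑ (x ∘ fsuc)))
      where
      eq : ∀ x P S → 1ℚ + ((1ℚ - x) * (P + S) + x * S) ≡ (1ℚ - x) * P + (x + S) + ((1ℚ - x) * 1ℚ + 0ℚ)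
      eq = solve-∀ ring

    ∏≡1⇒ : ∀ {n} (b : Fin n → Bool) → 0ℚ < ∏ (λ i → ⟦ b i ⟧) → ∀ i → b i ≡ true
    ∏≡1⇒ {suc n} b h i with b fzero in e
    ... | false = ⊥-elim (ℚP.<-irrefl refl (subst (0ℚ <_) (ℚP.*-zeroˡ (∏ (λ i → ⟦ b (fsuc i) ⟧))) h))
    ∏≡1⇒ {suc n} b h fzero | true = e
    ∏≡1⇒ {suc n} b h (fsuc i) | true = ∏≡1⇒ (b ∘ fsuc) (subst (0ℚ <_) (ℚP.*-identityˡ (∏ (λ i → ⟦ b (fsuc i) ⟧))) h) i

  <ᵇ-true : ∀ {a b} → (a ℕ.<ᵇ b) ≡ true → a ℕ.< b
  <ᵇ-true {a} {b} e = ℕP.<ᵇ⇒< a b (subst T (sym e) _)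

  <ᵇ-false : ∀ {a b} → (a ℕ.<ᵇ b) ≡ false → ¬ a ℕ.< b
  <ᵇ-false e h = subst T e (ℕP.<⇒<ᵇ h)

  module _ {Ω : Set} (X : Exp Ω) {n m : ℕ} (A : Fin m → Vec Ω n → Bool) (R : Fin m → Fin n → Bool) (dep : Fin m →
      Fin m → Bool)
    (local : ∀ v ω ω′ → Agree X (R v) ω ω′ → A v ω ≡ A v ω′)
    (dep-correct : ∀ v w → dep v w ≡ false → ∀ i → R w i ≡ true → R v i ≡ false)
    (p d : ℚ) (0≤p : 0ℚ ≤ p) (A≤p : ∀ v → 𝔼 (vec X n) (λ ω → ⟦ A v ω ⟧) ≤ p)
    (dep≤d : ∀ v → ∑ (λ w → ⟦ dep v w ⟧) ≤ d) (4pd≤1 : 4ℚ * p * d ≤ 1ℚ) (4p≤1 : 4ℚ * p ≤ 1ℚ) where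

    private
      Y : Exp (Vec Ω n)
      Y = vec X n
      none : (Fin m → Bool) → Vec Ω n → ℚ
      none S ω = ∏ (λ s → ⟦ not (S s ∧ A s ω) ⟧)
      0≤none : ∀ S ω → 0ℚ ≤ none S ω
      0≤none S ω = ∏-nonneg (λ s → 0≤⟦ not (S s ∧ A s ω) ⟧)
      near far : Fin m → (Fin m → Bool) → Fin m → Bool
      near v S s = S s ∧ dep v s
      far v S s = S s ∧ not (dep v s)

      none-split : ∀ v S ω → none S ω ≡ none (near v S) ω * none (far v S) ω
      none-split v S ω = trans (∏-cong (λ s → pt (S s) (dep v s) (A s ω))) (∏-* _ _)
        where
        pt : ∀ a b c → ⟦ not (a ∧ c) ⟧ ≡ ⟦ not ((a ∧ b) ∧ c) ⟧ * ⟦ not ((a ∧ not b) ∧ c) ⟧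
        pt true true true = refl
        pt true true false = refl
        pt true false true = refl
        pt true false false = refl
        pt false b c = refl

      none≤far : ∀ v S ω → none S ω ≤ none (far v S) ω
      none≤far v S ω = ∏-mono (λ s → 0≤⟦ not (S s ∧ A s ω) ⟧) (λ s → pt (S s) (dep v s) (A s ω))
        where
        pt : ∀ a b c → ⟦ not (a ∧ c) ⟧ ≤ ⟦ not ((a ∧ not b) ∧ c) ⟧
        pt true true true = 0≤1
        pt true true false = ≤-refl
        pt true false c = ≤-refl
        pt false b c = ≤-refl

      factor : ∀ v S → 𝔼 Y (λ ω → ⟦ A v ω ⟧ * none (far v S) ω) ≡ 𝔼 Y (λ ω → ⟦ A v ω ⟧) * 𝔼 Y (none (far v S))
      factor v S = indep X (R v) _ _ (λ ω ω′ h → cong ⟦_⟧ (local v ω ω′ h)) (λ ω ω′ h → ∏-cong (λ s → pt s ω ω′ h))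
        where
        pt : ∀ s ω ω′ → Agree X (not ∘ R v) ω ω′ → ⟦ not (far v S s ∧ A s ω) ⟧ ≡ ⟦ not (far v S s ∧ A s ω′) ⟧
        pt s ω ω′ h with S s | dep v s in e
        ... | false | _ = refl
        ... | true | true = refl
        ... | true | false = cong (⟦_⟧ ∘ not) (local s ω ω′ (λ i r → h i (cong not (dep-correct v s e i r))))

      step₁ : ∀ v S → 𝔼 Y (λ ω → ⟦ A v ω ⟧ * none S ω) ≤ p * 𝔼 Y (none (far v S))
      step₁ v S = mono Y (λ ω → 0≤⟦ A v ω ⟧ ⊙ none≤far v S ω) ⨾ ≤-reflexive (factor v S)
          ⨾ (A≤p v ⊙ʳ 𝔼-nonneg Y (0≤none (far v S)))

      -- The customary bound 2p on the probability of `A v` given that no event of `S` occurs,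
      -- multiplied out: no denominator can vanish, and positivity is needed only at the end.
      Claim : (Fin m → Bool) → Set
      Claim S = ∀ v → 𝔼 Y (λ ω → ⟦ A v ω ⟧ * none S ω) ≤ 2ℚ * p * 𝔼 Y (none S)

      -- Given that no far event occurs, each of the at most d near events has probability at most
      -- 2p, so together they occur with probability at most 2pd ≤ ½.
      half : ∀ v S → Claim (far v S) → 𝔼 Y (none (far v S)) ≤ 2ℚ * 𝔼 Y (none S)
      half v S ih = ≤-by (≤₁ ⊕ ≤₁ ⊕ ≤₂) (eq F N p d)
        where
        F N : ℚ
        F = 𝔼 Y (none (far v S))
        N = 𝔼 Y (none S)
        pt : ∀ ω → none (far v S) ω ≤ none S ω + ∑ (λ s → ⟦ near v S s ⟧ * (⟦ A s ω ⟧ * none (far v S) ω))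
        pt ω = ≤-by (union-bound (λ s → ⟦ near v S s ∧ A s ω ⟧) (λ s → 0≤⟦ near v S s ∧ A s ω ⟧) (λ s →
            ⟦ near v S s ∧ A s ω ⟧≤1) ⊙ʳ 0≤none (far v S) ω)
          (trans (eq₁ P Σ′ O) (sym (cong₂ (λ a b → a + b + 1ℚ * O) (trans (none-split v S ω) (cong (_* O) (∏-cong
              (λ s → ⟦not⟧ (near v S s ∧ A s ω)))))
            (trans (∑-cong (λ s → trans (sym (ℚP.*-assoc ⟦ near v S s ⟧ ⟦ A s ω ⟧ O)) (cong (_* O) (sym (⟦∧⟧
                (near v S s) (A s ω)))))) (∑-*ʳ O _)))))
          where
          O P Σ′ : ℚ
          O = none (far v S) ω
          P = ∏ (λ s → 1ℚ - ⟦ near v S s ∧ A s ω ⟧)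
          Σ′ = ∑ (λ s → ⟦ near v S s ∧ A s ω ⟧)
          eq₁ : ∀ P S O → O + (P + S) * O ≡ P * O + S * O + 1ℚ * O
          eq₁ = solve-∀ ring
        near≤ : ∀ s → ⟦ near v S s ⟧ ≤ ⟦ dep v s ⟧
        near≤ s with S s
        ... | true = ≤-refl
        ... | false = 0≤⟦ dep v s ⟧
        0≤F : 0ℚ ≤ F
        0≤F = 𝔼-nonneg Y (0≤none (far v S))
        0≤2pF : 0ℚ ≤ 2ℚ * p * F
        0≤2pF = 0≤a*b (0≤a*b {2ℚ} dec≤ 0≤p) 0≤F
        ≤₁ : F ≤ N + d * (2ℚ * p * F)
        ≤₁ = mono Y pt ⨾ ≤-reflexive (trans (𝔼-+ Y _ _) (cong (λ z → N + z) (trans (𝔼-∑ Y _) (∑-cong (λ s →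
            𝔼-*ˡ Y ⟦ near v S s ⟧ _)))))
          ⨾ (≤-refl {N} ⊕ (∑-mono (λ s → *-mono (𝔼-nonneg Y (λ ω → 0≤a*b 0≤⟦ A s ω ⟧ (0≤none
              (far v S) ω))) 0≤⟦ dep v s ⟧ (near≤ s) (ih s))
          ⨾ ≤-reflexive (∑-*ʳ (2ℚ * p * F) _) ⨾ (dep≤d v ⊙ʳ 0≤2pF)))
        ≤₂ : 4ℚ * p * d * F ≤ 1ℚ * F
        ≤₂ = 4pd≤1 ⊙ʳ 0≤F
        eq : ∀ F N p d → F + (N + d * (2ℚ * p * F) + (N + d * (2ℚ * p * F)) + 1ℚ * F)
            ≡ 2ℚ * N + (F + F + 4ℚ * p * d * F)
        eq = solve-∀ ring

      -- Induction on the size of `S`, passing to `far v S`. If no event of `S` is near v, that set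
      -- does not shrink, but then independence alone suffices.
      claim : ∀ k S → card S ℕ.≤ k → Claim S
      claim k S h v with FinP.any? (λ s → near v S s BoolP.≟ true)
      ... | no none-near = step₁ v S ⨾ (0≤p ⊙ ≤-reflexive (𝔼-cong Y (λ ω → ∏-cong (λ s → cong (λ z →
          ⟦ not (z ∧ A s ω) ⟧) (same s)))))
              ⨾ ≤-by (0≤a*b 0≤p (𝔼-nonneg Y (0≤none S))) (eq p (𝔼 Y (none S)))
        where
        same : ∀ s → far v S s ≡ S s
        same s with S s in e | dep v s in e′
        ... | false | _ = refl
        ... | true | false = refl
        ... | true | true = ⊥-elim (none-near (s , cong₂ _∧_ e e′))
        eq : ∀ p N → p * N + p * N ≡ 2ℚ * p * N + 0ℚ
        eq = solve-∀ ring
      ... | yes (s , e) = go k h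
        where
        far⊆ : far v S ⊆ S
        far⊆ i q with S i
        ... | true = refl
        far-s : far v S s ≡ false
        far-s = cong₂ (λ x y → x ∧ not y) (∧-trueˡ {S s} e) (∧-trueʳ {S s} e)
        S-s : S s ≡ true
        S-s = ∧-trueˡ e
        lt : card (far v S) ℕ.< card S
        lt = card-strict far⊆ s far-s S-s
        go : ∀ k → card S ℕ.≤ k → 𝔼 Y (λ ω → ⟦ A v ω ⟧ * none S ω) ≤ 2ℚ * p * 𝔼 Y (none S)
        go zero h = ⊥-elim (ℕP.n≮0 (ℕP.<-≤-trans lt h))
        go (suc k) h = step₁ v S ⨾ (0≤p ⊙ half v S (claim k (far v S) (ℕP.≤-pred (ℕP.≤-trans lt h))))
            ⨾ ≤-reflexive (eq p (𝔼 Y (none S)))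
          where
          eq : ∀ p N → p * (2ℚ * N) ≡ 2ℚ * p * N
          eq = solve-∀ ring

      below : ℕ → Fin m → Bool
      below k s = toℕ s ℕ.<ᵇ k

      -- Forbidding one more event costs at most the fraction 2p ≤ ½ of the probability that is
      -- left, so it never reaches 0.
      positive-below : ∀ k → k ℕ.≤ m → 0ℚ < 𝔼 Y (none (below k))
      positive-below zero _ = subst (0ℚ <_) (sym (trans (𝔼-cong Y (λ ω → ∏-one m)) (one Y))) dec<
        where
        ∏-one : ∀ m → ∏ {m} (λ _ → 1ℚ) ≡ 1ℚ
        ∏-one zero = ∏-zero _
        ∏-one (suc m) = trans (∏-suc _) (trans (ℚP.*-identityˡ (∏ {m} (λ _ → 1ℚ))) (∏-one m))
      positive-below (suc k) h = pos-factor {2ℚ} dec≤ (<-≤-trans (positive-below k (ℕP.<⇒≤ h)) bound)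
        where
        v : Fin m
        v = Fin.fromℕ< h
        N N′ : ℚ
        N = 𝔼 Y (none (below k))
        N′ = 𝔼 Y (none (below (suc k)))
        pt : ∀ ω → none (below k) ω ≤ none (below (suc k)) ω + ⟦ A v ω ⟧ * none (below k) ω
        pt ω with A v ω in e
        ... | true = ≤-by (0≤none (below (suc k)) ω) (eq (none (below k) ω) _)
          where
          eq : ∀ a b → a + b ≡ b + 1ℚ * a + 0ℚ
          eq = solve-∀ ring
        ... | false = ∏-mono (λ s → 0≤⟦ not (below k s ∧ A s ω) ⟧) le
            ⨾ ≤-reflexive (eq (none (below (suc k)) ω) (none (below k) ω))
          where
          eq : ∀ a b → a ≡ a + 0ℚ * b
          eq = solve-∀ ring
          le : ∀ s → ⟦ not (below k s ∧ A s ω) ⟧ ≤ ⟦ not (below (suc k) s ∧ A s ω) ⟧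
          le s with toℕ s ℕ.<ᵇ k in q | toℕ s ℕ.<ᵇ suc k in q′
          ... | true | true = ≤-refl
          ... | false | false = ≤-refl
          ... | true | false = ⊥-elim (<ᵇ-false {toℕ s} {suc k} q′ (ℕP.m≤n⇒m≤1+n (<ᵇ-true q)))
          ... | false | true = ≤-reflexive (cong (⟦_⟧ ∘ not) (sym (trans (cong (λ z → A z ω) s≡v) e)))
            where
            s≡v : s ≡ v
            s≡v = FinP.toℕ-injective (trans (ℕP.≤-antisym (ℕP.≤-pred (<ᵇ-true {toℕ s} {suc k} q′)) (ℕP.≮⇒≥
                (<ᵇ-false {toℕ s} {k} q))) (sym (FinP.toℕ-fromℕ< h)))
        bound : N ≤ 2ℚ * N′
        bound = ≤-by (≤₁ ⊕ ≤₁ ⊕ (4p≤1 ⊙ʳ 𝔼-nonneg Y (0≤none (below k)))) (eq N N′ p)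
          where
          ≤₁ : N ≤ N′ + 2ℚ * p * N
          ≤₁ = mono Y pt ⨾ ≤-reflexive (𝔼-+ Y _ _) ⨾ (≤-refl {N′} ⊕ claim (card (below k)) (below k) ℕP.≤-refl v)
          eq : ∀ N N′ p → N + (N′ + 2ℚ * p * N + (N′ + 2ℚ * p * N) + 1ℚ * N) ≡ 2ℚ * N′ + (N + N + 4ℚ * p * N)
          eq = solve-∀ ring

    local-lemma : ∃[ ω ] ∀ v → A v ω ≡ false
    local-lemma with pick Y (none (below m)) (positive-below m ℕP.≤-refl)
    ... | ω , h = ω , λ v → un (A v ω) (subst (λ z → not (z ∧ A v ω) ≡ true) (all-below v) (∏≡1⇒ (λ s →
        not (below m s ∧ A s ω)) h v))
      where
      un : ∀ a → not (true ∧ a) ≡ true → a ≡ false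
      un false _ = refl
      all-below : ∀ v → below m v ≡ true
      all-below v with toℕ v ℕ.<ᵇ m in e
      ... | true = refl
      ... | false = ⊥-elim (<ᵇ-false e (FinP.toℕ<n v))

-- Random choices at a vertex and survival against outsiders

module Combinatorics where

  open LocalLemma public
  open import Data.Bool using (_xor_) public
  open import Data.Maybe using (Maybe; just; nothing) public
  open import Defs using (Graph; adj; irrefl) public
  import Data.Bool.Properties as BoolP
  import Data.Fin as Fin
  import Data.Fin.Properties as FinP
  import Data.Nat as ℕ
  import Data.Nat.Properties as ℕP
  import Data.Rational.Properties as ℚP
  import Data.Vec.Properties as VecP

  allB anyB : ∀ {n} → (Fin n → Bool) → Bool
  allB {zero} f = true
  allB {suc n} f = f fzero ∧ allB (f ∘ fsuc)
  anyB f = not (allB (not ∘ f))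

  allB-cong : ∀ {n} {f g : Fin n → Bool} → (∀ i → f i ≡ g i) → allB f ≡ allB g
  allB-cong {zero} h = refl
  allB-cong {suc n} h = cong₂ _∧_ (h fzero) (allB-cong (h ∘ fsuc))

  anyB-cong : ∀ {n} {f g : Fin n → Bool} → (∀ i → f i ≡ g i) → anyB f ≡ anyB g
  anyB-cong h = cong not (allB-cong (cong not ∘ h))

  allB-elim : ∀ {n} {f : Fin n → Bool} → allB f ≡ true → ∀ i → f i ≡ true
  allB-elim {f = f} h fzero = ∧-trueˡ h
  allB-elim {f = f} h (fsuc i) = allB-elim {f = f ∘ fsuc} (∧-trueʳ {f fzero} h) i

  allB-intro : ∀ {n} {f : Fin n → Bool} → (∀ i → f i ≡ true) → allB f ≡ true
  allB-intro {zero} h = refl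
  allB-intro {suc n} h = cong₂ _∧_ (h fzero) (allB-intro (h ∘ fsuc))

  not-true : ∀ {b} → not b ≡ true → b ≡ false
  not-true {false} _ = refl

  anyB-false : ∀ {n} {f : Fin n → Bool} → anyB f ≡ false → ∀ i → f i ≡ false
  anyB-false {f = f} h i = not-true (allB-elim {f = not ∘ f} (trans (sym (BoolP.not-involutive _)) (cong not h)) i)

  anyB-intro : ∀ {n} {f : Fin n → Bool} i → f i ≡ true → anyB f ≡ true
  anyB-intro {f = f} i h with anyB f in e
  ... | true = refl
  ... | false = false≢true (anyB-false {f = f} e i) h

  anyB-none : ∀ {n} {f : Fin n → Bool} → (∀ i → f i ≡ false) → anyB f ≡ false
  anyB-none {f = f} h = cong not (allB-intro {f = not ∘ f} (cong not ∘ h))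

  opaque
    unfolding ∑ ∏

    ⟦allB⟧ : ∀ {n} (f : Fin n → Bool) → ⟦ allB f ⟧ ≡ ∏ (λ i → ⟦ f i ⟧)
    ⟦allB⟧ {zero} f = refl
    ⟦allB⟧ {suc n} f = trans (⟦∧⟧ (f fzero) _) (cong (⟦ f fzero ⟧ *_) (⟦allB⟧ (f ∘ fsuc)))

    ∑-card : ∀ {n} (f : Fin n → Bool) → ∑ (λ i → ⟦ f i ⟧) ≡ ι (card f)
    ∑-card {zero} f = sym ι-0
    ∑-card {suc n} f with f fzero
    ... | true = trans (cong (λ z → 1ℚ + z) (∑-card (f ∘ fsuc))) (sym (ι-suc (card (f ∘ fsuc))))
    ... | false = trans (ℚP.+-identityˡ (∑ (λ i → ⟦ f (fsuc i) ⟧))) (∑-card (f ∘ fsuc))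

  anyB-elim : ∀ {n} {f : Fin n → Bool} → anyB f ≡ true → ∃[ i ] f i ≡ true
  anyB-elim {f = f} h with FinP.any? (λ i → f i BoolP.≟ true)
  ... | yes p = p
  ... | no ¬p = false≢true (anyB-none {f = f} (λ i → BoolP.¬-not (λ e → ¬p (i , e)))) h

  ⟦anyB⟧≤ : ∀ {n} (f : Fin n → Bool) → ⟦ anyB f ⟧ ≤ ∑ (λ i → ⟦ f i ⟧)
  ⟦anyB⟧≤ f with anyB f in e
  ... | false = ∑-nonneg (λ i → 0≤⟦ f i ⟧)
  ... | true with anyB-elim {f = f} e
  ...   | i , h = ≤-reflexive (cong ⟦_⟧ (sym h)) ⨾ term≤∑ (λ i → 0≤⟦ f i ⟧) i

  card-cong : ∀ {n} {f g : Fin n → Bool} → (∀ i → f i ≡ g i) → card f ≡ card g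
  card-cong {zero} h = refl
  card-cong {suc n} h = cong₂ ℕ._+_ (cong (λ z → if z then 1 else 0) (h fzero)) (card-cong (h ∘ fsuc))

  ∑-single : ∀ {n} (f : Fin n → Bool) → (∀ i j → f i ≡ true → f j ≡ true → i ≡ j) → ∑ (λ i → ⟦ f i ⟧) ≤ 1ℚ
  ∑-single {zero} f h = ≤-reflexive (∑-zero _) ⨾ 0≤1
  ∑-single {suc n} f h with f fzero in e
  ... | false = ≤-reflexive (trans (∑-suc _) (trans (cong (λ z → ⟦ z ⟧ + ∑ (λ i →
      ⟦ f (fsuc i) ⟧)) e) (ℚP.+-identityˡ (∑ (λ i → ⟦ f (fsuc i) ⟧)))))
         ⨾ ∑-single (f ∘ fsuc) (λ i j p q → FinP.suc-injective (h (fsuc i) (fsuc j) p q))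
  ... | true = ≤-reflexive (trans (∑-suc _) (trans (cong₂ (λ z w → ⟦ z ⟧ + w) e (trans (∑-cong (λ i →
      cong ⟦_⟧ (rest i))) (∑-0 n))) (ℚP.+-identityʳ 1ℚ)))
    where
    rest : ∀ i → f (fsuc i) ≡ false
    rest i = BoolP.¬-not (λ q → FinP.0≢1+n (h fzero (fsuc i) e q))

  ≡ᵇ-true : ∀ {a b} → (a ℕ.≡ᵇ b) ≡ true → a ≡ b
  ≡ᵇ-true {a} {b} e = ℕP.≡ᵇ⇒≡ a b (subst T (sym e) _)

  ≡ᵇ-refl : ∀ a → (a ℕ.≡ᵇ a) ≡ true
  ≡ᵇ-refl zero = refl
  ≡ᵇ-refl (suc a) = ≡ᵇ-refl a

  eqc : Maybe ℕ → ℕ → Bool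
  eqc nothing c = false
  eqc (just a) c = a ℕ.≡ᵇ c

  firstTrue : ∀ {D} → ℕ → Vec Bool D → Bool
  firstTrue zero bs = true
  firstTrue (suc m) []ᵛ = true
  firstTrue (suc m) (b ∷ᵛ bs) = b ∧ firstTrue m bs

  inv≤1 : ∀ k → inv k ≤ 1ℚ
  inv≤1 k = ≤-by (<⇒≤ (0<inv k) ⊙ ι-mono {1} {suc k} (ℕ.s≤s ℕ.z≤n)) (trans (cong (λ z →
      inv k + z) (inv-eq k)) (trans (eq (inv k)) (cong (λ z → 1ℚ + inv k * z) (sym ι-1))))
    where
    eq : ∀ x → x + 1ℚ ≡ 1ℚ + x * 1ℚ
    eq = solve-∀ ring

  ∑-≤-card : ∀ {n} (a b : Fin n → Bool) → ∑ (λ i → ⟦ a i ∧ b i ⟧) ≤ ∑ (λ i → ⟦ a i ⟧)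
  ∑-≤-card a b = ∑-mono (λ i → pt (a i) (b i))
    where
    pt : ∀ a b → ⟦ a ∧ b ⟧ ≤ ⟦ a ⟧
    pt true b = ⟦ b ⟧≤1
    pt false b = ≤-refl

  module _ {Ω : Set} (X : Exp Ω) where
    𝔼-proj : ∀ {n} (i : Fin n) (f : Ω → ℚ) → 𝔼 (vec X n) (λ ω → f (lookup ω i)) ≡ 𝔼 X f
    𝔼-proj {n} i f = trans (resample X i _) (𝔼-cong X (λ a → trans (𝔼-cong (vec X n) (λ ω →
        cong f (VecP.lookup∘updateAt i ω))) (𝔼-const (vec X n) (f a))))

    𝔼-inj-∏ : ∀ {m n} (z : Fin m → Fin n) → (∀ i j → z i ≡ z j → i ≡ j) → (f : Fin m → Ω → ℚ) →
      𝔼 (vec X n) (λ ω → ∏ (λ j → f j (lookup ω (z j)))) ≡ ∏ (λ j → 𝔼 X (f j))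
    𝔼-inj-∏ {zero} {n} z inj f = trans (𝔼-cong (vec X n) (λ _ → ∏-zero _)) (trans (one (vec X n)) (sym (∏-zero _)))
    𝔼-inj-∏ {suc m} {n} z inj f = trans (𝔼-cong (vec X n) (λ _ → ∏-suc _)) (trans (indep X S _ _
         (λ ω ω′ h → cong (f fzero) (h (z fzero) S-self))
         (λ ω ω′ h → ∏-cong (λ j → cong (f (fsuc j)) (h (z (fsuc j)) (cong not (S-other j))))))
       (trans (cong₂ _*_ (𝔼-proj (z fzero) (f fzero)) (𝔼-inj-∏ (z ∘ fsuc) (λ i j e →
           FinP.suc-injective (inj (fsuc i) (fsuc j) e)) (f ∘ fsuc))) (sym (∏-suc _))))
      where
      S : Fin n → Bool
      S i = does (i FinP.≟ z fzero)
      S-self : S (z fzero) ≡ true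
      S-self with z fzero FinP.≟ z fzero
      ... | yes _ = refl
      ... | no ¬p = ⊥-elim (¬p refl)
      S-other : ∀ j → S (z (fsuc j)) ≡ false
      S-other j with z (fsuc j) FinP.≟ z fzero
      ... | yes p = ⊥-elim (FinP.0≢1+n (sym (inj (fsuc j) fzero p)))
      ... | no _ = refl

  firstTrue-prob : ∀ p (p≥0 : 0ℚ ≤ p) (p≤1 : p ≤ 1ℚ) {D} m → m ℕ.≤ D → 𝔼 (vec (coin p p≥0 p≤1) D) (λ bs →
      ⟦ firstTrue m bs ⟧) ≡ p ^ m
  firstTrue-prob p p≥0 p≤1 {D} zero h = 𝔼-const (vec (coin p p≥0 p≤1) D) 1ℚ
  firstTrue-prob p p≥0 p≤1 {suc D} (suc m) (ℕ.s≤s h) = trans (𝔼-cong (vec C D) (λ bs →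
      eq p ⟦ firstTrue m bs ⟧)) (trans (𝔼-*ˡ (vec C D) p _) (cong (p *_) (firstTrue-prob p p≥0 p≤1 m h)))
    where
    C : Exp Bool
    C = coin p p≥0 p≤1
    eq : ∀ p x → p * x + (1ℚ - p) * 0ℚ ≡ p * x
    eq = solve-∀ ring

  -- A vertex draws a colour, one fair bit for every vertex to orient edges, and `D` ghost coins. A
  -- ghost strikes with probability `q` = 1/(2C), exactly the chance that a neighbour with the
  -- colour in its list holds it and wins the edge.
  module Space (n k D : ℕ) where
    q : ℚ
    q = ½ * inv k
    0≤q : 0ℚ ≤ q
    0≤q = 0≤a*b {½} dec≤ (<⇒≤ (0<inv k))
    q≤½ : q ≤ ½
    q≤½ = ((0ℚ ≤ ½ ∋ dec≤) ⊙ inv≤1 k) ⨾ ≤-reflexive (ℚP.*-identityʳ ½)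
    0≤1-q : 0ℚ ≤ 1ℚ - q
    0≤1-q = 0≤b-a {q} {1ℚ} (q≤½ ⨾ dec≤)
    1-q≤1 : 1ℚ - q ≤ 1ℚ
    1-q≤1 = 1-a≤1 0≤q
    opaque
      Bits : Exp (Vec Bool n)
      Bits = vec (coin ½ dec≤ dec≤) n
      Bits-∏ : ∀ {m} (z : Fin m → Fin n) → (∀ i j → z i ≡ z j → i ≡ j) → (f : Fin m → Bool → ℚ) →
        𝔼 Bits (λ bs → ∏ (λ j → f j (lookup bs (z j)))) ≡ ∏ (λ j → ½ * f j true + (1ℚ - ½) * f j false)
      Bits-∏ z inj f = 𝔼-inj-∏ (coin ½ dec≤ dec≤) z inj f
      Ghosts : Exp (Vec Bool D)
      Ghosts = vec (coin (1ℚ - q) 0≤1-q 1-q≤1) D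
      Ghosts-first : ∀ m → m ℕ.≤ D → 𝔼 Ghosts (λ gs → ⟦ firstTrue m gs ⟧) ≡ (1ℚ - q) ^ m
      Ghosts-first m h = firstTrue-prob (1ℚ - q) 0≤1-q 1-q≤1 m h
      X : Exp (Fin (suc k) × Vec Bool n × Vec Bool D)
      X = unif k ⊗ Bits ⊗ Ghosts
      𝔼-X : ∀ f → 𝔼 X f ≡ inv k * ∑ (λ κ → 𝔼 Bits (λ bs → 𝔼 Ghosts (λ gs → f (κ , bs , gs))))
      𝔼-X f = refl
    𝔼-κ : ∀ (g : Fin (suc k) → ℚ) → 𝔼 X (λ a → g (proj₁ a)) ≡ inv k * ∑ g
    𝔼-κ g = trans (𝔼-X (λ a → g (proj₁ a))) (cong (inv k *_) (∑-cong (λ i → trans (𝔼-cong Bits (λ _ →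
        𝔼-const Ghosts (g i))) (𝔼-const Bits (g i)))))

  opaque
    unfolding ∏

    ∏-one : ∀ {n} {f : Fin n → ℚ} → (∀ i → f i ≡ 1ℚ) → ∏ f ≡ 1ℚ
    ∏-one {zero} h = refl
    ∏-one {suc n} h = trans (cong₂ _*_ (h fzero) (∏-one (h ∘ fsuc))) (ℚP.*-identityˡ 1ℚ)

    ∏-swap : ∀ {m n} (f : Fin m → Fin n → ℚ) → ∏ (λ i → ∏ (f i)) ≡ ∏ (λ j → ∏ (λ i → f i j))
    ∏-swap {zero} {n} f = sym (∏-one {n} {λ _ → 1ℚ} (λ _ → refl))
    ∏-swap {suc m} f = trans (cong (∏ (f fzero) *_) (∏-swap (f ∘ fsuc))) (sym (∏-* (f fzero) _))

    ∏-pow : ∀ {n} x (α : Fin n → Bool) → ∏ (λ i → 1ℚ - x * ⟦ α i ⟧) ≡ (1ℚ - x) ^ card α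
    ∏-pow {zero} x α = refl
    ∏-pow {suc n} x α with α fzero
    ... | true = cong₂ _*_ (cong (λ z → 1ℚ - z) (ℚP.*-identityʳ x)) (∏-pow x (α ∘ fsuc))
    ... | false = trans (cong₂ _*_ (cong (λ z → 1ℚ - z) (ℚP.*-zeroʳ x)) (∏-pow x (α ∘ fsuc))) (ℚP.*-identityˡ
        ((1ℚ - x) ^ card (α ∘ fsuc)))

  updAll : ∀ {Ω : Set} {m n} → Vec Ω n → (Fin m → Fin n) → Vec Ω m → Vec Ω n
  updAll ω z []ᵛ = ω
  updAll ω z (a ∷ᵛ as) = updAll ω (z ∘ fsuc) as [ z fzero ]≔ a

  lookup-updAll : ∀ {Ω : Set} {m n} (ω : Vec Ω n) (z : Fin m → Fin n) (as : Vec Ω m) → (∀ i j → z i ≡ z j → i ≡ j) →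
      ∀ j → lookup (updAll ω z as) (z j) ≡ lookup as j
  lookup-updAll ω z (a ∷ᵛ as) inj fzero = VecP.lookup∘updateAt (z fzero) (updAll ω (z ∘ fsuc) as)
  lookup-updAll ω z (a ∷ᵛ as) inj (fsuc j) = trans (VecP.lookup∘updateAt′ (z (fsuc j)) (z fzero) (λ e →
      FinP.0≢1+n (sym (inj (fsuc j) fzero e))) (updAll ω (z ∘ fsuc) as))
     (lookup-updAll ω (z ∘ fsuc) as (λ i j e → FinP.suc-injective (inj (fsuc i) (fsuc j) e)) j)

  lookup-updAll′ : ∀ {Ω : Set} {m n} (ω : Vec Ω n) (z : Fin m → Fin n) (as : Vec Ω m) y → (∀ j → z j ≢ y) →
      lookup (updAll ω z as) y ≡ lookup ω y
  lookup-updAll′ ω z []ᵛ y h = refl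
  lookup-updAll′ ω z (a ∷ᵛ as) y h = trans (VecP.lookup∘updateAt′ y (z fzero) (λ e →
      h fzero (sym e)) (updAll ω (z ∘ fsuc) as)) (lookup-updAll′ ω (z ∘ fsuc) as y (h ∘ fsuc))

  -- Draws the coordinates `z` separately, so that they can be held fixed while all others are still
  -- random.
  resampleAll : ∀ {Ω : Set} (X : Exp Ω) {m n} (z : Fin m → Fin n) f → 𝔼 (vec X n) f ≡ 𝔼 (vec X m) (λ as →
      𝔼 (vec X n) (λ ω → f (updAll ω z as)))
  resampleAll X {zero} z f = refl
  resampleAll X {suc m} {n} z f = trans (resample X (z fzero) f) (trans (𝔼-cong X (λ a →
      resampleAll X (z ∘ fsuc) (λ ω → f (ω [ z fzero ]≔ a)))) (swap X (lin (vec X m)) _))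

  -- A single fair bit makes the xor fair for every value of the remaining bits: the orientation of
  -- an edge stays uniform after one end has been fixed.
  half-coin : ∀ a p l → ½ * ⟦ not (a ∧ not ((p xor true) xor l)) ⟧ + (1ℚ - ½) * ⟦ not (a ∧ not
      ((p xor false) xor l)) ⟧ ≡ 1ℚ - ½ * ⟦ a ⟧
  half-coin false false false = refl
  half-coin false false true = refl
  half-coin false true false = refl
  half-coin false true true = refl
  half-coin true false false = refl
  half-coin true false true = refl
  half-coin true true false = refl
  half-coin true true true = refl

  ∏1 : (f : Fin 1 → ℚ) → ∏ f ≡ f fzero
  ∏1 f = trans (∏-suc f) (trans (cong (f fzero *_) (∏-zero _)) (ℚP.*-identityʳ (f fzero)))

  ∏2 : (f : Fin 2 → ℚ) → ∏ f ≡ f fzero * f (fsuc fzero)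
  ∏2 f = trans (∏-suc f) (cong (f fzero *_) (∏1 (f ∘ fsuc)))

  ∏3 : (f : Fin 3 → ℚ) → ∏ f ≡ f fzero * (f (fsuc fzero) * f (fsuc (fsuc fzero)))
  ∏3 f = trans (∏-suc f) (cong (f fzero *_) (∏2 (f ∘ fsuc)))

  two : ∀ {A : Set} → A → A → Fin 2 → A
  two a b fzero = a
  two a b (fsuc fzero) = b

  three : ∀ {A : Set} → A → A → A → Fin 3 → A
  three a b c fzero = a
  three a b c (fsuc fzero) = b
  three a b c (fsuc (fsuc fzero)) = c

  single-inj : ∀ {A : Set} {a : A} (i j : Fin 1) → a ≡ a → i ≡ j
  single-inj fzero fzero _ = refl

  two-inj : ∀ {A : Set} {a b : A} → a ≢ b → ∀ i j → two a b i ≡ two a b j → i ≡ j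
  two-inj h fzero fzero e = refl
  two-inj h fzero (fsuc fzero) e = ⊥-elim (h e)
  two-inj h (fsuc fzero) fzero e = ⊥-elim (h (sym e))
  two-inj h (fsuc fzero) (fsuc fzero) e = refl

  three-inj : ∀ {A : Set} {a b c : A} → a ≢ b → a ≢ c → b ≢ c → ∀ i j → three a b c i ≡ three a b c j → i ≡ j
  three-inj h₁ h₂ h₃ fzero fzero e = refl
  three-inj h₁ h₂ h₃ fzero (fsuc fzero) e = ⊥-elim (h₁ e)
  three-inj h₁ h₂ h₃ fzero (fsuc (fsuc fzero)) e = ⊥-elim (h₂ e)
  three-inj h₁ h₂ h₃ (fsuc fzero) fzero e = ⊥-elim (h₁ (sym e))
  three-inj h₁ h₂ h₃ (fsuc fzero) (fsuc fzero) e = refl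
  three-inj h₁ h₂ h₃ (fsuc fzero) (fsuc (fsuc fzero)) e = ⊥-elim (h₃ e)
  three-inj h₁ h₂ h₃ (fsuc (fsuc fzero)) fzero e = ⊥-elim (h₂ (sym e))
  three-inj h₁ h₂ h₃ (fsuc (fsuc fzero)) (fsuc fzero) e = ⊥-elim (h₃ (sym e))
  three-inj h₁ h₂ h₃ (fsuc (fsuc fzero)) (fsuc (fsuc fzero)) e = refl

  -- 1 - x(1 - 2⁻ʲ) is the chance that an outsider adjacent to j of the equally coloured vertices beats
  -- none of them; x = 1/C.
  module Outsider (x : ℚ) (0≤x : 0ℚ ≤ x) (x≤1 : x ≤ 1ℚ) where
    m₁ : Bool → ℚ
    m₁ a = 1ℚ - ½ * ⟦ a ⟧

    out₂ : Bool → Bool → Bool → ℚ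
    out₂ h a b = 1ℚ - x * ⟦ h ⟧ * (1ℚ - m₁ a * m₁ b)

    out₃ : Bool → Bool → Bool → Bool → ℚ
    out₃ h a b c = 1ℚ - x * ⟦ h ⟧ * (1ℚ - m₁ a * (m₁ b * m₁ c))

    lone : ∀ a h → 1ℚ - x * ⟦ h ⟧ * (1ℚ - m₁ a) ≡ 1ℚ - ½ * x * ⟦ a ∧ h ⟧
    lone true h = eq x ⟦ h ⟧
      where
      eq : ∀ x h → 1ℚ - x * h * (1ℚ - (1ℚ - ½ * 1ℚ)) ≡ 1ℚ - ½ * x * h
      eq = solve-∀ ring
    lone false h = eq x ⟦ h ⟧
      where
      eq : ∀ x h → 1ℚ - x * h * (1ℚ - (1ℚ - ½ * 0ℚ)) ≡ 1ℚ - ½ * x * 0ℚ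
      eq = solve-∀ ring

    -- A common neighbour that beats both vertices uses a single colour choice, so the survivals are
    -- positively correlated; for a common neighbour the gap is ¼ x (1 - x).
    pair : ∀ h a b → (1ℚ - ½ * x * ⟦ a ∧ h ⟧) * (1ℚ - ½ * x * ⟦ b ∧ h ⟧) ≤ out₂ h a b
    pair true true true = ≤-by (0≤a*b {½ * ½} dec≤ (0≤a*b 0≤x (0≤b-a x≤1))) (eq x)
      where
      eq : ∀ x → (1ℚ - ½ * x * 1ℚ) * (1ℚ - ½ * x * 1ℚ) + ½ * ½ * (x * (1ℚ - x))
          ≡ 1ℚ - x * 1ℚ * (1ℚ - (1ℚ - ½ * 1ℚ) * (1ℚ - ½ * 1ℚ)) + 0ℚ
      eq = solve-∀ ring
    pair true true false = ≤-reflexive (eq x)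
      where
      eq : ∀ x → (1ℚ - ½ * x * 1ℚ) * (1ℚ - ½ * x * 0ℚ) ≡ 1ℚ - x * 1ℚ * (1ℚ - (1ℚ - ½ * 1ℚ) * (1ℚ - ½ * 0ℚ))
      eq = solve-∀ ring
    pair true false true = ≤-reflexive (eq x)
      where
      eq : ∀ x → (1ℚ - ½ * x * 0ℚ) * (1ℚ - ½ * x * 1ℚ) ≡ 1ℚ - x * 1ℚ * (1ℚ - (1ℚ - ½ * 0ℚ) * (1ℚ - ½ * 1ℚ))
      eq = solve-∀ ring
    pair true false false = ≤-reflexive (eq x)
      where
      eq : ∀ x → (1ℚ - ½ * x * 0ℚ) * (1ℚ - ½ * x * 0ℚ) ≡ 1ℚ - x * 1ℚ * (1ℚ - (1ℚ - ½ * 0ℚ) * (1ℚ - ½ * 0ℚ))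
      eq = solve-∀ ring
    pair false a b = ≤-reflexive (trans (cong₂ (λ u v → (1ℚ - ½ * x * ⟦ u ⟧) * (1ℚ - ½ * x * ⟦ v ⟧))
        (BoolP.∧-zeroʳ a) (BoolP.∧-zeroʳ b)) (eq x (m₁ a * m₁ b)))
      where
      eq : ∀ x y → (1ℚ - ½ * x * 0ℚ) * (1ℚ - ½ * x * 0ℚ) ≡ 1ℚ - x * 0ℚ * (1ℚ - y)
      eq = solve-∀ ring

    y₇ : ℚ
    y₇ = (+ 7 / 8) * x

    private
      cube : ℚ → ℚ
      cube z = z * z * z
      v₁ v₂ v₃ : ℚ
      v₁ = 1ℚ - ½ * x
      v₂ = 1ℚ - (+ 3 / 4) * x
      v₃ = 1ℚ - y₇

      c₁ : cube v₁ ≤ v₃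
      c₁ = ≤-by (0≤a*b (0≤a*b 0≤x (0≤b-a x≤1)) (0≤b-a {(+ 1 / 8) * x} {+ 5 / 8} (((0ℚ ≤ + 1 / 8 ∋ dec≤) ⊙ x≤1)
          ⨾ dec≤))) (eq x)
        where
        eq : ∀ x → (1ℚ - ½ * x) * (1ℚ - ½ * x) * (1ℚ - ½ * x) + x * (1ℚ - x) * (+ 5 / 8 - (+ 1 / 8) * x)
            ≡ 1ℚ - (+ 7 / 8) * x + 0ℚ
        eq = solve-∀ ring
      c₂ : cube v₂ ≤ v₃ * v₃
      c₂ = ≤-by (0≤a*b (0≤a*b 0≤x (0≤b-a x≤1)) (0≤b-a {(+ 27 / 64) * x} {½} (((0ℚ ≤ + 27 / 64 ∋ dec≤) ⊙ x≤1)
          ⨾ dec≤))) (eq x)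
        where
        eq : ∀ x → (1ℚ - (+ 3 / 4) * x) * (1ℚ - (+ 3 / 4) * x) * (1ℚ - (+ 3 / 4) * x) + x * (1ℚ - x) * (½ -
            (+ 27 / 64) * x) ≡ (1ℚ - (+ 7 / 8) * x) * (1ℚ - (+ 7 / 8) * x) + 0ℚ
        eq = solve-∀ ring

      fit : ∀ {o r} p q → o ≡ p → r ≡ q → cube p ≤ q → cube o ≤ r
      fit p q refl refl h = h

    v₁³≤v₃ : v₁ * v₁ * v₁ ≤ v₃
    v₁³≤v₃ = c₁

    0≤v₃ : 0ℚ ≤ v₃
    0≤v₃ = 0≤b-a {y₇} {1ℚ} (((0ℚ ≤ + 7 / 8 ∋ dec≤) ⊙ x≤1) ⨾ dec≤)

    -- Source of the 7/8: an outsider adjacent to all three beats some of them with probability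
    -- 7x/8, and the factor is divided equally among the three. Adjacency to only one or two gives
    -- (1 - x/2)³ ≤ 1 - 7x/8 and (1 - 3x/4)³ ≤ (1 - 7x/8)², so sharing neighbours is the worst case.
    triple : ∀ h a b c → out₃ h a b c * out₃ h a b c * out₃ h a b c
        ≤ (1ℚ - y₇ * ⟦ a ∧ h ⟧) * ((1ℚ - y₇ * ⟦ b ∧ h ⟧) * (1ℚ - y₇ * ⟦ c ∧ h ⟧))
    triple true true true true = ≤-reflexive (eq x)
      where
      eq : ∀ x → let o = 1ℚ - x * 1ℚ * (1ℚ - (1ℚ - ½ * 1ℚ) * ((1ℚ - ½ * 1ℚ) * (1ℚ - ½ * 1ℚ))) ; r = 1ℚ - (+ 7 / 8) * x * 1ℚ in o * o * o ≡ r * (r * r)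
      eq = solve-∀ ring
    triple true true true false = fit v₂ (v₃ * v₃) (e₁ x) (e₂ x) c₂
      where
      e₁ : ∀ x → 1ℚ - x * 1ℚ * (1ℚ - (1ℚ - ½ * 1ℚ) * ((1ℚ - ½ * 1ℚ) * (1ℚ - ½ * 0ℚ))) ≡ 1ℚ - (+ 3 / 4) * x
      e₁ = solve-∀ ring
      e₂ : ∀ x → (1ℚ - (+ 7 / 8) * x * 1ℚ) * ((1ℚ - (+ 7 / 8) * x * 1ℚ) * (1ℚ - (+ 7 / 8) * x * 0ℚ))
          ≡ (1ℚ - (+ 7 / 8) * x) * (1ℚ - (+ 7 / 8) * x)
      e₂ = solve-∀ ring
    triple true true false true = fit v₂ (v₃ * v₃) (e₁ x) (e₂ x) c₂
      where
      e₁ : ∀ x → 1ℚ - x * 1ℚ * (1ℚ - (1ℚ - ½ * 1ℚ) * ((1ℚ - ½ * 0ℚ) * (1ℚ - ½ * 1ℚ))) ≡ 1ℚ - (+ 3 / 4) * x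
      e₁ = solve-∀ ring
      e₂ : ∀ x → (1ℚ - (+ 7 / 8) * x * 1ℚ) * ((1ℚ - (+ 7 / 8) * x * 0ℚ) * (1ℚ - (+ 7 / 8) * x * 1ℚ))
          ≡ (1ℚ - (+ 7 / 8) * x) * (1ℚ - (+ 7 / 8) * x)
      e₂ = solve-∀ ring
    triple true false true true = fit v₂ (v₃ * v₃) (e₁ x) (e₂ x) c₂
      where
      e₁ : ∀ x → 1ℚ - x * 1ℚ * (1ℚ - (1ℚ - ½ * 0ℚ) * ((1ℚ - ½ * 1ℚ) * (1ℚ - ½ * 1ℚ))) ≡ 1ℚ - (+ 3 / 4) * x
      e₁ = solve-∀ ring
      e₂ : ∀ x → (1ℚ - (+ 7 / 8) * x * 0ℚ) * ((1ℚ - (+ 7 / 8) * x * 1ℚ) * (1ℚ - (+ 7 / 8) * x * 1ℚ))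
          ≡ (1ℚ - (+ 7 / 8) * x) * (1ℚ - (+ 7 / 8) * x)
      e₂ = solve-∀ ring
    triple true true false false = fit v₁ v₃ (e₁ x) (e₂ x) c₁
      where
      e₁ : ∀ x → 1ℚ - x * 1ℚ * (1ℚ - (1ℚ - ½ * 1ℚ) * ((1ℚ - ½ * 0ℚ) * (1ℚ - ½ * 0ℚ))) ≡ 1ℚ - ½ * x
      e₁ = solve-∀ ring
      e₂ : ∀ x → (1ℚ - (+ 7 / 8) * x * 1ℚ) * ((1ℚ - (+ 7 / 8) * x * 0ℚ) * (1ℚ - (+ 7 / 8) * x * 0ℚ))
          ≡ 1ℚ - (+ 7 / 8) * x
      e₂ = solve-∀ ring
    triple true false true false = fit v₁ v₃ (e₁ x) (e₂ x) c₁
      where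
      e₁ : ∀ x → 1ℚ - x * 1ℚ * (1ℚ - (1ℚ - ½ * 0ℚ) * ((1ℚ - ½ * 1ℚ) * (1ℚ - ½ * 0ℚ))) ≡ 1ℚ - ½ * x
      e₁ = solve-∀ ring
      e₂ : ∀ x → (1ℚ - (+ 7 / 8) * x * 0ℚ) * ((1ℚ - (+ 7 / 8) * x * 1ℚ) * (1ℚ - (+ 7 / 8) * x * 0ℚ))
          ≡ 1ℚ - (+ 7 / 8) * x
      e₂ = solve-∀ ring
    triple true false false true = fit v₁ v₃ (e₁ x) (e₂ x) c₁
      where
      e₁ : ∀ x → 1ℚ - x * 1ℚ * (1ℚ - (1ℚ - ½ * 0ℚ) * ((1ℚ - ½ * 0ℚ) * (1ℚ - ½ * 1ℚ))) ≡ 1ℚ - ½ * x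
      e₁ = solve-∀ ring
      e₂ : ∀ x → (1ℚ - (+ 7 / 8) * x * 0ℚ) * ((1ℚ - (+ 7 / 8) * x * 0ℚ) * (1ℚ - (+ 7 / 8) * x * 1ℚ))
          ≡ 1ℚ - (+ 7 / 8) * x
      e₂ = solve-∀ ring
    triple true false false false = ≤-reflexive (eq x)
      where
      eq : ∀ x → let o = 1ℚ - x * 1ℚ * (1ℚ - (1ℚ - ½ * 0ℚ) * ((1ℚ - ½ * 0ℚ) * (1ℚ - ½ * 0ℚ))) ; r = 1ℚ - (+ 7 / 8) * x * 0ℚ in o * o * o ≡ r * (r * r)
      eq = solve-∀ ring
    triple false a b c rewrite BoolP.∧-zeroʳ a | BoolP.∧-zeroʳ b | BoolP.∧-zeroʳ c = ≤-reflexive (eq x (m₁ a *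
        (m₁ b * m₁ c)))
      where
      eq : ∀ x w → let o = 1ℚ - x * 0ℚ * (1ℚ - w) ; r = 1ℚ - (+ 7 / 8) * x * 0ℚ in o * o * o ≡ r * (r * r)
      eq = solve-∀ ring

  ∑-only : ∀ {n} (f : Fin n → ℚ) i → (∀ j → j ≢ i → f j ≡ 0ℚ) → ∑ f ≡ f i
  ∑-only {suc n} f fzero h = trans (∑-suc f) (trans (cong (λ z → f fzero + z) (trans (∑-cong (λ j →
      h (fsuc j) (λ ()))) (∑-0 n))) (ℚP.+-identityʳ (f fzero)))
  ∑-only {suc n} f (fsuc i) h = trans (∑-suc f) (trans (cong₂ _+_ (h fzero (λ ())) (∑-only (f ∘ fsuc) i (λ j ne →
      h (fsuc j) (ne ∘ FinP.suc-injective)))) (ℚP.+-identityˡ (f (fsuc i))))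

  <ᵇ-antisym : ∀ {a b} → a ≢ b → (a ℕ.<ᵇ b) ≡ not (b ℕ.<ᵇ a)
  <ᵇ-antisym {a} {b} ne with a ℕ.<ᵇ b in p | b ℕ.<ᵇ a in q
  ... | true | true = ⊥-elim (ℕP.<-asym (<ᵇ-true {a} {b} p) (<ᵇ-true {b} {a} q))
  ... | true | false = refl
  ... | false | true = refl
  ... | false | false = ⊥-elim (ne (ℕP.≤-antisym (ℕP.≮⇒≥ (<ᵇ-false {b} {a} q)) (ℕP.≮⇒≥ (<ᵇ-false {a} {b} p))))

  -- Inclusion and exclusion to third order

  1/6 : ℚ
  1/6 = + 1 / 6

  -- Each vertex u lies in at most min(a, d(u)²) ≤ r d(u) ordered triangles.
  triangle-bound : ∀ {n} (F : Fin n → Fin n → ℚ) r → (∀ u w → 0ℚ ≤ F u w) → (∀ u w → F u w ≤ 1ℚ) → 0ℚ ≤ r → ∑ (λ u →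
      ∑ (F u)) ≤ r * r →
    ∑ (λ u → ∑ (λ w → ∑ (λ t → F u w * (F u t * F w t)))) ≤ r * ∑ (λ u → ∑ (F u))
  triangle-bound {n} F r 0≤F F≤1 0≤r a≤r² = ∑-mono per-u ⨾ ≤-reflexive (∑-*ˡ r _)
    where
    d : Fin n → ℚ
    d u = ∑ (F u)
    0≤d : ∀ u → 0ℚ ≤ d u
    0≤d u = ∑-nonneg (0≤F u)
    per-u : ∀ u → ∑ (λ w → ∑ (λ t → F u w * (F u t * F w t))) ≤ r * d u
    per-u u with ℚP.≤-total r (d u)
    ... | inj₁ h = ∑-mono (λ w → ∑-mono (λ t → *-mono (0≤a*b (0≤F u t) (0≤F w t)) 0≤1 (F≤1 u w) (*-mono
        (0≤F w t) 0≤1 (F≤1 u t) (≤-refl {F w t})) ⨾ ≤-reflexive (trans (ℚP.*-identityˡ (1ℚ * F w t)) (ℚP.*-identityˡ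
        (F w t)))))
           ⨾ a≤r² ⨾ (0≤r ⊙ h)
    ... | inj₂ h = ∑-mono (λ w → ∑-mono (λ t → 0≤F u w ⊙ ((0≤F u t ⊙ F≤1 w t)
        ⨾ ≤-reflexive (ℚP.*-identityʳ (F u t)))))
           ⨾ ≤-reflexive (trans (∑-cong (λ w → ∑-*ˡ (F u w) (F u))) (∑-*ʳ (d u) (F u))) ⨾ (h ⊙ʳ 0≤d u)

  -- X is the set of vertices of N keeping a given colour; distinct members of X are related by nf.
  module Bonferroni {n} (S N X : Fin n → Bool) (eqf nf : Fin n → Fin n → Bool)
    (S⊆N : S ⊆ N) (∑eqf≤1 : ∀ u → ∑ (λ w → ⟦ eqf u w ⟧) ≤ 1ℚ)
    (diag : ∀ u (f : Fin n → ℚ) → ∑ (λ w → ⟦ eqf u w ⟧ * f w) ≡ f u)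
    (split : ∀ u w → X u ≡ true → X w ≡ true → ⟦ nf u w ⟧ + ⟦ eqf u w ⟧ ≡ 1ℚ) where

    y : Fin n → ℚ
    y u = ⟦ S u ∧ X u ⟧

    0≤y : ∀ u → 0ℚ ≤ y u
    0≤y u = 0≤⟦ S u ∧ X u ⟧

    Yn : ℕ
    Yn = card (λ u → S u ∧ X u)

    -- Counts of ordered tuples: a pair appears twice and a triple six times, whence the later
    -- factors ½ and 1/6.
    V P T₃ : ℚ
    V = ∑ y
    P = ∑ (λ u → ∑ (λ w → ⟦ nf u w ⟧ * (y u * y w)))
    T₃ = ∑ (λ u → ∑ (λ w → ∑ (λ t → ⟦ nf u w ⟧ * (⟦ nf u t ⟧ * ⟦ nf w t ⟧) * (y u * (y w * y t)))))

    split-y : ∀ u w → ⟦ nf u w ⟧ * (y u * y w) + ⟦ eqf u w ⟧ * (y u * y w) ≡ y u * y w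
    split-y u w with S u ∧ X u in e | S w ∧ X w in e′
    ... | false | b = eq ⟦ nf u w ⟧ ⟦ eqf u w ⟧ ⟦ b ⟧
      where
      eq : ∀ a b c → a * (0ℚ * c) + b * (0ℚ * c) ≡ 0ℚ * c
      eq = solve-∀ ring
    ... | true | false = eq ⟦ nf u w ⟧ ⟦ eqf u w ⟧
      where
      eq : ∀ a b → a * (1ℚ * 0ℚ) + b * (1ℚ * 0ℚ) ≡ 1ℚ * 0ℚ
      eq = solve-∀ ring
    ... | true | true = trans (eq ⟦ nf u w ⟧ ⟦ eqf u w ⟧) (split u w (∧-trueʳ {S u} e) (∧-trueʳ {S w} e′))
      where
      eq : ∀ a b → a * (1ℚ * 1ℚ) + b * (1ℚ * 1ℚ) ≡ a + b
      eq = solve-∀ ring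

    bool-sq : ∀ b → ⟦ b ⟧ * ⟦ b ⟧ ≡ ⟦ b ⟧
    bool-sq true = refl
    bool-sq false = refl

    P+V : P + V ≡ V * V
    P+V = trans (cong (λ z → P + z) (∑-cong (λ u → sym (trans (diag u (λ w → y u * y w)) (bool-sq (S u ∧ X u))))))
       (trans (sym (∑-+ _ _)) (trans (∑-cong (λ u → trans (sym (∑-+ _ _)) (∑-cong (split-y u)))) (trans (∑-cong
           (λ u → ∑-*ˡ (y u) y)) (∑-*ʳ V y))))

    -- Every pair is completed to a triple by each of the V - 2 remaining members, since distinct
    -- members are always related by `nf`.
    T≥ : P * (V - 2ℚ) ≤ T₃
    T≥ = ≤-reflexive (trans (sym (∑-*ʳ (V - 2ℚ) _)) (∑-cong (λ u → sym (∑-*ʳ (V - 2ℚ) _))))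
        ⨾ ∑-mono (λ u → ∑-mono (λ w → cell u w))
      where
      nfyy : Fin n → Fin n → ℚ
      nfyy u w = ⟦ nf u w ⟧ * (y u * y w)
      term : ∀ u w t → nfyy u w * (y t - ⟦ eqf u t ⟧ - ⟦ eqf w t ⟧)
          ≤ ⟦ nf u w ⟧ * (⟦ nf u t ⟧ * ⟦ nf w t ⟧) * (y u * (y w * y t))
      term u w t = go (nf u w) (S u ∧ X u) (S w ∧ X w) (S t ∧ X t) (nf u t) (nf w t) (eqf u t) (eqf w t)
          (λ p r → split u t (∧-trueʳ {S u} p) (∧-trueʳ {S t} r)) (λ p r →
              split w t (∧-trueʳ {S w} p) (∧-trueʳ {S t} r))
        where
        go : ∀ a yu yw yt ut wt eu ew → (yu ≡ true → yt ≡ true → ⟦ ut ⟧ + ⟦ eu ⟧ ≡ 1ℚ) → (yw ≡ true → yt ≡ true →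
            ⟦ wt ⟧ + ⟦ ew ⟧ ≡ 1ℚ) →
          ⟦ a ⟧ * (⟦ yu ⟧ * ⟦ yw ⟧) * (⟦ yt ⟧ - ⟦ eu ⟧ - ⟦ ew ⟧) ≤ ⟦ a ⟧ * (⟦ ut ⟧ * ⟦ wt ⟧) * (⟦ yu ⟧ *
              (⟦ yw ⟧ * ⟦ yt ⟧))
        go false yu yw yt ut wt eu ew h h′ = ≤-reflexive (z (⟦ yu ⟧ * ⟦ yw ⟧) (⟦ yt ⟧ - ⟦ eu ⟧ - ⟦ ew ⟧)
            (⟦ ut ⟧ * ⟦ wt ⟧) (⟦ yu ⟧ * (⟦ yw ⟧ * ⟦ yt ⟧)))
          where
          z : ∀ a b c d → 0ℚ * a * b ≡ 0ℚ * c * d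
          z = solve-∀ ring
        go true false yw yt ut wt eu ew h h′ = ≤-reflexive (z ⟦ yw ⟧ (⟦ yt ⟧ - ⟦ eu ⟧ - ⟦ ew ⟧) (⟦ ut ⟧ * ⟦ wt ⟧)
            (⟦ yw ⟧ * ⟦ yt ⟧))
          where
          z : ∀ a b c d → 1ℚ * (0ℚ * a) * b ≡ 1ℚ * c * (0ℚ * d)
          z = solve-∀ ring
        go true true false yt ut wt eu ew h h′ = ≤-reflexive (z (⟦ yt ⟧ - ⟦ eu ⟧ - ⟦ ew ⟧) (⟦ ut ⟧ * ⟦ wt ⟧) ⟦ yt ⟧)
          where
          z : ∀ b c d → 1ℚ * (1ℚ * 0ℚ) * b ≡ 1ℚ * c * (1ℚ * (0ℚ * d))
          z = solve-∀ ring
        go true true true false ut wt eu ew h h′ = ≤-by (0≤⟦ eu ⟧ ⊕ 0≤⟦ ew ⟧) (z ⟦ eu ⟧ ⟦ ew ⟧ (⟦ ut ⟧ * ⟦ wt ⟧))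
          where
          z : ∀ a b c → 1ℚ * (1ℚ * 1ℚ) * (0ℚ - a - b) + (a + b) ≡ 1ℚ * c * (1ℚ * (1ℚ * 0ℚ)) + (0ℚ + 0ℚ)
          z = solve-∀ ring
        go true true true true ut wt eu ew h h′ = ≤-by (0≤a*b 0≤⟦ eu ⟧ 0≤⟦ ew ⟧)
             (trans (z ⟦ eu ⟧ ⟦ ew ⟧) (cong₂ (λ a b → 1ℚ * (a * b) * (1ℚ * (1ℚ * 1ℚ)) + 0ℚ) (mv ⟦ ut ⟧ ⟦ eu ⟧
                 (h refl refl)) (mv ⟦ wt ⟧ ⟦ ew ⟧ (h′ refl refl))))
          where
          z : ∀ a b → 1ℚ * (1ℚ * 1ℚ) * (1ℚ - a - b) + a * b ≡ 1ℚ * ((1ℚ - a) * (1ℚ - b)) * (1ℚ * (1ℚ * 1ℚ)) + 0ℚ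
          z = solve-∀ ring
          mv : ∀ a b → a + b ≡ 1ℚ → 1ℚ - b ≡ a
          mv a b e = trans (cong (_- b) (sym e)) (can a b)
            where
            can : ∀ a b → a + b - b ≡ a
            can = solve-∀ ring
      0≤nfyy : ∀ u w → 0ℚ ≤ nfyy u w
      0≤nfyy u w = 0≤a*b 0≤⟦ nf u w ⟧ (0≤a*b (0≤y u) (0≤y w))
      cell : ∀ u w → nfyy u w * (V - 2ℚ) ≤ ∑ (λ t → ⟦ nf u w ⟧ * (⟦ nf u t ⟧ * ⟦ nf w t ⟧) * (y u * (y w * y t)))
      cell u w = (0≤nfyy u w ⊙ (≤-by (∑eqf≤1 u ⊕ ∑eqf≤1 w) (e₁ V (∑ (λ t → ⟦ eqf u t ⟧)) (∑ (λ t → ⟦ eqf w t ⟧)))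
          ⨾ ≤-reflexive (sym (trans (∑-sub _ _) (cong (λ z → z - ∑ (λ t → ⟦ eqf w t ⟧)) (∑-sub _ _))))))
          ⨾ ≤-reflexive (sym (∑-*ˡ (nfyy u w) _)) ⨾ ∑-mono (term u w)
        where
        e₁ : ∀ V a b → V - 2ℚ + (1ℚ + 1ℚ) ≡ V - a - b + (a + b)
        e₁ = solve-∀ ring

    -- (Y-1)(Y-2)(Y-3) ≥ 0 for every positive integer Y.
    hit≤ : ⟦ anyB (λ u → S u ∧ X u) ⟧ ≤ V - ½ * (V * V - V) + 1/6 * ((V * V - V) * (V - 2ℚ))
    hit≤ with anyB (λ u → S u ∧ X u) in e
    ... | false = ≤-reflexive (sym (trans (cong (λ z → z - ½ * (z * z - z) + 1/6 * ((z * z - z) * (z - 2ℚ))) (trans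
        (∑-cong (λ u → cong ⟦_⟧ (anyB-false {f = λ u → S u ∧ X u} e u))) (∑-0 n))) refl))
    ... | true with anyB-elim {f = λ u → S u ∧ X u} e
    ...   | i , h = subst (λ z → 1ℚ ≤ z - ½ * (z * z - z) + 1/6 * ((z * z - z) * (z - 2ℚ))) (sym (∑-card _))
        (poly Yn (ι-cancel (≤-reflexive (trans ι-1 (cong ⟦_⟧ (sym h))) ⨾ term≤∑ 0≤y i ⨾ ≤-reflexive (∑-card _))))
      where
      poly : ∀ m → 1 ℕ.≤ m → 1ℚ ≤ ι m - ½ * (ι m * ι m - ι m) + 1/6 * ((ι m * ι m - ι m) * (ι m - 2ℚ))
      poly 1 _ = subst (λ z → 1ℚ ≤ z - ½ * (z * z - z) + 1/6 * ((z * z - z) * (z - 2ℚ))) (sym ι-1) dec≤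
      poly 2 _ = subst (λ z → 1ℚ ≤ z - ½ * (z * z - z) + 1/6 * ((z * z - z) * (z - 2ℚ))) (sym (ι-def 2)) dec≤
      poly (suc (suc (suc m))) _ = subst (λ z → 1ℚ ≤ z - ½ * (z * z - z) + 1/6 * ((z * z - z) * (z - 2ℚ))) (sym
          (trans (ι-+ 3 m) (cong (_+ ι m) (ι-def 3))))
          (≤-by (0≤a*b {1/6} dec≤ (0≤a*b (0≤a*b {2ℚ + ι m} (0≤a+b {2ℚ} dec≤ (0≤ι m)) (0≤a+b {1ℚ} dec≤ (0≤ι m)))
              (0≤ι m))) (eq (ι m)))
        where
        eq : ∀ m → let z = 3ℚ + m in 1ℚ + 1/6 * ((2ℚ + m) * (1ℚ + m) * m) ≡ z - ½ * (z * z - z) + 1/6 * ((z * z - z) * (z - 2ℚ)) + 0ℚ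
        eq = solve-∀ ring

    -- The third-order estimate is used inside `S` only; members of `N` outside `S` enter through
    -- the union bound.
    bonferroni : ⟦ anyB (λ u → N u ∧ X u) ⟧ ≤ ∑ (λ u → ⟦ N u ⟧ * ⟦ X u ⟧) - ½ * P + 1/6 * T₃
    bonferroni = cover ⨾ ≤-by (hit≤ ⊕ ((0ℚ ≤ 1/6 ∋ dec≤) ⊙ T≥) ⊕ ≤-reflexive sumN) (trans (cong (λ z →
        hitS + rest + (V - ½ * z + 1/6 * (z * (V - 2ℚ)) + 1/6 * T₃ + sumNX)) VV-V) (eq hitS rest V P T₃ sumNX))
      where
      hitS rest sumNX : ℚ
      hitS = ⟦ anyB (λ u → S u ∧ X u) ⟧
      rest = ∑ (λ u → ⟦ (N u ∧ X u) ∧ not (S u) ⟧)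
      sumNX = ∑ (λ u → ⟦ N u ⟧ * ⟦ X u ⟧)
      VV-V : V * V - V ≡ P
      VV-V = trans (cong (_- V) (sym P+V)) (w P V)
        where
        w : ∀ a b → a + b - b ≡ a
        w = solve-∀ ring
      sumN : V + rest ≡ sumNX
      sumN = trans (sym (∑-+ _ _)) (∑-cong (λ u → go (S u) (N u) (X u) (S⊆N u)))
        where
        go : ∀ s n x → (s ≡ true → n ≡ true) → ⟦ s ∧ x ⟧ + ⟦ (n ∧ x) ∧ not s ⟧ ≡ ⟦ n ⟧ * ⟦ x ⟧
        go true false x h with h refl
        ... | ()
        go true true true h = refl
        go true true false h = refl
        go false true true h = refl
        go false true false h = refl
        go false false x h = sym (ℚP.*-zeroˡ ⟦ x ⟧)
      0≤rest : ∀ u → 0ℚ ≤ ⟦ (N u ∧ X u) ∧ not (S u) ⟧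
      0≤rest u = 0≤⟦ (N u ∧ X u) ∧ not (S u) ⟧
      cover : ⟦ anyB (λ u → N u ∧ X u) ⟧ ≤ hitS + rest
      cover with anyB (λ u → N u ∧ X u) in e
      ... | false = 0≤a+b 0≤⟦ anyB (λ u → S u ∧ X u) ⟧ (∑-nonneg 0≤rest)
      ... | true with anyB-elim {f = λ u → N u ∧ X u} e
      ...   | i , h with S i in s
      ...     | true = ≤-by {0ℚ} {rest} (∑-nonneg 0≤rest) (trans (cong (λ b →
          ⟦ b ⟧ + rest) (sym (anyB-intro {f = λ u → S u ∧ X u} i (cong₂ _∧_ s (∧-trueʳ {N i} h))))) (sym
          (ℚP.+-identityʳ (hitS + rest))))
      ...     | false = ≤-reflexive (cong₂ (λ a b → ⟦ a ∧ not b ⟧) (sym h) (sym s)) ⨾ term≤∑ 0≤rest i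
          ⨾ ≤-by 0≤⟦ anyB (λ u → S u ∧ X u) ⟧ (w hitS rest)
        where
        w : ∀ a b → b + a ≡ a + b + 0ℚ
        w = solve-∀ ring
      eq : ∀ h r V P T s → h + r + (V - ½ * P + 1/6 * (P * (V - 2ℚ)) + 1/6 * T + s)
          ≡ s - ½ * P + 1/6 * T + (h + 1/6 * (P * (V - 2ℚ)) + (V + r))
      eq = solve-∀ ring

  -- The number of related pairs grows by at most 2x when a vertex is added, so some initial
  -- segment of N either is all of N or has within 2x of the target number of pairs.
  module Prefix {n} (N : Fin n → Bool) (nf : Fin n → Fin n → Bool) (x : ℚ) (N≤x : ∑ (λ u → ⟦ N u ⟧) ≤ x) where
    seg : ℕ → Fin n → Bool
    seg j u = N u ∧ (toℕ u ℕ.<ᵇ j)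

    pairs : (Fin n → Bool) → ℚ
    pairs S = ∑ (λ u → ∑ (λ w → ⟦ S u ⟧ * ⟦ S w ⟧ * ⟦ nf u w ⟧))

    seg⊆ : ∀ j → seg j ⊆ N
    seg⊆ j u e = ∧-trueˡ e

    seg-all : ∀ u → seg n u ≡ N u
    seg-all u with toℕ u ℕ.<ᵇ n in e
    ... | true = BoolP.∧-identityʳ (N u)
    ... | false = ⊥-elim (<ᵇ-false e (FinP.toℕ<n u))

    seg-step : ∀ j → pairs (seg (suc j)) ≤ pairs (seg j) + 2ℚ * x
    seg-step j = ∑-mono (λ u → ∑-mono (cell u)) ⨾ ≤-reflexive (trans (∑-cong (λ u → trans (∑-+ _ _) (cong (λ z →
        ∑ (λ w → ⟦ seg j u ⟧ * ⟦ seg j w ⟧ * ⟦ nf u w ⟧) + z) (trans (∑-+ _ _) (cong₂ _+_ (∑-*ˡ (e u) (λ w →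
        ⟦ N w ⟧)) (∑-*ʳ ⟦ N u ⟧ e)))))) (trans (∑-+ _ _) (cong (λ z →
        pairs (seg j) + z) (trans (∑-+ _ _) (cong₂ _+_ (∑-*ʳ (∑ (λ w → ⟦ N w ⟧)) e) (∑-*ˡ (∑ e) (λ u → ⟦ N u ⟧)))))))
        ⨾ (≤-refl {pairs (seg j)} ⊕ ((*-mono (∑-nonneg (λ u → 0≤⟦ N u ⟧)) 0≤1 Σe≤1 N≤x
            ⊕ *-mono (∑-nonneg (λ u → 0≤⟦ N u ⟧)) 0≤1 Σe≤1 N≤x) ⨾ ≤-reflexive (eq x)))
      where
      e : Fin n → ℚ
      e u = ⟦ toℕ u ℕ.≡ᵇ j ⟧
      Σe≤1 : ∑ e ≤ 1ℚ
      Σe≤1 = ∑-single (λ u → toℕ u ℕ.≡ᵇ j) (λ a b p r → FinP.toℕ-injective (trans (≡ᵇ-true p) (sym (≡ᵇ-true r))))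
      eq : ∀ x → 1ℚ * x + 1ℚ * x ≡ 2ℚ * x
      eq = solve-∀ ring
      <ᵇ-suc : ∀ a → (a ℕ.<ᵇ suc j) ≡ true → (a ℕ.≡ᵇ j) ≡ false → (a ℕ.<ᵇ j) ≡ true
      <ᵇ-suc a h h′ with a ℕ.<ᵇ j in r
      ... | true = refl
      ... | false = ⊥-elim (false≢true h′ (subst (λ z → (a ℕ.≡ᵇ z)
          ≡ true) (ℕP.≤-antisym (ℕP.≤-pred (<ᵇ-true {a} {suc j} h)) (ℕP.≮⇒≥ (<ᵇ-false {a} {j} r))) (≡ᵇ-refl a)))
      cell : ∀ u w → ⟦ seg (suc j) u ⟧ * ⟦ seg (suc j) w ⟧ * ⟦ nf u w ⟧
          ≤ ⟦ seg j u ⟧ * ⟦ seg j w ⟧ * ⟦ nf u w ⟧ + (e u * ⟦ N w ⟧ + e w * ⟦ N u ⟧)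
      cell u w = go (N u) (N w) (nf u w) (toℕ u ℕ.<ᵇ suc j) (toℕ w ℕ.<ᵇ suc j) (toℕ u ℕ.<ᵇ j) (toℕ w ℕ.<ᵇ j)
          (toℕ u ℕ.≡ᵇ j) (toℕ w ℕ.≡ᵇ j) (<ᵇ-suc (toℕ u)) (<ᵇ-suc (toℕ w))
        where
        pos : ∀ a b c d e f g → 0ℚ ≤ ⟦ a ⟧ * ⟦ b ⟧ * ⟦ c ⟧ + (⟦ d ⟧ * ⟦ e ⟧ + ⟦ f ⟧ * ⟦ g ⟧)
        pos a b c d e f g = 0≤a+b (0≤a*b (0≤a*b 0≤⟦ a ⟧ 0≤⟦ b ⟧) 0≤⟦ c ⟧) (0≤a+b (0≤a*b 0≤⟦ d ⟧ 0≤⟦ e ⟧)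
            (0≤a*b 0≤⟦ f ⟧ 0≤⟦ g ⟧))
        go : ∀ nu nw f a b a′ b′ eu ew → (a ≡ true → eu ≡ false → a′ ≡ true) → (b ≡ true → ew ≡ false → b′ ≡ true) →
          ⟦ nu ∧ a ⟧ * ⟦ nw ∧ b ⟧ * ⟦ f ⟧ ≤ ⟦ nu ∧ a′ ⟧ * ⟦ nw ∧ b′ ⟧ * ⟦ f ⟧ + (⟦ eu ⟧ * ⟦ nw ⟧ + ⟦ ew ⟧ * ⟦ nu ⟧)
        go false nw f a b a′ b′ eu ew h h′ = ≤-reflexive (z ⟦ nw ∧ b ⟧ ⟦ f ⟧) ⨾ pos false (nw ∧ b′) f eu nw ew false
          where
          z : ∀ a b → 0ℚ * a * b ≡ 0ℚ
          z = solve-∀ ring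
        go true false f a b a′ b′ eu ew h h′ = ≤-reflexive (z ⟦ a ⟧ ⟦ f ⟧) ⨾ pos a′ false f eu false ew true
          where
          z : ∀ a b → a * 0ℚ * b ≡ 0ℚ
          z = solve-∀ ring
        go true true f false b a′ b′ eu ew h h′ = ≤-reflexive (z ⟦ b ⟧ ⟦ f ⟧) ⨾ pos a′ b′ f eu true ew true
          where
          z : ∀ a b → 0ℚ * a * b ≡ 0ℚ
          z = solve-∀ ring
        go true true f true false a′ b′ eu ew h h′ = ≤-reflexive (z ⟦ f ⟧) ⨾ pos a′ b′ f eu true ew true
          where
          z : ∀ b → 1ℚ * 0ℚ * b ≡ 0ℚ
          z = solve-∀ ring
        go true true f true true a′ b′ true ew h h′ = ≤-by (0≤a*b (0≤a*b 0≤⟦ a′ ⟧ 0≤⟦ b′ ⟧) 0≤⟦ f ⟧ ⊕ 0≤⟦ ew ⟧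
            ⊕ ⟦ f ⟧≤1) (z (⟦ a′ ⟧ * ⟦ b′ ⟧ * ⟦ f ⟧) ⟦ ew ⟧ ⟦ f ⟧)
          where
          z : ∀ p e f → 1ℚ * 1ℚ * f + (p + e + 1ℚ) ≡ p + (1ℚ * 1ℚ + e * 1ℚ) + (0ℚ + 0ℚ + f)
          z = solve-∀ ring
        go true true f true true a′ b′ false true h h′ = ≤-by (0≤a*b (0≤a*b 0≤⟦ a′ ⟧ 0≤⟦ b′ ⟧) 0≤⟦ f ⟧
            ⊕ ⟦ f ⟧≤1) (z (⟦ a′ ⟧ * ⟦ b′ ⟧ * ⟦ f ⟧) ⟦ f ⟧)
          where
          z : ∀ p f → 1ℚ * 1ℚ * f + (p + 1ℚ) ≡ p + (0ℚ * 1ℚ + 1ℚ * 1ℚ) + (0ℚ + f)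
          z = solve-∀ ring
        go true true f true true a′ b′ false false h h′ = ≤-reflexive (trans (z ⟦ f ⟧) (cong₂ (λ p r →
            ⟦ p ⟧ * ⟦ r ⟧ * ⟦ f ⟧ + (0ℚ * 1ℚ + 0ℚ * 1ℚ)) (sym (h refl refl)) (sym (h′ refl refl))))
          where
          z : ∀ f → 1ℚ * 1ℚ * f ≡ 1ℚ * 1ℚ * f + (0ℚ * 1ℚ + 0ℚ * 1ℚ)
          z = solve-∀ ring

    pairs-cong : ∀ {S S′} → (∀ u → S u ≡ S′ u) → pairs S ≡ pairs S′
    pairs-cong h = ∑-cong (λ u → ∑-cong (λ w → cong₂ (λ a b → ⟦ a ⟧ * ⟦ b ⟧ * ⟦ nf u w ⟧) (h u) (h w)))

    choose : ∀ a* → 0ℚ ≤ a* → ∃[ S ] (S ⊆ N) × (pairs S ≤ a*) × ((pairs S ≡ pairs N) ⊎ (a* ≤ pairs S + 2ℚ * x))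
    choose a* 0≤a* with pairs (seg n) ≤? a*
    ... | yes h = seg n , seg⊆ n , h , inj₁ (pairs-cong seg-all)
    ... | no ¬h = descend n (<⇒≤ (ℚP.≰⇒> ¬h))
      where
      empty : pairs (seg 0) ≡ 0ℚ
      empty = trans (∑-cong (λ u → trans (∑-cong (λ w → z₀ u w)) (∑-0 n))) (∑-0 n)
        where
        z : ∀ a b → 0ℚ * a * b ≡ 0ℚ
        z = solve-∀ ring
        z₀ : ∀ u w → ⟦ seg 0 u ⟧ * ⟦ seg 0 w ⟧ * ⟦ nf u w ⟧ ≡ 0ℚ
        z₀ u w = trans (cong (λ b → ⟦ b ⟧ * ⟦ seg 0 w ⟧ * ⟦ nf u w ⟧) (BoolP.∧-zeroʳ (N u)))
            (z ⟦ seg 0 w ⟧ ⟦ nf u w ⟧)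
      descend : ∀ j → a* ≤ pairs (seg j) → ∃[ S ] (S ⊆ N) × (pairs S ≤ a*) × ((pairs S
          ≡ pairs N) ⊎ (a* ≤ pairs S + 2ℚ * x))
      descend zero h = seg 0 , seg⊆ 0 , (≤-reflexive empty ⨾ 0≤a*) , inj₂ (h
          ⨾ ≤-by (0≤a*b {2ℚ} dec≤ (∑-nonneg (λ u → 0≤⟦ N u ⟧) ⨾ N≤x)) (eq (pairs (seg 0)) (2ℚ * x)))
        where
        eq : ∀ a b → a + b ≡ a + b + 0ℚ
        eq = solve-∀ ring
      descend (suc j) h with pairs (seg j) ≤? a*
      ... | yes p = seg j , seg⊆ j , p , inj₂ (h ⨾ seg-step j)
      ... | no ¬p = descend j (<⇒≤ (ℚP.≰⇒> ¬p))

  -- The two ways the number a of non-adjacent pairs can compare with its target a*, and why both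
  -- lose only z.
  module Saving (x z τ a a* m : ℚ) (0≤z : 0ℚ ≤ z) (0≤τ : 0ℚ ≤ τ) (zx≤1 : z * x ≤ 1ℚ) (m≤x : m ≤ x) (a≤a* : a
      ≤ a*) where
    -- The missing pairs cost ½ z² (x² - m² + m), where ½ z² (x² - m²) ≤ z² x (x - m) ≤ z (x - m) by
    -- z x ≤ 1. This is no more than what the x - m neighbours without the colour save in the linear
    -- term; the rest is at most ½ z.
    few : a* - a ≤ x * x - m * m + m → m * z - ½ * (a * (z * z)) + 1/6 * (τ * a)
        ≤ x * z - ½ * (a* * (z * z)) + 1/6 * (τ * a*) + z
    few h = ≤-by (0≤a*b {½} dec≤ (0≤a*b (0≤sq z) (0≤b-a h)) ⊕ 0≤a*b (0≤a*b 0≤z (0≤b-a zx≤1)) (0≤b-a m≤x)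
        ⊕ 0≤a*b {½} dec≤ (0≤a*b (0≤sq z) (0≤sq (x - m)))
        ⊕ 0≤a*b {½} dec≤ (0≤a*b 0≤z (0≤b-a zx≤1)) ⊕ 0≤a*b {½} dec≤ (0≤a*b (0≤sq z) (0≤b-a m≤x))
            ⊕ 0≤a*b {½} dec≤ 0≤z ⊕ 0≤a*b {1/6} dec≤ (0≤a*b 0≤τ (0≤b-a a≤a*))) (eq x z τ a a* m)
      where
      eq : ∀ x z τ a a* m → m * z - ½ * (a * (z * z)) + 1/6 * (τ * a)
          + (½ * (z * z * (x * x - m * m + m - (a* - a))) + z * (1ℚ - z * x) * (x - m) + ½ * (z * z * ((x - m) *
              (x - m))) + ½ * (z * (1ℚ - z * x)) + ½ * (z * z * (x - m)) + ½ * z + 1/6 * (τ * (a* - a)))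
          ≡ x * z - ½ * (a* * (z * z)) + 1/6 * (τ * a*) + z + (0ℚ + 0ℚ + 0ℚ + 0ℚ + 0ℚ + 0ℚ + 0ℚ)
      eq = solve-∀ ring
    many : a* ≤ a + 2ℚ * x → m * z - ½ * (a * (z * z)) + 1/6 * (τ * a)
        ≤ x * z - ½ * (a* * (z * z)) + 1/6 * (τ * a*) + z
    many h = ≤-by (0≤a*b {½} dec≤ (0≤a*b (0≤sq z) (0≤b-a h)) ⊕ 0≤a*b 0≤z (0≤b-a zx≤1) ⊕ 0≤a*b 0≤z (0≤b-a m≤x)
        ⊕ 0≤a*b {1/6} dec≤ (0≤a*b 0≤τ (0≤b-a a≤a*))) (eq x z τ a a* m)
      where
      eq : ∀ x z τ a a* m → m * z - ½ * (a * (z * z)) + 1/6 * (τ * a) + (½ * (z * z * (a + 2ℚ * x - a*)) + z *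
          (1ℚ - z * x) + z * (x - m) + 1/6 * (τ * (a* - a)))
          ≡ x * z - ½ * (a* * (z * z)) + 1/6 * (τ * a*) + z + (0ℚ + 0ℚ + 0ℚ + 0ℚ)
      eq = solve-∀ ring

  ∨-false : ∀ {a b} → a ∨ b ≡ false → (a ≡ false) × (b ≡ false)
  ∨-false {false} {false} _ = refl , refl

  toBool : ∀ {A : Set} → Dec A → Bool
  toBool (yes _) = true
  toBool (no _) = false

  toBool-true : ∀ {A : Set} (d : Dec A) → toBool d ≡ true → A
  toBool-true (yes p) _ = p

  toBool-false : ∀ {A : Set} (d : Dec A) → toBool d ≡ false → ¬ A
  toBool-false (no ¬p) _ = ¬p

  opaque
    leq : ℚ → ℚ → Bool
    leq a b = toBool (a ≤? b)

    leq-true : ∀ {a b} → leq a b ≡ true → a ≤ b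
    leq-true {a} {b} e = toBool-true (a ≤? b) e

    leq-false : ∀ {a b} → leq a b ≡ false → b ≤ a
    leq-false {a} {b} e = <⇒≤ (ℚP.≰⇒> (toBool-false (a ≤? b) e))

  192ℚ : ℚ
  192ℚ = + 192 / 1

  12ℚ : ℚ
  12ℚ = + 12 / 1

  -- Degrees, neighbourhood density and greedy list colouring

  nbhdPairs : ∀ {n} → Graph n → Fin n → ℚ
  nbhdPairs G v = ∑ (λ u → ∑ (λ w → ⟦ adj G v u ⟧ * ⟦ adj G v w ⟧ * ⟦ adj G u w ⟧))

  degℚ : ∀ {n} → Graph n → Fin n → ℚ
  degℚ G v = ∑ (λ u → ⟦ adj G v u ⟧)

  Injective : ∀ {n C} → (Fin n → Fin C → ℕ) → Set
  Injective L = ∀ v i j → L v i ≡ L v j → i ≡ j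

  ListColouring : ∀ {n} → Graph n → (C : ℕ) → (Fin n → Fin C → ℕ) → Set
  ListColouring {n} G C L = Σ (Fin n → ℕ) λ c → (∀ v → ∃[ i ] c v ≡ L v i) × (∀ u v → adj G u v ≡ true → c u ≢ c v)

  select : ∀ {n} (S : Fin n → Bool) m → m ℕ.≤ card S → Σ (Fin m → Fin n) λ f → (∀ j → S (f j) ≡ true) × (∀ i j →
      f i ≡ f j → i ≡ j)
  select {n} S zero h = (λ ()) , (λ ()) , (λ ())
  select {suc n} S (suc m) h with S fzero in e
  ... | false = let (f , p , q) = select (S ∘ fsuc) (suc m) h in fsuc ∘ f , p , λ i j eq → q i j (FinP.suc-injective eq)
  ... | true = let (f , p , q) = select (S ∘ fsuc) m (ℕP.≤-pred h) in
        (λ { fzero → fzero ; (fsuc j) → fsuc (f j) }) , (λ { fzero → e ; (fsuc j) → p j }) ,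
        λ { fzero fzero _ → refl ; fzero (fsuc j) () ; (fsuc i) fzero () ; (fsuc i) (fsuc j) eq →
            cong fsuc (q i j (FinP.suc-injective eq)) }

  greedy : ∀ {n} (G : Graph n) C (L : Fin n → Fin C → ℕ) → Injective L → (∀ v → degℚ G v < ι C) → ListColouring G C L
  greedy {n} G C L inj deg< = let (c , p , q) = go n ℕP.≤-refl in c , (λ v → p v (FinP.toℕ<n v)) , (λ u v → q u v (FinP.toℕ<n u) (FinP.toℕ<n v))
    where
    blocked : (Fin n → ℕ) → Fin n → Fin C → Bool
    blocked c v i = anyB (λ u → adj G v u ∧ (L v i ℕ.≡ᵇ c u))
    free : ∀ c v → ∃[ i ] blocked c v i ≡ false
    free c v with FinP.any? (λ i → blocked c v i BoolP.≟ false)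
    ... | yes p = p
    ... | no ¬p = ⊥-elim (ℚP.<-irrefl refl (<-≤-trans (deg< v) (≤-reflexive (sym (trans (∑-cong (λ i →
        cong ⟦_⟧ (BoolP.¬-not (λ e → ¬p (i , e))))) (trans (∑-const C 1ℚ) (ℚP.*-identityʳ (ι C))))) ⨾ Σblocked)))
      where
      Σblocked : ∑ (λ i → ⟦ blocked c v i ⟧) ≤ degℚ G v
      Σblocked = ∑-mono (λ i → ⟦anyB⟧≤ _) ⨾ ≤-reflexive (∑-swap ∑-lin _)
          ⨾ ∑-mono (λ u → ≤-reflexive (trans (∑-cong (λ i → ⟦∧⟧ (adj G v u) _)) (∑-*ˡ ⟦ adj G v u ⟧ _)) ⨾
          (0≤⟦ adj G v u ⟧ ⊙ ∑-single (λ i → L v i ℕ.≡ᵇ c u) (λ a b p r →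
              inj v a b (trans (≡ᵇ-true {L v a} p) (sym (≡ᵇ-true {L v b} r)))))
              ⨾ ≤-reflexive (ℚP.*-identityʳ ⟦ adj G v u ⟧))
    go : ∀ j → j ℕ.≤ n → Σ (Fin n → ℕ) λ c → (∀ v → toℕ v ℕ.< j → ∃[ i ] c v ≡ L v i) × (∀ u v → toℕ u ℕ.< j →
        toℕ v ℕ.< j → adj G u v ≡ true → c u ≢ c v)
    -- Uncoloured vertices carry the default 0. It may block a colour, but a neighbour never blocks
    -- more than one, so the degree bound still leaves a free colour.
    go zero h = (λ _ → 0) , (λ _ ()) , (λ _ _ ())
    go (suc j) h = c′ , lists , prop
      where
      c : Fin n → ℕ
      c = proj₁ (go j (ℕP.<⇒≤ h))
      v₀ : Fin n
      v₀ = Fin.fromℕ< h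
      i₀ : Fin C
      i₀ = proj₁ (free c v₀)
      c′ : Fin n → ℕ
      c′ u = if toBool (u FinP.≟ v₀) then L v₀ i₀ else c u
      c′-new : ∀ u → u ≡ v₀ → c′ u ≡ L v₀ i₀
      c′-new u e with u FinP.≟ v₀
      ... | yes _ = refl
      ... | no ¬p = ⊥-elim (¬p e)
      c′-old : ∀ u → u ≢ v₀ → c′ u ≡ c u
      c′-old u e with u FinP.≟ v₀
      ... | yes p = ⊥-elim (e p)
      ... | no ¬p = refl
      older : ∀ u → u ≢ v₀ → toℕ u ℕ.< suc j → toℕ u ℕ.< j
      older u ne (ℕ.s≤s lt) = ℕP.≤∧≢⇒< lt (λ e → ne (FinP.toℕ-injective (trans e (sym (FinP.toℕ-fromℕ< h)))))
      lists : ∀ v → toℕ v ℕ.< suc j → ∃[ i ] c′ v ≡ L v i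
      lists v lt with v FinP.≟ v₀
      ... | yes refl = i₀ , refl
      ... | no ne = proj₁ (proj₂ (go j (ℕP.<⇒≤ h))) v (older v ne lt)
      avoid : ∀ u → adj G v₀ u ≡ true → L v₀ i₀ ≢ c u
      avoid u a e = false≢true (anyB-false {f = λ u → adj G v₀ u ∧ (L v₀ i₀ ℕ.≡ᵇ c u)} (proj₂ (free c v₀)) u)
          (cong₂ _∧_ a (subst (λ z → (L v₀ i₀ ℕ.≡ᵇ z) ≡ true) e (≡ᵇ-refl (L v₀ i₀))))
      prop : ∀ u v → toℕ u ℕ.< suc j → toℕ v ℕ.< suc j → adj G u v ≡ true → c′ u ≢ c′ v
      prop u v lu lv a e = by-cases (u FinP.≟ v₀) (v FinP.≟ v₀)
        where
        by-cases : Dec (u ≡ v₀) → Dec (v ≡ v₀) → ⊥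
        by-cases (yes p) (yes q) = false≢true (irrefl G v₀) (subst₂ (λ x y → adj G x y ≡ true) p q a)
        by-cases (yes p) (no q) = avoid v (subst (λ x → adj G x v
            ≡ true) p a) (trans (sym (c′-new u p)) (trans e (c′-old v q)))
        by-cases (no p) (yes q) = avoid u (subst (λ x → adj G x u
            ≡ true) q (trans (Graph.sym G v u) a)) (trans (sym (c′-new v q)) (trans (sym e) (c′-old u p)))
        by-cases (no p) (no q) = proj₂ (proj₂ (go j (ℕP.<⇒≤ h))) u v (older u p lu) (older v q lv) a (trans (sym
            (c′-old u p)) (trans e (c′-old v q)))

-- One round of the naive colouring procedure

module NaiveColouring where

  open Combinatorics public
  import Data.Bool.Properties as BoolP
  import Data.Fin.Properties as FinP
  import Data.Nat as ℕ
  import Data.Nat.Properties as ℕP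
  import Data.Rational.Properties as ℚP
  import Data.Vec as Vec
  import Data.Vec.Properties as VecP

  record RoundInput (n : ℕ) : Set where
    field
      G : Graph n
      k D K : ℕ
      L : Fin n → Fin (suc k) → ℕ
      L-inj : Injective L
      deg≤ : ∀ u → degℚ G u ≤ ι D

  -- One round of the naive colouring procedure.  Vertex u picks a colour from its list; on each
  -- monochromatic edge one end, chosen by a random orientation, loses its colour.  The ghost coins
  -- act as extra colourless neighbours making every survival probability equal.
  module Procedure {n} (I : RoundInput n) where
    open RoundInput I

    Ω : Set
    Ω = Fin (suc k) × Vec Bool n × Vec Bool D

    -- A state that comes from an outcome always has a colour; `nothing` serves to neutralise a
    -- vertex when measuring its influence.
    St : Set
    St = Maybe ℕ × Vec Bool n × Vec Bool D

    State : Set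
    State = Fin n → St

    has : Fin n → ℕ → Bool
    has y c = anyB (λ i → L y i ℕ.≡ᵇ c)

    mult : Fin n → ℕ → ℕ
    mult u c = card (λ y → adj G u y ∧ has y c)

    col : State → Fin n → Maybe ℕ
    col σ u = proj₁ (σ u)

    bit : St → Fin n → Bool
    bit s y = lookup (proj₁ (proj₂ s)) y

    -- Each end contributes a bit, so the randomness of a vertex stays within its own coordinate.
    -- The comparison of indices breaks the symmetry: exactly one end wins each edge.
    wins : Fin n → Fin n → St → St → Bool
    wins u y s t = (bit s y xor bit t u) xor (toℕ u ℕ.<ᵇ toℕ y)

    beaten : ℕ → Fin n → Fin n → St → St → Bool
    beaten c u y s t = adj G u y ∧ (eqc (proj₁ t) c ∧ not (wins u y s t))

    ghostOK : ℕ → Fin n → St → Bool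
    ghostOK c u s = firstTrue (D ℕ.∸ mult u c) (proj₂ (proj₂ s))

    self : ℕ → Fin n → St → Bool
    self c u s = eqc (proj₁ s) c ∧ ghostOK c u s

    keepc : State → Fin n → ℕ → Bool
    keepc σ u c = self c u (σ u) ∧ allB (λ y → not (beaten c u y (σ u) (σ y)))

    class : Fin n → State → ℕ → ℕ
    class v σ c = card (λ w → adj G v w ∧ eqc (col σ w) c)

    -- Truncation for the sake of concentration: if more than `K` neighbours of v hold the same
    -- colour, all of them count as uncoloured, so that a change of one vertex can alter only
    -- boundedly many of these indicators.
    Tc : Fin n → State → Fin n → ℕ → Bool
    Tc v σ u c = keepc σ u c ∧ (class v σ c ℕ.≤ᵇ K)

    lift : (ℕ → Bool) → Maybe ℕ → Bool
    lift f nothing = false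
    lift f (just c) = f c

    lift-cong : ∀ {f g} → (∀ c → f c ≡ g c) → ∀ m → lift f m ≡ lift g m
    lift-cong h nothing = refl
    lift-cong h (just c) = h c

    Tk : Fin n → State → Fin n → Bool
    Tk v σ u = lift (Tc v σ u) (col σ u)

    keep : State → Fin n → Bool
    keep σ u = lift (keepc σ u) (col σ u)

    lost : Fin n → State → ℕ → Bool
    lost v σ c = anyB (λ u → adj G v u ∧ keepc σ u c)

    loss : Fin n → State → ℚ
    loss v σ = ∑ (λ i → ⟦ lost v σ (L v i) ⟧)

    degT : Fin n → State → ℚ
    degT v σ = ∑ (λ u → ⟦ adj G v u ⟧ * (1ℚ - ⟦ Tk v σ u ⟧))

    edgT : Fin n → State → ℚ
    edgT v σ = ∑ (λ u → ∑ (λ w → ⟦ adj G v u ⟧ * ⟦ adj G v w ⟧ * ⟦ adj G u w ⟧ * ((1ℚ - ⟦ Tk v σ u ⟧) *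
        (1ℚ - ⟦ Tk v σ w ⟧))))

    st : Vec Ω n → State
    st ω u = just (L u (proj₁ (lookup ω u))) , proj₂ (lookup ω u)

    ball : Fin n → Fin n → Bool
    ball v y = anyB (λ u → adj G v u ∧ (does (u FinP.≟ y) ∨ adj G u y))

    ball-self : ∀ {v u} → adj G v u ≡ true → ball v u ≡ true
    ball-self {v} {u} h = anyB-intro u (cong₂ _∧_ h (cong (_∨ adj G u u) (does-refl u)))
      where
      does-refl : ∀ u → does (u FinP.≟ u) ≡ true
      does-refl u with u FinP.≟ u
      ... | yes _ = refl
      ... | no ¬p = ⊥-elim (¬p refl)

    ball-nbr : ∀ {v u y} → adj G v u ≡ true → adj G u y ≡ true → ball v y ≡ true
    ball-nbr {v} {u} {y} h h′ = anyB-intro u (cong₂ _∧_ h (trans (cong (does (u FinP.≟ y) ∨_) h′) (BoolP.∨-zeroʳ _)))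

    SameOn : (Fin n → Bool) → State → State → Set
    SameOn S σ σ′ = ∀ y → S y ≡ true → σ y ≡ σ′ y

    keepc-cong : ∀ {σ σ′} u c → σ u ≡ σ′ u → (∀ y → adj G u y ≡ true → σ y ≡ σ′ y) → keepc σ u c ≡ keepc σ′ u c
    keepc-cong {σ} {σ′} u c h h′ = cong₂ _∧_ (cong (self c u) h) (allB-cong pt)
      where
      pt : ∀ y → not (beaten c u y (σ u) (σ y)) ≡ not (beaten c u y (σ′ u) (σ′ y))
      pt y with adj G u y in e
      ... | false = refl
      ... | true = cong not (cong₂ (λ s t → eqc (proj₁ t) c ∧ not (wins u y s t)) h (h′ y e))

    module _ {v σ σ′} (h : SameOn (ball v) σ σ′) where
      keepc-local : ∀ u c → adj G v u ≡ true → keepc σ u c ≡ keepc σ′ u c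
      keepc-local u c e = keepc-cong u c (h u (ball-self e)) (λ y e′ → h y (ball-nbr e e′))

      class-local : ∀ c → class v σ c ≡ class v σ′ c
      class-local c = card-cong pt
        where
        pt : ∀ w → adj G v w ∧ eqc (col σ w) c ≡ adj G v w ∧ eqc (col σ′ w) c
        pt w with adj G v w in e
        ... | false = refl
        ... | true = cong (λ s → eqc (proj₁ s) c) (h w (ball-self e))

      Tk-local : ∀ u → adj G v u ≡ true → Tk v σ u ≡ Tk v σ′ u
      Tk-local u e = trans (lift-cong (λ c → cong₂ _∧_ (keepc-local u c e) (cong (ℕ._≤ᵇ K) (class-local c)))
          (col σ u))
                           (cong (λ s → lift (Tc v σ′ u) (proj₁ s)) (h u (ball-self e)))

      lost-local : ∀ c → lost v σ c ≡ lost v σ′ c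
      lost-local c = anyB-cong pt
        where
        pt : ∀ u → adj G v u ∧ keepc σ u c ≡ adj G v u ∧ keepc σ′ u c
        pt u with adj G v u in e
        ... | false = refl
        ... | true = keepc-local u c e

      loss-local : loss v σ ≡ loss v σ′
      loss-local = ∑-cong (λ i → cong ⟦_⟧ (lost-local (L v i)))

      degT-local : degT v σ ≡ degT v σ′
      degT-local = ∑-cong pt
        where
        pt : ∀ u → ⟦ adj G v u ⟧ * (1ℚ - ⟦ Tk v σ u ⟧) ≡ ⟦ adj G v u ⟧ * (1ℚ - ⟦ Tk v σ′ u ⟧)
        pt u with adj G v u in e
        ... | true = cong (λ z → 1ℚ * (1ℚ - ⟦ z ⟧)) (Tk-local u e)
        ... | false = trans (ℚP.*-zeroˡ (1ℚ - ⟦ Tk v σ u ⟧)) (sym (ℚP.*-zeroˡ (1ℚ - ⟦ Tk v σ′ u ⟧)))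

      edgT-local : edgT v σ ≡ edgT v σ′
      edgT-local = ∑-cong (λ u → ∑-cong (pt u))
        where
        pt : ∀ u w → ⟦ adj G v u ⟧ * ⟦ adj G v w ⟧ * ⟦ adj G u w ⟧ * ((1ℚ - ⟦ Tk v σ u ⟧) * (1ℚ - ⟦ Tk v σ w ⟧))
            ≡ ⟦ adj G v u ⟧ * ⟦ adj G v w ⟧ * ⟦ adj G u w ⟧ * ((1ℚ - ⟦ Tk v σ′ u ⟧) * (1ℚ - ⟦ Tk v σ′ w ⟧))
        pt u w with adj G v u in e | adj G v w in e′
        ... | true | true = cong₂ (λ a b → 1ℚ * 1ℚ * ⟦ adj G u w ⟧ * ((1ℚ - ⟦ a ⟧) * (1ℚ - ⟦ b ⟧))) (Tk-local u e)
            (Tk-local w e′)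
        ... | false | b = trans (zero₁ ⟦ b ⟧ ⟦ adj G u w ⟧ ((1ℚ - ⟦ Tk v σ u ⟧) * (1ℚ - ⟦ Tk v σ w ⟧))) (sym
            (zero₁ ⟦ b ⟧ ⟦ adj G u w ⟧ ((1ℚ - ⟦ Tk v σ′ u ⟧) * (1ℚ - ⟦ Tk v σ′ w ⟧))))
          where
          zero₁ : ∀ x y z → 0ℚ * x * y * z ≡ 0ℚ
          zero₁ = solve-∀ ring
        ... | true | false = trans (zero₁ ⟦ adj G u w ⟧ ((1ℚ - ⟦ Tk v σ u ⟧) * (1ℚ - ⟦ Tk v σ w ⟧))) (sym
            (zero₁ ⟦ adj G u w ⟧ ((1ℚ - ⟦ Tk v σ′ u ⟧) * (1ℚ - ⟦ Tk v σ′ w ⟧))))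
          where
          zero₁ : ∀ y z → 1ℚ * 0ℚ * y * z ≡ 0ℚ
          zero₁ = solve-∀ ring

    mult≤D : ∀ u c → mult u c ℕ.≤ D
    mult≤D u c = ι-cancel (≤-reflexive (sym (∑-card _)) ⨾ ∑-≤-card (adj G u) (λ y → has y c) ⨾ deg≤ u)

    open Space n k D public

    -- Bounded differences for the lost colours, degrees and edges

    neutral : St
    neutral = nothing , Vec.replicate n false , Vec.replicate D false

    st₀ : Fin n → Vec Ω n → State
    st₀ i ω j with i FinP.≟ j
    ... | yes _ = neutral
    ... | no _ = st ω j

    st₀-indep : ∀ i ω a j → st₀ i (ω [ i ]≔ a) j ≡ st₀ i ω j
    st₀-indep i ω a j with i FinP.≟ j
    ... | yes _ = refl
    ... | no ¬p = cong (λ z → just (L j (proj₁ z)) , proj₂ z) (VecP.lookup∘updateAt′ j i (¬p ∘ sym) ω)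

    st₀-other : ∀ i ω j → i ≢ j → st₀ i ω j ≡ st ω j
    st₀-other i ω j h with i FinP.≟ j
    ... | yes p = ⊥-elim (h p)
    ... | no _ = refl

    st₀-self : ∀ i ω → st₀ i ω i ≡ neutral
    st₀-self i ω with i FinP.≟ i
    ... | yes p = refl
    ... | no ¬p = ⊥-elim (¬p refl)

    ΣTc≤K : ∀ v σ c → ∑ (λ u → ⟦ adj G v u ⟧ * ⟦ Tc v σ u c ⟧) ≤ ι K
    ΣTc≤K v σ c with class v σ c ℕ.≤ᵇ K in e
    ... | false = ≤-reflexive (trans (∑-cong (λ u → trans (cong (λ z →
        ⟦ adj G v u ⟧ * ⟦ z ⟧) (BoolP.∧-zeroʳ (keepc σ u c))) (ℚP.*-zeroʳ ⟦ adj G v u ⟧))) (∑-0 n)) ⨾ 0≤ι K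
    ... | true = ∑-mono pt ⨾ ≤-reflexive (∑-card _) ⨾ ι-mono (ℕP.≤ᵇ⇒≤ (class v σ c) K (subst T (sym e) _))
      where
      pt : ∀ u → ⟦ adj G v u ⟧ * ⟦ keepc σ u c ∧ true ⟧ ≤ ⟦ adj G v u ∧ eqc (col σ u) c ⟧
      pt u with adj G v u | eqc (col σ u) c
      ... | false | b = ≤-reflexive (ℚP.*-zeroˡ ⟦ ((b ∧ ghostOK c u (σ u)) ∧ allB (λ y →
          not (beaten c u y (σ u) (σ y)))) ∧ true ⟧)
      ... | true | false = ≤-refl
      ... | true | true = ≤-reflexive (ℚP.*-identityˡ ⟦ (ghostOK c u (σ u) ∧ allB (λ y →
          not (beaten c u y (σ u) (σ y)))) ∧ true ⟧) ⨾ ⟦ (ghostOK c u (σ u) ∧ allB (λ y →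
          not (beaten c u y (σ u) (σ y)))) ∧ true ⟧≤1

    -- Neutralising i affects only its colour `cᵢ`: it neither keeps another colour nor beats anyone
    -- over it.
    module Neutralise (v i : Fin n) (ω : Vec Ω n) where
      σ σ₀ : State
      σ = st ω
      σ₀ = st₀ i ω
      cᵢ : ℕ
      cᵢ = L i (proj₁ (lookup ω i))

      eqc-other : ∀ c → c ≢ cᵢ → eqc (col σ i) c ≡ false
      eqc-other c h = BoolP.¬-not (λ e → h (sym (≡ᵇ-true e)))

      eqc-σ₀ : ∀ c y → c ≢ cᵢ → eqc (col σ y) c ≡ eqc (col σ₀ y) c
      eqc-σ₀ c y h with i FinP.≟ y
      ... | no _ = refl
      ... | yes refl = eqc-other c h

      keepc-other : ∀ u c → c ≢ cᵢ → keepc σ u c ≡ keepc σ₀ u c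
      keepc-other u c h with i FinP.≟ u
      ... | yes refl = cong (λ z → (z ∧ ghostOK c i (σ i)) ∧ allB (λ y →
          not (beaten c i y (σ i) (σ y)))) (eqc-other c h)
      ... | no _ = cong (self c u (σ u) ∧_) (allB-cong pt)
        where
        pt : ∀ y → not (beaten c u y (σ u) (σ y)) ≡ not (beaten c u y (σ u) (σ₀ y))
        pt y with i FinP.≟ y
        ... | no _ = refl
        ... | yes refl = cong (λ z → not (adj G u i ∧ (z ∧ not (wins u i (σ u) (σ i))))) (eqc-other c h)

      keepc-nonadj : ∀ u c → i ≢ u → adj G u i ≡ false → keepc σ u c ≡ keepc σ₀ u c
      keepc-nonadj u c h h′ = keepc-cong u c (sym (st₀-other i ω u h)) (λ y e → sym (st₀-other i ω y (λ { refl →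
          false≢true h′ e })))

      class-other : ∀ c → c ≢ cᵢ → class v σ c ≡ class v σ₀ c
      class-other c h = card-cong (λ w → cong (adj G v w ∧_) (eqc-σ₀ c w h))

      class-nonadj : ∀ c → adj G v i ≡ false → class v σ c ≡ class v σ₀ c
      class-nonadj c h = card-cong pt
        where
        pt : ∀ w → adj G v w ∧ eqc (col σ w) c ≡ adj G v w ∧ eqc (col σ₀ w) c
        pt w with i FinP.≟ w
        ... | no _ = refl
        ... | yes refl rewrite h = refl

      Tc-other : ∀ u c → c ≢ cᵢ → Tc v σ u c ≡ Tc v σ₀ u c
      Tc-other u c h = cong₂ (λ a b → a ∧ (b ℕ.≤ᵇ K)) (keepc-other u c h) (class-other c h)

      ∣a-b∣≤a+b : ∀ a b → ∣ ⟦ a ⟧ - ⟦ b ⟧ ∣ ≤ ⟦ a ⟧ + ⟦ b ⟧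
      ∣a-b∣≤a+b true true = dec≤
      ∣a-b∣≤a+b true false = dec≤
      ∣a-b∣≤a+b false true = dec≤
      ∣a-b∣≤a+b false false = dec≤

      ∣a-a∣≤ : ∀ {a b : Bool} {x} → a ≡ b → 0ℚ ≤ x → ∣ ⟦ a ⟧ - ⟦ b ⟧ ∣ ≤ x
      ∣a-a∣≤ {a} refl h = ≤-reflexive (cong ∣_∣ (ℚP.+-inverseʳ ⟦ a ⟧)) ⨾ h

      Tk-diff : ∀ u → ∣ ⟦ Tk v σ u ⟧ - ⟦ Tk v σ₀ u ⟧ ∣ ≤ ⟦ Tc v σ u cᵢ ⟧ + ⟦ Tc v σ₀ u cᵢ ⟧
      Tk-diff u = by-cases (i FinP.≟ u) (cu ℕP.≟ cᵢ)
        where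
        cu : ℕ
        cu = L u (proj₁ (lookup ω u))
        0≤rhs : ∀ a b → 0ℚ ≤ ⟦ a ⟧ + ⟦ b ⟧
        0≤rhs a b = 0≤a+b 0≤⟦ a ⟧ 0≤⟦ b ⟧
        by-cases : Dec (i ≡ u) → Dec (cu ≡ cᵢ) → ∣ ⟦ Tk v σ u ⟧ - ⟦ Tk v σ₀ u ⟧ ∣ ≤ ⟦ Tc v σ u cᵢ ⟧ + ⟦ Tc v σ₀ u cᵢ ⟧
        by-cases (yes refl) _ = ≤-reflexive (cong (λ z → ∣ ⟦ Tc v σ i cᵢ ⟧ - ⟦ lift (Tc v σ₀ i) (proj₁ z) ⟧ ∣)
            (st₀-self i ω))
             ⨾ ≤-reflexive (0≤-id ⟦ Tc v σ i cᵢ ⟧ 0≤⟦ Tc v σ i cᵢ ⟧)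
                 ⨾ ≤-by 0≤⟦ Tc v σ₀ i cᵢ ⟧ (eq ⟦ Tc v σ i cᵢ ⟧ ⟦ Tc v σ₀ i cᵢ ⟧)
          where
          0≤-id : ∀ x → 0ℚ ≤ x → ∣ x - 0ℚ ∣ ≡ x
          0≤-id x h = trans (cong ∣_∣ (ℚP.+-identityʳ x)) (ℚP.0≤p⇒∣p∣≡p h)
          eq : ∀ a b → a + b ≡ a + b + 0ℚ
          eq = solve-∀ ring
        by-cases (no ne) d = subst (λ z → ∣ ⟦ Tk v σ u ⟧ - ⟦ lift (Tc v σ₀ u) (proj₁ z) ⟧ ∣
            ≤ ⟦ Tc v σ u cᵢ ⟧ + ⟦ Tc v σ₀ u cᵢ ⟧) (sym (st₀-other i ω u ne)) (go d)
          where
          go : Dec (cu ≡ cᵢ) → ∣ ⟦ Tc v σ u cu ⟧ - ⟦ Tc v σ₀ u cu ⟧ ∣ ≤ ⟦ Tc v σ u cᵢ ⟧ + ⟦ Tc v σ₀ u cᵢ ⟧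
          go (yes e) = subst (λ c → ∣ ⟦ Tc v σ u cu ⟧ - ⟦ Tc v σ₀ u cu ⟧ ∣
              ≤ ⟦ Tc v σ u c ⟧ + ⟦ Tc v σ₀ u c ⟧) e (∣a-b∣≤a+b (Tc v σ u cu) (Tc v σ₀ u cu))
          go (no e) = ∣a-a∣≤ (Tc-other u cu e) (0≤rhs (Tc v σ u cᵢ) (Tc v σ₀ u cᵢ))

      ΣTk-diff : ∑ (λ u → ⟦ adj G v u ⟧ * ∣ ⟦ Tk v σ u ⟧ - ⟦ Tk v σ₀ u ⟧ ∣) ≤ ι K + ι K
      ΣTk-diff = ∑-mono (λ u → (0≤⟦ adj G v u ⟧ ⊙ Tk-diff u) ⨾ ≤-reflexive
          (ℚP.*-distribˡ-+ ⟦ adj G v u ⟧ ⟦ Tc v σ u cᵢ ⟧ ⟦ Tc v σ₀ u cᵢ ⟧))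
         ⨾ ≤-reflexive (∑-+ _ _) ⨾ (ΣTc≤K v σ cᵢ ⊕ ΣTc≤K v σ₀ cᵢ)

      -- The vertex i can matter to v only if it is adjacent to v or shares its colour with a common
      -- neighbour. Each possible coincidence has probability at most 1/C, so the total influence is
      -- only of order D although about D² vertices are in reach.
      touched : Bool
      touched = adj G v i ∨ anyB (λ u → adj G v u ∧ (adj G u i ∧ eqc (col σ u) cᵢ))

      module Untouched (h : touched ≡ false) where
        vi : adj G v i ≡ false
        vi = ∨-falseˡ h
          where
          ∨-falseˡ : ∀ {a b} → a ∨ b ≡ false → a ≡ false
          ∨-falseˡ {false} _ = refl
        none : ∀ u → adj G v u ∧ (adj G u i ∧ eqc (col σ u) cᵢ) ≡ false
        none = anyB-false (∨-falseʳ {adj G v i} h)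
          where
          ∨-falseʳ : ∀ {a b} → a ∨ b ≡ false → b ≡ false
          ∨-falseʳ {false} e = e
        i≢ : ∀ u → adj G v u ≡ true → i ≢ u
        i≢ u e refl = false≢true vi e
        keepc-same : ∀ u c → adj G v u ≡ true → keepc σ u c ≡ keepc σ₀ u c
        keepc-same u c e = by-cases (adj G u i) refl (c ℕP.≟ cᵢ)
          where
          by-cases : ∀ b → adj G u i ≡ b → Dec (c ≡ cᵢ) → keepc σ u c ≡ keepc σ₀ u c
          by-cases false p _ = keepc-nonadj u c (i≢ u e) p
          by-cases true p (no ne) = keepc-other u c ne
          by-cases true p (yes refl) = trans (cong (λ z → (z ∧ ghostOK c u (σ u)) ∧ allB (λ y →
              not (beaten c u y (σ u) (σ y)))) ecu)
              (sym (cong (λ z → (z ∧ ghostOK c u (σ₀ u)) ∧ allB (λ y →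
                  not (beaten c u y (σ₀ u) (σ₀ y)))) (trans (cong (λ s →
                  eqc (proj₁ s) cᵢ) (st₀-other i ω u (i≢ u e))) ecu)))
            where
            ecu : eqc (col σ u) cᵢ ≡ false
            ecu = trans (sym (cong₂ (λ a b → a ∧ (b ∧ eqc (col σ u) cᵢ)) e p)) (none u)
        Tk-same : ∀ u → adj G v u ≡ true → Tk v σ u ≡ Tk v σ₀ u
        Tk-same u e = trans (lift-cong (λ c → cong₂ (λ a b → a ∧ (b ℕ.≤ᵇ K)) (keepc-same u c e) (class-nonadj c vi))
            (col σ u))
          (cong (λ s → lift (Tc v σ₀ u) (proj₁ s)) (sym (st₀-other i ω u (i≢ u e))))
        loss-same : loss v σ ≡ loss v σ₀
        loss-same = ∑-cong (λ j → cong ⟦_⟧ (anyB-cong (pt (L v j))))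
          where
          pt : ∀ c u → adj G v u ∧ keepc σ u c ≡ adj G v u ∧ keepc σ₀ u c
          pt c u with adj G v u in e
          ... | false = refl
          ... | true = keepc-same u c e
        diff-zero : ∀ u → ⟦ adj G v u ⟧ * ∣ ⟦ Tk v σ u ⟧ - ⟦ Tk v σ₀ u ⟧ ∣ ≡ 0ℚ
        diff-zero u with adj G v u in e
        ... | false = ℚP.*-zeroˡ ∣ ⟦ Tk v σ u ⟧ - ⟦ Tk v σ₀ u ⟧ ∣
        ... | true = trans (ℚP.*-identityˡ ∣ ⟦ Tk v σ u ⟧ - ⟦ Tk v σ₀ u ⟧ ∣) (cong ∣_∣ (trans (cong (λ z →
            ⟦ z ⟧ - ⟦ Tk v σ₀ u ⟧) (Tk-same u e)) (ℚP.+-inverseʳ ⟦ Tk v σ₀ u ⟧)))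

      ΣTk-close : ∑ (λ u → ⟦ adj G v u ⟧ * ∣ ⟦ Tk v σ u ⟧ - ⟦ Tk v σ₀ u ⟧ ∣) ≤ (ι K + ι K) * ⟦ touched ⟧
      ΣTk-close with touched in e
      ... | true = ΣTk-diff ⨾ ≤-reflexive (sym (ℚP.*-identityʳ (ι K + ι K)))
      ... | false = ≤-reflexive (trans (∑-cong (Untouched.diff-zero e)) (trans (∑-0 n) (sym (ℚP.*-zeroʳ
          (ι K + ι K)))))

      -- Only the status of `cᵢ` can change, and it occupies at most one place in the list of v;
      -- hence the constant 1 instead of 2K.
      loss-close : ∣ loss v σ - loss v σ₀ ∣ ≤ 1ℚ * ⟦ touched ⟧
      loss-close with touched in e
      ... | false = ≤-reflexive (cong ∣_∣ (trans (cong (_- loss v σ₀) (Untouched.loss-same e)) (ℚP.+-inverseʳ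
          (loss v σ₀))))
      ... | true = ≤-reflexive (cong ∣_∣ (sym (∑-sub _ _))) ⨾ ∑-abs _ ⨾ ∑-mono pt
          ⨾ ∑-single (λ j → L v j ℕ.≡ᵇ cᵢ) (λ a b p q → L-inj v a b (trans (≡ᵇ-true p) (sym (≡ᵇ-true q))))
        where
        ∣a-b∣≤1 : ∀ a b → ∣ ⟦ a ⟧ - ⟦ b ⟧ ∣ ≤ 1ℚ
        ∣a-b∣≤1 true true = dec≤
        ∣a-b∣≤1 true false = dec≤
        ∣a-b∣≤1 false true = dec≤
        ∣a-b∣≤1 false false = dec≤
        pt : ∀ j → ∣ ⟦ lost v σ (L v j) ⟧ - ⟦ lost v σ₀ (L v j) ⟧ ∣ ≤ ⟦ L v j ℕ.≡ᵇ cᵢ ⟧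
        pt j with L v j ℕ.≡ᵇ cᵢ in q
        ... | true = ∣a-b∣≤1 (lost v σ (L v j)) (lost v σ₀ (L v j))
        ... | false = ∣a-a∣≤ (anyB-cong (λ u → cong (adj G v u ∧_) (keepc-other u (L v j) (λ { r →
            false≢true q (subst (λ z → (L v j ℕ.≡ᵇ z) ≡ true) r (≡ᵇ-refl (L v j))) })))) ≤-refl

      degT-close : ∣ degT v σ - degT v σ₀ ∣ ≤ (ι K + ι K) * ⟦ touched ⟧
      degT-close = ≤-reflexive (cong ∣_∣ (sym (∑-sub _ _))) ⨾ ∑-abs _ ⨾ ∑-mono pt ⨾ ΣTk-close
        where
        eq : ∀ a x y → a * (1ℚ - x) - a * (1ℚ - y) ≡ - (a * (x - y))
        eq = solve-∀ ring
        pt : ∀ u → ∣ ⟦ adj G v u ⟧ * (1ℚ - ⟦ Tk v σ u ⟧) - ⟦ adj G v u ⟧ * (1ℚ - ⟦ Tk v σ₀ u ⟧) ∣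
            ≤ ⟦ adj G v u ⟧ * ∣ ⟦ Tk v σ u ⟧ - ⟦ Tk v σ₀ u ⟧ ∣
        pt u = ≤-reflexive (trans (cong ∣_∣ (eq ⟦ adj G v u ⟧ ⟦ Tk v σ u ⟧ ⟦ Tk v σ₀ u ⟧)) (trans (ℚP.∣-p∣≡∣p∣
            (⟦ adj G v u ⟧ * (⟦ Tk v σ u ⟧ - ⟦ Tk v σ₀ u ⟧)))
           (trans (∣p*q∣≡∣p∣*∣q∣ ⟦ adj G v u ⟧ _) (cong (_* ∣ ⟦ Tk v σ u ⟧ - ⟦ Tk v σ₀ u ⟧ ∣)
               (ℚP.0≤p⇒∣p∣≡p 0≤⟦ adj G v u ⟧)))))

      -- The changes of the indicators add up to at most 2K, and each one affects at most D ordered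
      -- pairs in either position.
      edgT-close : (∀ u → ∑ (λ w → ⟦ adj G u w ⟧) ≤ ι D) → ∣ edgT v σ - edgT v σ₀ ∣ ≤ 4ℚ * ι K * ι D * ⟦ touched ⟧
      edgT-close deg≤ = ≤-reflexive (cong ∣_∣ (sym (trans (∑-cong (λ u → ∑-sub _ _)) (∑-sub _ _)))) ⨾ ∑-abs _
          ⨾ ∑-mono (λ u → ∑-abs _ ⨾ ∑-mono (pt u))
         ⨾ ≤-reflexive (trans (∑-cong (λ u → ∑-+ _ _)) (∑-+ _ _)) ⨾ (half₁ ⊕ half₂)
             ⨾ ≤-reflexive (eq₂ (ι K) (ι D) ⟦ touched ⟧)
        where
        av : Fin n → ℚ
        av u = ⟦ adj G v u ⟧
        δT : Fin n → ℚ
        δT u = ∣ ⟦ Tk v σ u ⟧ - ⟦ Tk v σ₀ u ⟧ ∣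
        eq : ∀ a x y x′ y′ → a * ((1ℚ - x) * (1ℚ - y)) - a * ((1ℚ - x′) * (1ℚ - y′))
            ≡ a * ((x′ - x) * (1ℚ - y) + (y′ - y) * (1ℚ - x′))
        eq = solve-∀ ring
        0≤1-b : ∀ b → ∣ 1ℚ - ⟦ b ⟧ ∣ ≤ 1ℚ
        0≤1-b true = dec≤
        0≤1-b false = dec≤
        swap-abs : ∀ x y → ∣ y - x ∣ ≡ ∣ x - y ∣
        swap-abs x y = trans (cong ∣_∣ (e x y)) (ℚP.∣-p∣≡∣p∣ (x - y))
          where
          e : ∀ x y → y - x ≡ - (x - y)
          e = solve-∀ ring
        pt : ∀ u w → ∣ av u * av w * ⟦ adj G u w ⟧ * ((1ℚ - ⟦ Tk v σ u ⟧) *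
            (1ℚ - ⟦ Tk v σ w ⟧)) - av u * av w * ⟦ adj G u w ⟧ * ((1ℚ - ⟦ Tk v σ₀ u ⟧) * (1ℚ - ⟦ Tk v σ₀ w ⟧)) ∣
              ≤ av u * δT u * (⟦ adj G u w ⟧) + av w * δT w * ⟦ adj G u w ⟧
        pt u w = ≤-reflexive (trans (cong ∣_∣ (eq a tu tw tu′ tw′)) (trans (∣p*q∣≡∣p∣*∣q∣ a _) (cong (_* ∣
            (tu′ - tu) * (1ℚ - tw) + (tw′ - tw) * (1ℚ - tu′) ∣) (ℚP.0≤p⇒∣p∣≡p 0≤a))))
            ⨾ (0≤a ⊙ (∣p+q∣≤∣p∣+∣q∣ ((tu′ - tu) * (1ℚ - tw)) ((tw′ - tw) * (1ℚ - tu′))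
                ⨾ ((≤-reflexive (∣p*q∣≡∣p∣*∣q∣ (tu′ - tu) (1ℚ - tw)) ⨾ (0≤∣p∣ (tu′ - tu) ⊙ 0≤1-b (Tk v σ w))
                ⨾ ≤-reflexive (trans (ℚP.*-identityʳ ∣ tu′ - tu ∣) (swap-abs tu tu′)))
                ⊕ (≤-reflexive (∣p*q∣≡∣p∣*∣q∣ (tw′ - tw) (1ℚ - tu′)) ⨾ (0≤∣p∣ (tw′ - tw) ⊙ 0≤1-b (Tk v σ₀ u))
                    ⨾ ≤-reflexive (trans (ℚP.*-identityʳ ∣ tw′ - tw ∣) (swap-abs tw tw′))))))
            ⨾ ≤-by ((0≤a*b (0≤a*b 0≤⟦ adj G v u ⟧ 0≤⟦ adj G u w ⟧) (0≤∣p∣ (tu - tu′)) ⊙ ⟦ adj G v w ⟧≤1)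
                ⊕ (0≤a*b (0≤a*b 0≤⟦ adj G v w ⟧ 0≤⟦ adj G u w ⟧) (0≤∣p∣ (tw - tw′)) ⊙ ⟦ adj G v u ⟧≤1))
               (eq₃ (av u) (av w) ⟦ adj G u w ⟧ (δT u) (δT w))
          where
          a tu tw tu′ tw′ : ℚ
          a = av u * av w * ⟦ adj G u w ⟧
          tu = ⟦ Tk v σ u ⟧
          tw = ⟦ Tk v σ w ⟧
          tu′ = ⟦ Tk v σ₀ u ⟧
          tw′ = ⟦ Tk v σ₀ w ⟧
          0≤a : 0ℚ ≤ a
          0≤a = 0≤a*b (0≤a*b 0≤⟦ adj G v u ⟧ 0≤⟦ adj G v w ⟧) 0≤⟦ adj G u w ⟧
          eq₃ : ∀ x y z p q → x * y * z * (p + q) + (x * z * p * 1ℚ + y * z * q * 1ℚ)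
              ≡ x * p * z + y * q * z + (x * z * p * y + y * z * q * x)
          eq₃ = solve-∀ ring
        B : ℚ
        B = (ι K + ι K) * ⟦ touched ⟧
        half₁ : ∑ (λ u → ∑ (λ w → av u * δT u * ⟦ adj G u w ⟧)) ≤ B * ι D
        half₁ = ∑-mono (λ u → ≤-reflexive (∑-*ˡ (av u * δT u) _) ⨾ (0≤a*b 0≤⟦ adj G v u ⟧ (0≤∣p∣ _) ⊙ deg≤ u))
            ⨾ ≤-reflexive (∑-*ʳ (ι D) _) ⨾ (ΣTk-close ⊙ʳ 0≤ι D)
        half₂ : ∑ (λ u → ∑ (λ w → av w * δT w * ⟦ adj G u w ⟧)) ≤ B * ι D
        half₂ = ≤-reflexive (∑-swap ∑-lin _) ⨾ ∑-mono (λ w → ≤-reflexive (∑-*ˡ (av w * δT w) _)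
            ⨾ (0≤a*b 0≤⟦ adj G v w ⟧ (0≤∣p∣ _) ⊙ (≤-reflexive (∑-cong (λ u → cong ⟦_⟧ (Graph.sym G u w))) ⨾ deg≤ w)))
           ⨾ ≤-reflexive (∑-*ʳ (ι D) _) ⨾ (ΣTk-close ⊙ʳ 0≤ι D)
        eq₂ : ∀ K D t → (K + K) * t * D + (K + K) * t * D ≡ 4ℚ * K * D * t
        eq₂ = solve-∀ ring

    open Neutralise using (touched)

    prob : Fin n → Fin n → ℚ
    prob v i = ⟦ adj G v i ⟧ + ∑ (λ u → ⟦ adj G v u ⟧ * ⟦ adj G u i ⟧ * inv k)

    0≤prob : ∀ v i → 0ℚ ≤ prob v i
    0≤prob v i = 0≤a+b 0≤⟦ adj G v i ⟧ (∑-nonneg (λ u → 0≤a*b (0≤a*b 0≤⟦ adj G v u ⟧ 0≤⟦ adj G u i ⟧) (<⇒≤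
        (0<inv k))))

    Σprob≤ : (∀ u → ∑ (λ w → ⟦ adj G u w ⟧) ≤ ι D) → ∀ v → ∑ (prob v) ≤ ι D + ι D * ι D * inv k
    Σprob≤ deg≤ v = ≤-reflexive (∑-+ _ _) ⨾ (deg≤ v ⊕ (≤-reflexive (∑-swap ∑-lin _) ⨾ ∑-mono (λ u →
         ≤-reflexive (trans (∑-*ʳ (inv k) _) (cong (_* inv k) (∑-*ˡ ⟦ adj G v u ⟧ _)))
             ⨾ ((0≤⟦ adj G v u ⟧ ⊙ deg≤ u) ⊙ʳ <⇒≤ (0<inv k)))
         ⨾ ≤-reflexive (trans (∑-*ʳ (inv k) _) (cong (_* inv k) (∑-*ʳ (ι D) _)))
             ⨾ ((deg≤ v ⊙ʳ 0≤ι D) ⊙ʳ <⇒≤ (0<inv k))))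

    touched-avg : ∀ v i ω → 𝔼 X (λ a → ⟦ touched v i (ω [ i ]≔ a) ⟧) ≤ prob v i
    touched-avg v i ω = mono X pt ⨾ ≤-reflexive (trans (𝔼-+ X _ _) (cong₂ _+_ (𝔼-const X ⟦ adj G v i ⟧) (trans
        (𝔼-∑ X _) (∑-cong (λ u → 𝔼-*ˡ X (⟦ adj G v u ⟧ * ⟦ adj G u i ⟧) _)))))
        ⨾ (≤-refl {⟦ adj G v i ⟧} ⊕ ∑-mono (λ u → 0≤a*b 0≤⟦ adj G v u ⟧ 0≤⟦ adj G u i ⟧ ⊙ hit u))
      where
      cu : Fin n → ℕ
      cu u = L u (proj₁ (lookup ω u))
      hit : ∀ u → 𝔼 X (λ a → ⟦ cu u ℕ.≡ᵇ L i (proj₁ a) ⟧) ≤ inv k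
      hit u = ≤-reflexive (𝔼-κ (λ j → ⟦ cu u ℕ.≡ᵇ L i j ⟧)) ⨾ (<⇒≤ (0<inv k) ⊙ ∑-single (λ j →
          cu u ℕ.≡ᵇ L i j) (λ a b p q → L-inj i a b (trans (sym (≡ᵇ-true {cu u} p)) (≡ᵇ-true {cu u} q))))
          ⨾ ≤-reflexive (ℚP.*-identityʳ (inv k))
      pt : ∀ a → ⟦ touched v i (ω [ i ]≔ a) ⟧ ≤ ⟦ adj G v i ⟧ + ∑ (λ u →
          ⟦ adj G v u ⟧ * ⟦ adj G u i ⟧ * ⟦ cu u ℕ.≡ᵇ L i (proj₁ a) ⟧)
      pt a = ⟦∨⟧≤ (adj G v i) _ ⨾ (≤-refl {⟦ adj G v i ⟧} ⊕ (⟦anyB⟧≤ _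
          ⨾ ∑-mono (λ u → ≤-reflexive (trans (⟦∧⟧ (adj G v u) _) (trans (cong (⟦ adj G v u ⟧ *_) (trans (⟦∧⟧
          (adj G u i) _) (fix u)))
             (sym (ℚP.*-assoc ⟦ adj G v u ⟧ ⟦ adj G u i ⟧ ⟦ cu u ℕ.≡ᵇ L i (proj₁ a) ⟧)))))))
        where
        fix : ∀ u → ⟦ adj G u i ⟧ * ⟦ L u (proj₁ (lookup (ω [ i ]≔ a) u)) ℕ.≡ᵇ L i (proj₁ (lookup
            (ω [ i ]≔ a) i)) ⟧ ≡ ⟦ adj G u i ⟧ * ⟦ cu u ℕ.≡ᵇ L i (proj₁ a) ⟧
        fix u with u FinP.≟ i
        ... | yes refl = trans (cong (λ z → ⟦ z ⟧ * ⟦ L i (proj₁ (lookup (ω [ i ]≔ a) i)) ℕ.≡ᵇ L i (proj₁ (lookup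
            (ω [ i ]≔ a) i)) ⟧) (irrefl G i))
                 (trans (ℚP.*-zeroˡ ⟦ L i (proj₁ (lookup (ω [ i ]≔ a) i)) ℕ.≡ᵇ L i (proj₁ (lookup
                     (ω [ i ]≔ a) i)) ⟧) (sym (trans (cong (λ z → ⟦ z ⟧ * ⟦ cu i ℕ.≡ᵇ L i (proj₁ a) ⟧) (irrefl G i))
                     (ℚP.*-zeroˡ ⟦ cu i ℕ.≡ᵇ L i (proj₁ a) ⟧))))
        ... | no ne = cong (⟦ adj G u i ⟧ *_) (cong₂ (λ x y → ⟦ L u (proj₁ x) ℕ.≡ᵇ L i (proj₁ y) ⟧)
            (VecP.lookup∘updateAt′ u i ne ω) (VecP.lookup∘updateAt i ω))

    boundedDiff : ∀ v (f : State → ℚ) B → (∀ {σ σ′} → SameOn (ball v) σ σ′ → f σ ≡ f σ′) → (∀ i ω →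
        ∣ f (st ω) - f (st₀ i ω) ∣ ≤ B * ⟦ touched v i ω ⟧) →
      BoundedDiff X (f ∘ st) B (prob v)
    boundedDiff v f B loc cl = record
      { f₀ = λ i ω → f (st₀ i ω)
      ; ind = λ i ω → ⟦ touched v i ω ⟧
      ; f₀-indep = λ i ω a → loc (λ y _ → st₀-indep i ω a y)
      ; close = cl
      ; 0≤ind = λ i ω → 0≤⟦ touched v i ω ⟧
      ; ind≤1 = λ i ω → ⟦ touched v i ω ⟧≤1
      ; ind-avg = touched-avg v }

    loss-BD : ∀ v → BoundedDiff X (loss v ∘ st) 1ℚ (prob v)
    loss-BD v = boundedDiff v (loss v) 1ℚ loss-local (λ i ω → Neutralise.loss-close v i ω)

    degT-BD : ∀ v → BoundedDiff X (degT v ∘ st) (ι K + ι K) (prob v)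
    degT-BD v = boundedDiff v (degT v) (ι K + ι K) degT-local (λ i ω → Neutralise.degT-close v i ω)

    edgT-BD : (∀ u → ∑ (λ w → ⟦ adj G u w ⟧) ≤ ι D) → ∀ v → BoundedDiff X (edgT v ∘ st) (4ℚ * ι K * ι D) (prob v)
    edgT-BD deg≤ v = boundedDiff v (edgT v) (4ℚ * ι K * ι D) edgT-local (λ i ω → Neutralise.edgT-close v i ω deg≤)

    -- Joint survival probabilities of one, two and three vertices

    Y : Exp (Vec Ω n)
    Y = vec X n

    toSt : Fin n → Ω → St
    toSt u x = just (L u (proj₁ x)) , proj₂ x

    has-sum : ∀ y c → ∑ (λ κ → ⟦ L y κ ℕ.≡ᵇ c ⟧) ≡ ⟦ has y c ⟧
    has-sum y c with has y c in e
    ... | false = trans (∑-cong (λ κ → cong ⟦_⟧ (anyB-false {f = λ i → L y i ℕ.≡ᵇ c} e κ))) (∑-0 (suc k))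
    ... | true = ℚP.≤-antisym (∑-single (λ κ → L y κ ℕ.≡ᵇ c) (λ a b p q →
        L-inj y a b (trans (≡ᵇ-true p) (sym (≡ᵇ-true q)))))
                   (≤-reflexive (cong ⟦_⟧ (sym e)) ⨾ ⟦anyB⟧≤ (λ κ → L y κ ℕ.≡ᵇ c))

    β : ℚ
    β = 1ℚ - q

    selfP : Fin n → ℕ → ℚ
    selfP u c = inv k * ⟦ has u c ⟧ * β ^ (D ℕ.∸ mult u c)

    𝔼-self : ∀ u c → 𝔼 X (λ x → ⟦ self c u (toSt u x) ⟧) ≡ selfP u c
    𝔼-self u c = trans (𝔼-X _) (trans (cong (inv k *_) (trans (∑-cong per-κ) (trans (∑-*ʳ ghost (λ κ →
        ⟦ L u κ ℕ.≡ᵇ c ⟧)) (cong (_* ghost) (has-sum u c))))) (sym (ℚP.*-assoc (inv k) ⟦ has u c ⟧ ghost)))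
      where
      M : ℕ
      M = D ℕ.∸ mult u c
      ghost : ℚ
      ghost = β ^ M
      gP : 𝔼 Ghosts (λ gs → ⟦ firstTrue M gs ⟧) ≡ ghost
      gP = Ghosts-first M (ℕP.m∸n≤m D (mult u c))
      per-κ : ∀ κ → 𝔼 Bits (λ bs → 𝔼 Ghosts (λ gs → ⟦ self c u (toSt u (κ , bs , gs)) ⟧)) ≡ ⟦ L u κ ℕ.≡ᵇ c ⟧ * ghost
      per-κ κ = trans (𝔼-const Bits (𝔼 Ghosts (λ gs → ⟦ (L u κ ℕ.≡ᵇ c) ∧ firstTrue M gs ⟧)))
        (trans (𝔼-cong Ghosts {g = λ gs → ⟦ L u κ ℕ.≡ᵇ c ⟧ * ⟦ firstTrue M gs ⟧} (λ gs →
            ⟦∧⟧ (L u κ ℕ.≡ᵇ c) (firstTrue M gs))) (trans (𝔼-*ˡ Ghosts ⟦ L u κ ℕ.≡ᵇ c ⟧ (λ gs → ⟦ firstTrue M gs ⟧))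
          (cong (⟦ L u κ ℕ.≡ᵇ c ⟧ *_) gP)))

    -- With the states of the vertices `z` fixed, all other vertices act independently, and `W y`
    -- bounds the chance that y beats none of them. Conflicts among the `z` are ignored in the upper
    -- bound and ruled out by non-adjacency in the lower bound.
    module Joint {m} (z : Fin m → Fin n) (z-inj : ∀ i j → z i ≡ z j → i ≡ j) (c : Fin m → ℕ) (W : Fin n → ℚ) where
      nb : (Fin m → St) → Fin n → St → ℚ
      nb s y t = ∏ (λ j → ⟦ not (beaten (c j) (z j) y (s j) t) ⟧)

      inZ : Fin n → Bool
      inZ y = anyB (λ j → does (z j FinP.≟ y))

      notin : ∀ y → inZ y ≡ false → ∀ j → z j ≢ y
      notin y e j p with z j FinP.≟ y | anyB-false {f = λ j → does (z j FinP.≟ y)} e j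
      ... | no ¬p | _ = ¬p p

      isin : ∀ y → inZ y ≡ true → ∃[ j ] z j ≡ y
      isin y e with anyB-elim {f = λ j → does (z j FinP.≟ y)} e
      ... | j , h with z j FinP.≟ y
      ...   | yes p = j , p

      g : (Fin m → St) → Fin n → Ω → ℚ
      g s y x = if inZ y then 1ℚ else nb s y (toSt y x)

      private
        module Fix (as : Vec Ω m) (ω : Vec Ω n) where
          s : Fin m → St
          s j = toSt (z j) (lookup as j)
          σ : State
          σ = st (updAll ω z as)
          σz : ∀ j → σ (z j) ≡ s j
          σz j = cong (toSt (z j)) (lookup-updAll ω z as z-inj j)
          prod : ∏ (λ j → ⟦ keepc σ (z j) (c j) ⟧) ≡ ∏ (λ j → ⟦ self (c j) (z j) (s j) ⟧) * ∏ (λ y → nb s y (σ y))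
          prod = trans (∏-cong (λ j → trans (⟦∧⟧ (self (c j) (z j) (σ (z j))) _) (cong₂ (λ a b →
              ⟦ self (c j) (z j) a ⟧ * b) (σz j)
                    (trans (⟦allB⟧ _) (∏-cong (λ y → cong (λ a → ⟦ not (beaten (c j) (z j) y a (σ y)) ⟧) (σz j)))))))
                 (trans (∏-* _ _) (cong (∏ (λ j → ⟦ self (c j) (z j) (s j) ⟧) *_) (∏-swap _)))
          0≤nb : ∀ y t → 0ℚ ≤ nb s y t
          0≤nb y t = ∏-nonneg (λ j → 0≤⟦ not (beaten (c j) (z j) y (s j) t) ⟧)
          nb≤1 : ∀ y t → nb s y t ≤ 1ℚ
          nb≤1 y t = ∏-mono (λ j → 0≤⟦ not (beaten (c j) (z j) y (s j) t) ⟧) (λ j →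
              ⟦ not (beaten (c j) (z j) y (s j) t) ⟧≤1) ⨾ ≤-reflexive (∏-one (λ _ → refl))
          out : ∀ y → inZ y ≡ false → σ y ≡ toSt y (lookup ω y)
          out y e = cong (toSt y) (lookup-updAll′ ω z as y (notin y e))
          0≤g : ∀ y x → 0ℚ ≤ g s y x
          0≤g y x with inZ y
          ... | true = 0≤1
          ... | false = 0≤nb y (toSt y x)
          upper : ∏ (λ y → nb s y (σ y)) ≤ ∏ (λ y → g s y (lookup ω y))
          upper = ∏-mono (λ y → 0≤nb y (σ y)) pt
            where
            pt : ∀ y → nb s y (σ y) ≤ g s y (lookup ω y)
            pt y with inZ y in e
            ... | true = nb≤1 y (σ y)
            ... | false = ≤-reflexive (cong (nb s y) (out y e))
          lower : (∀ i j → adj G (z i) (z j) ≡ false) → ∏ (λ y → g s y (lookup ω y)) ≤ ∏ (λ y → nb s y (σ y))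
          lower na = ∏-mono (λ y → 0≤g y (lookup ω y)) pt
            where
            pt : ∀ y → g s y (lookup ω y) ≤ nb s y (σ y)
            pt y with inZ y in e
            ... | false = ≤-reflexive (cong (nb s y) (sym (out y e)))
            ... | true with isin y e
            ...   | i , refl = ≤-reflexive (sym (∏-one (λ j → cong (λ b →
                ⟦ not (b ∧ (eqc (proj₁ (σ (z i))) (c j) ∧ not (wins (z j) (z i) (s j) (σ (z i))))) ⟧) (na j i))))

        total : ℚ
        total = ∏ (λ j → selfP (z j) (c j))

        sAs : Vec Ω m → Fin m → St
        sAs as j = toSt (z j) (lookup as j)

        𝔼-selfs : 𝔼 (vec X m) (λ as → ∏ (λ j → ⟦ self (c j) (z j) (sAs as j) ⟧)) ≡ total
        𝔼-selfs = trans (𝔼-∏ X (λ j x → ⟦ self (c j) (z j) (toSt (z j) x) ⟧)) (∏-cong (λ j → 𝔼-self (z j) (c j)))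

        middle : ∀ as → 𝔼 Y (λ ω → ∏ (λ j → ⟦ self (c j) (z j) (sAs as j) ⟧) * ∏ (λ y →
            g (sAs as) y (lookup ω y))) ≡ ∏ (λ j → ⟦ self (c j) (z j) (sAs as j) ⟧) * ∏ (λ y → 𝔼 X (g (sAs as) y))
        middle as = trans (𝔼-*ˡ Y (∏ (λ j → ⟦ self (c j) (z j) (sAs as j) ⟧)) (λ ω → ∏ (λ y →
            g (sAs as) y (lookup ω y)))) (cong (∏ (λ j → ⟦ self (c j) (z j) (sAs as j) ⟧) *_) (𝔼-∏ X (g (sAs as))))

        0≤selfs : ∀ as → 0ℚ ≤ ∏ (λ j → ⟦ self (c j) (z j) (sAs as j) ⟧)
        0≤selfs as = ∏-nonneg (λ j → 0≤⟦ self (c j) (z j) (sAs as j) ⟧)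

      joint-upper : (∀ s y → inZ y ≡ false → 𝔼 X (λ x → nb s y (toSt y x)) ≤ W y) → (∀ y → inZ y ≡ true → 1ℚ ≤ W y) →
        𝔼 Y (λ ω → ∏ (λ j → ⟦ keepc (st ω) (z j) (c j) ⟧)) ≤ ∏ (λ j → selfP (z j) (c j)) * ∏ W
      joint-upper h h₁ = ≤-reflexive (resampleAll X z _) ⨾ mono (vec X m) (λ as → mono Y (λ ω →
          ≤-reflexive (Fix.prod as ω) ⨾ (0≤selfs as ⊙ Fix.upper as ω)) ⨾ ≤-reflexive (middle as)
           ⨾ (0≤selfs as ⊙ ∏-mono (λ y → 𝔼-nonneg X (0≤g (sAs as) y)) (bound (sAs as))))
         ⨾ ≤-reflexive (trans (𝔼-*ʳ (vec X m) (∏ W) _) (cong (_* ∏ W) 𝔼-selfs))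
        where
        0≤g : ∀ s y x → 0ℚ ≤ g s y x
        0≤g s y x with inZ y
        ... | true = 0≤1
        ... | false = ∏-nonneg (λ j → 0≤⟦ not (beaten (c j) (z j) y (s j) (toSt y x)) ⟧)
        bound : ∀ s y → 𝔼 X (g s y) ≤ W y
        bound s y with inZ y in e
        ... | true = ≤-reflexive (one X) ⨾ h₁ y e
        ... | false = h s y e

      joint-lower : (∀ i j → adj G (z i) (z j) ≡ false) → (∀ y → 0ℚ ≤ W y) → (∀ s y → inZ y ≡ false →
          W y ≤ 𝔼 X (λ x → nb s y (toSt y x))) → (∀ y → W y ≤ 1ℚ) →
        ∏ (λ j → selfP (z j) (c j)) * ∏ W ≤ 𝔼 Y (λ ω → ∏ (λ j → ⟦ keepc (st ω) (z j) (c j) ⟧))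
      joint-lower na 0≤W h W≤1 = ≤-reflexive (sym (trans (𝔼-*ʳ (vec X m) (∏ W) _) (cong (_* ∏ W) 𝔼-selfs))) ⨾
         mono (vec X m) (λ as → (0≤selfs as ⊙ ∏-mono 0≤W (bound (sAs as))) ⨾ ≤-reflexive (sym (middle as))
             ⨾ mono Y (λ ω → (0≤selfs as ⊙ Fix.lower as ω na) ⨾ ≤-reflexive (sym (Fix.prod as ω))))
         ⨾ ≤-reflexive (sym (resampleAll X z _))
        where
        bound : ∀ s y → W y ≤ 𝔼 X (g s y)
        bound s y with inZ y in e
        ... | true = W≤1 y ⨾ ≤-reflexive (sym (one X))
        ... | false = h s y e

    module Mono {m} (z : Fin m → Fin n) (z-inj : ∀ i j → z i ≡ z j → i ≡ j) (c : ℕ) where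
      miss : Fin n → ℚ
      miss y = ∏ (λ j → 1ℚ - ½ * ⟦ adj G (z j) y ⟧)

      Wm : Fin n → ℚ
      Wm y = 1ℚ - inv k * ⟦ has y c ⟧ * (1ℚ - miss y)

      open Joint z z-inj (λ _ → c) Wm public

      -- If y holds c, its edges to the vertices `z j` are decided by different bits of y,
      -- independently of one another; distinctness of the `z j` is what makes the bits different.
      𝔼-nb : ∀ s y → 𝔼 X (λ x → nb s y (toSt y x)) ≡ Wm y
      𝔼-nb s y = trans (𝔼-X _) (trans (cong (inv k *_) (trans (∑-cong per-κ) (trans (∑-+ (λ _ → 1ℚ) (λ κ →
          ⟦ L y κ ℕ.≡ᵇ c ⟧ * (- (1ℚ - miss y)))) (cong₂ _+_ (∑-const (suc k) 1ℚ)
            (trans (∑-*ʳ (- (1ℚ - miss y)) _) (cong (_* (- (1ℚ - miss y))) (has-sum y c))))))) (trans (eq (inv k) (ι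
                (suc k)) ⟦ has y c ⟧ (miss y)) (cong (λ a → a - inv k * ⟦ has y c ⟧ * (1ℚ - miss y)) (inv-eq k))))
        where
        eq : ∀ i s h w → i * (s * 1ℚ + h * (- (1ℚ - w))) ≡ i * s - i * h * (1ℚ - w)
        eq = solve-∀ ring
        factor : Fin m → Bool → Bool → ℚ
        factor j b x = ⟦ not (adj G (z j) y ∧ (b ∧ not ((bit (s j) y xor x) xor (toℕ (z j) ℕ.<ᵇ toℕ y)))) ⟧
        by-hit : ∀ b → 𝔼 Bits (λ bs → 𝔼 Ghosts (λ _ → ∏ (λ j → factor j b (lookup bs (z j)))))
            ≡ 1ℚ + ⟦ b ⟧ * (- (1ℚ - miss y))
        by-hit false = trans (𝔼-cong Bits (λ bs → trans (𝔼-const Ghosts (∏ (λ j →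
            factor j false (lookup bs (z j))))) (∏-one (λ j → cong (⟦_⟧ ∘ not) (BoolP.∧-zeroʳ (adj G (z j) y))))))
            (trans (one Bits) (sym (eq₀ (miss y))))
          where
          eq₀ : ∀ w → 1ℚ + 0ℚ * (- (1ℚ - w)) ≡ 1ℚ
          eq₀ = solve-∀ ring
        by-hit true = trans (𝔼-cong Bits (λ bs → 𝔼-const Ghosts (∏ (λ j →
            factor j true (lookup bs (z j)))))) (trans (Bits-∏ z z-inj (λ j → factor j true))
             (trans (∏-cong (λ j → half-coin (adj G (z j) y) (bit (s j) y) (toℕ (z j) ℕ.<ᵇ toℕ y))) (sym (eq₁
                 (miss y)))))
          where
          eq₁ : ∀ w → 1ℚ + 1ℚ * (- (1ℚ - w)) ≡ w
          eq₁ = solve-∀ ring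
        per-κ : ∀ κ → 𝔼 Bits (λ bs → 𝔼 Ghosts (λ gs → nb s y (toSt y (κ , bs , gs))))
            ≡ 1ℚ + ⟦ L y κ ℕ.≡ᵇ c ⟧ * (- (1ℚ - miss y))
        per-κ κ = by-hit (L y κ ℕ.≡ᵇ c)

      0≤half : ∀ b → 0ℚ ≤ 1ℚ - ½ * ⟦ b ⟧
      0≤half true = dec≤
      0≤half false = dec≤
      half≤1 : ∀ b → 1ℚ - ½ * ⟦ b ⟧ ≤ 1ℚ
      half≤1 true = dec≤
      half≤1 false = dec≤
      miss≤1 : ∀ y → miss y ≤ 1ℚ
      miss≤1 y = ∏-mono (λ j → 0≤half (adj G (z j) y)) (λ j → half≤1 (adj G (z j) y))
          ⨾ ≤-reflexive (∏-one (λ _ → refl))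
      0≤miss : ∀ y → 0ℚ ≤ miss y
      0≤miss y = ∏-nonneg (λ j → 0≤half (adj G (z j) y))
      Wm≤1 : ∀ y → Wm y ≤ 1ℚ
      Wm≤1 y = 1-a≤1 (0≤a*b (0≤a*b (<⇒≤ (0<inv k)) 0≤⟦ has y c ⟧) (0≤b-a (miss≤1 y)))
      0≤Wm : ∀ y → 0ℚ ≤ Wm y
      0≤Wm y = 0≤b-a {inv k * ⟦ has y c ⟧ * (1ℚ - miss y)} {1ℚ} (*-mono (0≤b-a (miss≤1 y)) 0≤1
          (*-mono 0≤⟦ has y c ⟧ 0≤1 (inv≤1 k) ⟦ has y c ⟧≤1) (1-a≤1 (0≤miss y)))

      Wm-Z : (∀ i j → adj G (z i) (z j) ≡ false) → ∀ y → inZ y ≡ true → 1ℚ ≤ Wm y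
      Wm-Z na y e with isin y e
      ... | i , refl = ≤-reflexive (sym (trans (cong (λ w → 1ℚ - inv k * ⟦ has y c ⟧ * (1ℚ - w)) (∏-one (λ j →
          cong (λ b → 1ℚ - ½ * ⟦ b ⟧) (na j i)))) (eq (inv k * ⟦ has y c ⟧))))
        where
        eq : ∀ x → 1ℚ - x * (1ℚ - 1ℚ) ≡ 1ℚ
        eq = solve-∀ ring

      mono-upper : (∀ i j → adj G (z i) (z j) ≡ false) → 𝔼 Y (λ ω → ∏ (λ j → ⟦ keepc (st ω) (z j) c ⟧)) ≤ ∏ (λ j →
          selfP (z j) c) * ∏ Wm
      mono-upper na = joint-upper (λ s y _ → ≤-reflexive (𝔼-nb s y)) (Wm-Z na)

      mono-lower : (∀ i j → adj G (z i) (z j) ≡ false) → ∏ (λ j → selfP (z j) c) * ∏ Wm ≤ 𝔼 Y (λ ω → ∏ (λ j →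
          ⟦ keepc (st ω) (z j) c ⟧))
      mono-lower na = joint-lower na 0≤Wm (λ s y _ → ≤-reflexive (sym (𝔼-nb s y))) Wm≤1

    open Outsider (inv k) (<⇒≤ (0<inv k)) (inv≤1 k) public

    ρ : ℚ
    ρ = β ^ D
    γ : ℚ
    γ = 1ℚ - y₇

    P1-out : ∀ u c → ∏ (Mono.Wm {1} (λ _ → u) single-inj c) ≡ β ^ mult u c
    P1-out u c = trans (∏-cong (λ y → trans (cong (λ w → 1ℚ - inv k * ⟦ has y c ⟧ * (1ℚ - w)) (∏1 (λ j →
        1ℚ - ½ * ⟦ adj G u y ⟧))) (lone (adj G u y) (has y c)))) (∏-pow q (λ y → adj G u y ∧ has y c))

    ghosts-complete : ∀ x u c → x ^ (D ℕ.∸ mult u c) * x ^ mult u c ≡ x ^ D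
    ghosts-complete x u c = trans (sym (^-+ x (D ℕ.∸ mult u c) (mult u c))) (cong (x ^_) (ℕP.m∸n+n≡m (mult≤D u c)))

    -- A neighbour with c in its list contributes a factor β, and so does a ghost. Together there
    -- are exactly D of them, which makes the value the same for all vertices; the upper and lower
    -- estimates coincide for a single vertex.
    keep-prob : ∀ u c → 𝔼 Y (λ ω → ⟦ keepc (st ω) u c ⟧) ≡ inv k * ⟦ has u c ⟧ * ρ
    keep-prob u c = trans (𝔼-cong Y (λ ω → sym (∏1 (λ _ → ⟦ keepc (st ω) u c ⟧)))) (trans (ℚP.≤-antisym
        (M.mono-upper na) (M.mono-lower na))
        (trans (cong₂ _*_ (∏1 _) (P1-out u c)) (trans (ℚP.*-assoc (inv k * ⟦ has u c ⟧) _ _) (cong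
            (inv k * ⟦ has u c ⟧ *_) (ghosts-complete β u c)))))
      where
      module M = Mono {1} (λ _ → u) single-inj c
      na : ∀ (i j : Fin 1) → adj G u u ≡ false
      na _ _ = irrefl G u

    -- By `pair`, common neighbours only help, so the outsiders contribute at least the product of
    -- the single factors, and the ghosts complete both exponents to D.
    pair-prob : ∀ u w c → u ≢ w → adj G u w ≡ false → (inv k * ⟦ has u c ⟧) * (inv k * ⟦ has w c ⟧) * (ρ * ρ)
        ≤ 𝔼 Y (λ ω → ⟦ keepc (st ω) u c ⟧ * ⟦ keepc (st ω) w c ⟧)
    pair-prob u w c ne nadj = ≤-reflexive (trans (cong (h₁ * h₂ *_) (cong₂ _*_ (sym (ghosts-complete β u c)) (sym
        (ghosts-complete β w c)))) (eq h₁ h₂ g₁ g₂ (β ^ mult u c) (β ^ mult w c)))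
        ⨾ (0≤a*b (0≤a*b 0≤h₁ (^-nonneg (D ℕ.∸ mult u c) 0≤1-q)) (0≤a*b 0≤h₂ (^-nonneg (D ℕ.∸ mult w c) 0≤1-q)) ⊙ out)
        ⨾ ≤-reflexive (cong (_* ∏ M.Wm) (sym (∏2 _))) ⨾ M.mono-lower na ⨾ ≤-reflexive (𝔼-cong Y (λ ω → ∏2 _))
      where
      h₁ h₂ g₁ g₂ : ℚ
      h₁ = inv k * ⟦ has u c ⟧
      h₂ = inv k * ⟦ has w c ⟧
      g₁ = β ^ (D ℕ.∸ mult u c)
      g₂ = β ^ (D ℕ.∸ mult w c)
      0≤h₁ : 0ℚ ≤ h₁
      0≤h₁ = 0≤a*b (<⇒≤ (0<inv k)) 0≤⟦ has u c ⟧
      0≤h₂ : 0ℚ ≤ h₂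
      0≤h₂ = 0≤a*b (<⇒≤ (0<inv k)) 0≤⟦ has w c ⟧
      eq : ∀ h₁ h₂ g₁ g₂ m₁ m₂ → h₁ * h₂ * ((g₁ * m₁) * (g₂ * m₂)) ≡ h₁ * g₁ * (h₂ * g₂) * (m₁ * m₂)
      eq = solve-∀ ring
      module M = Mono (two u w) (two-inj ne) c
      na : ∀ i j → adj G (two u w i) (two u w j) ≡ false
      na fzero fzero = irrefl G u
      na fzero (fsuc fzero) = nadj
      na (fsuc fzero) fzero = trans (Graph.sym G w u) nadj
      na (fsuc fzero) (fsuc fzero) = irrefl G w
      out : β ^ mult u c * β ^ mult w c ≤ ∏ M.Wm
      out = ≤-reflexive (sym (trans (∏-* _ _) (cong₂ _*_ (∏-pow q (λ y → adj G u y ∧ has y c)) (∏-pow q (λ y →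
          adj G w y ∧ has y c)))))
          ⨾ ∏-mono (λ y → 0≤a*b (0≤f (adj G u y ∧ has y c)) (0≤f (adj G w y ∧ has y c))) (λ y →
              pair (has y c) (adj G u y) (adj G w y) ⨾ ≤-reflexive (cong (λ z →
              1ℚ - inv k * ⟦ has y c ⟧ * (1ℚ - z)) (sym (∏2 _))))
        where
        0≤f : ∀ b → 0ℚ ≤ 1ℚ - q * ⟦ b ⟧
        0≤f b = 0≤b-a {q * ⟦ b ⟧} {1ℚ} (*-mono 0≤⟦ b ⟧ 0≤1 (q≤½ ⨾ dec≤) ⟦ b ⟧≤1)

    -- In cubed form `triple` gives each of the three vertices a factor γ for every neighbour having
    -- c. A cubed ghost factor obeys β³ ≤ γ, so each vertex receives γ^D, and the cube root of their
    -- product is γ^D.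
    triple-prob : ∀ u w t c → u ≢ w → u ≢ t → w ≢ t → adj G u w ≡ false → adj G u t ≡ false → adj G w t ≡ false →
      𝔼 Y (λ ω → ⟦ keepc (st ω) u c ⟧ * (⟦ keepc (st ω) w c ⟧ * ⟦ keepc (st ω) t c ⟧))
          ≤ (inv k * ⟦ has u c ⟧) * ((inv k * ⟦ has w c ⟧) * (inv k * ⟦ has t c ⟧)) * γ ^ D
    triple-prob u w t c n₁ n₂ n₃ a₁ a₂ a₃ = ≤-reflexive (𝔼-cong Y (λ ω → sym (∏3 _))) ⨾ M.mono-upper na
        ⨾ ≤-reflexive (trans (cong (_* ∏ M.Wm) (∏3 _)) (eq (h u) (h w) (h t) (g u) (g w) (g t) (∏ M.Wm)))
        ⨾ (0≤a*b (0≤h u) (0≤a*b (0≤h w) (0≤h t)) ⊙ bound)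
      where
      h g : Fin n → ℚ
      h u = inv k * ⟦ has u c ⟧
      g u = β ^ (D ℕ.∸ mult u c)
      0≤h : ∀ u → 0ℚ ≤ h u
      0≤h u = 0≤a*b (<⇒≤ (0<inv k)) 0≤⟦ has u c ⟧
      eq : ∀ a b c x y z w → a * x * (b * y * (c * z)) * w ≡ a * (b * c) * (x * (y * z) * w)
      eq = solve-∀ ring
      module M = Mono (three u w t) (three-inj n₁ n₂ n₃) c
      na : ∀ i j → adj G (three u w t i) (three u w t j) ≡ false
      na fzero fzero = irrefl G u
      na fzero (fsuc fzero) = a₁
      na fzero (fsuc (fsuc fzero)) = a₂
      na (fsuc fzero) fzero = trans (Graph.sym G w u) a₁
      na (fsuc fzero) (fsuc fzero) = irrefl G w
      na (fsuc fzero) (fsuc (fsuc fzero)) = a₃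
      na (fsuc (fsuc fzero)) fzero = trans (Graph.sym G t u) a₂
      na (fsuc (fsuc fzero)) (fsuc fzero) = trans (Graph.sym G t w) a₃
      na (fsuc (fsuc fzero)) (fsuc (fsuc fzero)) = irrefl G t
      W : ℚ
      W = ∏ M.Wm
      W³ : W * W * W ≤ γ ^ mult u c * (γ ^ mult w c * γ ^ mult t c)
      W³ = ≤-reflexive (sym (trans (∏-* _ _) (cong (_* W) (∏-* _ _))))
         ⨾ ∏-mono (λ y → 0≤a*b (0≤a*b (M.0≤Wm y) (M.0≤Wm y)) (M.0≤Wm y)) (λ y → ≤-reflexive (cong (λ z →
             z * z * z) (cong (λ z → 1ℚ - inv k * ⟦ has y c ⟧ * (1ℚ - z)) (∏3 _)))
             ⨾ triple (has y c) (adj G u y) (adj G w y) (adj G t y))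
         ⨾ ≤-reflexive (trans (∏-* _ _) (cong₂ _*_ (∏-pow y₇ (λ y →
             adj G u y ∧ has y c)) (trans (∏-* _ _) (cong₂ _*_ (∏-pow y₇ (λ y →
             adj G w y ∧ has y c)) (∏-pow y₇ (λ y → adj G t y ∧ has y c))))))
      0≤g : ∀ u → 0ℚ ≤ g u
      0≤g u = ^-nonneg (D ℕ.∸ mult u c) 0≤1-q
      g³ : ∀ u → g u * g u * g u ≤ γ ^ (D ℕ.∸ mult u c)
      g³ u = ≤-reflexive (sym (trans (^-* (β * β) β m) (cong (_* g u) (^-* β β m))))
          ⨾ ^-mono m (0≤a*b (0≤a*b 0≤1-q 0≤1-q) 0≤1-q) v₁³≤v₃
        where
        m : ℕ
        m = D ℕ.∸ mult u c
      0≤γ^ : ∀ m → 0ℚ ≤ γ ^ m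
      0≤γ^ m = ^-nonneg m 0≤v₃
      bound : g u * (g w * g t) * W ≤ γ ^ D
      bound = cube-cancel (0≤γ^ D) (≤-reflexive (eq₁ (g u) (g w) (g t) W)
         ⨾ *-mono (0≤a*b (0≤a*b (0≤W) 0≤W) 0≤W) (0≤a*b (0≤γ^ (e u)) (0≤a*b (0≤γ^ (e w)) (0≤γ^ (e t))))
             (*-mono (0≤a*b (0≤c (g w) (0≤g w)) (0≤c (g t) (0≤g t))) (0≤γ^ (e u)) (g³ u) (*-mono (0≤c (g t) (0≤g t))
                 (0≤γ^ (e w)) (g³ w) (g³ t))) W³
         ⨾ ≤-reflexive (trans (eq₂ (γ ^ (D ℕ.∸ mult u c)) (γ ^ (D ℕ.∸ mult w c)) (γ ^ (D ℕ.∸ mult t c))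
             (γ ^ mult u c) (γ ^ mult w c) (γ ^ mult t c))
             (cong₂ _*_ (cong₂ _*_ (ghosts-complete γ u c) (ghosts-complete γ w c)) (ghosts-complete γ t c))))
        where
        e : Fin n → ℕ
        e u = D ℕ.∸ mult u c
        0≤W : 0ℚ ≤ W
        0≤W = ∏-nonneg M.0≤Wm
        0≤c : ∀ x → 0ℚ ≤ x → 0ℚ ≤ x * x * x
        0≤c x p = 0≤a*b (0≤a*b p p) p
        eq₁ : ∀ a b c W → let x = a * (b * c) * W in x * x * x ≡ a * a * a * (b * b * b * (c * c * c)) * (W * W * W)
        eq₁ = solve-∀ ring
        eq₂ : ∀ a b c x y z → a * (b * c) * (x * (y * z)) ≡ a * x * (b * y) * (c * z)
        eq₂ = solve-∀ ring

    -- Different colours are negatively correlated, since an outsider holds at most one of them. The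
    -- factor β² compensates for u and w, which the joint bound does not count as opponents of each
    -- other.
    adjacent-prob : ∀ u w a b → u ≢ w → a ≢ b → β * β * 𝔼 Y (λ ω → ⟦ keepc (st ω) u a ⟧ * ⟦ keepc (st ω) w b ⟧)
        ≤ (inv k * ⟦ has u a ⟧) * (inv k * ⟦ has w b ⟧) * (ρ * ρ)
    adjacent-prob u w a b ne a≢b = (0≤a*b 0≤1-q 0≤1-q ⊙ (≤-reflexive (𝔼-cong Y (λ ω → sym (∏2 _)))
        ⨾ J.joint-upper h h₁))
         ⨾ ≤-reflexive (trans (cong (λ z → β * β * (z * ∏ W)) (∏2 _)) (eq β h₁′ h₂′ g₁ g₂ (∏ W)))
             ⨾ (0≤a*b (0≤a*b 0≤h₁ (^-nonneg (D ℕ.∸ mult u a) 0≤1-q)) (0≤a*b 0≤h₂ (^-nonneg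
             (D ℕ.∸ mult w b) 0≤1-q)) ⊙ outs)
         ⨾ ≤-reflexive (trans (eq₂ h₁′ h₂′ g₁ g₂ (β ^ mult u a) (β ^ mult w b)) (cong (h₁′ * h₂′ *_) (cong₂ _*_
             (ghosts-complete β u a) (ghosts-complete β w b))))
      where
      h₁′ h₂′ g₁ g₂ : ℚ
      h₁′ = inv k * ⟦ has u a ⟧
      h₂′ = inv k * ⟦ has w b ⟧
      g₁ = β ^ (D ℕ.∸ mult u a)
      g₂ = β ^ (D ℕ.∸ mult w b)
      0≤h₁ : 0ℚ ≤ h₁′
      0≤h₁ = 0≤a*b (<⇒≤ (0<inv k)) 0≤⟦ has u a ⟧
      0≤h₂ : 0ℚ ≤ h₂′
      0≤h₂ = 0≤a*b (<⇒≤ (0<inv k)) 0≤⟦ has w b ⟧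
      α₁ α₂ : Fin n → Bool
      α₁ y = adj G u y ∧ has y a
      α₂ y = adj G w y ∧ has y b
      f : Bool → ℚ
      f b = 1ℚ - q * ⟦ b ⟧
      isZ : Fin n → Fin n → Bool
      isZ u y = does (u FinP.≟ y)
      W : Fin n → ℚ
      W y = if isZ u y ∨ isZ w y then 1ℚ else f (α₁ y) * f (α₂ y)
      module J = Joint (two u w) (two-inj ne) (two a b) W
      eq : ∀ β a b x y W → β * β * (a * x * (b * y) * W) ≡ a * x * (b * y) * (β * β * W)
      eq = solve-∀ ring
      eq₂ : ∀ h₁ h₂ g₁ g₂ m₁ m₂ → h₁ * g₁ * (h₂ * g₂) * (m₁ * m₂) ≡ h₁ * h₂ * ((g₁ * m₁) * (g₂ * m₂))
      eq₂ = solve-∀ ring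
      0≤f : ∀ b → 0ℚ ≤ f b
      0≤f b = 0≤b-a {q * ⟦ b ⟧} {1ℚ} (*-mono 0≤⟦ b ⟧ 0≤1 (q≤½ ⨾ dec≤) ⟦ b ⟧≤1)
      isZ-refl : ∀ u → isZ u u ≡ true
      isZ-refl u with u FinP.≟ u
      ... | yes _ = refl
      ... | no ¬p = ⊥-elim (¬p refl)
      h₁ : ∀ y → J.inZ y ≡ true → 1ℚ ≤ W y
      h₁ y e with J.isin y e
      ... | fzero , refl = ≤-reflexive (sym (cong (λ z → if z ∨ isZ w u then 1ℚ else f (α₁ u) * f (α₂ u))
          (isZ-refl u)))
      ... | fsuc fzero , refl = ≤-reflexive (sym (cong (λ z → if z then 1ℚ else f (α₁ w) * f (α₂ w)) (trans (cong
          (isZ u w ∨_) (isZ-refl w)) (BoolP.∨-zeroʳ (isZ u w)))))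
      notZ : ∀ y → J.inZ y ≡ false → isZ u y ∨ isZ w y ≡ false
      notZ y e = go (J.notin y e fzero) (J.notin y e (fsuc fzero))
        where
        go : u ≢ y → w ≢ y → isZ u y ∨ isZ w y ≡ false
        go p p′ with u FinP.≟ y | w FinP.≟ y
        ... | yes q | _ = ⊥-elim (p q)
        ... | no _ | yes q = ⊥-elim (p′ q)
        ... | no _ | no _ = refl
      module M₁ (u : Fin n) (a : ℕ) = Mono {1} (λ _ → u) single-inj a
      single : ∀ u a s y → 𝔼 X (λ x → ⟦ not (beaten a u y s (toSt y x)) ⟧) ≡ f (adj G u y ∧ has y a)
      single u a s y = trans (𝔼-cong X (λ x → sym (∏1 _))) (trans (M₁.𝔼-nb u a (λ _ → s) y) (trans (cong (λ w →
          1ℚ - inv k * ⟦ has y a ⟧ * (1ℚ - w)) (∏1 (λ j → 1ℚ - ½ * ⟦ adj G u y ⟧))) (lone (adj G u y) (has y a))))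
      h : ∀ s y → J.inZ y ≡ false → 𝔼 X (λ x → J.nb s y (toSt y x)) ≤ W y
      -- At most one of the two vertices is beaten by y, so the product of the indicators is their
      -- sum minus 1; then 1 - s - t ≤ (1 - s)(1 - t).
      h s y e = mono X pt ⨾ ≤-reflexive (trans (𝔼-sub X _ _) (cong₂ _-_ (trans (𝔼-+ X _ _) (cong₂ _+_ (single u a
          (s fzero) y) (single w b (s (fsuc fzero)) y))) (one X)))
          ⨾ ≤-by (0≤a*b (0≤a*b 0≤q 0≤⟦ α₁ y ⟧) (0≤a*b 0≤q 0≤⟦ α₂ y ⟧)) (e₁ (q * ⟦ α₁ y ⟧) (q * ⟦ α₂ y ⟧))
              ⨾ ≤-reflexive (sym (cong (λ z → if z then 1ℚ else f (α₁ y) * f (α₂ y)) (notZ y e)))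
        where
        e₁ : ∀ x y → 1ℚ - x + (1ℚ - y) - 1ℚ + x * y ≡ (1ℚ - x) * (1ℚ - y) + 0ℚ
        e₁ = solve-∀ ring
        excl : ∀ p r c → (c ℕ.≡ᵇ a) ≡ true → (c ℕ.≡ᵇ b) ≡ true → ⟦ p ⟧ * ⟦ r ⟧ ≤ ⟦ p ⟧ + ⟦ r ⟧ - 1ℚ
        excl p r c e₁ e₂ = ⊥-elim (a≢b (trans (sym (≡ᵇ-true {c} e₁)) (≡ᵇ-true {c} e₂)))
        le₁ : ∀ r → ⟦ true ⟧ * ⟦ r ⟧ ≤ ⟦ true ⟧ + ⟦ r ⟧ - 1ℚ
        le₁ true = dec≤
        le₁ false = dec≤
        le₂ : ∀ p → ⟦ p ⟧ * ⟦ true ⟧ ≤ ⟦ p ⟧ + ⟦ true ⟧ - 1ℚ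
        le₂ true = dec≤
        le₂ false = dec≤
        gen : ∀ c p r p′ r′ → ⟦ not (p ∧ ((c ℕ.≡ᵇ a) ∧ p′)) ⟧ * ⟦ not (r ∧ ((c ℕ.≡ᵇ b) ∧ r′)) ⟧
            ≤ ⟦ not (p ∧ ((c ℕ.≡ᵇ a) ∧ p′)) ⟧ + ⟦ not (r ∧ ((c ℕ.≡ᵇ b) ∧ r′)) ⟧ - 1ℚ
        gen c p r p′ r′ with c ℕ.≡ᵇ a in e₁ | c ℕ.≡ᵇ b in e₂
        ... | true | true = excl (not (p ∧ (true ∧ p′))) (not (r ∧ (true ∧ r′))) c e₁ e₂
        ... | false | s = subst (λ z → ⟦ not z ⟧ * ⟦ not (r ∧ (s ∧ r′)) ⟧
            ≤ ⟦ not z ⟧ + ⟦ not (r ∧ (s ∧ r′)) ⟧ - 1ℚ) (sym (BoolP.∧-zeroʳ p)) (le₁ (not (r ∧ (s ∧ r′))))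
        ... | true | false = subst (λ z → ⟦ not (p ∧ p′) ⟧ * ⟦ not z ⟧
            ≤ ⟦ not (p ∧ p′) ⟧ + ⟦ not z ⟧ - 1ℚ) (sym (BoolP.∧-zeroʳ r)) (le₂ (not (p ∧ p′)))
        pt : ∀ x → J.nb s y (toSt y x) ≤ ⟦ not (beaten a u y (s fzero) (toSt y x)) ⟧ + ⟦ not (beaten b w y (s
            (fsuc fzero)) (toSt y x)) ⟧ - 1ℚ
        pt x = ≤-reflexive (∏2 _) ⨾ gen (L y (proj₁ x)) (adj G u y) (adj G w y) (not (wins u y (s fzero)
            (toSt y x))) (not (wins w y (s (fsuc fzero)) (toSt y x)))
      card-isZ : ∀ u → ∏ (λ y → 1ℚ - q * ⟦ isZ u y ⟧) ≡ β
      card-isZ u = trans (∏-pow q (isZ u)) (trans (cong (β ^_) (card-single u)) (ℚP.*-identityʳ β))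
        where
        card-none : ∀ {m} (S : Fin m → Bool) → (∀ i → S i ≡ false) → card S ≡ 0
        card-none {zero} S h = refl
        card-none {suc m} S h = cong₂ (λ z w → (if z then 1 else 0) ℕ.+ w) (h fzero) (card-none (S ∘ fsuc) (h ∘ fsuc))
        card-single : ∀ {m} (u : Fin m) → card (λ y → does (u FinP.≟ y)) ≡ 1
        card-single {suc m} fzero = cong suc (card-none {m} _ (λ _ → refl))
        card-single {suc m} (fsuc u) = trans (card-cong (λ y → does-suc u y)) (card-single u)
          where
          does-suc : ∀ {m} (u y : Fin m) → does (fsuc u FinP.≟ fsuc y) ≡ does (u FinP.≟ y)
          does-suc u y = refl
      outs : β * β * ∏ W ≤ β ^ mult u a * β ^ mult w b
      outs = ≤-reflexive (sym (trans (∏-* _ _) (cong (_* ∏ W) (trans (∏-* _ _) (cong₂ _*_ (card-isZ u)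
          (card-isZ w))))))
           ⨾ ∏-mono (λ y → 0≤a*b (0≤a*b (0≤f (isZ u y)) (0≤f (isZ w y))) (0≤W y)) pt
               ⨾ ≤-reflexive (trans (∏-* _ _) (cong₂ _*_ (∏-pow q α₁) (∏-pow q α₂)))
        where
        0≤W : ∀ y → 0ℚ ≤ W y
        0≤W y with isZ u y ∨ isZ w y
        ... | true = 0≤1
        ... | false = 0≤a*b (0≤f (α₁ y)) (0≤f (α₂ y))
        f≥ : ∀ b → f true ≤ f b
        f≥ true = ≤-refl
        f≥ false = +-mono-≤ (≤-refl {1ℚ}) (neg-≤ (0≤q ⊙ 0≤1))
        self-no : ∀ (u : Fin n) (h : Bool) → adj G u u ∧ h ≡ false
        self-no u h = cong (_∧ h) (irrefl G u)
        pt : ∀ y → f (isZ u y) * f (isZ w y) * W y ≤ f (α₁ y) * f (α₂ y)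
        pt y with u FinP.≟ y | w FinP.≟ y
        ... | no _ | no _ = ≤-reflexive (e (q * 0ℚ) (f (α₁ y) * f (α₂ y)) (ℚP.*-zeroʳ q))
          where
          e : ∀ z x → z ≡ 0ℚ → (1ℚ - z) * (1ℚ - z) * x ≡ x
          e _ x refl = ℚP.*-identityˡ x
        ... | yes refl | yes refl = ⊥-elim (ne refl)
        ... | yes refl | no _ = ≤-reflexive (e₁ (f true) (q * 0ℚ) (ℚP.*-zeroʳ q)) ⨾ f≥ (α₂ y)
            ⨾ ≤-reflexive (sym (trans (cong (λ z → f z * f (α₂ y)) (self-no y (has y a))) (e₂ (q * 0ℚ) (f (α₂ y))
            (ℚP.*-zeroʳ q))))
          where
          e₁ : ∀ x z → z ≡ 0ℚ → x * (1ℚ - z) * 1ℚ ≡ x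
          e₁ x _ refl = trans (ℚP.*-identityʳ (x * 1ℚ)) (ℚP.*-identityʳ x)
          e₂ : ∀ z x → z ≡ 0ℚ → (1ℚ - z) * x ≡ x
          e₂ _ x refl = ℚP.*-identityˡ x
        ... | no _ | yes refl = ≤-reflexive (e₁ (f true) (q * 0ℚ) (ℚP.*-zeroʳ q)) ⨾ f≥ (α₁ y)
            ⨾ ≤-reflexive (sym (trans (cong (λ z → f (α₁ y) * f z) (self-no y (has y b))) (e₂ (q * 0ℚ) (f (α₁ y))
            (ℚP.*-zeroʳ q))))
          where
          e₁ : ∀ x z → z ≡ 0ℚ → (1ℚ - z) * x * 1ℚ ≡ x
          e₁ x _ refl = trans (ℚP.*-identityʳ (1ℚ * x)) (ℚP.*-identityˡ x)
          e₂ : ∀ z x → z ≡ 0ℚ → x * (1ℚ - z) ≡ x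
          e₂ _ x refl = ℚP.*-identityʳ x

    0≤i : 0ℚ ≤ inv k
    0≤i = <⇒≤ (0<inv k)

    0≤ρ : 0ℚ ≤ ρ
    0≤ρ = ^-nonneg D 0≤1-q
    ρ≤1 : ρ ≤ 1ℚ
    ρ≤1 = ^-≤1 D 0≤1-q 1-q≤1

    -- Both ends would have to win the edge between them.
    proper : ∀ σ u w c → adj G u w ≡ true → keepc σ u c ≡ true → keepc σ w c ≡ true → ⊥
    proper σ u w c a k₁ k₂ = go (bit (σ u) w) (bit (σ w) u) (toℕ u ℕ.<ᵇ toℕ w) (toℕ w ℕ.<ᵇ toℕ u) (<ᵇ-antisym (λ e →
        u≢w (FinP.toℕ-injective e))) (win u w a k₁ k₂) (win w u (trans (Graph.sym G w u) a) k₂ k₁)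
      where
      u≢w : u ≢ w
      u≢w refl = false≢true (irrefl G u) a
      win : ∀ u w → adj G u w ≡ true → keepc σ u c ≡ true → keepc σ w c ≡ true → wins u w (σ u) (σ w) ≡ true
      win u w a k₁ k₂ = un (adj G u w) (eqc (col σ w) c) (wins u w (σ u) (σ w)) a (∧-trueˡ {eqc (col σ w) c}
          (∧-trueˡ {self c w (σ w)} k₂)) (allB-elim {f = λ y → not (beaten c u y (σ u) (σ y))} (∧-trueʳ {self c u
          (σ u)} k₁) w)
        where
        un : ∀ a e w → a ≡ true → e ≡ true → not (a ∧ (e ∧ not w)) ≡ true → w ≡ true
        un true true true _ _ _ = refl
      go : ∀ p r l l′ → l ≡ not l′ → ((p xor r) xor l) ≡ true → ((r xor p) xor l′) ≡ true → ⊥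
      go true true true false _ _ ()
      go true true false true _ ()
      go true false true false _ ()
      go true false false true _ _ ()
      go false true true false _ ()
      go false true false true _ _ ()
      go false false true false _ _ ()
      go false false false true _ ()

    -- Expected residual degrees and neighbourhood edges

    κ : Vec Ω n → Fin n → Fin (suc k)
    κ ω u = proj₁ (lookup ω u)

    keepc-κ : ∀ ω u i → i ≢ κ ω u → keepc (st ω) u (L u i) ≡ false
    keepc-κ ω u i ne = cong (λ z → (z ∧ ghostOK (L u i) u (st ω u)) ∧ allB (λ y →
        not (beaten (L u i) u y (st ω u) (st ω y)))) (BoolP.¬-not (λ e → ne (sym (L-inj u _ _ (≡ᵇ-true e)))))

    keep-sum : ∀ ω u → ⟦ keep (st ω) u ⟧ ≡ ∑ (λ i → ⟦ keepc (st ω) u (L u i) ⟧)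
    keep-sum ω u = sym (∑-only _ (κ ω u) (λ j ne → cong ⟦_⟧ (keepc-κ ω u j ne)))

    has-own : ∀ u i → has u (L u i) ≡ true
    has-own u i = anyB-intro {f = λ j → L u j ℕ.≡ᵇ L u i} i (≡ᵇ-refl (L u i))

    keep-mean : ∀ u → 𝔼 Y (λ ω → ⟦ keep (st ω) u ⟧) ≡ ρ
    keep-mean u = trans (𝔼-cong Y (λ ω → keep-sum ω u)) (trans (𝔼-∑ Y _) (trans (∑-cong (λ i →
        trans (keep-prob u (L u i)) (cong (λ b → inv k * ⟦ b ⟧ * ρ) (has-own u i))))
       (trans (∑-const (suc k) (inv k * 1ℚ * ρ)) (trans (eq (ι (suc k)) (inv k) ρ) (trans (cong (_* ρ) (inv-eq k))
           (ℚP.*-identityˡ ρ))))))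
      where
      eq : ∀ s i r → s * (i * 1ℚ * r) ≡ i * s * r
      eq = solve-∀ ring

    big : Fin n → Vec Ω n → Fin n → Bool
    big v ω u = not (class v (st ω) (L u (κ ω u)) ℕ.≤ᵇ K)

    η₁ : ℚ
    η₁ = inv K * (1ℚ + ι D * inv k)

    0≤η₁ : 0ℚ ≤ η₁
    0≤η₁ = 0≤a*b (<⇒≤ (0<inv K)) (0≤a+b 0≤1 (0≤a*b (0≤ι D) 0≤i))

    big≤ : ∀ v ω u → ⟦ big v ω u ⟧ ≤ inv K * ι (class v (st ω) (L u (κ ω u)))
    big≤ v ω u = go (class v (st ω) (L u (κ ω u)))
      where
      go : ∀ m → ⟦ not (m ℕ.≤ᵇ K) ⟧ ≤ inv K * ι m
      go m with m ℕ.≤ᵇ K in e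
      ... | true = 0≤a*b (<⇒≤ (0<inv K)) (0≤ι m)
      ... | false = ≤-reflexive (sym (inv-eq K)) ⨾ (<⇒≤ (0<inv K) ⊙ ι-mono (ℕP.≰⇒> (λ p → subst T e (ℕP.≤⇒≤ᵇ p))))

    same-colour : ∀ u w → u ≢ w → 𝔼 Y (λ ω → ⟦ L w (κ ω w) ℕ.≡ᵇ L u (κ ω u) ⟧) ≤ inv k
    same-colour u w ne = ≤-reflexive (trans (resample X w _) (swap X (lin Y) _)) ⨾ mono Y pt
        ⨾ ≤-reflexive (𝔼-const Y (inv k))
      where
      pt : ∀ ω → 𝔼 X (λ a → ⟦ L w (κ (ω [ w ]≔ a) w) ℕ.≡ᵇ L u (κ (ω [ w ]≔ a) u) ⟧) ≤ inv k
      pt ω = ≤-reflexive (trans (𝔼-cong X (λ a → cong₂ (λ x y → ⟦ L w (proj₁ x) ℕ.≡ᵇ L u (proj₁ y) ⟧)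
          (VecP.lookup∘updateAt w ω) (VecP.lookup∘updateAt′ u w ne ω))) (𝔼-κ (λ j → ⟦ L w j ℕ.≡ᵇ L u (κ ω u) ⟧)))
         ⨾ (0≤i ⊙ ∑-single (λ j → L w j ℕ.≡ᵇ L u (κ ω u)) (λ a b p q →
             L-inj w a b (trans (≡ᵇ-true {L w a} p) (sym (≡ᵇ-true {L w b} q)))))
             ⨾ ≤-reflexive (ℚP.*-identityʳ (inv k))

    isEq : Fin n → Fin n → Bool
    isEq u w = does (u FinP.≟ w)

    isEq-true : ∀ {u w} → isEq u w ≡ true → u ≡ w
    isEq-true {u} {w} e with u FinP.≟ w
    ... | yes p = p

    ∑-isEq : ∀ u → ∑ (λ w → ⟦ isEq u w ⟧) ≤ 1ℚ
    ∑-isEq u = ∑-single (isEq u) (λ i j p q → trans (sym (isEq-true {u} {i} p)) (isEq-true {u} {j} q))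

    -- Markov's inequality: the expected class size is at most 1 + D/C, where the 1 is due to u
    -- itself, and a truncated class has at least K + 1 members.
    big-mean : ∀ v u → 𝔼 Y (λ ω → ⟦ big v ω u ⟧) ≤ η₁
    big-mean v u = mono Y (λ ω → big≤ v ω u) ⨾ ≤-reflexive (𝔼-*ˡ Y (inv K) _)
        ⨾ (<⇒≤ (0<inv K) ⊙ (≤-reflexive (trans (𝔼-cong Y (λ ω → sym (∑-card _))) (𝔼-∑ Y _)) ⨾ ∑-mono pt
        ⨾ ≤-reflexive (trans (∑-+ _ _) (cong (λ z → ∑ (λ w → ⟦ isEq u w ⟧) + z) (∑-*ʳ (inv k) _)))
            ⨾ (∑-isEq u ⊕ (deg≤ v ⊙ʳ 0≤i))))
      where
      pt : ∀ w → 𝔼 Y (λ ω → ⟦ adj G v w ∧ (L w (κ ω w) ℕ.≡ᵇ L u (κ ω u)) ⟧) ≤ ⟦ isEq u w ⟧ + ⟦ adj G v w ⟧ * inv k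
      pt w with u FinP.≟ w
      ... | yes _ = mono Y (λ ω → ⟦ adj G v w ∧ (L w (κ ω w) ℕ.≡ᵇ L u (κ ω u)) ⟧≤1) ⨾ ≤-reflexive (one Y)
          ⨾ ≤-by (0≤a*b 0≤⟦ adj G v w ⟧ 0≤i) (eq (⟦ adj G v w ⟧ * inv k))
        where
        eq : ∀ x → 1ℚ + x ≡ 1ℚ + x + 0ℚ
        eq = solve-∀ ring
      ... | no ne = ≤-reflexive (trans (𝔼-cong Y (λ ω → ⟦∧⟧ (adj G v w) _)) (𝔼-*ˡ Y ⟦ adj G v w ⟧ _))
          ⨾ (0≤⟦ adj G v w ⟧ ⊙ same-colour u w ne) ⨾ ≤-reflexive (sym (ℚP.+-identityˡ (⟦ adj G v w ⟧ * inv k)))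

    1-T≤ : ∀ v ω u → 1ℚ - ⟦ Tk v (st ω) u ⟧ ≤ 1ℚ - ⟦ keep (st ω) u ⟧ + ⟦ big v ω u ⟧
    1-T≤ v ω u = go (keep (st ω) u) (class v (st ω) (L u (κ ω u)) ℕ.≤ᵇ K)
      where
      go : ∀ a b → 1ℚ - ⟦ a ∧ b ⟧ ≤ 1ℚ - ⟦ a ⟧ + ⟦ not b ⟧
      go true true = dec≤
      go true false = dec≤
      go false true = dec≤
      go false false = dec≤

    degT-mean : ∀ v → 𝔼 Y (degT v ∘ st) ≤ ι D * (1ℚ - ρ + η₁)
    degT-mean v = ≤-reflexive (trans (𝔼-∑ Y _) (∑-cong (λ u → 𝔼-*ˡ Y ⟦ adj G v u ⟧ _)))
        ⨾ ∑-mono (λ u → 0≤⟦ adj G v u ⟧ ⊙ one-T u) ⨾ ≤-reflexive (∑-*ʳ (1ℚ - ρ + η₁) _)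
        ⨾ (deg≤ v ⊙ʳ 0≤a+b (0≤b-a ρ≤1) 0≤η₁)
      where
      one-T : ∀ u → 𝔼 Y (λ ω → 1ℚ - ⟦ Tk v (st ω) u ⟧) ≤ 1ℚ - ρ + η₁
      one-T u = mono Y (λ ω → 1-T≤ v ω u) ⨾ ≤-reflexive (trans (𝔼-+ Y _ _) (cong (λ z → z + 𝔼 Y (λ ω →
          ⟦ big v ω u ⟧)) (trans (𝔼-sub Y _ _) (cong₂ _-_ (one Y) (keep-mean u))))) ⨾ (≤-refl {1ℚ - ρ} ⊕ big-mean v u)

    -- Equal colours cannot both survive on an edge, and different ones are negatively correlated;
    -- this gives β² E ≤ ρ². Removing β² = (1 - q)² costs at most 2q = 1/C.
    both-keep : ∀ u w → adj G u w ≡ true → 𝔼 Y (λ ω → ⟦ keep (st ω) u ⟧ * ⟦ keep (st ω) w ⟧) ≤ ρ * ρ + inv k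
    both-keep u w a = ≤-by (small ⊕ (0≤2q ⊙ E≤1) ⊕ 0≤a*b (0≤a*b 0≤q 0≤q) 0≤E) (eq E ρ q)
        ⨾ ≤-reflexive (cong (λ z → ρ * ρ + z) (eq₂ (inv k)))
      where
      E : ℚ
      E = 𝔼 Y (λ ω → ⟦ keep (st ω) u ⟧ * ⟦ keep (st ω) w ⟧)
      eq₂ : ∀ x → 2ℚ * (½ * x) ≡ x
      eq₂ = solve-∀ ring
      eq : ∀ E r q → E + (r * r + 2ℚ * q * 1ℚ + q * q * E) ≡ r * r + 2ℚ * q + ((1ℚ - q) *
          (1ℚ - q) * E + 2ℚ * q * E + 0ℚ)
      eq = solve-∀ ring
      0≤2q : 0ℚ ≤ 2ℚ * q
      0≤2q = 0≤a*b {2ℚ} dec≤ 0≤q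
      0≤E : 0ℚ ≤ E
      0≤E = 𝔼-nonneg Y (λ ω → 0≤a*b 0≤⟦ keep (st ω) u ⟧ 0≤⟦ keep (st ω) w ⟧)
      E≤1 : E ≤ 1ℚ
      E≤1 = mono Y (λ ω → *-mono 0≤⟦ keep (st ω) w ⟧ 0≤1 ⟦ keep (st ω) u ⟧≤1 ⟦ keep (st ω) w ⟧≤1)
          ⨾ ≤-reflexive (one Y)
      u≢w : u ≢ w
      u≢w refl = false≢true (irrefl G u) a
      pt : ∀ ω → ⟦ keep (st ω) u ⟧ * ⟦ keep (st ω) w ⟧ ≡ ∑ (λ i → ∑ (λ j →
          ⟦ keepc (st ω) u (L u i) ⟧ * ⟦ keepc (st ω) w (L w j) ⟧))
      pt ω = trans (cong₂ _*_ (keep-sum ω u) (keep-sum ω w)) (trans (sym (∑-*ʳ _ _)) (∑-cong (λ i →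
          sym (∑-*ˡ ⟦ keepc (st ω) u (L u i) ⟧ _))))
      cell : ∀ i j → β * β * 𝔼 Y (λ ω → ⟦ keepc (st ω) u (L u i) ⟧ * ⟦ keepc (st ω) w (L w j) ⟧)
          ≤ inv k * inv k * (ρ * ρ)
      cell i j with L u i ℕP.≟ L w j
      ... | no ne = adjacent-prob u w (L u i) (L w j) u≢w ne ⨾ ≤-reflexive (cong₂ (λ x y →
          inv k * ⟦ x ⟧ * (inv k * ⟦ y ⟧) * (ρ * ρ)) (has-own u i) (has-own w j) ) ⨾ ≤-reflexive (e (inv k) (ρ * ρ))
        where
        e : ∀ i r → i * 1ℚ * (i * 1ℚ) * r ≡ i * i * r
        e = solve-∀ ring
      ... | yes p = ≤-reflexive (trans (cong (β * β *_) (trans (𝔼-cong Y (λ ω → trans (cong (λ c →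
          ⟦ keepc (st ω) u c ⟧ * ⟦ keepc (st ω) w (L w j) ⟧) p) (zero-prod (keepc (st ω) u (L w j)) (keepc (st ω) w
          (L w j)) (proper (st ω) u w (L w j) a)))) (𝔼-const Y 0ℚ))) (ℚP.*-zeroʳ (β * β)))
          ⨾ 0≤a*b (0≤a*b 0≤i 0≤i) (0≤sq ρ)
        where
        zero-prod : ∀ x y → (x ≡ true → y ≡ true → ⊥) → ⟦ x ⟧ * ⟦ y ⟧ ≡ 0ℚ
        zero-prod true true h = ⊥-elim (h refl refl)
        zero-prod true false h = refl
        zero-prod false y h = ℚP.*-zeroˡ ⟦ y ⟧
      small : β * β * E ≤ ρ * ρ
      small = ≤-reflexive (trans (cong (β * β *_) (trans (𝔼-cong Y pt) (trans (𝔼-∑ Y _) (∑-cong (λ i →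
          𝔼-∑ Y _))))) (trans (sym (∑-*ˡ (β * β) _)) (∑-cong (λ i → sym (∑-*ˡ (β * β) _)))))
        ⨾ ∑-mono (λ i → ∑-mono (λ j → cell i j)) ⨾ ≤-reflexive (trans (∑-cong (λ i →
            ∑-const (suc k) (inv k * inv k * (ρ * ρ)))) (trans (∑-const (suc k) (ι (suc k) * (inv k * inv k *
            (ρ * ρ)))) (trans (e (ι (suc k)) (inv k) (ρ * ρ)) (trans (cong (λ z →
            z * z * (ρ * ρ)) (inv-eq k)) (ℚP.*-identityˡ (ρ * ρ))))))
        where
        e : ∀ s i r → s * (s * (i * i * r)) ≡ i * s * (i * s) * r
        e = solve-∀ ring

    edges : Fin n → ℚ
    edges v = ∑ (λ u → ∑ (λ w → ⟦ adj G v u ⟧ * ⟦ adj G v w ⟧ * ⟦ adj G u w ⟧))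

    edgT-mean : ∀ v → 𝔼 Y (edgT v ∘ st) ≤ edges v * ((1ℚ - ρ) * (1ℚ - ρ) + inv k + (η₁ + η₁))
    edgT-mean v = ≤-reflexive (trans (𝔼-∑ Y _) (∑-cong (λ u → trans (𝔼-∑ Y _) (∑-cong (λ w →
        𝔼-*ˡ Y (⟦ adj G v u ⟧ * ⟦ adj G v w ⟧ * ⟦ adj G u w ⟧) _)))))
        ⨾ ∑-mono (λ u → ∑-mono (cell u)) ⨾ ≤-reflexive (trans (∑-cong (λ u → ∑-*ʳ B _)) (∑-*ʳ B _))
      where
      B : ℚ
      B = (1ℚ - ρ) * (1ℚ - ρ) + inv k + (η₁ + η₁)
      pt : ∀ u w ω → (1ℚ - ⟦ Tk v (st ω) u ⟧) * (1ℚ - ⟦ Tk v (st ω) w ⟧)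
          ≤ (1ℚ - ⟦ keep (st ω) u ⟧ - ⟦ keep (st ω) w ⟧ + ⟦ keep (st ω) u ⟧ * ⟦ keep (st ω) w ⟧) +
          (⟦ big v ω u ⟧ + ⟦ big v ω w ⟧)
      pt u w ω = go (keep (st ω) u) (class v (st ω) (L u (κ ω u)) ℕ.≤ᵇ K) (keep (st ω) w) (class v (st ω) (L w
          (κ ω w)) ℕ.≤ᵇ K)
        where
        go : ∀ a b c d → (1ℚ - ⟦ a ∧ b ⟧) * (1ℚ - ⟦ c ∧ d ⟧) ≤ (1ℚ - ⟦ a ⟧ - ⟦ c ⟧ + ⟦ a ⟧ * ⟦ c ⟧) +
            (⟦ not b ⟧ + ⟦ not d ⟧)
        go true true true true = dec≤
        go true true true false = dec≤
        go true true false true = dec≤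
        go true true false false = dec≤
        go true false true true = dec≤
        go true false true false = dec≤
        go true false false true = dec≤
        go true false false false = dec≤
        go false true true true = dec≤
        go false true true false = dec≤
        go false true false true = dec≤
        go false true false false = dec≤
        go false false true true = dec≤
        go false false true false = dec≤
        go false false false true = dec≤
        go false false false false = dec≤
      cell : ∀ u w → ⟦ adj G v u ⟧ * ⟦ adj G v w ⟧ * ⟦ adj G u w ⟧ * 𝔼 Y (λ ω →
          (1ℚ - ⟦ Tk v (st ω) u ⟧) * (1ℚ - ⟦ Tk v (st ω) w ⟧)) ≤ ⟦ adj G v u ⟧ * ⟦ adj G v w ⟧ * ⟦ adj G u w ⟧ * B
      cell u w with adj G u w in e
      ... | false = ≤-reflexive (trans (z ⟦ adj G v u ⟧ ⟦ adj G v w ⟧ (𝔼 Y (λ ω →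
          (1ℚ - ⟦ Tk v (st ω) u ⟧) * (1ℚ - ⟦ Tk v (st ω) w ⟧)))) (sym (z ⟦ adj G v u ⟧ ⟦ adj G v w ⟧ B)))
        where
        z : ∀ a b x → a * b * 0ℚ * x ≡ 0ℚ
        z = solve-∀ ring
      ... | true = 0≤a*b (0≤a*b 0≤⟦ adj G v u ⟧ 0≤⟦ adj G v w ⟧) 0≤1 ⊙ (mono Y (pt u w)
          ⨾ ≤-reflexive (trans (𝔼-+ Y _ _) (cong₂ _+_ (trans (𝔼-+ Y _ _) (cong (λ z →
          z + E) (trans (𝔼-sub Y _ _) (cong₂ _-_ (trans (𝔼-sub Y _ _) (cong₂ _-_ (one Y) (keep-mean u)))
          (keep-mean w))))) (𝔼-+ Y _ _)))
            ⨾ ((≤-refl {1ℚ - ρ - ρ} ⊕ both-keep u w e) ⊕ (big-mean v u ⊕ big-mean v w))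
                ⨾ ≤-reflexive (eq ρ (inv k) (η₁ + η₁)))
        where
        E : ℚ
        E = 𝔼 Y (λ ω → ⟦ keep (st ω) u ⟧ * ⟦ keep (st ω) w ⟧)
        eq : ∀ r i h → 1ℚ - r - r + (r * r + i) + h ≡ (1ℚ - r) * (1ℚ - r) + i + h
        eq = solve-∀ ring

    -- Expected number of colours lost from a list

    nf : Fin n → Fin n → Bool
    nf u w = not (adj G u w) ∧ not (isEq u w)

    isEq-refl : ∀ u → isEq u u ≡ true
    isEq-refl u with u FinP.≟ u
    ... | yes _ = refl
    ... | no ¬p = ⊥-elim (¬p refl)

    diag : ∀ u (f : Fin n → ℚ) → ∑ (λ w → ⟦ isEq u w ⟧ * f w) ≡ f u
    diag u f = trans (∑-only _ u (λ j ne → off j ne)) (trans (cong (λ b →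
        ⟦ b ⟧ * f u) (isEq-refl u)) (ℚP.*-identityˡ (f u)))
      where
      off : ∀ j → j ≢ u → ⟦ isEq u j ⟧ * f j ≡ 0ℚ
      off j ne with u FinP.≟ j
      ... | yes p = ⊥-elim (ne (sym p))
      ... | no _ = ℚP.*-zeroˡ (f j)

    keepc-has : ∀ ω u c → keepc (st ω) u c ≡ true → has u c ≡ true
    keepc-has ω u c h = anyB-intro {f = λ i → L u i ℕ.≡ᵇ c} (κ ω u) (∧-trueˡ {L u (κ ω u) ℕ.≡ᵇ c} (∧-trueˡ {self c u
        (st ω u)} h))

    module Colour (v : Fin n) (c : ℕ) (δ σ : ℚ) (0≤δ : 0ℚ ≤ δ) (0≤σ : 0ℚ ≤ σ) (δ≤σ² : δ ≤ σ * σ) (edges≤ : edges v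
        ≤ (1ℚ - δ) * (ι D * ι D)) (small : inv k * ρ * ι D ≤ 1ℚ) where
      -- Here `z` bounds the chance that a neighbour keeps c, `a*` is the number of ordered
      -- non-adjacent pairs that sparsity promises, up to the diagonal, if all D neighbours had c,
      -- and `τ` is the expected number of triples charged to each pair.
      x z Γ τ a* : ℚ
      x = ι D
      z = inv k * ρ
      Γ = γ ^ D
      τ = σ * x * (inv k * inv k * inv k * Γ)
      a* = δ * (x * x)

      N : Fin n → Bool
      N u = adj G v u ∧ has u c

      m : ℚ
      m = ∑ (λ u → ⟦ N u ⟧)

      m≤x : m ≤ x
      m≤x = ∑-≤-card (adj G v) (λ u → has u c) ⨾ deg≤ v

      open Prefix N nf x m≤x

      0≤Γ : 0ℚ ≤ Γ
      0≤Γ = ^-nonneg D 0≤v₃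

      -- Each of the m² ordered pairs of `N` is non-adjacent, an edge of the neighbourhood of v, or
      -- diagonal.
      pairs-full : a* - pairs N ≤ x * x - m * m + m
      pairs-full = ≤-by (edges≤ ⊕ mm) (eq δ x (pairs N) (edges v) m)
        where
        eq : ∀ δ x p e m → δ * (x * x) - p + ((1ℚ - δ) * (x * x) + (p + e + m)) ≡ x * x - m * m + m + (e + m * m)
        eq = solve-∀ ring
        cell : ∀ u w → ⟦ N u ⟧ * ⟦ N w ⟧ ≤ ⟦ N u ⟧ * ⟦ N w ⟧ * ⟦ nf u w ⟧ + ⟦ adj G v u ⟧ * ⟦ adj G v w ⟧ * ⟦ adj G u
            w ⟧ + ⟦ isEq u w ⟧ * ⟦ N u ⟧
        cell u w = go (adj G v u) (has u c) (adj G v w) (has w c) (adj G u w) (isEq u w)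
          where
          pos : ∀ p r s t → 0ℚ ≤ p → 0ℚ ≤ r → 0ℚ ≤ s → 0ℚ ≤ t → 0ℚ ≤ p + r + s * t
          pos p r s t h₁ h₂ h₃ h₄ = 0≤a+b (0≤a+b h₁ h₂) (0≤a*b h₃ h₄)
          go : ∀ a h a′ h′ e i → ⟦ a ∧ h ⟧ * ⟦ a′ ∧ h′ ⟧ ≤ ⟦ a ∧ h ⟧ * ⟦ a′ ∧ h′ ⟧ * ⟦ not e ∧ not i ⟧ + ⟦ a ⟧ * ⟦ a′
              ⟧ * ⟦ e ⟧ + ⟦ i ⟧ * ⟦ a ∧ h ⟧
          go false h a′ h′ e i = ≤-reflexive (ℚP.*-zeroˡ ⟦ a′ ∧ h′ ⟧)
              ⨾ pos (⟦ false ⟧ * ⟦ a′ ∧ h′ ⟧ * ⟦ not e ∧ not i ⟧) (⟦ false ⟧ * ⟦ a′ ⟧ * ⟦ e ⟧) ⟦ i ⟧ 0ℚ (0≤a*b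
              (0≤a*b ≤-refl 0≤⟦ a′ ∧ h′ ⟧) 0≤⟦ not e ∧ not i ⟧) (0≤a*b (0≤a*b ≤-refl 0≤⟦ a′ ⟧) 0≤⟦ e ⟧) 0≤⟦ i ⟧ ≤-refl
          go true false a′ h′ e i = ≤-reflexive (ℚP.*-zeroˡ ⟦ a′ ∧ h′ ⟧)
              ⨾ pos (⟦ false ⟧ * ⟦ a′ ∧ h′ ⟧ * ⟦ not e ∧ not i ⟧) (⟦ true ⟧ * ⟦ a′ ⟧ * ⟦ e ⟧) ⟦ i ⟧ 0ℚ (0≤a*b
              (0≤a*b ≤-refl 0≤⟦ a′ ∧ h′ ⟧) 0≤⟦ not e ∧ not i ⟧) (0≤a*b (0≤a*b 0≤1 0≤⟦ a′ ⟧) 0≤⟦ e ⟧) 0≤⟦ i ⟧ ≤-refl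
          go true true false h′ e i = pos (⟦ true ⟧ * 0ℚ * ⟦ not e ∧ not i ⟧) (⟦ true ⟧ * 0ℚ * ⟦ e ⟧) ⟦ i ⟧ 1ℚ
              (0≤a*b {1ℚ * 0ℚ} dec≤ 0≤⟦ not e ∧ not i ⟧) (0≤a*b {1ℚ * 0ℚ} dec≤ 0≤⟦ e ⟧) 0≤⟦ i ⟧ 0≤1
          go true true true false e i = pos (⟦ true ⟧ * 0ℚ * ⟦ not e ∧ not i ⟧) (⟦ true ⟧ * 1ℚ * ⟦ e ⟧) ⟦ i ⟧ 1ℚ
              (0≤a*b {1ℚ * 0ℚ} dec≤ 0≤⟦ not e ∧ not i ⟧) (0≤a*b {1ℚ * 1ℚ} dec≤ 0≤⟦ e ⟧) 0≤⟦ i ⟧ 0≤1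
          go true true true true true true = dec≤
          go true true true true true false = dec≤
          go true true true true false true = dec≤
          go true true true true false false = dec≤
        mm : m * m ≤ pairs N + edges v + m
        mm = ≤-reflexive (sym (trans (∑-cong (λ u → ∑-*ˡ ⟦ N u ⟧ _)) (∑-*ʳ m _))) ⨾ ∑-mono (λ u → ∑-mono (cell u))
           ⨾ ≤-reflexive (trans (∑-cong (λ u → trans (∑-+ _ _) (cong₂ _+_ (∑-+ _ _) (diag u (λ _ →
               ⟦ N u ⟧))))) (trans (∑-+ _ _) (cong (_+ m) (∑-+ _ _))))

      module WithS (S : Fin n → Bool) (S⊆N : S ⊆ N) (pairs≤ : pairs S ≤ a*) where
        X′ : Vec Ω n → Fin n → Bool
        X′ ω u = keepc (st ω) u c

        split : ∀ ω u w → X′ ω u ≡ true → X′ ω w ≡ true → ⟦ nf u w ⟧ + ⟦ isEq u w ⟧ ≡ 1ℚ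
        split ω u w p r with adj G u w in e | u FinP.≟ w
        ... | true | _ = ⊥-elim (proper (st ω) u w c e p r)
        ... | false | yes _ = refl
        ... | false | no _ = refl

        module Bf (ω : Vec Ω n) = Bonferroni S N (X′ ω) isEq nf S⊆N ∑-isEq diag (split ω)

        has-S : ∀ u → S u ≡ true → has u c ≡ true
        has-S u h = ∧-trueʳ {adj G v u} (S⊆N u h)

        lost-N : ∀ ω → lost v (st ω) c ≡ anyB (λ u → N u ∧ X′ ω u)
        lost-N ω = anyB-cong (λ u → go (adj G v u) (has u c) (X′ ω u) (keepc-has ω u c))
          where
          go : ∀ a h x → (x ≡ true → h ≡ true) → a ∧ x ≡ (a ∧ h) ∧ x
          go false h x _ = refl
          go true true x _ = refl
          go true false false _ = refl
          go true false true q with q refl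
          ... | ()

        meanN : 𝔼 Y (λ ω → ∑ (λ u → ⟦ N u ⟧ * ⟦ X′ ω u ⟧)) ≤ m * z
        meanN = ≤-reflexive (trans (𝔼-∑ Y _) (∑-cong (λ u → trans (𝔼-*ˡ Y ⟦ N u ⟧ _) (cong (⟦ N u ⟧ *_)
            (keep-prob u c))))) ⨾ ∑-mono (λ u → 0≤⟦ N u ⟧ ⊙ (((0≤i ⊙ ⟦ has u c ⟧≤1)
            ⨾ ≤-reflexive (ℚP.*-identityʳ (inv k))) ⊙ʳ 0≤ρ)) ⨾ ≤-reflexive (∑-*ʳ z _)

        meanP : pairs S * (z * z) ≤ 𝔼 Y Bf.P
        meanP = ≤-reflexive (trans (sym (∑-*ʳ (z * z) _)) (∑-cong (λ u → sym (∑-*ʳ (z * z) _))))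
            ⨾ ∑-mono (λ u → ∑-mono (cell u)) ⨾ ≤-reflexive (sym (trans (𝔼-∑ Y _) (∑-cong (λ u → 𝔼-∑ Y _))))
          where
          cell : ∀ u w → ⟦ S u ⟧ * ⟦ S w ⟧ * ⟦ nf u w ⟧ * (z * z) ≤ 𝔼 Y (λ ω →
              ⟦ nf u w ⟧ * (⟦ S u ∧ X′ ω u ⟧ * ⟦ S w ∧ X′ ω w ⟧))
          cell u w with S u in su | S w in sw | nf u w in e
          ... | false | b | f = ≤-reflexive (z₀ ⟦ b ⟧ ⟦ f ⟧ (z * z))
              ⨾ 𝔼-nonneg Y (λ ω → 0≤a*b 0≤⟦ f ⟧ (0≤a*b ≤-refl 0≤⟦ b ∧ X′ ω w ⟧))
            where
            z₀ : ∀ a b c → 0ℚ * a * b * c ≡ 0ℚ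
            z₀ = solve-∀ ring
          ... | true | false | f = ≤-reflexive (z₀ ⟦ f ⟧ (z * z))
              ⨾ 𝔼-nonneg Y (λ ω → 0≤a*b 0≤⟦ f ⟧ (0≤a*b 0≤⟦ X′ ω u ⟧ ≤-refl))
            where
            z₀ : ∀ b c → 1ℚ * 0ℚ * b * c ≡ 0ℚ
            z₀ = solve-∀ ring
          ... | true | true | false = ≤-reflexive (z₀ (z * z)) ⨾ 𝔼-nonneg Y (λ ω →
              0≤a*b {0ℚ} ≤-refl (0≤a*b 0≤⟦ X′ ω u ⟧ 0≤⟦ X′ ω w ⟧))
            where
            z₀ : ∀ c → 1ℚ * 1ℚ * 0ℚ * c ≡ 0ℚ
            z₀ = solve-∀ ring
          ... | true | true | true = ≤-reflexive (trans (e₁ (inv k) ρ) (cong₂ (λ a b →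
              inv k * ⟦ a ⟧ * (inv k * ⟦ b ⟧) * (ρ * ρ)) (sym (has-S u su)) (sym (has-S w sw))))
              ⨾ pair-prob u w c (λ { refl → false≢true (cong not (isEq-refl u)) (∧-trueʳ {not (adj G u u)} e) })
              (not-true (∧-trueˡ e)) ⨾ ≤-reflexive (𝔼-cong Y (λ ω → sym (ℚP.*-identityˡ (⟦ X′ ω u ⟧ * ⟦ X′ ω w ⟧))))
            where
            e₁ : ∀ i r → 1ℚ * 1ℚ * 1ℚ * (i * r * (i * r)) ≡ i * 1ℚ * (i * 1ℚ) * (r * r)
            e₁ = solve-∀ ring

        F : Fin n → Fin n → ℚ
        F u w = ⟦ S u ⟧ * ⟦ S w ⟧ * ⟦ nf u w ⟧
        0≤F : ∀ u w → 0ℚ ≤ F u w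
        0≤F u w = 0≤a*b (0≤a*b 0≤⟦ S u ⟧ 0≤⟦ S w ⟧) 0≤⟦ nf u w ⟧
        F≤1 : ∀ u w → F u w ≤ 1ℚ
        F≤1 u w = *-mono 0≤⟦ nf u w ⟧ 0≤1 (*-mono 0≤⟦ S w ⟧ 0≤1 ⟦ S u ⟧≤1 ⟦ S w ⟧≤1) ⟦ nf u w ⟧≤1

        J₃ : ℚ
        J₃ = inv k * inv k * inv k * Γ

        0≤J₃ : 0ℚ ≤ J₃
        0≤J₃ = 0≤a*b (0≤a*b (0≤a*b 0≤i 0≤i) 0≤i) 0≤Γ

        -- Trimming to `S` pays off here: at most a* ≤ (σ x)² pairs remain, so `triangle-bound`
        -- applies with r = σ x. This produces the factor σ δ, that is δ^(3/2), in front of the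
        -- triple term.
        meanT : 𝔼 Y Bf.T₃ ≤ τ * pairs S
        meanT = ≤-reflexive (trans (𝔼-∑ Y _) (∑-cong (λ u → trans (𝔼-∑ Y _) (∑-cong (λ w → 𝔼-∑ Y _)))))
            ⨾ ∑-mono (λ u → ∑-mono (λ w → ∑-mono (cell u w)))
            ⨾ ≤-reflexive (trans (∑-cong (λ u → trans (∑-cong (λ w → ∑-*ʳ J₃ _)) (∑-*ʳ J₃ _))) (∑-*ʳ J₃ _))
            ⨾ (triangle-bound F (σ * x) 0≤F F≤1 (0≤a*b 0≤σ (0≤ι D)) (pairs≤ ⨾ (δ≤σ² ⊙ʳ 0≤sq x)
                ⨾ ≤-reflexive (e₂ σ x)) ⊙ʳ 0≤J₃) ⨾ ≤-reflexive (e₃ (σ * x) (pairs S) J₃)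
          where
          e₂ : ∀ s x → s * s * (x * x) ≡ s * x * (s * x)
          e₂ = solve-∀ ring
          e₃ : ∀ s p j → s * p * j ≡ s * j * p
          e₃ = solve-∀ ring
          zero-left : ∀ {f : Vec Ω n → ℚ} {b} → (∀ ω → f ω ≡ 0ℚ) → 0ℚ ≤ b → 𝔼 Y f ≤ b
          zero-left h p = ≤-reflexive (trans (𝔼-cong Y h) (𝔼-const Y 0ℚ)) ⨾ p
          cell : ∀ u w t → 𝔼 Y (λ ω → ⟦ nf u w ⟧ * (⟦ nf u t ⟧ * ⟦ nf w t ⟧) * (⟦ S u ∧ X′ ω u ⟧ *
              (⟦ S w ∧ X′ ω w ⟧ * ⟦ S t ∧ X′ ω t ⟧))) ≤ F u w * (F u t * F w t) * J₃
          cell u w t = go (S u) (S w) (S t) (nf u w) (nf u t) (nf w t) refl refl refl refl refl refl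
            where
            rhs : Bool → Bool → Bool → Bool → Bool → Bool → ℚ
            rhs a b c p q r = ⟦ a ⟧ * ⟦ b ⟧ * ⟦ p ⟧ * (⟦ a ⟧ * ⟦ c ⟧ * ⟦ q ⟧ * (⟦ b ⟧ * ⟦ c ⟧ * ⟦ r ⟧)) * J₃
            0≤rhs : ∀ a b c p q r → 0ℚ ≤ rhs a b c p q r
            0≤rhs a b c p q r = 0≤a*b (0≤a*b (0≤a*b (0≤a*b 0≤⟦ a ⟧ 0≤⟦ b ⟧) 0≤⟦ p ⟧) (0≤a*b (0≤a*b
                (0≤a*b 0≤⟦ a ⟧ 0≤⟦ c ⟧) 0≤⟦ q ⟧) (0≤a*b (0≤a*b 0≤⟦ b ⟧ 0≤⟦ c ⟧) 0≤⟦ r ⟧))) 0≤J₃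
            ne : ∀ {u w} → nf u w ≡ true → u ≢ w
            ne {u} e refl = false≢true (cong not (isEq-refl u)) (∧-trueʳ {not (adj G u u)} e)
            go : ∀ a b d p q r → S u ≡ a → S w ≡ b → S t ≡ d → nf u w ≡ p → nf u t ≡ q → nf w t ≡ r →
              𝔼 Y (λ ω → ⟦ p ⟧ * (⟦ q ⟧ * ⟦ r ⟧) * (⟦ a ∧ X′ ω u ⟧ * (⟦ b ∧ X′ ω w ⟧ * ⟦ d ∧ X′ ω t ⟧)))
                  ≤ rhs a b d p q r
            go a b d false q r _ _ _ _ _ _ = zero-left (λ ω → z₀ (⟦ q ⟧ * ⟦ r ⟧) (⟦ a ∧ X′ ω u ⟧ *
                (⟦ b ∧ X′ ω w ⟧ * ⟦ d ∧ X′ ω t ⟧))) (0≤rhs a b d false q r)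
              where
              z₀ : ∀ a b → 0ℚ * a * b ≡ 0ℚ
              z₀ = solve-∀ ring
            go a b d true false r _ _ _ _ _ _ = zero-left (λ ω → z₀ ⟦ r ⟧ (⟦ a ∧ X′ ω u ⟧ *
                (⟦ b ∧ X′ ω w ⟧ * ⟦ d ∧ X′ ω t ⟧))) (0≤rhs a b d true false r)
              where
              z₀ : ∀ a b → 1ℚ * (0ℚ * a) * b ≡ 0ℚ
              z₀ = solve-∀ ring
            go a b d true true false _ _ _ _ _ _ = zero-left (λ ω →
                z₀ (⟦ a ∧ X′ ω u ⟧ * (⟦ b ∧ X′ ω w ⟧ * ⟦ d ∧ X′ ω t ⟧))) (0≤rhs a b d true true false)
              where
              z₀ : ∀ b → 1ℚ * (1ℚ * 0ℚ) * b ≡ 0ℚ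
              z₀ = solve-∀ ring
            go false b d true true true _ _ _ _ _ _ = zero-left (λ ω →
                z₀ (⟦ b ∧ X′ ω w ⟧ * ⟦ d ∧ X′ ω t ⟧)) (0≤rhs false b d true true true)
              where
              z₀ : ∀ b → 1ℚ * (1ℚ * 1ℚ) * (0ℚ * b) ≡ 0ℚ
              z₀ = solve-∀ ring
            go true false d true true true _ _ _ _ _ _ = zero-left (λ ω →
                z₀ ⟦ X′ ω u ⟧ ⟦ d ∧ X′ ω t ⟧) (0≤rhs true false d true true true)
              where
              z₀ : ∀ a b → 1ℚ * (1ℚ * 1ℚ) * (a * (0ℚ * b)) ≡ 0ℚ
              z₀ = solve-∀ ring
            go true true false true true true _ _ _ _ _ _ = zero-left (λ ω →
                z₀ ⟦ X′ ω u ⟧ ⟦ X′ ω w ⟧) (0≤rhs true true false true true true)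
              where
              z₀ : ∀ a b → 1ℚ * (1ℚ * 1ℚ) * (a * (b * 0ℚ)) ≡ 0ℚ
              z₀ = solve-∀ ring
            go true true true true true true su sw st′ p q r = ≤-reflexive (𝔼-cong Y (λ ω →
                ℚP.*-identityˡ (⟦ X′ ω u ⟧ * (⟦ X′ ω w ⟧ * ⟦ X′ ω t ⟧))))
                ⨾ triple-prob u w t c (ne p) (ne q) (ne r) (not-true (∧-trueˡ p)) (not-true (∧-trueˡ q)) (not-true
                    (∧-trueˡ r))
                ⨾ *-mono 0≤Γ (0≤a*b (0≤a*b 0≤i 0≤1) (0≤a*b (0≤a*b 0≤i 0≤1) (0≤a*b 0≤i 0≤1))) (*-mono (0≤a*b (0≤h w)
                    (0≤h t)) (0≤a*b 0≤i 0≤1) (0≤i ⊙ ⟦ has u c ⟧≤1) (*-mono (0≤h t) (0≤a*b 0≤i 0≤1)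
                    (0≤i ⊙ ⟦ has w c ⟧≤1) (0≤i ⊙ ⟦ has t c ⟧≤1))) (≤-refl {Γ}) ⨾ ≤-reflexive (e₄ (inv k) Γ)
              where
              0≤h : ∀ u → 0ℚ ≤ inv k * ⟦ has u c ⟧
              0≤h u = 0≤a*b 0≤i 0≤⟦ has u c ⟧
              e₄ : ∀ i g → i * 1ℚ * (i * 1ℚ * (i * 1ℚ)) * g ≡ 1ℚ * 1ℚ * 1ℚ * (1ℚ * 1ℚ * 1ℚ * (1ℚ * 1ℚ * 1ℚ)) *
                  (i * i * i * g)
              e₄ = solve-∀ ring

        mean : 𝔼 Y (λ ω → ⟦ lost v (st ω) c ⟧) ≤ m * z - ½ * (pairs S * (z * z)) + 1/6 * (τ * pairs S)
        mean = mono Y (λ ω → ≤-reflexive (cong ⟦_⟧ (lost-N ω)) ⨾ Bf.bonferroni ω)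
            ⨾ ≤-reflexive (trans (𝔼-+ Y _ _) (cong₂ _+_ (trans (𝔼-sub Y _ _) (cong (λ w →
            A - w) (𝔼-*ˡ Y ½ _))) (𝔼-*ˡ Y 1/6 _)))
            ⨾ ((meanN ⊕ neg-≤ ((0ℚ ≤ ½ ∋ dec≤) ⊙ meanP)) ⊕ ((0ℚ ≤ 1/6 ∋ dec≤) ⊙ meanT))
          where
          A : ℚ
          A = 𝔼 Y (λ ω → ∑ (λ u → ⟦ N u ⟧ * ⟦ X′ ω u ⟧))

      lost-mean : 𝔼 Y (λ ω → ⟦ lost v (st ω) c ⟧) ≤ x * z - ½ * (a* * (z * z)) + 1/6 * (τ * a*) + z
      lost-mean with choose a* (0≤a*b 0≤δ (0≤sq x))
      ... | S , S⊆N , ≤a* , inj₁ e = WithS.mean S S⊆N ≤a* ⨾ Saving.few x z τ (pairs S) a* m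
          (0≤a*b 0≤i 0≤ρ) 0≤τ small m≤x ≤a* (subst (λ p → a* - p ≤ x * x - m * m + m) (sym e) pairs-full)
        where
        0≤τ : 0ℚ ≤ τ
        0≤τ = 0≤a*b (0≤a*b 0≤σ (0≤ι D)) (WithS.0≤J₃ S S⊆N ≤a*)
      ... | S , S⊆N , ≤a* , inj₂ h = WithS.mean S S⊆N ≤a* ⨾ Saving.many x z τ (pairs S) a* m
          (0≤a*b 0≤i 0≤ρ) 0≤τ small m≤x ≤a* h
        where
        0≤τ : 0ℚ ≤ τ
        0≤τ = 0≤a*b (0≤a*b 0≤σ (0≤ι D)) (WithS.0≤J₃ S S⊆N ≤a*)

    -- Sum over the C colours in the list of v. The error `z` per colour adds up to ρ, which is the
    -- final 1.
    loss-mean : ∀ v δ σ → 0ℚ ≤ δ → 0ℚ ≤ σ → δ ≤ σ * σ → edges v ≤ (1ℚ - δ) * (ι D * ι D) → inv k * ρ * ι D ≤ 1ℚ →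
      𝔼 Y (loss v ∘ st) ≤ ι D * ρ - ½ * (δ * (ι D * (ι D * inv k)) * (ρ * ρ)) + 1/6 * (σ * δ * (ι D *
          (ι D * inv k) * (ι D * inv k)) * γ ^ D) + 1ℚ
    loss-mean v δ σ h₁ h₂ h₃ h₄ h₅ = ≤-reflexive (𝔼-∑ Y _) ⨾ ∑-mono (λ i →
        Colour.lost-mean v (L v i) δ σ h₁ h₂ h₃ h₄ h₅) ⨾ ≤-reflexive (trans (∑-const (suc k) _)
       (trans (eq (ι (suc k)) (inv k) (ι D) ρ δ σ (γ ^ D)) (trans (cong (_* B) (inv-eq k)) (ℚP.*-identityˡ B))))
           ⨾ (≤-refl {ι D * ρ - ½ * (δ * (ι D * (ι D * inv k)) * (ρ * ρ)) + 1/6 * (σ * δ * (ι D * (ι D * inv k) *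
           (ι D * inv k)) * γ ^ D)} ⊕ ρ≤1)
      where
      B : ℚ
      B = ι D * ρ - ½ * (δ * (ι D * (ι D * inv k)) * (ρ * ρ)) + 1/6 * (σ * δ * (ι D * (ι D * inv k) *
          (ι D * inv k)) * γ ^ D) + ρ
      eq : ∀ C i x r d s g → C * (x * (i * r) - ½ * (d * (x * x) * (i * r * (i * r))) + 1/6 * (s * x *
          (i * i * i * g) * (d * (x * x))) + i * r)
         ≡ i * C * (x * r - ½ * (d * (x * (x * i)) * (r * r)) + 1/6 * (s * d * (x * (x * i) * (x * i)) * g) + r)
      eq = solve-∀ ring

    -- An outcome without large deviations

    module Round (j : ℕ) (η ζ y : ℚ) (0<η : 0ℚ < η) (ηζ : η * ζ ≡ 1ℚ) (xy : ι D * y ≡ 1ℚ)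
      (1≤x : 1ℚ ≤ ι D) (1≤K : 1ℚ ≤ ι K) (xi≤2 : ι D * inv k ≤ 2ℚ) where

      -- The 192 is 4 · 4² · 3, from the edge count: differences up to 4 K x and total influence 3
      -- x. For all three quantities the ratio of V to the squared deviation then equals κ² ζ² / x.
      x κ² p₀ : ℚ
      x = ι D
      κ² = 192ℚ * (ι K * ι K)
      p₀ = momentCoeff j * (κ² * (ζ * ζ * y)) ^ j

      private
        0<x : 0ℚ < x
        0<x = <-≤-trans {0ℚ} {1ℚ} dec< 1≤x
        0≤x : 0ℚ ≤ x
        0≤x = <⇒≤ 0<x
        0≤K² : 0ℚ ≤ ι K * ι K
        0≤K² = 0≤sq (ι K)
        1≤K² : 1ℚ ≤ ι K * ι K
        1≤K² = *-mono 0≤1 (0≤ι K) 1≤K 1≤K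

        Σp≤3x : ∀ v → ∑ (prob v) ≤ 3ℚ * x
        Σp≤3x v = Σprob≤ deg≤ v ⨾ ≤-by (0≤x ⊙ xi≤2) (eq x (inv k))
          where
          eq : ∀ x i → x + x * x * i + x * 2ℚ ≡ 3ℚ * x + x * (x * i)
          eq = solve-∀ ring

        tail : ∀ B V t (f : State → ℚ) v → 0ℚ ≤ B → 0ℚ < t → 4ℚ * (B * B) * (3ℚ * x) ≤ V →
            V ≡ κ² * (ζ * ζ * y) * (t * t) → BoundedDiff X (f ∘ st) B (prob v) →
          (A : Vec Ω n → Bool) → (∀ ω → A ω ≡ true → 𝔼 Y (f ∘ st) + t ≤ f (st ω)) → 𝔼 Y (λ ω → ⟦ A ω ⟧) ≤ p₀
        tail B V t f v 0≤B 0<t V≥ V≡ bd A hA = ⊙-cancel (^-pos j (0<a*b 0<t 0<t)) (≤-reflexive (ℚP.*-comm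
            ((t * t) ^ j) _) ⨾
            tail-bound X B V t 0≤B (<⇒≤ 0<t) κ≤V j (f ∘ st) (prob v) (0≤prob v) bd ((0≤B′ ⊙ Σp≤3x v) ⨾ V≥) A hA
            ⨾ ≤-reflexive (trans (cong (λ z → momentCoeff j * z ^ j) V≡) (trans (cong (momentCoeff j *_) (^-* (κ² *
                (ζ * ζ * y)) (t * t) j)) (eq (momentCoeff j) ((κ² * (ζ * ζ * y)) ^ j) ((t * t) ^ j)))))
          where
          0≤B′ : 0ℚ ≤ 4ℚ * (B * B)
          0≤B′ = 0≤a*b {4ℚ} dec≤ (0≤sq B)
          κ≤V : 4ℚ * (B * B) ≤ V
          κ≤V = ≤-reflexive (sym (ℚP.*-identityʳ _)) ⨾ (0≤B′ ⊙ ((1ℚ ≤ 3ℚ * 1ℚ ∋ dec≤) ⨾ ((0ℚ ≤ 3ℚ ∋ dec≤) ⊙ 1≤x)))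
              ⨾ V≥
          eq : ∀ c a b → c * (a * b) ≡ b * (c * a)
          eq = solve-∀ ring

        V₁ V₃ : ℚ
        V₁ = κ² * x
        V₃ = κ² * (x * x * x)

        0<ηx : 0ℚ < η * x
        0<ηx = 0<a*b 0<η 0<x

        V₁≡ : V₁ ≡ κ² * (ζ * ζ * y) * (η * x * (η * x))
        V₁≡ = sym (trans (eq κ² ζ y η x) (trans (cong₂ (λ a b → κ² * x * (a * a) * b) ηζ xy) (eq₂ κ² x)))
          where
          eq : ∀ k z y h x → k * (z * z * y) * (h * x * (h * x)) ≡ k * x * (h * z * (h * z)) * (x * y)
          eq = solve-∀ ring
          eq₂ : ∀ k x → k * x * (1ℚ * 1ℚ) * 1ℚ ≡ k * x
          eq₂ = solve-∀ ring
        V₃≡ : V₃ ≡ κ² * (ζ * ζ * y) * (η * x * x * (η * x * x))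
        V₃≡ = sym (trans (eq κ² ζ y η x) (trans (cong₂ (λ a b → κ² * (x * x * x) * (a * a) * b) ηζ xy) (eq₂ κ² x)))
          where
          eq : ∀ k z y h x → k * (z * z * y) * (h * x * x * (h * x * x))
              ≡ k * (x * x * x) * (h * z * (h * z)) * (x * y)
          eq = solve-∀ ring
          eq₂ : ∀ k x → k * (x * x * x) * (1ℚ * 1ℚ) * 1ℚ ≡ k * (x * x * x)
          eq₂ = solve-∀ ring

        bad₁ bad₂ bad₃ : Fin n → State → Bool
        bad₁ v σ = leq (𝔼 Y (loss v ∘ st) + η * x) (loss v σ)
        bad₂ v σ = leq (𝔼 Y (degT v ∘ st) + η * x) (degT v σ)
        bad₃ v σ = leq (𝔼 Y (edgT v ∘ st) + η * x * x) (edgT v σ)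

        A : Fin n → Vec Ω n → Bool
        A v ω = bad₁ v (st ω) ∨ (bad₂ v (st ω) ∨ bad₃ v (st ω))

        P₁ : ∀ v → 𝔼 Y (λ ω → ⟦ bad₁ v (st ω) ⟧) ≤ p₀
        P₁ v = tail 1ℚ V₁ (η * x) (loss v) v 0≤1 0<ηx (≤-by (0≤a*b {12ℚ} dec≤ (0≤a*b 0≤x (0≤b-a 1≤K²))
            ⊕ 0≤a*b {192ℚ - 12ℚ} dec≤ (0≤a*b 0≤x 0≤K²)) (eq x (ι K * ι K))) V₁≡ (loss-BD v) _ (λ ω e → leq-true e)
          where
          eq : ∀ x K → 4ℚ * (1ℚ * 1ℚ) * (3ℚ * x) + (12ℚ * (x * (K - 1ℚ)) + (192ℚ - 12ℚ) * (x * K))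
              ≡ 192ℚ * K * x + (0ℚ + 0ℚ)
          eq = solve-∀ ring
        P₂ : ∀ v → 𝔼 Y (λ ω → ⟦ bad₂ v (st ω) ⟧) ≤ p₀
        P₂ v = tail (ι K + ι K) V₁ (η * x) (degT v) v (0≤a+b (0≤ι K) (0≤ι K)) 0<ηx (≤-by (0≤a*b {+ 144 / 1} dec≤
            (0≤a*b 0≤x 0≤K²)) (eq x (ι K))) V₁≡ (degT-BD v) _ (λ ω e → leq-true e)
          where
          eq : ∀ x K → 4ℚ * ((K + K) * (K + K)) * (3ℚ * x) + (+ 144 / 1) * (x * (K * K)) ≡ 192ℚ * (K * K) * x + 0ℚ
          eq = solve-∀ ring
        P₃ : ∀ v → 𝔼 Y (λ ω → ⟦ bad₃ v (st ω) ⟧) ≤ p₀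
        P₃ v = tail (4ℚ * ι K * x) V₃ (η * x * x) (edgT v) v (0≤a*b (0≤a*b {4ℚ} dec≤ (0≤ι K)) 0≤x) (0<a*b 0<ηx 0<x)
            (≤-reflexive (eq x (ι K))) V₃≡ (edgT-BD deg≤ v) _ (λ ω e → leq-true e)
          where
          eq : ∀ x K → 4ℚ * (4ℚ * K * x * (4ℚ * K * x)) * (3ℚ * x) ≡ 192ℚ * (K * K) * (x * x * x)
          eq = solve-∀ ring

        A≤ : ∀ v → 𝔼 Y (λ ω → ⟦ A v ω ⟧) ≤ p₀ + (p₀ + p₀)
        A≤ v = mono Y (λ ω → ⟦∨⟧≤ (bad₁ v (st ω)) _ ⨾ (≤-refl {⟦ bad₁ v (st ω) ⟧} ⊕ ⟦∨⟧≤ (bad₂ v (st ω)) _))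
            ⨾ ≤-reflexive (trans (𝔼-+ Y _ _) (cong (λ z → 𝔼 Y (λ ω → ⟦ bad₁ v (st ω) ⟧) + z) (𝔼-+ Y _ _)))
            ⨾ (P₁ v ⊕ (P₂ v ⊕ P₃ v))

        dep : Fin n → Fin n → Bool
        dep v w = anyB (λ i → ball v i ∧ ball w i)

        local : ∀ v ω ω′ → Agree X (ball v) ω ω′ → A v ω ≡ A v ω′
        local v ω ω′ h = cong₂ _∨_ (cong (λ z → leq (𝔼 Y (loss v ∘ st) + η * x) (z)) (loss-local same)) (cong₂ _∨_
            (cong (λ z → leq (𝔼 Y (degT v ∘ st) + η * x) (z)) (degT-local same)) (cong (λ z →
            leq (𝔼 Y (edgT v ∘ st) + η * x * x) (z)) (edgT-local same)))
          where
          same : SameOn (ball v) (st ω) (st ω′)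
          same y e = cong (toSt y) (h y e)

        dep-correct : ∀ v w → dep v w ≡ false → ∀ i → ball w i ≡ true → ball v i ≡ false
        dep-correct v w e i h with ball v i in q
        ... | false = refl
        ... | true = false≢true (anyB-false {f = λ i → ball v i ∧ ball w i} e i) (cong₂ _∧_ q h)

        rel : Fin n → Fin n → ℚ
        rel v y = ∑ (λ u → ⟦ adj G v u ⟧ * (⟦ isEq u y ⟧ + ⟦ adj G u y ⟧))

        0≤rel : ∀ v y → 0ℚ ≤ rel v y
        0≤rel v y = ∑-nonneg (λ u → 0≤a*b 0≤⟦ adj G v u ⟧ (0≤a+b 0≤⟦ isEq u y ⟧ 0≤⟦ adj G u y ⟧))

        ball≤rel : ∀ v y → ⟦ ball v y ⟧ ≤ rel v y
        ball≤rel v y = ⟦anyB⟧≤ _ ⨾ ∑-mono (λ u → ≤-reflexive (⟦∧⟧ (adj G v u) _)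
            ⨾ (0≤⟦ adj G v u ⟧ ⊙ ⟦∨⟧≤ (isEq u y) (adj G u y)))

        R : ℚ
        R = x * (1ℚ + x)
        0≤R : 0ℚ ≤ R
        0≤R = 0≤a*b 0≤x (0≤a+b 0≤1 0≤x)

        Σrel : ∀ v → ∑ (rel v) ≤ R
        Σrel v = ≤-reflexive (∑-swap ∑-lin _) ⨾ ∑-mono (λ u → ≤-reflexive (trans (∑-*ˡ ⟦ adj G v u ⟧ _) (cong
            (⟦ adj G v u ⟧ *_) (∑-+ _ _))) ⨾ (0≤⟦ adj G v u ⟧ ⊙ (∑-isEq u ⊕ deg≤ u)))
            ⨾ ≤-reflexive (∑-*ʳ (1ℚ + x) _) ⨾ (deg≤ v ⊙ʳ 0≤a+b 0≤1 0≤x)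

        Σrelᵀ : ∀ y → ∑ (λ w → rel w y) ≤ R
        Σrelᵀ y = ≤-reflexive (∑-swap ∑-lin _) ⨾ ∑-mono (λ u → ≤-reflexive (trans (∑-*ʳ
            (⟦ isEq u y ⟧ + ⟦ adj G u y ⟧) _) (cong (_* (⟦ isEq u y ⟧ + ⟦ adj G u y ⟧)) (∑-cong (λ w →
            cong ⟦_⟧ (Graph.sym G w u))))) ⨾ (deg≤ u ⊙ʳ 0≤a+b 0≤⟦ isEq u y ⟧ 0≤⟦ adj G u y ⟧))
            ⨾ ≤-reflexive (trans (∑-*ˡ x _) (cong (x *_) (∑-+ _ _)))
           ⨾ (0≤x ⊙ (∑-single (λ u → isEq u y) (λ a b p r → trans (isEq-true {a} {y} p) (sym
               (isEq-true {b} {y} r))) ⊕ (≤-reflexive (∑-cong (λ u → cong ⟦_⟧ (Graph.sym G u y))) ⨾ deg≤ y)))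

        -- Dependent events have balls with a common vertex: the ball of v has at most R vertices,
        -- and each lies in at most R balls.
        dep≤ : ∀ v → ∑ (λ w → ⟦ dep v w ⟧) ≤ R * R
        dep≤ v = ∑-mono (λ w → ⟦anyB⟧≤ _ ⨾ ∑-mono (λ y → ≤-reflexive (⟦∧⟧ (ball v y) (ball w y))
            ⨾ *-mono 0≤⟦ ball w y ⟧ (0≤rel v y) (ball≤rel v y) (ball≤rel w y))) ⨾ ≤-reflexive (∑-swap ∑-lin _)
           ⨾ ∑-mono (λ y → ≤-reflexive (∑-*ˡ (rel v y) _) ⨾ (0≤rel v y ⊙ Σrelᵀ y)) ⨾ ≤-reflexive (∑-*ʳ R _)
               ⨾ (Σrel v ⊙ʳ 0≤R)

      48ℚ : ℚ
      48ℚ = + 48 / 1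

      -- The 48 is 4 · 3 · 2²: the constant of the local lemma, three bad events per vertex, and R ≤
      -- 2 x².
      good-outcome : 48ℚ * p₀ * (x * x * (x * x)) ≤ 1ℚ → 0ℚ ≤ p₀ →
        ∃[ ω ] ∀ v → (loss v (st ω) ≤ 𝔼 Y (loss v ∘ st) + η * x) × (degT v (st ω)
            ≤ 𝔼 Y (degT v ∘ st) + η * x) × (edgT v (st ω) ≤ 𝔼 Y (edgT v ∘ st) + η * x * x)
      good-outcome h 0≤p₀ = proj₁ res , (λ v → good v (proj₁ res) (proj₂ res v))
        where
        1≤x² : 1ℚ ≤ x * x
        1≤x² = *-mono 0≤1 0≤x 1≤x 1≤x
        R≤ : R ≤ 2ℚ * (x * x)
        R≤ = ≤-by (0≤x ⊙ 1≤x) (eq x)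
          where
          eq : ∀ x → x * (1ℚ + x) + x * x ≡ 2ℚ * (x * x) + x * 1ℚ
          eq = solve-∀ ring
        4pd : 4ℚ * (p₀ + (p₀ + p₀)) * (R * R) ≤ 1ℚ
        4pd = (0≤a*b {4ℚ} dec≤ (0≤a+b 0≤p₀ (0≤a+b 0≤p₀ 0≤p₀)) ⊙ *-mono 0≤R (0≤a*b {2ℚ} dec≤ (0≤sq x)) R≤ R≤)
            ⨾ ≤-reflexive (eq p₀ x) ⨾ h
          where
          eq : ∀ p x → 4ℚ * (p + (p + p)) * (2ℚ * (x * x) * (2ℚ * (x * x))) ≡ 48ℚ * p * (x * x * (x * x))
          eq = solve-∀ ring
        4p : 4ℚ * (p₀ + (p₀ + p₀)) ≤ 1ℚ
        4p = ≤-by (0≤a*b {+ 36 / 1} dec≤ 0≤p₀ ⊕ (0≤a*b {48ℚ} dec≤ 0≤p₀ ⊙ *-mono 0≤1 (0≤sq x) 1≤x² 1≤x²)) (eq p₀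
            (48ℚ * p₀ * (x * x * (x * x)))) ⨾ h
          where
          eq : ∀ p w → 4ℚ * (p + (p + p)) + ((+ 36 / 1) * p + w) ≡ w + (0ℚ + 48ℚ * p * (1ℚ * 1ℚ))
          eq = solve-∀ ring
        res : ∃[ ω ] ∀ v → A v ω ≡ false
        res = local-lemma X A ball dep local dep-correct (p₀ + (p₀ + p₀)) (R * R) (0≤a+b 0≤p₀
            (0≤a+b 0≤p₀ 0≤p₀)) A≤ dep≤ 4pd 4p
        good : ∀ v ω → A v ω ≡ false → (loss v (st ω) ≤ 𝔼 Y (loss v ∘ st) + η * x) × (degT v (st ω)
            ≤ 𝔼 Y (degT v ∘ st) + η * x) × (edgT v (st ω) ≤ 𝔼 Y (edgT v ∘ st) + η * x * x)
        good v ω e = leq-false (proj₁ split₁) , leq-false (proj₁ split₂) , leq-false (proj₂ split₂)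
          where
          split₁ : (bad₁ v (st ω) ≡ false) × (bad₂ v (st ω) ∨ bad₃ v (st ω) ≡ false)
          split₁ = ∨-false e
          split₂ : (bad₂ v (st ω) ≡ false) × (bad₃ v (st ω) ≡ false)
          split₂ = ∨-false (proj₂ split₁)

    -- The residual graph and its lists

    module At (ω : Vec Ω n) (C′ : ℕ) (loss≤ : ∀ v → loss v (st ω) + ι C′ ≤ ι (suc k)) where
      σ : State
      σ = st ω

      -- Coloured vertices remain as isolated ones, so that the vertex set is the same in every
      -- round.
      G′ : Graph n
      G′ = record
        { adj = λ u v → adj G u v ∧ (not (keep σ u) ∧ not (keep σ v))
        ; sym = λ u v → cong₂ _∧_ (Graph.sym G u v) (BoolP.∧-comm (not (keep σ u)) (not (keep σ v)))
        ; irrefl = λ v → cong (_∧ (not (keep σ v) ∧ not (keep σ v))) (irrefl G v) }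

      remaining : ∀ v → C′ ℕ.≤ card (λ i → not (lost v σ (L v i)))
      remaining v = ι-cancel (≤-by (loss≤ v) (trans (cong (λ z → ι C′ + z) (sym total)) (eq (ι C′) (loss v σ) (∑
          (λ i → ⟦ not (lost v σ (L v i)) ⟧)))) ⨾ ≤-reflexive (∑-card (λ i → not (lost v σ (L v i)))))
        where
        total : loss v σ + ∑ (λ i → ⟦ not (lost v σ (L v i)) ⟧) ≡ ι (suc k)
        total = trans (sym (∑-+ _ _)) (trans (∑-cong (λ i → b+¬b (lost v σ (L v i)))) (trans (∑-const (suc k) 1ℚ)
            (ℚP.*-identityʳ (ι (suc k)))))
          where
          b+¬b : ∀ b → ⟦ b ⟧ + ⟦ not b ⟧ ≡ 1ℚ
          b+¬b true = refl
          b+¬b false = refl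
        eq : ∀ c l s → c + (l + s) ≡ s + (l + c)
        eq = solve-∀ ring

      sel : ∀ v → Σ (Fin C′ → Fin (suc k)) λ f → (∀ j → not (lost v σ (L v (f j))) ≡ true) × (∀ i j → f i ≡ f j →
          i ≡ j)
      sel v = select (λ i → not (lost v σ (L v i))) C′ (remaining v)

      L′ : Fin n → Fin C′ → ℕ
      L′ v j = L v (proj₁ (sel v) j)

      L′-inj : Injective L′
      L′-inj v i j e = proj₂ (proj₂ (sel v)) i j (L-inj v _ _ e)

      Tk≤keep : ∀ v u → ⟦ Tk v σ u ⟧ ≤ ⟦ keep σ u ⟧
      Tk≤keep v u = go (keep σ u) (class v σ (L u (κ ω u)) ℕ.≤ᵇ K)
        where
        go : ∀ a b → ⟦ a ∧ b ⟧ ≤ ⟦ a ⟧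
        go true b = ⟦ b ⟧≤1
        go false b = ≤-refl

      ¬keep≤ : ∀ v u → ⟦ not (keep σ u) ⟧ ≤ 1ℚ - ⟦ Tk v σ u ⟧
      ¬keep≤ v u = ≤-reflexive (⟦not⟧ (keep σ u)) ⨾ (≤-refl {1ℚ} ⊕ neg-≤ (Tk≤keep v u))

      deg′ : ∀ v → degℚ G′ v ≤ degT v σ
      deg′ v = ∑-mono (λ u → ≤-reflexive (⟦∧⟧ (adj G v u) _) ⨾ (0≤⟦ adj G v u ⟧ ⊙ (drop (not (keep σ v)) (not
          (keep σ u)) ⨾ ¬keep≤ v u)))
        where
        drop : ∀ a b → ⟦ a ∧ b ⟧ ≤ ⟦ b ⟧
        drop true b = ≤-refl
        drop false b = 0≤⟦ b ⟧

      pairs′ : ∀ v → nbhdPairs G′ v ≤ edgT v σ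
      pairs′ v = ∑-mono (λ u → ∑-mono (λ w → go (adj G v u) (adj G v w) (adj G u w) (not (keep σ v)) (not
          (keep σ u)) (not (keep σ w)) ⨾
           (0≤a*b (0≤a*b 0≤⟦ adj G v u ⟧ 0≤⟦ adj G v w ⟧) 0≤⟦ adj G u w ⟧ ⊙ *-mono 0≤⟦ not (keep σ w) ⟧ (0≤⟦ not
               (keep σ u) ⟧ ⨾ ¬keep≤ v u) (¬keep≤ v u) (¬keep≤ v w))))
        where
        go : ∀ a b c x y z → ⟦ a ∧ (x ∧ y) ⟧ * ⟦ b ∧ (x ∧ z) ⟧ * ⟦ c ∧ (y ∧ z) ⟧
            ≤ ⟦ a ⟧ * ⟦ b ⟧ * ⟦ c ⟧ * (⟦ y ⟧ * ⟦ z ⟧)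
        go a b c x y z = ≤-reflexive (cong₂ _*_ (cong₂ _*_ (e a x y) (e b x z)) (e c y z)) ⨾
            ≤-reflexive (eq ⟦ a ⟧ ⟦ b ⟧ ⟦ c ⟧ ⟦ x ⟧ ⟦ y ⟧ ⟦ z ⟧) ⨾ (0≤a*b (0≤a*b 0≤⟦ a ⟧ 0≤⟦ b ⟧) 0≤⟦ c ⟧ ⊙ *-mono
                (0≤a*b (0≤a*b 0≤⟦ z ⟧ 0≤⟦ z ⟧) (0≤a*b 0≤⟦ x ⟧ 0≤⟦ x ⟧)) 0≤⟦ y ⟧ (≤-reflexive (sq y)) (*-mono
                (0≤a*b 0≤⟦ x ⟧ 0≤⟦ x ⟧) 0≤⟦ z ⟧ (≤-reflexive (sq z)) (*-mono 0≤⟦ x ⟧ 0≤1 ⟦ x ⟧≤1 ⟦ x ⟧≤1)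
                ⨾ ≤-reflexive (ℚP.*-identityʳ ⟦ z ⟧)))
          where
          e : ∀ a x y → ⟦ a ∧ (x ∧ y) ⟧ ≡ ⟦ a ⟧ * (⟦ x ⟧ * ⟦ y ⟧)
          e a x y = trans (⟦∧⟧ a (x ∧ y)) (cong (⟦ a ⟧ *_) (⟦∧⟧ x y))
          sq : ∀ b → ⟦ b ⟧ * ⟦ b ⟧ ≡ ⟦ b ⟧
          sq true = refl
          sq false = refl
          eq : ∀ a b c x y z → a * (x * y) * (b * (x * z)) * (c * (y * z)) ≡ a * b * c * (y * y * (z * z * (x * x)))
          eq = solve-∀ ring

      -- A residual list contains no colour kept by a neighbour, so old and new colours cannot
      -- clash; a vertex already coloured ignores the colour it receives as an isolated vertex.
      extend : ListColouring G′ C′ L′ → ListColouring G (suc k) L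
      extend (c , lists , prop) = c″ , in-list , proper″
        where
        own : Fin n → ℕ
        own v = L v (κ ω v)
        c″ : Fin n → ℕ
        c″ v = if keep σ v then own v else c v
        in-list : ∀ v → ∃[ i ] c″ v ≡ L v i
        in-list v = go (keep σ v)
          where
          go : ∀ b → ∃[ i ] (if b then own v else c v) ≡ L v i
          go true = κ ω v , refl
          go false = proj₁ (sel v) (proj₁ (lists v)) , proj₂ (lists v)
        conflict : ∀ u v → adj G v u ≡ true → keep σ u ≡ true → own u ≢ c v
        conflict u v a ku e = false≢true (not-true (proj₁ (proj₂ (sel v)) (proj₁ (lists v)))) (anyB-intro {f = λ w →
            adj G v w ∧ keepc σ w (L′ v (proj₁ (lists v)))} u (cong₂ _∧_ a (subst (λ z →
            keepc σ u z ≡ true) (trans e (proj₂ (lists v))) ku)))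
        proper″ : ∀ u v → adj G u v ≡ true → c″ u ≢ c″ v
        proper″ u v a = by-cases (keep σ u) (keep σ v) refl refl
          where
          by-cases : ∀ x y → keep σ u ≡ x → keep σ v ≡ y → (if x then own u else c u) ≢ (if y then own v else c v)
          by-cases true true p r e = proper σ u v (own u) a p (subst (λ z → keepc σ v z ≡ true) (sym e) r)
          by-cases true false p r e = conflict u v (trans (Graph.sym G v u) a) p e
          by-cases false true p r e = conflict v u a r (sym e)
          by-cases false false p r e = prop u v (cong₂ _∧_ a (cong₂ (λ x y → not x ∧ not y) p r)) e

  one-round : ∀ {n} (G : Graph n) k D K (L : Fin n → Fin (suc k) → ℕ) (L-inj : Injective L) (deg≤ : ∀ u →
      degℚ G u ≤ ι D)
    j η ζ y → 0ℚ < η → η * ζ ≡ 1ℚ → ι D * y ≡ 1ℚ → 1ℚ ≤ ι D → 1ℚ ≤ ι K → ι D * inv k ≤ 2ℚ →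
    let x = ι D ; i = inv k ; ρ = (1ℚ - ½ * i) ^ D ; Γ = (1ℚ - (+ 7 / 8) * i) ^ D ; η₁ = inv K * (1ℚ + x * i)
        p₀ = momentCoeff j * (192ℚ * (ι K * ι K) * (ζ * ζ * y)) ^ j in
    (+ 48 / 1) * p₀ * (x * x * (x * x)) ≤ 1ℚ → 0ℚ ≤ p₀ →
    ∀ δ σ → 0ℚ ≤ δ → 0ℚ ≤ σ → δ ≤ σ * σ → (∀ v → nbhdPairs G v ≤ (1ℚ - δ) * (x * x)) → i * ρ * x ≤ 1ℚ →
    ∀ C′ → x * ρ - ½ * (δ * (x * (x * i)) * (ρ * ρ)) + 1/6 * (σ * δ * (x * (x * i) *
        (x * i)) * Γ) + 1ℚ + η * x + ι C′ ≤ ι (suc k) →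
    Σ (Graph n) λ G′ → Σ (Fin n → Fin C′ → ℕ) λ L′ → Injective L′ × (∀ v → degℚ G′ v ≤ x * (1ℚ - ρ + η₁) + η * x) ×
      (∀ v → nbhdPairs G′ v ≤ nbhdPairs G v * ((1ℚ - ρ) * (1ℚ - ρ) + i + (η₁ + η₁)) + η * x * x) ×
          (ListColouring G′ C′ L′ → ListColouring G (suc k) L)
  one-round G k D K L L-inj deg≤ j η ζ y 0<η ηζ xy 1≤x 1≤K xi≤2 h 0≤p₀ δ σ 0≤δ 0≤σ δ≤σ² pairs≤ small C′ C′≤ =
    G′ , L′ , L′-inj , (λ v → deg′ v ⨾ proj₁ (proj₂ (proj₂ outcome v)) ⨾ (degT-mean v ⊕ ≤-refl {η * ι D})) ,
    (λ v → pairs′ v ⨾ proj₂ (proj₂ (proj₂ outcome v)) ⨾ (edgT-mean v ⊕ ≤-refl {η * ι D * ι D})) , extend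
    where
    input : RoundInput _
    input = record { G = G ; k = k ; D = D ; K = K ; L = L ; L-inj = L-inj ; deg≤ = deg≤ }
    open Procedure input
    open Round j η ζ y 0<η ηζ xy 1≤x 1≤K xi≤2
    outcome : ∃[ ω ] ∀ v → (loss v (st ω) ≤ 𝔼 Y (loss v ∘ st) + η * ι D) × (degT v (st ω)
        ≤ 𝔼 Y (degT v ∘ st) + η * ι D) × (edgT v (st ω) ≤ 𝔼 Y (edgT v ∘ st) + η * ι D * ι D)
    outcome = good-outcome h 0≤p₀
    fits : ∀ v → loss v (st (proj₁ outcome)) + ι C′ ≤ ι (suc k)
    fits v = ((proj₁ (proj₂ outcome v) ⨾ (loss-mean v δ σ 0≤δ 0≤σ δ≤σ² (pairs≤ v) small ⊕ ≤-refl {η * ι D}))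
        ⊕ ≤-refl {ι C′}) ⨾ C′≤
    open At (proj₁ outcome) C′ fits

  -- The statement for the induction over rounds. `D` is an upper bound on the degrees and need not
  -- be attained, and density is compared with D², because the maximum degree of a residual graph is
  -- not controlled from below.
  Col : ℚ → ℚ → Set
  Col ε δ = ∃[ D₀ ] (∀ D → D₀ ℕ.≤ D → ∀ {n} (G : Graph n) C (L : Fin n → Fin C → ℕ) → Injective L → (∀ v →
      degℚ G v ≤ ι D) →
     (1ℚ - ε) * ι D ≤ ι C → (∀ v → nbhdPairs G v ≤ (1ℚ - δ) * (ι D * ι D)) → ListColouring G C L)

-- Numerical inequalities between the exponentials

module Numerics where

  open NaiveColouring public
  import Data.Rational.Properties as ℚP

  1/24 : ℚ
  1/24 = + 1 / 24

  -- Truncations of (1 - z)ᴰ at y = D z, alternately from above and below; each bound at D + 1 follows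
  -- from the bounds of the two neighbouring orders at D.
  module PowerBounds (z : ℚ) (0≤z : 0ℚ ≤ z) (z≤1 : z ≤ 1ℚ) where
    private
      b : ℚ
      b = 1ℚ - z
      0≤b : 0ℚ ≤ b
      0≤b = 0≤b-a z≤1
      b≤1 : b ≤ 1ℚ
      b≤1 = ≤-by 0≤z (eq z)
        where
        eq : ∀ z → 1ℚ - z + z ≡ 1ℚ + 0ℚ
        eq = solve-∀ ring
      at-zero : ∀ {x} → x ≡ ι 0 * z → x ≡ 0ℚ
      at-zero e = trans e (trans (cong (_* z) ι-0) (ℚP.*-zeroˡ z))
      at-suc : ∀ D → ι (suc D) * z ≡ ι D * z + z
      at-suc D = trans (cong (_* z) (ι-suc D)) (eq (ι D) z)
        where
        eq : ∀ d z → (1ℚ + d) * z ≡ d * z + z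
        eq = solve-∀ ring
      P≤1 : ∀ D → b ^ D ≤ 1ℚ
      P≤1 D = ^-≤1 D 0≤b b≤1

    L1 : ∀ D → 1ℚ - ι D * z ≤ b ^ D
    L1 zero = ≤-reflexive (cong (λ y → 1ℚ - y) (at-zero refl))
    L1 (suc D) = ≤-by (L1 D ⊕ (0≤z ⊙ P≤1 D)) (trans (cong (λ y → 1ℚ - y + (b ^ D + z * 1ℚ)) (at-suc D)) (eq
        (ι D * z) z (b ^ D)))
      where
      eq : ∀ y z P → 1ℚ - (y + z) + (P + z * 1ℚ) ≡ (1ℚ - z) * P + (1ℚ - y + z * P)
      eq = solve-∀ ring

    U2 : ∀ D → let y = ι D * z in b ^ D ≤ 1ℚ - y + ½ * (y * y)
    U2 zero = ≤-reflexive (sym (cong (λ y → 1ℚ - y + ½ * (y * y)) (at-zero refl)))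
    U2 (suc D) = ≤-by (U2 D ⊕ (0≤z ⊙ L1 D) ⊕ 0≤a*b {½} dec≤ (0≤sq z)) (trans (eq (ι D * z) z (b ^ D)) (cong (λ y →
        1ℚ - y + ½ * (y * y) + (b ^ D + z * (1ℚ - ι D * z) + 0ℚ)) (sym (at-suc D))))
      where
      eq : ∀ y z P → (1ℚ - z) * P + (1ℚ - y + ½ * (y * y) + z * P + ½ * (z * z))
          ≡ 1ℚ - (y + z) + ½ * ((y + z) * (y + z)) + (P + z * (1ℚ - y) + 0ℚ)
      eq = solve-∀ ring

    -- The power (1 - z)^D lies below e^(-y) by roughly ½ y z e^(-y), whence the last term; the
    -- summand y z of `U4` absorbs the effect of this correction.
    L3 : ∀ D → let y = ι D * z in 1ℚ - y + ½ * (y * y) - 1/6 * (y * y * y) - ½ * (y * z) ≤ b ^ D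
    L3 zero = ≤-reflexive (trans (cong (λ y → 1ℚ - y + ½ * (y * y) - 1/6 * (y * y * y) - ½ * (y * z))
        (at-zero refl)) (eq z))
      where
      eq : ∀ z → 1ℚ - 0ℚ + ½ * (0ℚ * 0ℚ) - 1/6 * (0ℚ * 0ℚ * 0ℚ) - ½ * (0ℚ * z) ≡ 1ℚ
      eq = solve-∀ ring
    L3 (suc D) = ≤-by (L3 D ⊕ (0≤z ⊙ U2 D) ⊕ 0≤a*b {½} dec≤ (0≤a*b 0≤y (0≤sq z))
        ⊕ 0≤a*b {1/6} dec≤ (0≤a*b (0≤sq z) 0≤z)) (trans (cong (λ y →
        1ℚ - y + ½ * (y * y) - 1/6 * (y * y * y) - ½ * (y * z) + (b ^ D + z * U + ½ * (y₀ * (z * z)) + 1/6 *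
        (z * z * z))) (at-suc D)) (eq y₀ z (b ^ D)))
      where
      y₀ U : ℚ
      y₀ = ι D * z
      U = 1ℚ - y₀ + ½ * (y₀ * y₀)
      0≤y : 0ℚ ≤ y₀
      0≤y = 0≤a*b (0≤ι D) 0≤z
      eq : ∀ y z P → let w = y + z in 1ℚ - w + ½ * (w * w) - 1/6 * (w * w * w) - ½ * (w * z) + (P + z * (1ℚ - y + ½ * (y * y)) + ½ * (y * (z * z)) + 1/6 * (z * z * z))
         ≡ (1ℚ - z) * P + (1ℚ - y + ½ * (y * y) - 1/6 * (y * y * y) - ½ * (y * z) + z * P + 0ℚ + 0ℚ)
      eq = solve-∀ ring

    U4 : ∀ D → ι D * z ≤ 1ℚ → let y = ι D * z in b ^ D ≤ 1ℚ - y + ½ * (y * y) - 1/6 * (y * y * y) + 1/24 * (y * y * (y * y)) + y * z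
    U4 zero h = ≤-reflexive (sym (trans (cong (λ y → 1ℚ - y + ½ * (y * y) - 1/6 * (y * y * y) + 1/24 * (y * y *
        (y * y)) + y * z) (at-zero refl)) (eq z)))
      where
      eq : ∀ z → 1ℚ - 0ℚ + ½ * (0ℚ * 0ℚ) - 1/6 * (0ℚ * 0ℚ * 0ℚ) + 1/24 * (0ℚ * 0ℚ * (0ℚ * 0ℚ)) + 0ℚ * z ≡ 1ℚ
      eq = solve-∀ ring
    U4 (suc D) h = ≤-by (U4 D y≤1 ⊕ (0≤z ⊙ L3 D) ⊕ 0≤a*b (0≤sq z) (0≤b-a y≤1)
        ⊕ 0≤a*b {1/6} dec≤ (0≤a*b (0≤sq z) (0≤b-a z≤1)) ⊕ 0≤a*b {+ 1 / 3} dec≤ (0≤sq z)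
        ⊕ 0≤a*b {1/6} dec≤ (0≤a*b (0≤sq z) (0≤a*b 0≤z 0≤y)) ⊕ 0≤a*b {½ * ½} dec≤ (0≤a*b (0≤sq z) (0≤sq y₀))
        ⊕ 0≤a*b {1/24} dec≤ (0≤a*b (0≤sq z) (0≤sq z)))
        (trans (eq y₀ z (b ^ D)) (cong (λ y → 1ℚ - y + ½ * (y * y) - 1/6 * (y * y * y) + 1/24 * (y * y *
            (y * y)) + y * z + (b ^ D + z * L + 0ℚ + 0ℚ + 0ℚ + 0ℚ + 0ℚ + 0ℚ)) (sym (at-suc D))))
      where
      y₀ L : ℚ
      y₀ = ι D * z
      L = 1ℚ - y₀ + ½ * (y₀ * y₀) - 1/6 * (y₀ * y₀ * y₀) - ½ * (y₀ * z)
      0≤y : 0ℚ ≤ y₀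
      0≤y = 0≤a*b (0≤ι D) 0≤z
      y≤1 : y₀ ≤ 1ℚ
      y≤1 = ≤-by 0≤z (e y₀ z) ⨾ ≤-reflexive (sym (at-suc D)) ⨾ h
        where
        e : ∀ y z → y + z ≡ y + z + 0ℚ
        e = solve-∀ ring
      eq : ∀ y z P → let w = y + z in (1ℚ - z) * P
          + (1ℚ - y + ½ * (y * y) - 1/6 * (y * y * y) + 1/24 * (y * y * (y * y)) + y * z + z * P + z * z *
              (1ℚ - y) + 1/6 * (z * z * (1ℚ - z)) + (+ 1 / 3) * (z * z) + 1/6 * (z * z * (z * y)) + ½ * ½ * (z * z *
              (y * y)) + 1/24 * (z * z * (z * z)))
         ≡ 1ℚ - w + ½ * (w * w) - 1/6 * (w * w * w) + 1/24 * (w * w * (w * w)) + w * z + (P + z * (1ℚ - y + ½ *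
             (y * y) - 1/6 * (y * y * y) - ½ * (y * z)) + 0ℚ + 0ℚ + 0ℚ + 0ℚ + 0ℚ + 0ℚ)
      eq = solve-∀ ring

  -- Here `cmax` exceeds 1 / (1 - 0.1617), `σmax` exceeds √0.9, and `slackℚ` is a little less than
  -- `Φ₀` at c = 1, which is about 0.00088.
  aℚ bℚ slackℚ cmax σmax : ℚ
  aℚ = + 3012 / 10000
  bℚ = + 1283 / 10000
  slackℚ = + 8 / 10000
  cmax = + 1193 / 1000
  σmax = + 949 / 1000

  -- Truncations of e^(-c/2) and e^(-3c/8). Up to errors of order 1/C, Φ₀ + σ Ψ is a lower bound for
  -- s / (δ ρ), s being the saving, minus the target a - b σ.
  g₃ h₄ Φ₀ Ψ : ℚ → ℚ
  g₃ c = 1ℚ - ½ * c + ½ * (½ * c * (½ * c)) - 1/6 * (½ * c * (½ * c) * (½ * c))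
  h₄ c = let w = (+ 3 / 8) * c in 1ℚ - w + ½ * (w * w) - 1/6 * (w * w * w) + 1/24 * (w * w * (w * w))
  Φ₀ c = ½ * c * g₃ c - aℚ
  Ψ c = bℚ - 1/6 * (c * c) * h₄ c

  -- Sign conditions on the coefficients in x = c - 1 that make a polynomial in c nonnegative on [1, 1 + X].
  module Poly (x X : ℚ) (0≤x : 0ℚ ≤ x) (x≤X : x ≤ X) (X≤1 : X ≤ 1ℚ) where
    private
      0≤x³ : 0ℚ ≤ x * x * x
      0≤x³ = 0≤a*b (0≤sq x) 0≤x
      0≤x⁵ : 0ℚ ≤ x * x * x * (x * x)
      0≤x⁵ = 0≤a*b 0≤x³ (0≤sq x)
      0≤X : 0ℚ ≤ X
      0≤X = 0≤x ⨾ x≤X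
      0≤1-x : 0ℚ ≤ 1ℚ - x
      0≤1-x = 0≤b-a (x≤X ⨾ X≤1)

    quartic : ∀ u₀ u₁ u₂ u₃ u₄ → let e₁ = u₁ + 2ℚ * u₂ + 3ℚ * u₃ + 4ℚ * u₄ ; e₂ = - (u₂ + 3ℚ * u₃ + (+ 6 / 1) * u₄) ; e₃ = u₃ + 4ℚ * u₄ ; e₄ = - u₄ in
      0ℚ ≤ u₀ + u₁ + u₂ + u₃ + u₄ → 0ℚ ≤ e₂ → 0ℚ ≤ e₄ → 0ℚ ≤ e₁ - e₂ * X → 0ℚ ≤ e₃ - e₄ →
      let c = 1ℚ + x in 0ℚ ≤ u₀ + u₁ * c + u₂ * (c * c) + u₃ * (c * c * c) + u₄ * (c * c * c * c)
    quartic u₀ u₁ u₂ u₃ u₄ h₀ h₂ h₄ h₁ h₃ = ≤-by (h₀ ⊕ 0≤a*b h₁ 0≤x ⊕ 0≤a*b h₂ (0≤a*b 0≤x (0≤b-a x≤X))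
        ⊕ 0≤a*b h₃ 0≤x³ ⊕ 0≤a*b h₄ (0≤a*b 0≤x³ 0≤1-x)) (eq u₀ u₁ u₂ u₃ u₄ x X)
      where
      eq : ∀ u₀ u₁ u₂ u₃ u₄ x X → let c = 1ℚ + x ; e₁ = u₁ + 2ℚ * u₂ + 3ℚ * u₃ + 4ℚ * u₄ ; e₂ = - (u₂ + 3ℚ * u₃ + (+ 6 / 1) * u₄) ; e₃ = u₃ + 4ℚ * u₄ ; e₄ = - u₄ in
        0ℚ + (u₀ + u₁ + u₂ + u₃ + u₄ + (e₁ - e₂ * X) * x + e₂ * (x * (X - x)) + (e₃ - e₄) * (x * x * x) + e₄ *
            (x * x * x * (1ℚ - x)))
        ≡ u₀ + u₁ * c + u₂ * (c * c) + u₃ * (c * c * c) + u₄ * (c * c * c * c) + (0ℚ + 0ℚ + 0ℚ + 0ℚ + 0ℚ)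
      eq = solve-∀ ring

    sextic : ∀ u₀ u₁ u₂ u₃ u₄ u₅ u₆ → let e₁ = - (u₁ + 2ℚ * u₂ + 3ℚ * u₃ + 4ℚ * u₄ + (+ 5 / 1) * u₅ + (+ 6 / 1) * u₆) ; e₂ = - (u₂ + 3ℚ * u₃ + (+ 6 / 1) * u₄ + (+ 10 / 1) * u₅ + (+ 15 / 1) * u₆) ; e₃ = u₃ + 4ℚ * u₄ + (+ 10 / 1) * u₅ + (+ 20 / 1) * u₆ ; e₄ = - (u₄ + (+ 5 / 1) * u₅ + (+ 15 / 1) * u₆) ; e₅ = u₅ + (+ 6 / 1) * u₆ ; e₆ = - u₆ in
      0ℚ ≤ u₀ + u₁ + u₂ + u₃ + u₄ + u₅ + u₆ - e₁ * X - e₂ * (X * X) → 0ℚ ≤ e₁ → 0ℚ ≤ e₂ → 0ℚ ≤ e₃ - e₄ → 0ℚ ≤ e₄ →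
          0ℚ ≤ e₅ - e₆ → 0ℚ ≤ e₆ →
      let c = 1ℚ + x in 0ℚ ≤ u₀ + u₁ * c + u₂ * (c * c) + u₃ * (c * c * c) + u₄ * (c * c * c * c) + u₅ * (c * c * c * c * c) + u₆ * (c * c * c * c * c * c)
    sextic u₀ u₁ u₂ u₃ u₄ u₅ u₆ h₀ h₁ h₂ h₃ h₄ h₅ h₆ = ≤-by (h₀ ⊕ 0≤a*b h₁ (0≤b-a x≤X)
        ⊕ 0≤a*b h₂ (0≤b-a (*-mono 0≤x 0≤X x≤X x≤X)) ⊕ 0≤a*b h₃ 0≤x³ ⊕ 0≤a*b h₄ (0≤a*b 0≤x³ 0≤1-x) ⊕ 0≤a*b h₅ 0≤x⁵
        ⊕ 0≤a*b h₆ (0≤a*b 0≤x⁵ 0≤1-x)) (eq u₀ u₁ u₂ u₃ u₄ u₅ u₆ x X)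
      where
      eq : ∀ u₀ u₁ u₂ u₃ u₄ u₅ u₆ x X → let c = 1ℚ + x ; e₁ = - (u₁ + 2ℚ * u₂ + 3ℚ * u₃ + 4ℚ * u₄ + (+ 5 / 1) * u₅ + (+ 6 / 1) * u₆) ; e₂ = - (u₂ + 3ℚ * u₃ + (+ 6 / 1) * u₄ + (+ 10 / 1) * u₅ + (+ 15 / 1) * u₆) ; e₃ = u₃ + 4ℚ * u₄ + (+ 10 / 1) * u₅ + (+ 20 / 1) * u₆ ; e₄ = - (u₄ + (+ 5 / 1) * u₅ + (+ 15 / 1) * u₆) ; e₅ = u₅ + (+ 6 / 1) * u₆ ; e₆ = - u₆ in
        0ℚ + (u₀ + u₁ + u₂ + u₃ + u₄ + u₅ + u₆ - e₁ * X - e₂ * (X * X) + e₁ * (X - x) + e₂ * (X * X - x * x) +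
            (e₃ - e₄) * (x * x * x) + e₄ * (x * x * x * (1ℚ - x)) + (e₅ - e₆) * (x * x * x * (x * x)) + e₆ *
            (x * x * x * (x * x) * (1ℚ - x)))
        ≡ u₀ + u₁ * c + u₂ * (c * c) + u₃ * (c * c * c) + u₄ * (c * c * c * c) + u₅ * (c * c * c * c * c) + u₆ *
            (c * c * c * c * c * c) + (0ℚ + 0ℚ + 0ℚ + 0ℚ + 0ℚ + 0ℚ + 0ℚ)
      eq = solve-∀ ring

  Φ₀-expand : ∀ c a s → ½ * c * g₃ c - a - s ≡ - a - s + ½ * c + (- (+ 1 / 4)) * (c * c) + (+ 1 / 16) *
      (c * c * c) + (- (+ 1 / 96)) * (c * c * c * c)
  Φ₀-expand = eq
    where
    eq : ∀ c a s → ½ * c * (1ℚ - ½ * c + ½ * (½ * c * (½ * c)) - 1/6 * (½ * c * (½ * c) * (½ * c))) - a - s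
        ≡ - a - s + ½ * c + (- (+ 1 / 4)) * (c * c) + (+ 1 / 16) * (c * c * c) + (- (+ 1 / 96)) * (c * c * c * c)
    eq = solve-∀ ring

  Ψ-expand : ∀ c a s m b → ½ * c * g₃ c - a + m * (b - 1/6 * (c * c) * h₄ c) - s
      ≡ (- a - s + m * b) + ½ * c + (- (+ 1 / 4) - 1/6 * m) * (c * c) + (+ 1 / 16 + (+ 1 / 16) * m) * (c * c * c) +
      (- (+ 1 / 96) - (+ 3 / 256) * m) * (c * c * c * c) + ((+ 3 / 2048) * m) * (c * c * c * c * c) + (-
      ((+ 9 / 65536) * m)) * (c * c * c * c * c * c)
  Ψ-expand = eq
    where
    eq : ∀ c a s m b → let w = (+ 3 / 8) * c in ½ * c * (1ℚ - ½ * c + ½ * (½ * c * (½ * c)) - 1/6 * (½ * c * (½ * c) * (½ * c))) - a + m * (b - 1/6 * (c * c) * (1ℚ - w + ½ * (w * w) - 1/6 * (w * w * w) + 1/24 * (w * w * (w * w)))) - s ≡ (- a - s + m * b) + ½ * c + (- (+ 1 / 4) - 1/6 * m) * (c * c) + (+ 1 / 16 + (+ 1 / 16) * m) * (c * c * c) + (- (+ 1 / 96) - (+ 3 / 256) * m) * (c * c * c * c) + ((+ 3 / 2048) * m) * (c * c * c * c * c) + (- ((+ 9 / 65536) * m)) * (c * c * c * c * c * c)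
    eq = solve-∀ ring

  module AtPoint (x : ℚ) (0≤x : 0ℚ ≤ x) (x≤X : x ≤ + 193 / 1000) where
    private
      module Q = Poly x (+ 193 / 1000) 0≤x x≤X dec≤
    -- The margin is smallest at c = 1, so `quartic` expands around that end.
    Φ₀≥ : slackℚ ≤ Φ₀ (1ℚ + x)
    Φ₀≥ = a≤b (subst (0ℚ ≤_) (sym (Φ₀-expand (1ℚ + x) aℚ slackℚ)) (Q.quartic (- aℚ - slackℚ) ½ (- (+ 1 / 4))
        (+ 1 / 16) (- (+ 1 / 96)) dec≤ dec≤ dec≤ dec≤ dec≤))
    -- Now the linear and quadratic coefficients in x are negative, so `sextic` evaluates them at
    -- the far end c = 1.193.
    Φ₁≥ : slackℚ ≤ Φ₀ (1ℚ + x) + σmax * Ψ (1ℚ + x)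
    Φ₁≥ = a≤b (subst (0ℚ ≤_) (sym (Ψ-expand (1ℚ + x) aℚ slackℚ σmax bℚ)) (Q.sextic (- aℚ - slackℚ + σmax * bℚ) ½ (-
        (+ 1 / 4) - 1/6 * σmax) (+ 1 / 16 + (+ 1 / 16) * σmax) (- (+ 1 / 96) - (+ 3 / 256) * σmax)
        ((+ 3 / 2048) * σmax) (- ((+ 9 / 65536) * σmax)) dec≤ dec≤ dec≤ dec≤ dec≤ dec≤ dec≤))

  -- The expression is linear in s, so the ends s = 0 and s = σmax suffice; the sign of Ψ tells
  -- which is worse.
  Φ≥ : ∀ c s → 1ℚ ≤ c → c ≤ cmax → 0ℚ ≤ s → s ≤ σmax → slackℚ ≤ Φ₀ c + s * Ψ c
  Φ≥ c s 1≤c c≤ 0≤s s≤ = subst (λ c → slackℚ ≤ Φ₀ c + s * Ψ c) (e c) (go (ℚP.≤-total 0ℚ (Ψ (1ℚ + x))))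
    where
    x : ℚ
    x = c - 1ℚ
    e : ∀ c → 1ℚ + (c - 1ℚ) ≡ c
    e = solve-∀ ring
    x≤ : x ≤ + 193 / 1000
    x≤ = (c≤ ⊕ ≤-refl { - 1ℚ}) ⨾ dec≤
    module P = AtPoint x (0≤b-a 1≤c) x≤
    go : (0ℚ ≤ Ψ (1ℚ + x)) ⊎ (Ψ (1ℚ + x) ≤ 0ℚ) → slackℚ ≤ Φ₀ (1ℚ + x) + s * Ψ (1ℚ + x)
    go (inj₁ p) = P.Φ₀≥ ⨾ ≤-by (0≤a*b 0≤s p) (w (Φ₀ (1ℚ + x)) (s * Ψ (1ℚ + x)))
      where
      w : ∀ a b → a + b ≡ a + b + 0ℚ
      w = solve-∀ ring
    go (inj₂ p) = P.Φ₁≥ ⨾ ≤-by (0≤a*b (0≤b-a s≤) (neg-≤ p)) (w (Φ₀ (1ℚ + x)) (Ψ (1ℚ + x)) s σmax)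
      where
      w : ∀ f p s m → f + m * p + (m - s) * (- p) ≡ f + s * p + 0ℚ
      w = solve-∀ ring

-- The saving of one round compared with ρ ε

module RoundGain where

  open Numerics public
  import Data.Rational.Properties as ℚP
  import Data.Nat as ℕ
  import Data.Nat.Properties as ℕP

  ceiling : ∀ y M → y ≤ ι M → 0ℚ ≤ y → ∃[ m ] (m ℕ.≤ M) × (y ≤ ι m) × (ι m ≤ y + 1ℚ)
  ceiling y zero h 0≤y = 0 , ℕ.z≤n , h , ≤-reflexive ι-0 ⨾ 0≤a+b 0≤y 0≤1
  ceiling y (suc M) h 0≤y with y ≤? ι M
  ... | yes p = let (m , a , b) = ceiling y M p 0≤y in m , ℕP.m≤n⇒m≤1+n a , b
  ... | no ¬p = suc M , ℕP.≤-refl , h , ≤-reflexive (ι-suc M) ⨾ ≤-by (<⇒≤ (ℚP.≰⇒> ¬p)) (eq (ι M) y)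
    where
    eq : ∀ m y → 1ℚ + m + y ≡ y + 1ℚ + m
    eq = solve-∀ ring

  floor : ∀ y → 0ℚ ≤ y → ∃[ m ] (ι m ≤ y) × (y ≤ ι m + 1ℚ)
  floor y 0≤y with archimedes y
  ... | M , h with ceiling y M h 0≤y
  ...   | zero , _ , a , _ = 0 , (≤-reflexive ι-0 ⨾ 0≤y) , (a ⨾ ≤-by 0≤1 (eq (ι 0)))
    where
    eq : ∀ m → m + 1ℚ ≡ m + 1ℚ + 0ℚ
    eq = solve-∀ ring
  ...   | suc m , _ , a , b = m , ≤-by b (trans (eq (ι m) y) (cong (λ z → y + z) (sym (ι-suc m)))) , (a
      ⨾ ≤-reflexive (trans (ι-suc m) (ℚP.+-comm 1ℚ (ι m))))
    where
    eq : ∀ m y → m + (y + 1ℚ) ≡ y + (1ℚ + m)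
    eq = solve-∀ ring

  -- One half of the slack pays for the terms of order 1/C in `bracket`, the other is left for
  -- rounding √δ and for ξ. The bound 0.1617 exceeds 0.3012 · 0.9 - 0.1283 · 0.9^(3/2), which is
  -- about 0.1615.
  halfSlack εmax : ℚ
  halfSlack = + 4 / 10000
  εmax = + 1617 / 10000

  2/5 3/8 5/8 : ℚ
  2/5 = + 2 / 5
  3/8 = + 3 / 8
  5/8 = + 5 / 8

  -- The fraction of colours lost in a round falls short of the fraction ρ of vertices coloured by
  -- s = ½ δ c ρ² - σ δ c² Γ / 6.
  module Gain (D k : ℕ) (1≤c : 1ℚ ≤ ι D * inv k) (c≤ : ι D * inv k ≤ cmax) (i≤ : inv k ≤ halfSlack) where
    i c ρ Γ Θ : ℚ
    i = inv k
    c = ι D * i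
    ρ = (1ℚ - ½ * i) ^ D
    Γ = (1ℚ - (+ 7 / 8) * i) ^ D
    Θ = (1ℚ - 3/8 * i) ^ D
    0≤i : 0ℚ ≤ i
    0≤i = <⇒≤ (0<inv k)
    i≤1 : i ≤ 1ℚ
    i≤1 = inv≤1 k
    0≤c : 0ℚ ≤ c
    0≤c = 0≤1 ⨾ 1≤c
    c≤2 : c ≤ 2ℚ
    c≤2 = c≤ ⨾ dec≤

    private
      frac≤1 : ∀ p → 0ℚ ≤ p → p ≤ 1ℚ → p * i ≤ 1ℚ
      frac≤1 p 0≤p p≤1 = *-mono 0≤i 0≤1 p≤1 i≤1
      module B½ = PowerBounds (½ * i) (0≤a*b {½} dec≤ 0≤i) (frac≤1 ½ dec≤ dec≤)
      module B⅜ = PowerBounds (3/8 * i) (0≤a*b {3/8} dec≤ 0≤i) (frac≤1 3/8 dec≤ dec≤)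
      scale : ∀ p → ι D * (p * i) ≡ p * c
      scale p = eq (ι D) p i
        where
        eq : ∀ d p i → d * (p * i) ≡ p * (d * i)
        eq = solve-∀ ring

    0≤ρ : 0ℚ ≤ ρ
    0≤ρ = ^-nonneg D (0≤b-a (frac≤1 ½ dec≤ dec≤))

    ρ≥ : 2/5 ≤ ρ
    ρ≥ = ≤-by (((0ℚ ≤ ½ ∋ dec≤) ⊙ c≤) ⊕ (2/5 + ½ * cmax ≤ 1ℚ ∋ dec≤)) (eq c cmax)
        ⨾ ≤-reflexive (cong (λ z → 1ℚ - z) (sym (scale ½))) ⨾ B½.L1 D
      where
      eq : ∀ c m → 2/5 + (½ * m + 1ℚ) ≡ 1ℚ - ½ * c + (½ * c + (2/5 + ½ * m))
      eq = solve-∀ ring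

    ρ≤ : ρ ≤ 5/8
    ρ≤ = B½.U2 D ⨾ ≤-reflexive (cong (λ z → 1ℚ - z + ½ * (z * z)) (scale ½))
        ⨾ ≤-by (0≤a*b {+ 1 / 8} dec≤ (0≤a*b (0≤b-a 1≤c) (0≤b-a {c} {3ℚ} (c≤2 ⨾ dec≤)))) (eq c)
      where
      eq : ∀ c → 1ℚ - ½ * c + ½ * (½ * c * (½ * c)) + (+ 1 / 8) * ((c - 1ℚ) * (3ℚ - c)) ≡ 5/8 + 0ℚ
      eq = solve-∀ ring

    -- A given colour is kept by at most one neighbour on average. This is the condition under which
    -- `Saving` trades missing neighbours for missing pairs.
    cρ≤1 : i * ρ * ι D ≤ 1ℚ
    cρ≤1 = ≤-reflexive (eq i ρ (ι D)) ⨾ *-mono 0≤ρ dec≤ c≤ ρ≤ ⨾ dec≤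
      where
      eq : ∀ i r d → i * r * d ≡ d * i * r
      eq = solve-∀ ring

    -- Since 7/8 = 1/2 + 3/8, a factor ρ can be split off the triple term and cancelled when the
    -- saving is compared with ρ ε.
    Γ≤ : Γ ≤ ρ * Θ
    Γ≤ = ^-mono D (0≤b-a (frac≤1 (+ 7 / 8) dec≤ dec≤)) (≤-by (0≤a*b {+ 3 / 16} dec≤ (0≤sq i)) (eq i))
        ⨾ ≤-reflexive (^-* (1ℚ - ½ * i) (1ℚ - 3/8 * i) D)
      where
      eq : ∀ i → 1ℚ - (+ 7 / 8) * i + (+ 3 / 16) * (i * i) ≡ (1ℚ - ½ * i) * (1ℚ - 3/8 * i) + 0ℚ
      eq = solve-∀ ring

    bracket : ∀ σ → 0ℚ ≤ σ → σ ≤ σmax → aℚ - bℚ * σ + halfSlack ≤ ½ * c * ρ - 1/6 * (σ * (c * c)) * Θ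
    bracket σ 0≤σ σ≤ = ≤-by
        (Φ≥ c σ 1≤c c≤ 0≤σ σ≤ ⊕ (0≤a*b {½} dec≤ 0≤c ⊙ ρ≥g) ⊕ (0≤a*b {1/6} dec≤ (0≤a*b 0≤σ (0≤sq c)) ⊙ Θ≤h) ⊕ i≤
            ⊕ (0≤i ⊙ E≤1))
        (eq (g₃ c) (h₄ c) c σ i ρ Θ aℚ bℚ halfSlack slackℚ dec-slack)
      where
      ρ≥g : g₃ c - (+ 1 / 8) * (c * i) ≤ ρ
      ρ≥g = ≤-reflexive (trans (e c i) (cong (λ z → 1ℚ - z + ½ * (z * z) - 1/6 * (z * z * z) - ½ * (z * (½ * i)))
          (sym (scale ½)))) ⨾ B½.L3 D
        where
        e : ∀ c i → 1ℚ - ½ * c + ½ * (½ * c * (½ * c)) - 1/6 * (½ * c * (½ * c) * (½ * c)) - (+ 1 / 8) * (c * i)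
            ≡ 1ℚ - ½ * c + ½ * (½ * c * (½ * c)) - 1/6 * (½ * c * (½ * c) * (½ * c)) - ½ * (½ * c * (½ * i))
        e = solve-∀ ring
      Θ≤h : Θ ≤ h₄ c + (+ 9 / 64) * (c * i)
      Θ≤h = B⅜.U4 D (≤-reflexive (scale 3/8) ⨾ ((0ℚ ≤ 3/8 ∋ dec≤) ⊙ c≤2) ⨾ dec≤)
          ⨾ ≤-reflexive (trans (cong (λ z → 1ℚ - z + ½ * (z * z) - 1/6 * (z * z * z) + 1/24 * (z * z *
          (z * z)) + z * (3/8 * i)) (scale 3/8)) (cong (λ z → h₄ c + z) (e c i)))
        where
        e : ∀ c i → 3/8 * c * (3/8 * i) ≡ (+ 9 / 64) * (c * i)
        e = solve-∀ ring
      E≤1 : (+ 1 / 16) * (c * c) + (+ 9 / 384) * (σ * (c * c) * c) ≤ 1ℚ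
      E≤1 = (((0ℚ ≤ + 1 / 16 ∋ dec≤) ⊙ cc≤4) ⊕ ((0ℚ ≤ + 9 / 384 ∋ dec≤) ⊙ *-mono 0≤c dec≤ (*-mono (0≤sq c) 0≤1 (σ≤
          ⨾ dec≤) cc≤4) c≤2)) ⨾ dec≤
        where
        cc≤4 : c * c ≤ 4ℚ
        cc≤4 = *-mono 0≤c (dec≤ {0ℚ} {2ℚ}) c≤2 c≤2 ⨾ dec≤
      dec-slack : slackℚ ≡ halfSlack + halfSlack
      dec-slack = refl
      eq : ∀ g h c σ i r t a b hs s → s ≡ hs + hs →
        a - b * σ + hs + (½ * c * g - a + σ * (b - 1/6 * (c * c) * h) + ½ * c * r + 1/6 * (σ * (c * c)) * (h +
            (+ 9 / 64) * (c * i)) + hs + i * 1ℚ)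
        ≡ ½ * c * r - 1/6 * (σ * (c * c)) * t + (s + ½ * c * (g - (+ 1 / 8) * (c * i)) + 1/6 * (σ *
            (c * c)) * t + i + i * ((+ 1 / 16) * (c * c) + (+ 9 / 384) * (σ * (c * c) * c)))
      eq g h c σ i r t a b hs _ refl = eq′ g h c σ i r t a b hs
        where
        eq′ : ∀ g h c σ i r t a b hs →
          a - b * σ + hs + (½ * c * g - a + σ * (b - 1/6 * (c * c) * h) + ½ * c * r + 1/6 * (σ * (c * c)) * (h +
              (+ 9 / 64) * (c * i)) + hs + i * 1ℚ)
          ≡ ½ * c * r - 1/6 * (σ * (c * c)) * t + ((hs + hs) + ½ * c * (g - (+ 1 / 8) * (c * i)) + 1/6 * (σ *
              (c * c)) * t + i + i * ((+ 1 / 16) * (c * c) + (+ 9 / 384) * (σ * (c * c) * c)))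
        eq′ = solve-∀ ring

    gain : ℚ → ℚ → ℚ
    gain σ δ = ½ * (δ * c * (ρ * ρ)) - 1/6 * (σ * δ * (c * c) * Γ)

    -- Multiply the hypothesis and `bracket` by ρ. The 5 in front of ξ is chosen because ρ ≥ 2/5
    -- turns 5 ρ ξ into the required 2 ξ.
    gain≥ : ∀ σ δ ε ξ → 0ℚ ≤ σ → σ ≤ σmax → 0ℚ ≤ δ → 0ℚ ≤ ξ → ε + (+ 5 / 1) * ξ ≤ δ * (aℚ - bℚ * σ + halfSlack) →
        ρ * ε + 2ℚ * ξ ≤ gain σ δ
    gain≥ σ δ ε ξ 0≤σ σ≤ 0≤δ 0≤ξ h = ≤-by ((0≤ρ ⊙ (h ⨾ (0≤δ ⊙ bracket σ 0≤σ σ≤)))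
        ⊕ (0≤a*b {1/6} dec≤ (0≤a*b (0≤a*b 0≤σ 0≤δ) (0≤sq c)) ⊙ Γ≤)
        ⊕ (0≤a*b {+ 5 / 1} dec≤ 0≤ξ ⊙ ρ≥)) (eq ρ ε ξ δ c σ Γ Θ)
      where
      eq : ∀ r e x d c s G t → r * e + 2ℚ * x + (r * (d * (½ * c * r - 1/6 * (s * (c * c)) * t)) + 1/6 * (s * d *
          (c * c)) * (r * t) + (+ 5 / 1) * x * r)
         ≡ ½ * (d * c * (r * r)) - 1/6 * (s * d * (c * c) * G) + (r * (e + (+ 5 / 1) * x) + 1/6 * (s * d *
             (c * c)) * G + (+ 5 / 1) * x * 2/5)
      eq = solve-∀ ring

-- From one instance to the next

module InductionStep where

  open RoundGain public
  import Data.Rational.Properties as ℚP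
  import Data.Nat as ℕ
  import Data.Nat.Properties as ℕP
  import Data.Fin as Fin
  import Data.Fin.Properties as FinP

  64ℚ 9ℚ 48ℚ : ℚ
  64ℚ = + 64 / 1
  9ℚ = + 9 / 1
  48ℚ = + 48 / 1

  -- Per unit of x, the requirement (1 - ε + ξ)(1 - ρ) exceeds the supply 1 - ε - ρ + s by ρ ε + ξ
  -- (1 - ρ) - s, which is at most -ξ - ξ ρ. The surplus ξ ≥ 9 μ covers deviations and rounding.
  lists-suffice : ∀ x ρ ε ξ μ s η₁ C C′ D′ → 0ℚ ≤ x → 0ℚ ≤ ρ → 0ℚ ≤ μ → 0ℚ ≤ ξ → 0ℚ ≤ 1ℚ - ε + ξ → 1ℚ - ε + ξ ≤ 2ℚ →
    (1ℚ - ε) * x ≤ C → 1ℚ ≤ μ * x → C - (x * ρ - x * s + 1ℚ + μ * x) ≤ C′ + 1ℚ → D′ ≤ (1ℚ - ρ + η₁ + μ) * x + 1ℚ →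
        η₁ ≤ μ → ρ * ε + 2ℚ * ξ ≤ s → 9ℚ * μ ≤ ξ →
    (1ℚ - (ε - ξ)) * D′ ≤ C′
  lists-suffice x ρ ε ξ μ s η₁ C C′ D′ 0≤x 0≤ρ 0≤μ 0≤ξ 0≤f f≤2 hC h₁ hY hD hη hs hμ =
    ≤-by ((0≤f ⊙ hD) ⊕ (0≤a*b 0≤f 0≤x ⊙ hη) ⊕ (0≤f ⊙ h₁) ⊕ (0≤a*b {3ℚ} dec≤ (0≤a*b 0≤μ 0≤x) ⊙ f≤2) ⊕ hC ⊕ hY
        ⊕ ((0ℚ ≤ 2ℚ ∋ dec≤) ⊙ h₁) ⊕ (0≤x ⊙ hs) ⊕ (0≤x ⊙ hμ) ⊕ 0≤a*b (0≤a*b 0≤x 0≤ξ) 0≤ρ)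
      (eq x ρ ε ξ μ s η₁ C C′ D′)
    where
    eq : ∀ x ρ ε ξ μ s h C C′ D → let f = 1ℚ - ε + ξ in
      (1ℚ - (ε - ξ)) * D + (f * ((1ℚ - ρ + h + μ) * x + 1ℚ) + f * x * μ + f * (μ * x) + 3ℚ * (μ * x) * 2ℚ + C +
          (C′ + 1ℚ) + 2ℚ * (μ * x) + x * s + x * ξ + x * ξ * ρ)
      ≡ C′ + (f * D + f * x * h + f * 1ℚ + 3ℚ * (μ * x) * f + (1ℚ - ε) * x + (C -
          (x * ρ - x * s + 1ℚ + μ * x)) + 2ℚ * 1ℚ + x * (ρ * ε + 2ℚ * ξ) + x * (9ℚ * μ) + 0ℚ)
    eq = solve-∀ ring

  -- The main terms match because pairs shrink by (1 - ρ)², just as the squared degree bound does.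
  -- Giving up τ gains at least (3/8)² τ x², while the errors amount to at most 4 μ x² ≤ τ x² / 16;
  -- this is the origin of 64.
  pairs-suffice : ∀ x ρ δ τ μ i η₁ E P D′ → 0ℚ ≤ x → ρ ≤ 5/8 → 0ℚ ≤ μ → 0ℚ ≤ τ → 0ℚ ≤ δ → δ ≤ 1ℚ → 0ℚ ≤ i → i ≤ μ →
      0ℚ ≤ η₁ → η₁ ≤ μ → 64ℚ * μ ≤ τ →
    E ≤ (1ℚ - δ) * (x * x) → P ≤ E * ((1ℚ - ρ) * (1ℚ - ρ) + i + (η₁ + η₁)) + μ * x * x → (1ℚ - ρ) * x ≤ D′ →
        P ≤ (1ℚ - (δ - τ)) * (D′ * D′)
  pairs-suffice x ρ δ τ μ i η₁ E P D′ 0≤x ρ≤ 0≤μ 0≤τ 0≤δ δ≤1 0≤i i≤μ 0≤η₁ η₁≤μ hτ hE hP hD =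
    hP ⨾ ((hE ⊙ʳ 0≤a+b (0≤a+b (0≤sq r) 0≤i) (0≤a+b 0≤η₁ 0≤η₁)) ⊕ ≤-refl {μ * x * x}) ⨾
    ≤-by ((0≤a*b 0≤1-δ (0≤sq x) ⊙ (i≤μ ⊕ (η₁≤μ ⊕ η₁≤μ))) ⊕ (0≤a*b {3ℚ} dec≤ (0≤a*b 0≤μ (0≤sq x)) ⊙ 1-δ≤1)
        ⊕ (0≤a*b (0≤sq x) 0≤τ ⊙ r²≥) ⊕ (0≤a*b {+ 1 / 16} dec≤ (0≤sq x) ⊙ hτ)
        ⊕ (0≤a*b {+ 5 / 64} dec≤ (0≤a*b (0≤sq x) 0≤τ))) (eq x r δ τ μ i η₁)
    ⨾ (0≤a+b 0≤1-δ 0≤τ ⊙ *-mono (0≤a*b 0≤r 0≤x) (0≤a*b 0≤r 0≤x ⨾ hD) hD hD)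
        ⨾ ≤-reflexive (cong (_* (D′ * D′)) (eq₂ δ τ))
    where
    r : ℚ
    r = 1ℚ - ρ
    r≥ : 3/8 ≤ r
    r≥ = ≤-by ρ≤ (e ρ)
      where
      e : ∀ ρ → 3/8 + 5/8 ≡ 1ℚ - ρ + ρ
      e = solve-∀ ring
    0≤r : 0ℚ ≤ r
    0≤r = dec≤ ⨾ r≥
    r²≥ : 3/8 * 3/8 ≤ r * r
    r²≥ = *-mono dec≤ 0≤r r≥ r≥
    0≤1-δ : 0ℚ ≤ 1ℚ - δ
    0≤1-δ = 0≤b-a δ≤1
    1-δ≤1 : 1ℚ - δ ≤ 1ℚ
    1-δ≤1 = 1-a≤1 0≤δ
    eq₂ : ∀ d t → 1ℚ - d + t ≡ 1ℚ - (d - t)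
    eq₂ = solve-∀ ring
    eq : ∀ x r δ τ μ i h → (1ℚ - δ) * (x * x) * (r * r + i + (h + h)) + μ * x * x + ((1ℚ - δ) * (x * x) * (μ +
        (μ + μ)) + 3ℚ * (μ * (x * x)) * 1ℚ + x * x * τ * (r * r) + (+ 1 / 16) * (x * x) * τ + (+ 5 / 64) *
        (x * x * τ))
       ≡ (1ℚ - δ + τ) * (r * x * (r * x)) + ((1ℚ - δ) * (x * x) * (i + (h + h)) + 3ℚ * (μ * (x * x)) *
           (1ℚ - δ) + x * x * τ * (3/8 * 3/8) + (+ 1 / 16) * (x * x) * (64ℚ * μ) + 0ℚ)
    eq = solve-∀ ring

  -- The exponent 6 leaves y² after the dependency factor x⁴ is cancelled, and x y² = y ≤ 1.
  failure-small : ∀ M B y x → 0ℚ ≤ M → x * y ≡ 1ℚ → 1ℚ ≤ x → 0ℚ ≤ y → 48ℚ * (M * B ^ 6) ≤ x →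
      48ℚ * (M * (B * y) ^ 6) * (x * x * (x * x)) ≤ 1ℚ
  failure-small M B y x 0≤M xy 1≤x 0≤y h = ≤-reflexive (trans (eq M B y x) (cong (λ z →
      48ℚ * (M * B ^ 6) * (y * y) * (z * z * (z * z))) xy)) ⨾ ((h ⊙ʳ 0≤a*b 0≤y 0≤y) ⊙ʳ dec≤)
      ⨾ ≤-reflexive (trans (eq₂ x y) (trans (cong (_* y) xy) (ℚP.*-identityˡ y)))
          ⨾ (≤-reflexive (sym (ℚP.*-identityˡ y)) ⨾ (1≤x ⊙ʳ 0≤y) ⨾ ≤-reflexive xy)
    where
    eq : ∀ M B y x → 48ℚ * (M * ((B * y) * ((B * y) * ((B * y) * ((B * y) * ((B * y) * ((B * y) * 1ℚ))))))) *
        (x * x * (x * x)) ≡ 48ℚ * (M * (B * (B * (B * (B * (B * (B * 1ℚ))))))) * (y * y) * (x * y * (x * y) *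
        (x * y * (x * y)))
    eq = solve-∀ ring
    eq₂ : ∀ x y → x * (y * y) * (1ℚ * 1ℚ * (1ℚ * 1ℚ)) ≡ x * y * y
    eq₂ = solve-∀ ring

  -- Used with e = εmax, s = σmax, h = halfSlack, a = aℚ and b = bℚ.
  record StepData (e s h a b : ℚ) : Set where
    field
      ε δ σ ξ τ μ : ℚ
      0≤ε : 0ℚ ≤ ε
      ε≤ : ε ≤ e
      0≤δ : 0ℚ ≤ δ
      δ≤1 : δ ≤ 1ℚ
      0≤σ : 0ℚ ≤ σ
      σ≤ : σ ≤ s
      δ≤σ² : δ ≤ σ * σ
      0≤ξ : 0ℚ ≤ ξ
      ξ≤1 : ξ ≤ 1ℚ
      0≤τ : 0ℚ ≤ τ
      0<μ : 0ℚ < μ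
      μ≤ : μ ≤ h
      H : ε + (ξ + ξ + ξ + ξ + ξ) ≤ δ * (a - b * σ + h)

  module Step (d : StepData εmax σmax halfSlack aℚ bℚ) (next : Col (StepData.ε d - StepData.ξ d)
      (StepData.δ d - StepData.τ d))
    (μ≤ξ : 64ℚ * StepData.μ d ≤ StepData.ξ d) (μ≤τ : 64ℚ * StepData.μ d ≤ StepData.τ d) where
    open StepData d

    private
      0≤μ : 0ℚ ≤ μ
      0≤μ = <⇒≤ 0<μ
      ζ : ℚ
      ζ = proj₁ (recip μ 0<μ)
      0<ζ : 0ℚ < ζ
      0<ζ = proj₁ (proj₂ (recip μ 0<μ))
      μζ : μ * ζ ≡ 1ℚ
      μζ = proj₂ (proj₂ (recip μ 0<μ))
      K₀ K : ℕ
      -- The truncation error is (1 + c) / (K + 1) with 1 + c ≤ 3; a multiple of 3 / μ brings it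
      -- below μ.
      K₀ = proj₁ (archimedes (3ℚ * ζ))
      K = suc K₀
      K₀≥ : 3ℚ * ζ ≤ ι K₀
      K₀≥ = proj₂ (archimedes (3ℚ * ζ))
      K≥ : 3ℚ * ζ ≤ ι (suc K)
      K≥ = K₀≥ ⨾ ι-mono (ℕP.m≤n⇒m≤1+n (ℕP.n≤1+n K₀))
      1≤K : 1ℚ ≤ ι K
      1≤K = ≤-reflexive (sym ι-1) ⨾ ι-mono (ℕ.s≤s ℕ.z≤n)
      3K≤μ : inv K * 3ℚ ≤ μ
      3K≤μ = ≤-reflexive (trans (sym (ℚP.*-identityʳ (inv K * 3ℚ))) (trans (cong (inv K * 3ℚ *_) (sym μζ)) (e
          (inv K) μ ζ))) ⨾ (0≤a*b 0≤μ (<⇒≤ (0<inv K)) ⊙ K≥) ⨾ ≤-reflexive (trans (ℚP.*-assoc μ (inv K) (ι (suc K)))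
          (trans (cong (μ *_) (inv-eq K)) (ℚP.*-identityʳ μ)))
        where
        e : ∀ k m z → k * 3ℚ * (m * z) ≡ m * k * (3ℚ * z)
        e = solve-∀ ring
      M Bq W : ℚ
      M = momentCoeff 6
      Bq = 192ℚ * (ι K * ι K) * (ζ * ζ)
      W = 48ℚ * (M * Bq ^ 6)
      0≤M : 0ℚ ≤ M
      0≤M = 0≤momentCoeff 6
      0≤W : 0ℚ ≤ W
      0≤W = 0≤a*b {48ℚ} dec≤ (0≤a*b 0≤M (^-nonneg 6 (0≤a*b (0≤a*b {192ℚ} dec≤ (0≤sq (ι K))) (0≤sq ζ))))
      D₁ : ℕ
      D₁ = proj₁ next
      T₀ : ℚ
      -- One summand for each demand: D ≥ 1, then μ D ≥ 2 against rounding, a failure probability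
      -- small enough for the local lemma, and a residual bound D′ ≥ 3 D / 8 that is at least `D₁`.
      T₀ = 1ℚ + 2ℚ * ζ + W + 3ℚ * ι D₁
      N₀ : ℕ
      N₀ = proj₁ (archimedes T₀)

      module Large (D : ℕ) (N₀≤D : N₀ ℕ.≤ D) {n} (G : Graph n) (deg≤ : ∀ v → degℚ G v ≤ ι D) (pairs≤ : ∀ v →
          nbhdPairs G v ≤ (1ℚ - δ) * (ι D * ι D)) where
        x : ℚ
        x = ι D
        T≤x : T₀ ≤ x
        T≤x = proj₂ (archimedes T₀) ⨾ ι-mono N₀≤D
        0≤2ζ : 0ℚ ≤ 2ℚ * ζ
        0≤2ζ = 0≤a*b {2ℚ} dec≤ (<⇒≤ 0<ζ)
        0≤3D₁ : 0ℚ ≤ 3ℚ * ι D₁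
        0≤3D₁ = 0≤a*b {3ℚ} dec≤ (0≤ι D₁)
        1≤x : 1ℚ ≤ x
        1≤x = ≤-by (0≤2ζ ⊕ 0≤W ⊕ 0≤3D₁) (e (2ℚ * ζ) W (3ℚ * ι D₁)) ⨾ T≤x
          where
          e : ∀ a b c → 1ℚ + (a + b + c) ≡ 1ℚ + a + b + c + (0ℚ + 0ℚ + 0ℚ)
          e = solve-∀ ring
        2ζ≤x : 2ℚ * ζ ≤ x
        2ζ≤x = ≤-by (0≤1 ⊕ 0≤W ⊕ 0≤3D₁) (e (2ℚ * ζ) W (3ℚ * ι D₁)) ⨾ T≤x
          where
          e : ∀ a b c → a + (1ℚ + b + c) ≡ 1ℚ + a + b + c + (0ℚ + 0ℚ + 0ℚ)
          e = solve-∀ ring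
        W≤x : W ≤ x
        W≤x = ≤-by (0≤1 ⊕ 0≤2ζ ⊕ 0≤3D₁) (e (2ℚ * ζ) W (3ℚ * ι D₁)) ⨾ T≤x
          where
          e : ∀ a b c → b + (1ℚ + a + c) ≡ 1ℚ + a + b + c + (0ℚ + 0ℚ + 0ℚ)
          e = solve-∀ ring
        3D₁≤x : 3ℚ * ι D₁ ≤ x
        3D₁≤x = ≤-by (0≤1 ⊕ 0≤2ζ ⊕ 0≤W) (e (2ℚ * ζ) W (3ℚ * ι D₁)) ⨾ T≤x
          where
          e : ∀ a b c → c + (1ℚ + a + b) ≡ 1ℚ + a + b + c + (0ℚ + 0ℚ + 0ℚ)
          e = solve-∀ ring
        0≤x : 0ℚ ≤ x
        0≤x = 0≤ι D
        0<x : 0ℚ < x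
        0<x = <-≤-trans {0ℚ} {1ℚ} dec< 1≤x
        2≤μx : 2ℚ ≤ μ * x
        2≤μx = ≤-reflexive (trans (sym (ℚP.*-identityʳ 2ℚ)) (trans (cong (2ℚ *_) (sym μζ)) (e μ ζ))) ⨾ (0≤μ ⊙ 2ζ≤x)
          where
          e : ∀ m z → 2ℚ * (m * z) ≡ m * (2ℚ * z)
          e = solve-∀ ring
        1≤μx : 1ℚ ≤ μ * x
        1≤μx = dec≤ ⨾ 2≤μx
        yx : ℚ
        yx = proj₁ (recip x 0<x)
        0<yx : 0ℚ < yx
        0<yx = proj₁ (proj₂ (recip x 0<x))
        xyx : x * yx ≡ 1ℚ
        xyx = proj₂ (proj₂ (recip x 0<x))

        module Lists (k : ℕ) (L : Fin n → Fin (suc k) → ℕ) (L-inj : Injective L) (C≥ : (1ℚ - ε) * x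
            ≤ ι (suc k)) (C≤x : ι (suc k) ≤ x) where
          i c : ℚ
          i = inv k
          c = x * i
          0≤i : 0ℚ ≤ i
          0≤i = <⇒≤ (0<inv k)
          1≤c : 1ℚ ≤ c
          1≤c = ≤-reflexive (trans (sym (inv-eq k)) (ℚP.*-comm i (ι (suc k)))) ⨾ (C≤x ⊙ʳ 0≤i)
          c′≤1 : (1ℚ - ε) * c ≤ 1ℚ
          c′≤1 = ≤-reflexive (sym (ℚP.*-assoc (1ℚ - ε) x i)) ⨾ (C≥ ⊙ʳ 0≤i)
              ⨾ ≤-reflexive (trans (ℚP.*-comm (ι (suc k)) i) (inv-eq k))
          c≤ : c ≤ cmax
          c≤ = ⊙-cancel {c = 1ℚ - εmax} dec< (((≤-refl {1ℚ} ⊕ neg-≤ ε≤) ⊙ʳ (0≤1 ⨾ 1≤c)) ⨾ c′≤1 ⨾ dec≤)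
          c≤2 : c ≤ 2ℚ
          c≤2 = c≤ ⨾ dec≤
          i≤μ : i ≤ μ
          i≤μ = ⊙-cancel {c = 2ℚ} dec< (≤-reflexive (ℚP.*-comm 2ℚ i) ⨾ (0≤i ⊙ 2≤μx) ⨾ ≤-reflexive (e i μ x)
              ⨾ (0≤μ ⊙ c≤2) ⨾ ≤-reflexive (ℚP.*-comm μ 2ℚ))
            where
            e : ∀ i m x → i * (m * x) ≡ m * (x * i)
            e = solve-∀ ring
          open Gain D k 1≤c c≤ (i≤μ ⨾ μ≤) using (ρ; ρ≥; ρ≤; 0≤ρ; cρ≤1; gain; gain≥; Γ)
          η₁ p₀ s ℓ : ℚ
          η₁ = inv K * (1ℚ + x * i)
          p₀ = M * (192ℚ * (ι K * ι K) * (ζ * ζ * yx)) ^ 6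
          s = gain σ δ
          ℓ = x * ρ - x * s + 1ℚ + μ * x
          η₁≤μ : η₁ ≤ μ
          η₁≤μ = (<⇒≤ (0<inv K) ⊙ ((≤-refl {1ℚ} ⊕ c≤2) ⨾ dec≤)) ⨾ 3K≤μ
          0≤η₁ : 0ℚ ≤ η₁
          0≤η₁ = 0≤a*b (<⇒≤ (0<inv K)) (0≤a+b 0≤1 (0≤1 ⨾ 1≤c))
          p₀-eq : p₀ ≡ M * (Bq * yx) ^ 6
          p₀-eq = cong (λ z → M * z ^ 6) (sym (ℚP.*-assoc (192ℚ * (ι K * ι K)) (ζ * ζ) yx))
          hs : ρ * ε + 2ℚ * ξ ≤ s
          hs = gain≥ σ δ ε ξ 0≤σ σ≤ 0≤δ 0≤ξ (≤-reflexive (five ε ξ) ⨾ H)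
            where
            five : ∀ ε ξ → ε + (+ 5 / 1) * ξ ≡ ε + (ξ + ξ + ξ + ξ + ξ)
            five = solve-∀ ring
          dTop : ℚ
          dTop = (1ℚ - ρ + η₁ + μ) * x
          0≤1-ρ : 0ℚ ≤ 1ℚ - ρ
          0≤1-ρ = 0≤b-a {ρ} {1ℚ} (ρ≤ ⨾ dec≤)
          0≤dTop : 0ℚ ≤ dTop
          0≤dTop = 0≤a*b (0≤a+b (0≤a+b 0≤1-ρ 0≤η₁) 0≤μ) 0≤x
          D′-res : ∃[ m ] (m ℕ.≤ proj₁ (archimedes dTop)) × (dTop ≤ ι m) × (ι m ≤ dTop + 1ℚ)
          D′-res = ceiling dTop (proj₁ (archimedes dTop)) (proj₂ (archimedes dTop)) 0≤dTop
          D′ : ℕ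
          D′ = proj₁ D′-res
          dTop≤D′ : dTop ≤ ι D′
          dTop≤D′ = proj₁ (proj₂ (proj₂ D′-res))
          D′≤ : ι D′ ≤ dTop + 1ℚ
          D′≤ = proj₂ (proj₂ (proj₂ D′-res))
          0≤f : 0ℚ ≤ 1ℚ - ε + ξ
          0≤f = 0≤a+b (0≤b-a {ε} {1ℚ} (ε≤ ⨾ dec≤)) 0≤ξ
          f≤2 : 1ℚ - ε + ξ ≤ 2ℚ
          f≤2 = ≤-by (0≤ε ⊕ ξ≤1) (e ε ξ)
            where
            e : ∀ e x → 1ℚ - e + x + (e + 1ℚ) ≡ 2ℚ + (0ℚ + x)
            e = solve-∀ ring
          9μ≤ξ : 9ℚ * μ ≤ ξ
          9μ≤ξ = ((9ℚ ≤ 64ℚ ∋ dec≤) ⊙ʳ 0≤μ) ⨾ μ≤ξ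
          lists-ok : ∀ C′ → ι (suc k) - ℓ ≤ C′ + 1ℚ → (1ℚ - (ε - ξ)) * ι D′ ≤ C′
          lists-ok C′ h = lists-suffice x ρ ε ξ μ s η₁ (ι (suc k)) C′
              (ι D′) 0≤x 0≤ρ 0≤μ 0≤ξ 0≤f f≤2 C≥ 1≤μx h D′≤ η₁≤μ hs 9μ≤ξ
          0≤Yq : 0ℚ ≤ ι (suc k) - ℓ
          -- The list estimate applied to the unrounded number of remaining colours shows that it is
          -- nonnegative, so it can be rounded down.
          0≤Yq = ≤-by (lists-ok (ι (suc k) - ℓ) (≤-by 0≤1 (e (ι (suc k) - ℓ)))
              ⊕ 0≤a*b 0≤f (0≤ι D′)) (e₂ (ι (suc k) - ℓ) ε ξ (ι D′))
            where
            e : ∀ a → a + 1ℚ ≡ a + 1ℚ + 0ℚ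
            e = solve-∀ ring
            e₂ : ∀ y ε ξ d → 0ℚ + (y + (1ℚ - ε + ξ) * d) ≡ y + ((1ℚ - (ε - ξ)) * d + 0ℚ)
            e₂ = solve-∀ ring
          C′-res : ∃[ m ] (ι m ≤ ι (suc k) - ℓ) × (ι (suc k) - ℓ ≤ ι m + 1ℚ)
          C′-res = floor (ι (suc k) - ℓ) 0≤Yq
          C′ : ℕ
          C′ = proj₁ C′-res
          fits : x * ρ - ½ * (δ * (x * (x * i)) * (ρ * ρ)) + 1/6 * (σ * δ * (x * (x * i) *
              (x * i)) * Γ) + 1ℚ + μ * x + ι C′ ≤ ι (suc k)
          fits = ≤-by (proj₁ (proj₂ C′-res)) (e x ρ δ c σ Γ μ (ι C′) (ι (suc k)))
            where
            e : ∀ x r d c s G m C′ C → x * r - ½ * (d * (x * c) * (r * r)) + 1/6 * (s * d *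
                (x * c * c) * G) + 1ℚ + m * x + C′ + (C - (x * r - x * (½ * (d * c * (r * r)) - 1/6 * (s * d *
                (c * c) * G)) + 1ℚ + m * x)) ≡ C + C′
            e = solve-∀ ring
          residual : Σ (Graph n) λ G′ → Σ (Fin n → Fin C′ → ℕ) λ L′ → Injective L′ × (∀ v →
              degℚ G′ v ≤ x * (1ℚ - ρ + η₁) + μ * x) ×
            (∀ v → nbhdPairs G′ v ≤ nbhdPairs G v * ((1ℚ - ρ) * (1ℚ - ρ) + i + (η₁ + η₁)) + μ * x * x) ×
                (ListColouring G′ C′ L′ → ListColouring G (suc k) L)
          residual = one-round G k D K L L-inj deg≤ 6 μ ζ yx 0<μ μζ xyx 1≤x 1≤K c≤2
            (≤-reflexive (cong (λ z → 48ℚ * z * (x * x * (x * x))) p₀-eq)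
                ⨾ failure-small M Bq yx x 0≤M xyx 1≤x (<⇒≤ 0<yx) W≤x)
            (subst (0ℚ ≤_) (sym p₀-eq) (0≤a*b 0≤M (^-nonneg 6 (0≤a*b (0≤a*b (0≤a*b {192ℚ} dec≤ (0≤sq (ι K)))
                (0≤sq ζ)) (<⇒≤ 0<yx)))))
            δ σ 0≤δ 0≤σ δ≤σ² pairs≤ cρ≤1 C′ fits
          G′ : Graph n
          G′ = proj₁ residual
          L′ : Fin n → Fin C′ → ℕ
          L′ = proj₁ (proj₂ residual)
          L′-inj : Injective L′
          L′-inj = proj₁ (proj₂ (proj₂ residual))
          deg-ok : ∀ v → degℚ G′ v ≤ ι D′
          deg-ok v = proj₁ (proj₂ (proj₂ (proj₂ residual))) v ⨾ ≤-reflexive (e x ρ η₁ μ) ⨾ dTop≤D′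
            where
            e : ∀ x r h m → x * (1ℚ - r + h) + m * x ≡ (1ℚ - r + h + m) * x
            e = solve-∀ ring
          1-ρ≤D′ : (1ℚ - ρ) * x ≤ ι D′
          1-ρ≤D′ = (≤-by {l = 1ℚ - ρ} {r = 1ℚ - ρ + η₁ + μ} (0≤η₁ ⊕ 0≤μ) (e (1ℚ - ρ) η₁ μ) ⊙ʳ 0≤x) ⨾ dTop≤D′
            where
            e : ∀ a b c → a + (b + c) ≡ a + b + c + (0ℚ + 0ℚ)
            e = solve-∀ ring
          pairs-ok : ∀ v → nbhdPairs G′ v ≤ (1ℚ - (δ - τ)) * (ι D′ * ι D′)
          pairs-ok v = pairs-suffice x ρ δ τ μ i η₁ (nbhdPairs G v) (nbhdPairs G′ v)
              (ι D′) 0≤x ρ≤ 0≤μ 0≤τ 0≤δ δ≤1 0≤i i≤μ 0≤η₁ η₁≤μ μ≤τ (pairs≤ v)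
            (proj₁ (proj₂ (proj₂ (proj₂ (proj₂ residual)))) v) 1-ρ≤D′
          D₁≤D′ : D₁ ℕ.≤ D′
          D₁≤D′ = ι-cancel (≤-by (0≤a*b {+ 1 / 8} dec≤ (0≤ι D₁) ⊕ ((0ℚ ≤ 3/8 ∋ dec≤) ⊙ 3D₁≤x)) (e (ι D₁) x)
              ⨾ (r≥ ⊙ʳ 0≤x) ⨾ 1-ρ≤D′)
            where
            e : ∀ d x → d + ((+ 1 / 8) * d + 3/8 * x) ≡ 3/8 * x + (0ℚ + 3/8 * (3ℚ * d))
            e = solve-∀ ring
            r≥ : 3/8 ≤ 1ℚ - ρ
            r≥ = ≤-by ρ≤ (e′ ρ)
              where
              e′ : ∀ ρ → 3/8 + 5/8 ≡ 1ℚ - ρ + ρ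
              e′ = solve-∀ ring
          colouring : ListColouring G (suc k) L
          colouring = proj₂ (proj₂ (proj₂ (proj₂ (proj₂ residual)))) (proj₂ next D′ D₁≤D′ G′ C′ L′ L′-inj deg-ok
              (lists-ok (ι C′) (proj₂ (proj₂ C′-res))) pairs-ok)

    step : Col ε δ
    step = N₀ , result
      where
      result : ∀ D → N₀ ℕ.≤ D → ∀ {n} (G : Graph n) C (L : Fin n → Fin C → ℕ) → Injective L → (∀ v → degℚ G v ≤ ι D) →
         (1ℚ - ε) * ι D ≤ ι C → (∀ v → nbhdPairs G v ≤ (1ℚ - δ) * (ι D * ι D)) → ListColouring G C L
      result D N₀≤D {n} G C L inj deg≤ C≥ pairs≤ = go (proj₁ size) (proj₂ size)
        where
        module Lg = Large D N₀≤D G deg≤ pairs≤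
        0<1-ε : 0ℚ < 1ℚ - ε
        0<1-ε = <-by (≤-<-trans ε≤ (εmax < 1ℚ ∋ dec<)) (e ε)
          where
          e : ∀ a → 0ℚ + 1ℚ ≡ 1ℚ - a + a
          e = solve-∀ ring
        y≤x : (1ℚ - ε) * ι D ≤ ι D
        y≤x = ≤-by (0≤a*b 0≤ε (0≤ι D)) (e ε (ι D))
          where
          e : ∀ a x → (1ℚ - a) * x + a * x ≡ x + 0ℚ
          e = solve-∀ ring
        y≤min : (1ℚ - ε) * ι D ≤ ι (C ℕ.⊓ D)
        y≤min = [ (λ e → subst (λ m → (1ℚ - ε) * ι D ≤ ι m) (sym e) C≥) , (λ e → subst (λ m →
            (1ℚ - ε) * ι D ≤ ι m) (sym e) y≤x) ]′ (ℕP.⊓-sel C D)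
        size : ∃[ m ] (m ℕ.≤ C ℕ.⊓ D) × ((1ℚ - ε) * ι D ≤ ι m) × (ι m ≤ (1ℚ - ε) * ι D + 1ℚ)
        -- Lists are first cut down, in any case to at most D colours, because the numerical
        -- estimates require c ≥ 1.
        size = ceiling ((1ℚ - ε) * ι D) (C ℕ.⊓ D) y≤min (0≤a*b (<⇒≤ 0<1-ε) (0≤ι D))
        go : ∀ m → (m ℕ.≤ C ℕ.⊓ D) × ((1ℚ - ε) * ι D ≤ ι m) × (ι m ≤ (1ℚ - ε) * ι D + 1ℚ) → ListColouring G C L
        go zero (_ , h , _) = ⊥-elim (ℚP.<-irrefl refl (<-≤-trans (0<a*b 0<1-ε Lg.0<x) (h ⨾ ≤-reflexive ι-0)))
        go (suc k) (h₁ , h₂ , _) = let (c , l , p) = col in c , (λ v → Fin.inject≤ (proj₁ (l v)) m≤C , proj₂ (l v)) , p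
          where
          m≤C : suc k ℕ.≤ C
          m≤C = ℕP.≤-trans h₁ (ℕP.m⊓n≤m C D)
          L₀ : Fin n → Fin (suc k) → ℕ
          L₀ v i = L v (Fin.inject≤ i m≤C)
          col : ListColouring G (suc k) L₀
          col = Lg.Lists.colouring k L₀ (λ v i j e → FinP.inject≤-injective m≤C m≤C i j (inj v _ _ e)) h₂ (ι-mono
              (ℕP.≤-trans h₁ (ℕP.m⊓n≤n C D)))

-- Iterating the rounds and choosing the constants

module Thresholds where

  open InductionStep public
  import Data.Rational.Properties as ℚP
  import Data.Nat as ℕ
  import Data.Nat.Properties as ℕP

  col-base : ∀ ε δ → ε < 0ℚ → Col ε δ
  col-base ε δ ε<0 = 1 , λ D 1≤D G C L inj deg≤ C≥ _ → greedy G C L inj (λ v →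
      ≤-<-trans (deg≤ v) (<-≤-trans (lt D 1≤D) C≥))
    where
    lt : ∀ D → 1 ℕ.≤ D → ι D < (1ℚ - ε) * ι D
    lt D 1≤D = <-by (0<a*b (ℚP.neg-antimono-< ε<0) (<-≤-trans {0ℚ} {1ℚ} dec< (≤-reflexive (sym ι-1)
        ⨾ ι-mono 1≤D))) (e ε (ι D))
      where
      e : ∀ a x → x + (- a) * x ≡ (1ℚ - a) * x + 0ℚ
      e = solve-∀ ring

  -- Both ε and δ drop by ξ in a round. The final hypothesis survives because the drop of δ costs ξ
  -- g ≤ ξ on the right, while the left falls by ξ; one `σ` serves all rounds, as δ only decreases.
  iterate : ∀ σ ξ → 0ℚ ≤ σ → σ ≤ σmax → 0ℚ < ξ → ξ ≤ halfSlack → ∀ N ε δ → ε < ι N * ξ → ε ≤ εmax → 0ℚ ≤ δ → δ ≤ 1ℚ →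
      δ ≤ σ * σ →
    ε + (+ 5 / 1) * ξ ≤ δ * (aℚ - bℚ * σ + halfSlack) → Col ε δ
  iterate σ ξ 0≤σ σ≤ 0<ξ ξ≤ = go
    where
    0≤ξ : 0ℚ ≤ ξ
    0≤ξ = <⇒≤ 0<ξ
    g μ : ℚ
    g = aℚ - bℚ * σ + halfSlack
    μ = (+ 1 / 64) * ξ
    g≤1 : g ≤ 1ℚ
    g≤1 = ≤-by (0≤a*b {bℚ} dec≤ 0≤σ ⊕ (aℚ + halfSlack ≤ 1ℚ ∋ dec≤)) (e aℚ (bℚ * σ) halfSlack)
      where
      e : ∀ a b h → a - b + h + (b + 1ℚ) ≡ 1ℚ + (0ℚ + (a + h))
      e = solve-∀ ring
    0<μ : 0ℚ < μ
    0<μ = 0<a*b {+ 1 / 64} dec< 0<ξ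
    64μ : 64ℚ * μ ≤ ξ
    64μ = ≤-reflexive (e ξ)
      where
      e : ∀ x → 64ℚ * ((+ 1 / 64) * x) ≡ x
      e = solve-∀ ring
    μ≤ : μ ≤ halfSlack
    μ≤ = ((+ 1 / 64 ≤ 1ℚ ∋ dec≤) ⊙ʳ 0≤ξ) ⨾ ≤-reflexive (ℚP.*-identityˡ ξ) ⨾ ξ≤
    go : ∀ N ε δ → ε < ι N * ξ → ε ≤ εmax → 0ℚ ≤ δ → δ ≤ 1ℚ → δ ≤ σ * σ → ε + (+ 5 / 1) * ξ ≤ δ * g → Col ε δ
    go zero ε δ h _ _ _ _ _ = col-base ε δ (subst (ε <_) (trans (cong (_* ξ) ι-0) (ℚP.*-zeroˡ ξ)) h)
    go (suc N) ε δ h ε≤ 0≤δ δ≤1 δ≤σ² H = by-sign (ε <? 0ℚ)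
      where
      sub : ∀ a → a - ξ ≤ a
      sub a = ≤-by 0≤ξ (e a ξ)
        where
        e : ∀ a x → a - x + x ≡ a + 0ℚ
        e = solve-∀ ring
      0≤δ-ξ : 0ℚ ≤ ε → 0ℚ ≤ δ - ξ
      0≤δ-ξ 0≤ε = ≤-by (H ⊕ (0≤δ ⊙ g≤1) ⊕ 0≤ε ⊕ 0≤a*b {4ℚ} dec≤ 0≤ξ) (e ε ξ δ g)
        where
        e : ∀ ε ξ δ g → 0ℚ + (δ * g + δ * 1ℚ + ε + 4ℚ * ξ) ≡ δ - ξ + (ε + (+ 5 / 1) * ξ + δ * g + 0ℚ + 0ℚ)
        e = solve-∀ ring
      ε-ξ< : ε - ξ < ι N * ξ
      ε-ξ< = <-by h (trans (cong (λ z → ε - ξ + z * ξ) (ι-suc N)) (e ε ξ (ι N)))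
        where
        e : ∀ ε ξ n → ε - ξ + (1ℚ + n) * ξ ≡ n * ξ + ε
        e = solve-∀ ring
      H′ : ε - ξ + (+ 5 / 1) * ξ ≤ (δ - ξ) * g
      H′ = ≤-by (H ⊕ (0≤ξ ⊙ g≤1)) (e ε ξ δ g)
        where
        e : ∀ ε ξ δ g → ε - ξ + (+ 5 / 1) * ξ + (δ * g + ξ * 1ℚ) ≡ (δ - ξ) * g + (ε + (+ 5 / 1) * ξ + ξ * g)
        e = solve-∀ ring
      five : ∀ ε ξ → ε + (+ 5 / 1) * ξ ≡ ε + (ξ + ξ + ξ + ξ + ξ)
      five = solve-∀ ring
      by-sign : Dec (ε < 0ℚ) → Col ε δ
      by-sign (yes ε<0) = col-base ε δ ε<0
      by-sign (no ε≮0) = Step.step (record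
        { ε = ε ; δ = δ ; σ = σ ; ξ = ξ ; τ = ξ ; μ = μ ; 0≤ε = ℚP.≮⇒≥ ε≮0 ; ε≤ = ε≤ ; 0≤δ = 0≤δ ; δ≤1 = δ≤1 ; 0≤σ =
            0≤σ ; σ≤ = σ≤
        ; δ≤σ² = δ≤σ² ; 0≤ξ = 0≤ξ ; ξ≤1 = ξ≤ ⨾ dec≤ ; 0≤τ = 0≤ξ ; 0<μ = 0<μ ; μ≤ = μ≤ ; H = ≤-reflexive (sym
            (five ε ξ)) ⨾ H })
        (go N (ε - ξ) (δ - ξ) ε-ξ< (sub ε ⨾ ε≤) (0≤δ-ξ (ℚP.≮⇒≥ ε≮0)) (sub δ ⨾ δ≤1) (sub δ ⨾ δ≤σ²) H′) 64μ 64μ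

  gridStep : ℚ
  gridStep = + 1 / 10000

  crossing : ∀ (f : ℕ → ℚ) y J → f 0 ≤ y → y < f J → ∃[ j ] (suc j ℕ.≤ J) × (f j ≤ y) × (y ≤ f (suc j))
  crossing f y zero h₀ h = ⊥-elim (ℚP.<-irrefl refl (≤-<-trans h₀ h))
  crossing f y (suc J) h₀ h with y <? f J
  ... | yes p = let (j , a , b) = crossing f y J h₀ p in j , ℕP.m≤n⇒m≤1+n a , b
  ... | no ¬p = J , ℕP.≤-refl , ℚP.≮⇒≥ ¬p , <⇒≤ h

  -- Lists of size (1 - δ (a - b σ′) - ξ) D suffice, where σ′ is a rational just below √δ.
  module Threshold (δ : ℚ) (0<δ : 0ℚ < δ) (δ≤ : δ ≤ + 9 / 10) where
    0≤δ : 0ℚ ≤ δ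
    0≤δ = <⇒≤ 0<δ
    J : ℕ
    -- The first grid point 0.9487 whose square exceeds 0.9.
    J = 9487
    private
      top : δ < ι J * gridStep * (ι J * gridStep)
      top = ≤-<-trans δ≤ (subst (λ z → + 9 / 10 < z * gridStep * (z * gridStep)) (sym (ι-def J)) dec<)
      br : ∃[ j ] (suc j ℕ.≤ J) × (ι j * gridStep * (ι j * gridStep) ≤ δ) × (δ
          ≤ ι (suc j) * gridStep * (ι (suc j) * gridStep))
      br = crossing (λ j → ι j * gridStep * (ι j * gridStep)) δ J (≤-reflexive (trans (cong (λ z →
          z * gridStep * (z * gridStep)) ι-0) refl) ⨾ 0≤δ) top
      j : ℕ
      j = proj₁ br
    θ σ′ σ ξ ε : ℚ
    -- Small enough that 6 ξ and the grid error bℚ δ / 10000 together fit into the half slack times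
    -- δ.
    θ = + 1 / 30000
    σ′ = ι j * gridStep
    σ = ι (suc j) * gridStep
    ξ = θ * δ
    ε = δ * (aℚ - bℚ * σ′) + ξ
    0≤σ : 0ℚ ≤ σ
    0≤σ = 0≤a*b {_} {gridStep} (0≤ι (suc j)) dec≤
    σ′²≤δ : σ′ * σ′ ≤ δ
    σ′²≤δ = proj₁ (proj₂ (proj₂ br))
    δ≤σ² : δ ≤ σ * σ
    δ≤σ² = proj₂ (proj₂ (proj₂ br))
    σ≤ : σ ≤ σmax
    σ≤ = (ι-mono (proj₁ (proj₂ br)) ⊙ʳ (0ℚ ≤ gridStep ∋ dec≤)) ⨾ subst (λ z →
        z * gridStep ≤ σmax) (sym (ι-def J)) dec≤
    σ≡ : σ ≡ σ′ + gridStep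
    σ≡ = trans (cong (_* gridStep) (ι-suc j)) (e (ι j) gridStep)
      where
      e : ∀ z g → (1ℚ + z) * g ≡ z * g + g
      e = solve-∀ ring
    0<ξ : 0ℚ < ξ
    0<ξ = 0<a*b {θ} dec< 0<δ
    ξ≤ : ξ ≤ halfSlack
    ξ≤ = ((0ℚ ≤ θ ∋ dec≤) ⊙ δ≤) ⨾ dec≤

    H : ε + (+ 5 / 1) * ξ ≤ δ * (aℚ - bℚ * σ + halfSlack)
    H = subst (λ z → ε + (+ 5 / 1) * ξ ≤ δ * (aℚ - bℚ * z + halfSlack)) (sym σ≡) (≤-by (0≤δ ⊙
        ((+ 6 / 1) * θ + bℚ * gridStep ≤ halfSlack ∋ dec≤)) (e δ aℚ bℚ σ′ gridStep halfSlack θ))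
      where
      e : ∀ d a b s g h t → d * (a - b * s) + t * d + (+ 5 / 1) * (t * d) + d * h
          ≡ d * (a - b * (s + g) + h) + d * ((+ 6 / 1) * t + b * g)
      e = solve-∀ ring

    -- σ ≥ δ / σmax by δ ≤ σ² ≤ σ σmax, so ε is at most a quadratic in δ, increasing up to 9/10.
    ε≤ : ε ≤ εmax
    ε≤ = ≤-by ((0≤a*b 0≤δ (0ℚ ≤ B ∋ dec≤) ⊙ δ≤σσmax) ⊕ 0≤a*b (0≤b-a δ≤) (0≤b-a {B * (+ 9 / 10 + δ)} {A} (((0ℚ
        ≤ B ∋ dec≤) ⊙ (≤-refl {+ 9 / 10} ⊕ δ≤)) ⨾ dec≤)) ⊕ ((+ 9 / 10) * (A - B * (+ 9 / 10)) ≤ εmax ∋ dec≤))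
        (trans (cong (λ z → δ * (aℚ - bℚ * z) + ξ + (δ * B * (σ * σmax) + (+ 9 / 10 - δ) * (A - B *
            (+ 9 / 10 + δ)) + εmax)) σ′≡) (e δ aℚ bℚ σ gridStep B σmax A (+ 9 / 10) εmax θ BA refl))
      where
      B A : ℚ
      B = (+ 1000 / 949) * bℚ
      A = aℚ + bℚ * gridStep + θ
      δ≤σσmax : δ ≤ σ * σmax
      δ≤σσmax = δ≤σ² ⨾ (0≤σ ⊙ σ≤)
      σ′≡ : σ′ ≡ σ - gridStep
      σ′≡ = trans (w σ′ gridStep) (cong (_- gridStep) (sym σ≡))
        where
        w : ∀ a b → a ≡ a + b - b
        w = solve-∀ ring
      BA : B * σmax ≡ bℚ
      BA = refl
      e : ∀ d a b s g B m A n E t → B * m ≡ b → A ≡ a + b * g + t →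
        d * (a - b * (s - g)) + t * d + (d * B * (s * m) + (n - d) * (A - B * (n + d)) + E)
            ≡ E + (d * B * d + 0ℚ + n * (A - B * n))
      e d a b s g B m A n E t refl refl = e′ d a g s B m n E t
        where
        e′ : ∀ d a g s B m n E t → let b = B * m ; A = a + b * g + t in
          d * (a - b * (s - g)) + t * d + (d * B * (s * m) + (n - d) * (A - B * (n + d)) + E)
              ≡ E + (d * B * d + 0ℚ + n * (A - B * n))
        e′ = solve-∀ ring

    colourable : Col ε δ
    colourable = iterate σ ξ 0≤σ σ≤ 0<ξ ξ≤ N ε δ (≤-<-trans ε≤ big) ε≤ 0≤δ (δ≤ ⨾ dec≤) δ≤σ² H
      where
      r : ∃[ y ] (0ℚ < y) × (ξ * y ≡ 1ℚ)
      r = recip ξ 0<ξ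
      N : ℕ
      N = proj₁ (archimedes (proj₁ r))
      big : εmax < ι N * ξ
      big = <-≤-trans {εmax} {1ℚ} dec< (≤-reflexive (trans (sym (proj₂ (proj₂ r))) (ℚP.*-comm ξ (proj₁ r)))
          ⨾ (proj₂ (archimedes (proj₁ r)) ⊙ʳ <⇒≤ 0<ξ))

-- Translation to chromatic and list chromatic numbers

module Reduction where

  open Thresholds public
  open import Defs using (deg; maxDeg; nbhdEdges; Sparse; _≤√_; BoundHolds; Colourable; IsChromaticNumber; ColourableFrom; Choosable; IsListChromaticNumber)
  import Data.Rational.Properties as ℚP
  import Data.Nat as ℕ
  import Data.Nat.Properties as ℕP
  import Data.Fin as Fin
  import Data.Fin.Properties as FinP
  import Data.Bool.Properties as BoolP
  import Data.List as List
  import Data.List.Properties as ListP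
  open import Data.List.Membership.Propositional using (_∈_)
  open import Data.List.Membership.Propositional.Properties using (∈-lookup; ∈-upTo⁻)
  import Data.List.Relation.Unary.All as All
  open import Data.List.Relation.Unary.AllPairs using (_∷_)
  open import Data.List.Relation.Unary.Unique.Propositional using (Unique)
  open import Data.List.Relation.Unary.Unique.Propositional.Properties using (upTo⁺)

  count : List Bool → ℕ
  count bs = List.length (List.filter (λ b → b BoolP.≟ true) bs)

  count-++ : ∀ as bs → count (as List.++ bs) ≡ count as ℕ.+ count bs
  count-++ as bs = trans (cong List.length (ListP.filter-++ (λ b → b BoolP.≟ true) as bs)) (ListP.length-++
      (List.filter (λ b → b BoolP.≟ true) as))

  count-row : ∀ {n} {A : Set} (f : A → Bool) (g : Fin n → A) → count (List.map f (List.tabulate g)) ≡ card (f ∘ g)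
  count-row {zero} f g = refl
  count-row {suc n} f g with f (g fzero)
  ... | true = cong suc (count-row f (g ∘ fsuc))
  ... | false = count-row f (g ∘ fsuc)

  filter-row : ∀ {n} {A : Set} (f : A → Bool) (g : Fin n → A) → List.length (List.filter (λ u →
      f u BoolP.≟ true) (List.tabulate g)) ≡ card (f ∘ g)
  filter-row {zero} f g = refl
  filter-row {suc n} f g with f (g fzero)
  ... | true = cong suc (filter-row f (g ∘ fsuc))
  ... | false = filter-row f (g ∘ fsuc)

  count-rows : ∀ {m n} {A : Set} (b : A → Fin n → Bool) (g : Fin m → A) →
    ι (count (List.concatMap (λ u → List.map (b u) (List.allFin n)) (List.tabulate g))) ≡ ∑ (λ u → ∑ (λ w →
        ⟦ b (g u) w ⟧))
  count-rows {zero} b g = trans ι-0 (sym (∑-zero _))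
  count-rows {suc m} {n} b g = trans (cong ι (count-++ (List.map (b (g fzero)) (List.allFin n)) _)) (trans (ι-+
      (count (List.map (b (g fzero)) (List.allFin n))) _)
     (trans (cong₂ _+_ (trans (cong ι (count-row (b (g fzero)) id)) (sym (∑-card (b (g fzero))))) (count-rows b
         (g ∘ fsuc))) (sym (∑-suc (λ u → ∑ (λ w → ⟦ b (g u) w ⟧))))))

  deg≡ : ∀ {n} (G : Graph n) v → degℚ G v ≡ ι (deg G v)
  deg≡ G v = trans (∑-card (adj G v)) (cong ι (sym (filter-row (adj G v) id)))

  ≤-max : ∀ {n} {A : Set} (f : A → ℕ) (g : Fin n → A) i → f (g i) ℕ.≤ List.foldr ℕ._⊔_ 0 (List.map f
      (List.tabulate g))
  ≤-max f g fzero = ℕP.m≤m⊔n (f (g fzero)) _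
  ≤-max f g (fsuc i) = ℕP.≤-trans (≤-max f (g ∘ fsuc) i) (ℕP.m≤n⊔m (f (g fzero)) _)

  deg≤maxDeg : ∀ {n} (G : Graph n) v → degℚ G v ≤ ι (maxDeg G)
  deg≤maxDeg G v = ≤-reflexive (deg≡ G v) ⨾ ι-mono (≤-max (deg G) id v)

  pairs≡2edges : ∀ {n} (G : Graph n) v → nbhdPairs G v ≡ ι (nbhdEdges G v) + ι (nbhdEdges G v)
  pairs≡2edges {n} G v = trans (∑-cong (λ u → trans (∑-cong (λ w → cell u w)) (∑-+ _ _))) (trans (∑-+ _ _)
      (cong₂ _+_ (sym count≡) (trans (∑-swap ∑-lin _) (sym count≡))))
    where
    b : Fin n → Fin n → Bool
    b u w = (toℕ u ℕ.<ᵇ toℕ w) ∧ adj G v u ∧ adj G v w ∧ adj G u w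
    count≡ : ι (nbhdEdges G v) ≡ ∑ (λ u → ∑ (λ w → ⟦ b u w ⟧))
    count≡ = count-rows b id
    cell : ∀ u w → ⟦ adj G v u ⟧ * ⟦ adj G v w ⟧ * ⟦ adj G u w ⟧ ≡ ⟦ b u w ⟧ + ⟦ b w u ⟧
    cell u w = go (adj G v u) (adj G v w) (adj G u w) (adj G w u) (toℕ u ℕ.<ᵇ toℕ w) (toℕ w ℕ.<ᵇ toℕ u)
        (Graph.sym G w u)
        (λ e → <ᵇ-antisym (λ p → false≢true (trans (cong (adj G u) (FinP.toℕ-injective (sym p))) (irrefl G u)) e))
      where
      go : ∀ a c e e′ l l′ → e′ ≡ e → (e ≡ true → l ≡ not l′) → ⟦ a ⟧ * ⟦ c ⟧ * ⟦ e ⟧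
          ≡ ⟦ l ∧ a ∧ c ∧ e ⟧ + ⟦ l′ ∧ c ∧ a ∧ e′ ⟧
      go true true true true true false _ _ = refl
      go true true true true false true _ _ = refl
      go true true true true true true _ h with h refl
      ... | ()
      go true true true true false false _ h with h refl
      ... | ()
      go true true false false true true _ _ = refl
      go true true false false true false _ _ = refl
      go true true false false false true _ _ = refl
      go true true false false false false _ _ = refl
      go true false e e′ true true _ _ = ℚP.*-zeroˡ ⟦ e ⟧
      go true false e e′ true false _ _ = ℚP.*-zeroˡ ⟦ e ⟧
      go true false e e′ false true _ _ = ℚP.*-zeroˡ ⟦ e ⟧
      go true false e e′ false false _ _ = ℚP.*-zeroˡ ⟦ e ⟧
      go false true e e′ true true _ _ = ℚP.*-zeroˡ ⟦ e ⟧
      go false true e e′ true false _ _ = ℚP.*-zeroˡ ⟦ e ⟧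
      go false true e e′ false true _ _ = ℚP.*-zeroˡ ⟦ e ⟧
      go false true e e′ false false _ _ = ℚP.*-zeroˡ ⟦ e ⟧
      go false false e e′ true true _ _ = ℚP.*-zeroˡ ⟦ e ⟧
      go false false e e′ true false _ _ = ℚP.*-zeroˡ ⟦ e ⟧
      go false false e e′ false true _ _ = ℚP.*-zeroˡ ⟦ e ⟧
      go false false e e′ false false _ _ = ℚP.*-zeroˡ ⟦ e ⟧

  -- Ordered pairs count every edge twice, and twice the binomial coefficient is D (D - 1) ≤ D².
  sparse-pairs : ∀ δ {n} (G : Graph n) → δ ≤ 1ℚ → Sparse δ G → ∀ v →
      nbhdPairs G v ≤ (1ℚ - δ) * (ι (maxDeg G) * ι (maxDeg G))
  sparse-pairs δ G δ≤1 sp v = ≤-reflexive (pairs≡2edges G v) ⨾ (h ⊕ h)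
      ⨾ ≤-reflexive (eq (1ℚ - δ) (ι D) (ι (D ℕ.∸ 1))) ⨾ (0≤b-a δ≤1 ⊙ (0≤ι D ⊙ ι-mono (ℕP.m∸n≤m D 1)))
    where
    D : ℕ
    D = maxDeg G
    h : ι (nbhdEdges G v) ≤ (1ℚ - δ) * (ι D * ι (D ℕ.∸ 1) * ½)
    h = ≤-reflexive (ι-def (nbhdEdges G v)) ⨾ sp v ⨾ ≤-reflexive (cong₂ (λ a b →
        (1ℚ - δ) * (a * b * ½)) (sym (ι-def D)) (sym (ι-def (D ℕ.∸ 1))))
    eq : ∀ d a b → d * (a * b * ½) + d * (a * b * ½) ≡ d * (a * b)
    eq = solve-∀ ring

  lookup-injective : ∀ {xs : List ℕ} → Unique xs → ∀ i j → List.lookup xs i ≡ List.lookup xs j → i ≡ j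
  lookup-injective (px ∷ pxs) fzero fzero e = refl
  lookup-injective {x ∷ xs} (px ∷ pxs) fzero (fsuc j) e = ⊥-elim (All.lookup px (∈-lookup {xs = xs} j) e)
  lookup-injective {x ∷ xs} (px ∷ pxs) (fsuc i) fzero e = ⊥-elim (All.lookup px (∈-lookup {xs = xs} i) (sym e))
  lookup-injective (px ∷ pxs) (fsuc i) (fsuc j) e = cong fsuc (lookup-injective pxs i j e)

  adjacent⇒true : ∀ {b} → T b → b ≡ true
  adjacent⇒true {true} _ = refl

  choosable : ∀ {n} (G : Graph n) k → (∀ (L : Fin n → Fin k → ℕ) → Injective L → ListColouring G k L) → Choosable G k
  choosable {n} G k h (Ls , ok) = c , (λ v → subst (_∈ Ls v) (sym (proj₂ (in-list v))) (∈-lookup {xs = Ls v}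
      (Fin.inject≤ (proj₁ (in-list v)) (proj₂ (ok v))))) , (λ u v a → proper u v (adjacent⇒true a))
    where
    L : Fin n → Fin k → ℕ
    L v i = List.lookup (Ls v) (Fin.inject≤ i (proj₂ (ok v)))
    col : ListColouring G k L
    col = h L (λ v i j e → FinP.inject≤-injective (proj₂ (ok v)) (proj₂ (ok v)) i j (lookup-injective (proj₁
        (ok v)) _ _ e))
    c : Fin n → ℕ
    c = proj₁ col
    in-list : ∀ v → ∃[ i ] c v ≡ L v i
    in-list = proj₁ (proj₂ col)
    proper : ∀ u v → adj G u v ≡ true → c u ≢ c v
    proper = proj₂ (proj₂ col)

  -- Give every vertex the same list of the numbers below k.
  choosable⇒colourable : ∀ {n} (G : Graph n) k → Choosable G k → Colourable G k
  choosable⇒colourable {n} G k ch = (λ v → Fin.fromℕ< (c< v)) , λ u v a e →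
      proj₂ (proj₂ col) u v a (trans (sym (FinP.toℕ-fromℕ< (c< u))) (trans (cong toℕ e) (FinP.toℕ-fromℕ< (c< v))))
    where
    col : ColourableFrom G (λ _ → List.upTo k)
    col = ch ((λ _ → List.upTo k) , λ v → upTo⁺ k , ℕP.≤-reflexive (sym (ListP.length-upTo k)))
    c< : ∀ v → proj₁ col v ℕ.< k
    c< v = ∈-upTo⁻ (proj₁ (proj₂ col) v)

  χ≤χℓ : ∀ {n} (G : Graph n) χ χℓ → IsChromaticNumber G χ → IsListChromaticNumber G χℓ → χ ℕ.≤ χℓ
  χ≤χℓ G χ χℓ (_ , minimal) (ch , _) with χ ℕ.≤? χℓ
  ... | yes p = p
  ... | no ¬p = ⊥-elim (minimal χℓ (ℕP.≰⇒> ¬p) (choosable⇒colourable G χℓ ch))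

  ≤√-or : ∀ x y → (x ≤√ y) ⊎ ((0ℚ < x) × (y < x * x))
  ≤√-or x y with x ≤? 0ℚ | (x * x) ≤? y
  ... | yes p | _ = inj₁ (inj₁ p)
  ... | no _ | yes p = inj₁ (inj₂ p)
  ... | no p | no q = inj₂ (ℚP.≰⇒> p , ℚP.≰⇒> q)

  square-cancel : ∀ {a b} → 0ℚ ≤ b → a * a ≤ b * b → a ≤ b
  square-cancel {a} {b} 0≤b h with a ≤? b
  ... | yes p = p
  ... | no ¬p = ⊥-elim (ℚP.<-irrefl refl (<-≤-trans (≤-<-trans (0≤b ⊙ <⇒≤ b<a) (ℚP.*-monoˡ-<-pos a {{positive
      (≤-<-trans 0≤b b<a)}} b<a)) h))
    where
    b<a : b < a
    b<a = ℚP.≰⇒> ¬p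

  -- The excess x = k - N (1 - a δ) over √(N²b²δ³) is in particular an excess over N b δ σ′ when σ′² ≤ δ.
  excess : ∀ x N b δ s → 0ℚ ≤ x → 0ℚ ≤ δ → s * s ≤ δ → (N * b) * (N * b) * (δ * δ * δ) ≤ x * x → N * b * δ * s ≤ x
  excess x N b δ s 0≤x 0≤δ s²≤δ h = square-cancel 0≤x (≤-reflexive (e N b δ s)
      ⨾ (0≤a*b (0≤sq (N * b)) (0≤sq δ) ⊙ s²≤δ) ⨾ ≤-reflexive (e₂ N b δ) ⨾ h)
    where
    e : ∀ N b d s → N * b * d * s * (N * b * d * s) ≡ (N * b) * (N * b) * (d * d) * (s * s)
    e = solve-∀ ring
    e₂ : ∀ N b d → (N * b) * (N * b) * (d * d) * d ≡ (N * b) * (N * b) * (d * d * d)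
    e₂ = solve-∀ ring

  -- Contrapositive form: if the bound fails for k + 1, then lists of size k already suffice, which
  -- is impossible when k + 1 is the list chromatic number.
  Conclusion : ℚ → Set
  Conclusion δ = ∃[ Δ₁ ] (∀ {n} (G : Graph n) → Sparse δ G → Δ₁ ℕ.< maxDeg G → ∀ k →
    ((ℕ→ℚ (suc k) - ℕ→ℚ (suc (maxDeg G)) * (1ℚ - aℚ * δ)) ≤√ ((ℕ→ℚ (suc (maxDeg G)) * bℚ) * (ℕ→ℚ (suc
        (maxDeg G)) * bℚ) * (δ * δ * δ))) ⊎ Choosable G k)

  -- Treated separately because ξ is proportional to δ and would vanish. Failure of the bound now
  -- says that k exceeds the maximum degree, so greedy colouring applies.
  bound-or-choosable₀ : ∀ δ → δ ≡ 0ℚ → Conclusion δ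
  bound-or-choosable₀ δ refl = 0 , λ G _ _ k → [ inj₁ , (λ h → inj₂ (choosable G k (λ L inj → greedy G k L inj (λ v →
      ≤-<-trans (deg≤maxDeg G v) (lt (maxDeg G) k (proj₁ h)))))) ]′
      (≤√-or (ℕ→ℚ (suc k) - ℕ→ℚ (suc (maxDeg G)) * (1ℚ - aℚ * 0ℚ)) _)
    where
    lt : ∀ D k → 0ℚ < ℕ→ℚ (suc k) - ℕ→ℚ (suc D) * (1ℚ - aℚ * 0ℚ) → ι D < ι k
    lt D k h = <-by h (trans (cong₂ (λ s t → ι D + (s - t * (1ℚ - aℚ * 0ℚ))) (trans (sym (ι-def (suc k))) (ι-suc k))
        (trans (sym (ι-def (suc D))) (ι-suc D))) (e (ι D) (ι k) aℚ))
      where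
      e : ∀ d k a → d + (1ℚ + k - (1ℚ + d) * (1ℚ - a * 0ℚ)) ≡ k + 0ℚ
      e = solve-∀ ring

  bound-or-choosable : ∀ δ → 0ℚ < δ → δ ≤ + 9 / 10 → Conclusion δ
  bound-or-choosable δ 0<δ δ≤ = D₀ , λ G sp Δ> k → [ inj₁ , (λ h → inj₂ (choosable G k (λ L inj →
      proj₂ Th.colourable (maxDeg G) (D₁≤ Δ>) G k L inj (deg≤maxDeg G) (enough (maxDeg G) k (D₂≤ Δ>) h)
      (sparse-pairs δ G (δ≤ ⨾ dec≤) sp)))) ]′
      (≤√-or (ℕ→ℚ (suc k) - ℕ→ℚ (suc (maxDeg G)) * (1ℚ - aℚ * δ)) _)
    where
    module Th = Threshold δ 0<δ δ≤
    D₁ D₂ D₀ : ℕ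
    D₁ = proj₁ Th.colourable
    r : ∃[ y ] (0ℚ < y) × (Th.ξ * y ≡ 1ℚ)
    r = recip Th.ξ Th.0<ξ
    D₂ = proj₁ (archimedes (proj₁ r))
    D₀ = D₁ ℕ.+ D₂
    D₁≤ : ∀ {D} → D₀ ℕ.< D → D₁ ℕ.≤ D
    D₁≤ h = ℕP.≤-trans (ℕP.m≤m+n D₁ D₂) (ℕP.<⇒≤ h)
    D₂≤ : ∀ {D} → D₀ ℕ.< D → D₂ ℕ.≤ D
    D₂≤ h = ℕP.≤-trans (ℕP.m≤n+m D₂ D₁) (ℕP.<⇒≤ h)
    -- Let ε₀ = δ (a - b σ′). Failure of the bound yields k + 1 ≥ (1 - ε₀)(D + 1); replacing k + 1
    -- and D + 1 by k and D costs ε₀ ≤ 1, which is paid for by ξ D ≥ 1.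
    enough : ∀ D k → D₂ ℕ.≤ D → (0ℚ < ℕ→ℚ (suc k) - ℕ→ℚ (suc D) * (1ℚ - aℚ * δ)) × ((ℕ→ℚ (suc D) * bℚ) * (ℕ→ℚ
        (suc D) * bℚ) * (δ * δ * δ) < (ℕ→ℚ (suc k) - ℕ→ℚ (suc D) * (1ℚ - aℚ * δ)) * (ℕ→ℚ (suc k) - ℕ→ℚ (suc D) *
        (1ℚ - aℚ * δ))) →
      (1ℚ - Th.ε) * ι D ≤ ι k
    enough D k h (pos , sq) = ≤-by (ex ⊕ ξx≥1 ⊕ ε₀≤1) (e (ι D) (ι k) δ aℚ bℚ Th.σ′ Th.ξ)
      where
      N : ℚ
      N = ℕ→ℚ (suc D)
      ex : (1ℚ + ι D) * bℚ * δ * Th.σ′ ≤ 1ℚ + ι k - (1ℚ + ι D) * (1ℚ - aℚ * δ)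
      ex = subst₂ (λ s t → s * bℚ * δ * Th.σ′ ≤ t - s * (1ℚ - aℚ * δ)) (trans (sym (ι-def (suc D))) (ι-suc D))
          (trans (sym (ι-def (suc k))) (ι-suc k))
             (excess (ℕ→ℚ (suc k) - N * (1ℚ - aℚ * δ)) N bℚ δ Th.σ′ (<⇒≤ pos) Th.0≤δ Th.σ′²≤δ (<⇒≤ sq))
      ξx≥1 : 1ℚ ≤ Th.ξ * ι D
      ξx≥1 = ≤-reflexive (sym (proj₂ (proj₂ r))) ⨾ (<⇒≤ Th.0<ξ ⊙ (proj₂ (archimedes (proj₁ r)) ⨾ ι-mono h))
      ε₀≤1 : δ * (aℚ - bℚ * Th.σ′) ≤ 1ℚ
      ε₀≤1 = ≤-by (<⇒≤ Th.0<ξ ⊕ Th.ε≤ ⊕ (εmax ≤ 1ℚ ∋ dec≤)) (e₁ (δ * (aℚ - bℚ * Th.σ′)) Th.ξ εmax)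
        where
        e₁ : ∀ a x m → a + (x + m + 1ℚ) ≡ 1ℚ + (0ℚ + (a + x) + m)
        e₁ = solve-∀ ring
      e : ∀ x k d a b s ξ → (1ℚ - (d * (a - b * s) + ξ)) * x + (1ℚ + k - (1ℚ + x) * (1ℚ - a * d) + ξ * x + 1ℚ)
          ≡ k + ((1ℚ + x) * b * d * s + 1ℚ + d * (a - b * s))
      e = solve-∀ ring

  bound-on-χℓ : (δ : ℚ) → 0ℚ ≤ δ → δ ≤ (+ 9 / 10) →
      ∃[ Δ₁ ] (∀ {n} (G : Graph n) → Sparse δ G → Δ₁ ℕ.< maxDeg G →
      ∀ χ χℓ → IsChromaticNumber G χ → IsListChromaticNumber G χℓ →
      (χ ℕ.≤ χℓ) × BoundHolds δ (maxDeg G) χℓ)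
  bound-on-χℓ δ 0≤δ δ≤ = proj₁ main , λ G sp Δ> χ χℓ isχ isχℓ → χ≤χℓ G χ χℓ isχ isχℓ , bound G sp Δ> χℓ isχℓ
    where
    main : Conclusion δ
    main = by-sign (0ℚ <? δ)
      where
      by-sign : Dec (0ℚ < δ) → Conclusion δ
      by-sign (yes p) = bound-or-choosable δ p δ≤
      by-sign (no ¬p) = bound-or-choosable₀ δ (ℚP.≤-antisym (ℚP.≮⇒≥ ¬p) 0≤δ)
    bound : ∀ {n} (G : Graph n) → Sparse δ G → proj₁ main ℕ.< maxDeg G → ∀ χℓ → IsListChromaticNumber G χℓ →
        BoundHolds δ (maxDeg G) χℓ
    -- The value 0 is not of the form k + 1, but then the left-hand side is at most 0.
    bound G sp Δ> zero _ = inj₁ (≤-by (0≤a*b (subst (0ℚ ≤_) (ι-def (suc (maxDeg G))) (0≤ι (suc (maxDeg G))))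
        (0≤b-a {aℚ * δ} {1ℚ} (*-mono {aℚ} {1ℚ} {δ} {1ℚ} 0≤δ 0≤1 dec≤ (δ≤
        ⨾ dec≤)))) (e (ℕ→ℚ (suc (maxDeg G)) * (1ℚ - aℚ * δ))))
      where
      e : ∀ x → 0ℚ - x + x ≡ 0ℚ + 0ℚ
      e = solve-∀ ring
    bound G sp Δ> (suc k) (_ , minimal) = [ id , (λ ch → ⊥-elim (minimal k (ℕP.n<1+n k) ch)) ]′ (proj₂ main G sp Δ> k)

open import Defs
open import Data.Nat using (ℕ; _<_; _≤_)
open import Data.Rational using (ℚ; _/_; 0ℚ) renaming (_≤_ to _≤ℚ_)
open import Data.Integer using (+_)
open import Data.Product using (_×_; ∃-syntax)

theorem1p6 : (δ : ℚ) → 0ℚ ≤ℚ δ → δ ≤ℚ (+ 9 / 10) →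
    ∃[ Δ₁ ] ∀ {n} (G : Graph n) → Sparse δ G → Δ₁ < maxDeg G →
    ∀ χ χℓ → IsChromaticNumber G χ → IsListChromaticNumber G χℓ →
    (χ ≤ χℓ) × BoundHolds δ (maxDeg G) χℓ
theorem1p6 = Reduction.bound-on-χℓ
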